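{- Let $A\subseteq K^n$ be definable of dimension at most $e$. Then there is a partition $A=\bigcup_{i=0}^kA_i$ (into finitely many definable sets) such that $\dim(A_0)<e$ and $A_i$ is a basic $e$-rectifiable set for every $i>0$. Moreover, the bounds of the $A_i$ ($i>0$) can be chosen to depend only on $n$ (and not on $A$). Such a tuple $(A_0,\dots,A_k)$ is called a basic $e$-rectifiable partition of $A$.
   Context: Throughout, $K$ is an $\aleph_1$-saturated o-minimal structure expanding a field; "definable" means definable in $K$ with parameters; $e\le n$ are natural numbers. An element of $K$ is finite if it is bounded in absolute value by a natural number. $M$-functions and $M$-cells ($M\in K_{>0}$). A definable differentiable function $f$ is an $M$-function if $|Df|\le M$ on its domain (operator norm; on a $\mathcal C^1$ cell that is not open, $Df(x)$ is the differential on the tangent space of the cell). In $K^1$ an $M$-cell is a point or an interval $(a,b)$ with $a<b$ in $K$. An $M$-cell in $K^{m+1}$ is either the graph of a definable $\mathcal C^1$ $M$-function $f:X\to K$, or a set $\{(x,r)\in X\times K: f(x)<r<g(x)\}$ with $f<g$ definable $\mathcal C^1$ $M$-functions on $X$, where $X\subseteq K^m$ is an $M$-cell. Basic $e$-rectifiable sets. $A\subseteq K^n$ is basic $e$-rectifiable with bound $M$ ($M$ finite) if, after a permutation of coordinates, $A$ is the graph of an $M$-function $f:U\to K^{n-e}$, where $U\subset K^e$ is an open $M$-cell.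
   Formalization: M-cells may here have infinite bounds: intervals and bands may extend to −∞ or +∞; with end points only in K the claim fails for A = K (n = e = 1), and for bounded A the two versions agree. -}

module Defs where

open import Algebra.Bundles using (CommutativeRing)
open import Data.Empty.Polymorphic using (⊥)
open import Data.Fin.Base using (Fin; zero; suc; toℕ)
open import Data.Fin.Permutation using (Permutation; _⟨$⟩ʳ_)
open import Data.List.Base using (List)
open import Data.List.Relation.Unary.All using (All)
open import Data.List.Relation.Unary.Any using (Any)
open import Data.Maybe.Base using (Maybe; just; nothing)
import Data.Maybe.Relation.Unary.All as Maybe
open import Data.Nat.Base as ℕ using (ℕ; suc; _∸_)
open import Data.Product.Base using (Σ; ∃; ∃₂; _×_; _,_)
open import Data.Sum.Base using (_⊎_)
open import Data.Vec.Functional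
  using (Vector; _∷_; _++_; head; init; last; take; drop)
open import Function.Base using (_∘_)
open import Level using (Level; _⊔_) renaming (suc to lsuc)
open import Relation.Binary.Core using (Rel)
open import Relation.Binary.PropositionalEquality.Core using (_≢_)
open import Relation.Binary.Structures using (IsStrictTotalOrder)
open import Relation.Nullary.Construct.Add.Extrema using (_±; ⊥±; ⊤±; [_])
open import Relation.Nullary.Negation.Core using (¬_)
open import Relation.Unary using (Pred; _∈_; _⊆_; _≐_; _⊥′_)

import Algebra.Definitions
import Algebra.Definitions.RawMonoid
import Relation.Binary.Construct.Add.Extrema.Strict
import Relation.Binary.Construct.StrictToNonStrict

------------------------------------------------------------------------
-- First-order structures expanding an ordered field

record OrderedField (ℓ : Level) : Set (lsuc ℓ) where
  infix 4 _<_
  field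
    commutativeRing : CommutativeRing ℓ ℓ

  open CommutativeRing commutativeRing public hiding (zero)

  field
    _<_                : Rel Carrier ℓ
    isStrictTotalOrder : IsStrictTotalOrder _≈_ _<_
    0≉1                : ¬ (0# ≈ 1#)
    invertible         : ∀ {x} → ¬ (x ≈ 0#) →
                         Algebra.Definitions.Invertible _≈_ 1# _*_ x
    +-monoˡ-<          : ∀ {x y} z → x < y → (x + z) < (y + z)
    *-pos              : ∀ {x y} → 0# < x → 0# < y → 0# < (x * y)

  open Relation.Binary.Construct.StrictToNonStrict _≈_ _<_ public
    using (_≤_)
  open Relation.Binary.Construct.Add.Extrema.Strict _<_ public
    using (_<±_)
  open Algebra.Definitions.RawMonoid +-rawMonoid public
    using (sum) renaming (_×_ to _·_)

  infix 4 _≋_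
  _≋_ : ∀ {n} → Rel (Vector Carrier n) ℓ
  x ≋ y = ∀ i → x i ≈ y i

  fromℕ : ℕ → Carrier
  fromℕ N = N · 1#

  IsFinite : Pred Carrier ℓ
  IsFinite x = ∃ λ N → (- fromℕ N ≤ x) × (x ≤ fromℕ N)

-- The symbols of the language other than those of ordered rings.
record Signature (s : Level) : Set (lsuc s) where
  field
    FunSym : ℕ → Set s
    RelSym : ℕ → Set s

module _ {s} (L : Signature s) where

  open Signature L

  infix  8 _≐′_ _<′_
  infixr 6 _∧′_
  infixr 5 _∨′_
  infixr 4 _⇒′_

  data Term (n : ℕ) : Set s where
    var       : Fin n → Term n
    0′ 1′     : Term n
    _+′_ _*′_ : Term n → Term n → Term n
    -′_       : Term n → Term n
    fun       : ∀ {k} → FunSym k → (Fin k → Term n) → Term n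

  data Formula (n : ℕ) : Set s where
    _≐′_ _<′_      : Term n → Term n → Formula n
    rel            : ∀ {k} → RelSym k → (Fin k → Term n) → Formula n
    false′         : Formula n
    _∧′_ _∨′_ _⇒′_ : Formula n → Formula n → Formula n
    ∀′_ ∃′_        : Formula (suc n) → Formula n

record Structure {s} (L : Signature s) (ℓ : Level) : Set (s ⊔ lsuc ℓ) where
  open Signature L
  field
    orderedField : OrderedField ℓ

  open OrderedField orderedField public

  field
    ⟦_⟧ᶠ     : ∀ {k} → FunSym k → Vector Carrier k → Carrier
    ⟦⟧ᶠ-cong : ∀ {k} (F : FunSym k) {x y} → x ≋ y → ⟦ F ⟧ᶠ x ≈ ⟦ F ⟧ᶠ y
    ⟦_⟧ʳ     : ∀ {k} → RelSym k → Pred (Vector Carrier k) ℓ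
    ⟦⟧ʳ-resp : ∀ {k} (R : RelSym k) {x y} → x ≋ y → ⟦ R ⟧ʳ x → ⟦ R ⟧ʳ y

  eval : ∀ {n} → Term L n → Vector Carrier n → Carrier
  eval (var i)    ρ = ρ i
  eval 0′         ρ = 0#
  eval 1′         ρ = 1#
  eval (t +′ u)   ρ = eval t ρ + eval u ρ
  eval (t *′ u)   ρ = eval t ρ * eval u ρ
  eval (-′ t)     ρ = - eval t ρ
  eval (fun F ts) ρ = ⟦ F ⟧ᶠ (λ i → eval (ts i) ρ)

  infix 4 _⊨_
  _⊨_ : ∀ {n} → Vector Carrier n → Formula L n → Set ℓ
  ρ ⊨ (t ≐′ u)   = eval t ρ ≈ eval u ρ
  ρ ⊨ (t <′ u)   = eval t ρ < eval u ρ
  ρ ⊨ (rel R ts) = ⟦ R ⟧ʳ (λ i → eval (ts i) ρ)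
  ρ ⊨ false′     = ⊥
  ρ ⊨ (φ ∧′ ψ)   = (ρ ⊨ φ) × (ρ ⊨ ψ)
  ρ ⊨ (φ ∨′ ψ)   = (ρ ⊨ φ) ⊎ (ρ ⊨ ψ)
  ρ ⊨ (φ ⇒′ ψ)   = (ρ ⊨ φ) → (ρ ⊨ ψ)
  ρ ⊨ (∀′ φ)     = ∀ a → (a ∷ ρ) ⊨ φ
  ρ ⊨ (∃′ φ)     = ∃ λ a → (a ∷ ρ) ⊨ φ

  K^ : ℕ → Set ℓ
  K^ n = Vector Carrier n

  -- Definable with parameters p.
  Definable : ∀ {n} → Pred (K^ n) ℓ → Set (s ⊔ ℓ)
  Definable {n} A =
    ∃ λ k → Σ (K^ k) λ p → Σ (Formula L (k ℕ.+ n)) λ φ →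
      A ≐ (λ x → (p ++ x) ⊨ φ)

  data Piece : Set ℓ where
    point    : Carrier → Piece
    interval : Carrier ± → Carrier ± → Piece

  _∈ᴾ_ : Carrier → Piece → Set ℓ
  x ∈ᴾ point a      = x ≈ a
  x ∈ᴾ interval a b = (a <± [ x ]) × ([ x ] <± b)

  OMinimal : Set (s ⊔ lsuc ℓ)
  OMinimal = ∀ (A : Pred (K^ 1) ℓ) → Definable A →
    ∃ λ (Ps : List Piece) → A ≐ (λ x → Any (head x ∈ᴾ_) Ps)

  -- Every 1-type over a countable set {p 0, p 1, …} of parameters that is
  -- finitely satisfiable is realised.  A formula over that set is a
  -- formula over its first k elements, for some k; variable 0 is the
  -- variable of the type.
  ℵ₁-Saturated : Set (lsuc (s ⊔ ℓ))
  ℵ₁-Saturated =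
    ∀ (p : ℕ → Carrier) (Γ : Pred (∃ λ k → Formula L (suc k)) (s ⊔ ℓ)) →
    let Realises : Carrier → Pred (∃ λ k → Formula L (suc k)) ℓ
        Realises x (k , φ) = (x ∷ (λ (i : Fin k) → p (toℕ i))) ⊨ φ
    in (∀ Δ → All (_∈ Γ) Δ → ∃ λ x → All (Realises x) Δ) →
       ∃ λ x → Γ ⊆ Realises x

record SaturatedOMinimalField (s ℓ : Level) : Set (lsuc (s ⊔ ℓ)) where
  field
    signature : Signature s
    structure : Structure signature ℓ

  open Structure structure public

  field
    oMinimal  : OMinimal
    saturated : ℵ₁-Saturated

module Geometry {s ℓ} (𝓚 : SaturatedOMinimalField s ℓ) where

  open SaturatedOMinimalField 𝓚 public
    using (Carrier; K^; Definable; fromℕ)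
  open SaturatedOMinimalField 𝓚
    hiding (Carrier; K^; Definable; fromℕ)

  ----------------------------------------------------------------------
  -- Euclidean norm and topology.  Norms are nonnegative, so inequalities
  -- between them are stated for their squares.

  ‖_‖² : ∀ {n} → K^ n → Carrier
  ‖ x ‖² = sum (λ i → x i * x i)

  _⊖_ : ∀ {n} → K^ n → K^ n → K^ n
  (x ⊖ y) i = x i - y i

  Ball : ∀ {n} → K^ n → Carrier → Pred (K^ n) ℓ
  Ball x δ y = ‖ y ⊖ x ‖² < δ * δ

  IsOpen : ∀ {n} → Pred (K^ n) ℓ → Set ℓ
  IsOpen X = ∀ x → x ∈ X → ∃ λ δ → (0# < δ) × (Ball x δ ⊆ X)

  ContinuousOn : ∀ {m d} → Pred (K^ m) ℓ → (K^ m → K^ d) → Set ℓ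
  ContinuousOn X f = ∀ x → x ∈ X → ∀ ε → 0# < ε → ∃ λ δ → (0# < δ) ×
    (∀ y → y ∈ X → y ∈ Ball x δ → f y ∈ Ball (f x) ε)

  -- Functions on a subset X are represented by functions on the ambient
  -- space, of which only the values on X matter.
  Graph : ∀ {m d} → Pred (K^ m) ℓ → (K^ m → K^ d) → Pred (K^ (m ℕ.+ d)) ℓ
  Graph {m} X f z = (take m z ∈ X) × (drop m z ≋ f (take m z))

  scalar : ∀ {m} → (K^ m → Carrier) → K^ m → K^ 1
  scalar f x _ = f x

  ----------------------------------------------------------------------
  -- Differentials

  Matrix : ℕ → ℕ → Set ℓ
  Matrix d m = Vector (K^ m) d

  _∙_ : ∀ {m d} → Matrix d m → K^ m → K^ d
  (L ∙ v) i = sum (λ j → L i j * v j)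

  HasDifferentialAt : ∀ {m d} → Pred (K^ m) ℓ → (K^ m → K^ d) →
                      K^ m → Matrix d m → Set ℓ
  HasDifferentialAt X f x L = ∀ ε → 0# < ε → ∃ λ δ → (0# < δ) ×
    (∀ y → y ∈ X → y ∈ Ball x δ →
       ‖ (f y ⊖ f x) ⊖ (L ∙ (y ⊖ x)) ‖² ≤ (ε * ε) * ‖ y ⊖ x ‖²)

  -- Velocities at x of curves lying in X: all of K^ m if X is open, the
  -- usual tangent space if X is a C¹ cell.
  Tangent : ∀ {m} → Pred (K^ m) ℓ → K^ m → Pred (K^ m) ℓ
  Tangent {m} X x v = ∃₂ λ (γ : K^ 1 → K^ m) δ →
    (0# < δ) × (γ 0ᵥ ≋ x) × (∀ t → t ∈ Ball 0ᵥ δ → γ t ∈ X) ×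
    HasDifferentialAt (Ball 0ᵥ δ) γ 0ᵥ (λ i _ → v i)
    where
    0ᵥ : K^ 1
    0ᵥ _ = 0#

  -- On a set that is not open the matrix Df x is not determined by f; its
  -- restriction to the tangent space of a C¹ cell is, and is the
  -- differential.  Accordingly the operator norm is taken on that space.
  IsDifferential : ∀ {m d} → Pred (K^ m) ℓ → (K^ m → K^ d) →
                   (K^ m → Matrix d m) → Set ℓ
  IsDifferential X f Df = ∀ x → x ∈ X → HasDifferentialAt X f x (Df x)

  OperatorNormBound : ∀ {m d} → Carrier → Pred (K^ m) ℓ →
                      (K^ m → Matrix d m) → Set ℓ
  OperatorNormBound M X Df = ∀ x → x ∈ X → ∀ v → v ∈ Tangent X x →
    ‖ Df x ∙ v ‖² ≤ (M * M) * ‖ v ‖²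

  IsMFunction : ∀ {m d} → Carrier → Pred (K^ m) ℓ → (K^ m → K^ d) → Set (s ⊔ ℓ)
  IsMFunction M X f = Definable (Graph X f) ×
    ∃ λ Df → IsDifferential X f Df × OperatorNormBound M X Df

  IsC¹MFunction : ∀ {m d} → Carrier → Pred (K^ m) ℓ → (K^ m → K^ d) → Set (s ⊔ ℓ)
  IsC¹MFunction M X f = Definable (Graph X f) ×
    ∃ λ Df → IsDifferential X f Df × OperatorNormBound M X Df ×
             (∀ i → ContinuousOn X (λ x → Df x i))

  ----------------------------------------------------------------------
  -- Cells

  -- A class of functions with values in K on subsets of the spaces K^ m.
  FunctionClass : Set (lsuc (s ⊔ ℓ))
  FunctionClass = ∀ {m} → Pred (K^ m) ℓ → (K^ m → Carrier) → Set (s ⊔ ℓ)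

  -- Bounding functions of a band; nothing stands for the constant -∞ as a
  -- lower bound and for the constant +∞ as an upper bound.
  Bound : ℕ → Set ℓ
  Bound m = Maybe (K^ m → Carrier)

  lower upper : ∀ {m} → Bound m → K^ m → Carrier ±
  lower nothing  x = ⊥±
  lower (just f) x = [ f x ]
  upper nothing  x = ⊤±
  upper (just g) x = [ g x ]

  cellGraph : ∀ {m} → Pred (K^ m) ℓ → (K^ m → Carrier) → Pred (K^ (suc m)) ℓ
  cellGraph Y f z = (init z ∈ Y) × (last z ≈ f (init z))

  cellBand : ∀ {m} → Pred (K^ m) ℓ → Bound m → Bound m → Pred (K^ (suc m)) ℓ
  cellBand Y f g z = (init z ∈ Y) ×
    (lower f (init z) <± [ last z ]) × ([ last z ] <± upper g (init z))

  -- IsCell 𝓕 d X: X is a d-dimensional cell whose defining functions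
  -- belong to 𝓕.  The recursion starts from the one-point space K^ 0, so
  -- that the cells in K^ 1 are the points and the open intervals.
  data IsCell (𝓕 : FunctionClass) :
              ∀ {m} → ℕ → Pred (K^ m) ℓ → Set (lsuc (s ⊔ ℓ)) where
    origin : ∀ {X : Pred (K^ 0) ℓ} → (∀ x → x ∈ X) → IsCell 𝓕 0 X
    graph  : ∀ {m d} {Y : Pred (K^ m) ℓ} {X : Pred (K^ (suc m)) ℓ}
             (f : K^ m → Carrier) → IsCell 𝓕 d Y → 𝓕 Y f →
             X ≐ cellGraph Y f → IsCell 𝓕 d X
    band   : ∀ {m d} {Y : Pred (K^ m) ℓ} {X : Pred (K^ (suc m)) ℓ}
             (f g : Bound m) → IsCell 𝓕 d Y →
             Maybe.All (𝓕 Y) f → Maybe.All (𝓕 Y) g →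
             (∀ x → x ∈ Y → lower f x <± upper g x) →
             X ≐ cellBand Y f g → IsCell 𝓕 (suc d) X

  -- Unbounded intervals and bands are M-cells: with finite end points
  -- only, every M-cell in K^ 1 would be bounded, and K itself would not
  -- be a finite union of such cells and a finite set.
  IsMCell : ∀ {m} → Carrier → Pred (K^ m) ℓ → Set (lsuc (s ⊔ ℓ))
  IsMCell M X = (0# < M) ×
    ∃ λ d → IsCell (λ Y f → IsC¹MFunction M Y (scalar f)) d X

  ----------------------------------------------------------------------
  -- Dimension

  -- The dimension of a definable set is the largest dimension of a cell
  -- (with definable continuous defining functions) contained in it, and
  -- -∞ for the empty set.
  IsContinuousCell : ∀ {m} → ℕ → Pred (K^ m) ℓ → Set (lsuc (s ⊔ ℓ))
  IsContinuousCell = IsCell λ Y f →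
    Definable (Graph Y (scalar f)) × ContinuousOn Y (scalar f)

  dim_≤_ dim_<_ : ∀ {n} → Pred (K^ n) ℓ → ℕ → Set (lsuc (s ⊔ ℓ))
  dim A ≤ e = ∀ d C → IsContinuousCell d C → C ⊆ A → d ℕ.≤ e
  dim A < e = ∀ d C → IsContinuousCell d C → C ⊆ A → d ℕ.< e

  ----------------------------------------------------------------------
  -- Rectifiability

  -- The bijection σ permutes the n = e + (n ∸ e) coordinates; there is
  -- none unless e ≤ n.
  IsBasicRectifiable : ∀ {n} → ℕ → Carrier → Pred (K^ n) ℓ →
                       Set (lsuc (s ⊔ ℓ))
  IsBasicRectifiable {n} e M A = IsFinite M ×
    ∃ λ (σ : Permutation (e ℕ.+ (n ∸ e)) n) →
    ∃₂ λ (U : Pred (K^ e) ℓ) (f : K^ e → K^ (n ∸ e)) →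
      IsMCell M U × IsOpen U × IsMFunction M U f ×
      (A ≐ λ x → x ∘ (σ ⟨$⟩ʳ_) ∈ Graph U f)

  record IsBasicRectifiablePartition {n} (e : ℕ) (M : Carrier)
         (A : Pred (K^ n) ℓ) {k} (As : Fin (suc k) → Pred (K^ n) ℓ)
         : Set (lsuc (s ⊔ ℓ)) where
    field
      definable   : ∀ i → Definable (As i)
      union       : A ≐ (λ x → ∃ λ i → x ∈ As i)
      disjoint    : ∀ i j → i ≢ j → As i ⊥′ As j
      dim-zero    : dim (As zero) < e
      rectifiable : ∀ i → IsBasicRectifiable e M (As (suc i))

{-# OPTIONS --safe #-}
-- ∀*ⁿ P says that the points of K^ n at which a definable P fails contain no
-- box.  If dim A ≤ e, no projection of A to e + 1 coordinates contains a box.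
-- Hence, over almost every choice of e coordinates, A is finite, and by
-- saturation it is covered by finitely many charts: definable sections of the
-- projections of K^ n to e coordinates.
--
-- Slopes are bounded by exchanging coordinates.  Where the largest slope of β
-- exceeds 1, and is that in the direction l, the graph x j = β x is also the
-- graph of finitely many functions x l = δ x, and each δ has Lipschitz
-- constant 3.  Treating the components of a chart one at a time, one obtains
-- charts with slopes bounded in terms of n alone.
--
-- It remains to cover almost all of a definable subset X of a coordinate
-- space by cells with bounded slopes (by induction on the dimension).  The
-- steep parts of the boundary of X are exchanged likewise; cut into pieces
-- with nearly constant slopes and extended à la McShane, they become nearly
-- affine walls x k = γ x, of colour k.  Each wall gets a weight whose products
-- with its slopes are not close to weights available to other colours.  In the
-- region where the walls of colour k are closest, in the weighted sense, the
-- boundary of X in direction k is nowhere steep: a wall of another colour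
-- would pass through it.  The boundary of the region itself consists of ties
-- between two walls, which have bounded slopes by the choice of the weights.
-- Thus X is, within the region, a union of bands in direction k.
module Submission where

open import Defs
open import Axiom.ExcludedMiddle using (ExcludedMiddle)
open import Data.Empty using (⊥-elim)
import Data.Empty.Polymorphic as Poly
open import Data.Fin.Base as Fin
  using (Fin; zero; suc; toℕ; fromℕ<; inject₁; punchIn; punchOut; opposite; splitAt; _↑ˡ_; _↑ʳ_)
open import Data.Fin.Permutation as Perm using (Permutation; _⟨$⟩ʳ_; _⟨$⟩ˡ_)
open import Data.Fin.Properties as Fin
  using (punchIn-injective; punchInᵢ≢i; punchIn-punchOut; splitAt-↑ˡ; splitAt-↑ʳ; toℕ-↑ʳ; toℕ<n; toℕ-injective)
open import Data.List.Base as List using (List; []; _∷_)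
open import Data.List.Membership.Propositional using (_∈_; find; lose)
open import Data.List.Membership.Propositional.Properties
  using (∈-map⁺; ∈-++⁺ˡ; ∈-++⁺ʳ; ∈-allFin; ∈-lookup)
open import Data.List.Properties using (length-map; length-++)
open import Data.List.Relation.Unary.All as All using (All; []; _∷_)
import Data.List.Relation.Unary.All.Properties as All
open import Data.List.Relation.Unary.AllPairs as AllPairs using (AllPairs; []; _∷_)
import Data.List.Relation.Unary.AllPairs.Properties as AllPairs
open import Data.List.Relation.Unary.Any as Any using (Any; here; there)
import Data.List.Relation.Unary.Any.Properties as Any
open import Data.Maybe.Base as Maybe using (Maybe; just; nothing)
import Data.Maybe.Relation.Unary.All as MaybeAll
open import Data.Nat.Base as ℕ using (ℕ; zero; suc)
import Data.Nat.Properties as ℕ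
open import Data.Product.Base as Prod using (Σ; ∃; ∃₂; _×_; _,_; proj₁; proj₂)
open import Data.Sum.Base as Sum using (_⊎_; inj₁; inj₂; [_,_]′)
open import Data.Vec.Base as Vec using (Vec; []; _∷_; lookup)
open import Data.Vec.Functional as Vector using (Vector; updateAt; init; last; take)
open import Data.Vec.Functional.Properties using (updateAt-updates; updateAt-minimal)
open import Function.Base using (_∘_; id; case_of_; _$_)
open import Level using (Level; Setω; _⊔_)
import Relation.Binary.Construct.Add.Infimum.Strict as Inf
import Relation.Binary.Construct.Add.Supremum.Strict as Sup
open import Relation.Binary.Definitions using (Tri; tri<; tri≈; tri>)
open import Relation.Binary.PropositionalEquality.Core as ≡ using (_≡_; _≢_)
open import Relation.Binary.Structures using (IsStrictTotalOrder)
import Relation.Nullary.Construct.Add.Infimum as Inf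
open import Relation.Nullary.Construct.Add.Extrema using (_±; ⊥±; ⊤±) renaming ([_] to [_]±)
open import Relation.Nullary.Decidable.Core using (yes; no)
open import Relation.Nullary.Negation.Core using (¬_)
open import Relation.Unary using (Pred)

-- Ordinary cell decomposition gives no control of slopes: the boundary of `X` may be steep in
-- different directions at different places, and exchanging coordinates for one piece tilts the
-- others. The number of walls depends on `A`, so the weights must come from lists fixed in terms of
-- `n`; these grow geometrically, each is longer than all later ones together, and a pigeonhole
-- argument serves every wall separately. On a tie, weight times height agrees up to sign for walls
-- `v` and `w`. Along the axis of `v` the first product changes at the rate `Wt v`, the second at
-- about `Wt w` times one slope of `w`. If these rates differ by 1 in absolute value, the tie can be
-- solved for the axis of `v` with bounded slopes. Walls are nearly affine so that a single number
-- stands for that slope everywhere. The constant does not grow in the induction: the bound of the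
-- smaller cells enters only the fineness of the grid of slopes. Saturation is applied only to bound
-- the sizes of finite fibres uniformly; choice, commuting quantifiers and derivatives almost
-- everywhere are built on that.

-- Certificates for linear arithmetic, found by Fourier–Motzkin
-- elimination.  Nothing is proved about the search: a certificate is
-- checked afterwards by the ring solver.
module FourierMotzkin where

 open import Data.Bool.Base using (Bool; true; false; T; _∧_; _∨_; not; if_then_else_)
 open import Data.Bool.ListAction using (any)
 open import Data.Integer.Base as ℤ using (ℤ; +_; -[1+_]; _⊖_)
 open import Data.Nat.Base using (_≡ᵇ_; _≤ᵇ_)
 open import Data.Unit.Base using (⊤; tt)

 Monomial : Set
 Monomial = List ℕ

 Poly : Set
 Poly = List (Monomial × ℤ)

 _==_ : Monomial → Monomial → Bool
 [] == [] = true
 (x ∷ xs) == (y ∷ ys) = (x ≡ᵇ y) ∧ (xs == ys)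
 _ == _ = false

 isZero : ℤ → Bool
 isZero (+ 0) = true
 isZero _ = false

 isPos isNeg : ℤ → Bool
 isPos (+ suc _) = true
 isPos _ = false
 isNeg -[1+ _ ] = true
 isNeg _ = false

 addTerm : Monomial × ℤ → Poly → Poly
 addTerm (m , c) [] = if isZero c then [] else (m , c) ∷ []
 addTerm (m , c) ((m′ , d) ∷ p) with m == m′
 ... | false = (m′ , d) ∷ addTerm (m , c) p
 ... | true = if isZero (c ℤ.+ d) then p else (m′ , c ℤ.+ d) ∷ p

 _⊕_ : Poly → Poly → Poly
 p ⊕ q = List.foldr addTerm q p

 scale : ℤ → Poly → Poly
 scale c = List.map λ (m , d) → m , c ℤ.* d

 insert : ℕ → Monomial → Monomial
 insert x [] = x ∷ []
 insert x (y ∷ ys) = if x ≤ᵇ y then x ∷ y ∷ ys else y ∷ insert x ys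

 _⊗_ : Poly → Poly → Poly
 p ⊗ q = List.foldr (λ (m , c) r → List.map (λ (m′ , d) → List.foldr insert m′ m , c ℤ.* d) q ⊕ r) [] p

 -- `cert` records how often each hypothesis was added up to give `poly`.
 record Row : Set where
   constructor row
   field
     strict : Bool
     poly : Poly
     cert : List ℕ
 open Row

 coeff : Monomial → Poly → ℤ
 coeff m [] = + 0
 coeff m ((m′ , c) ∷ p) = if m == m′ then c else coeff m p

 addCert : ℕ → List ℕ → ℕ → List ℕ → List ℕ
 addCert a (x ∷ xs) b (y ∷ ys) = (a ℕ.* x ℕ.+ b ℕ.* y) ∷ addCert a xs b ys
 addCert a xs b [] = List.map (a ℕ.*_) xs
 addCert a [] b ys = List.map (b ℕ.*_) ys

 absurd : Row → Bool
 absurd (row s [] c) = s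
 absurd (row s (([] , d) ∷ []) c) = isNeg d
 absurd _ = false

 combine : Monomial → Row → Row → Row
 combine m r₁ r₂ = row (strict r₁ ∨ strict r₂) (scale (+ b) (poly r₁) ⊕ scale (+ a) (poly r₂))
     (addCert b (cert r₁) a (cert r₂))
   where
   a = ℤ.∣ coeff m (poly r₁) ∣
   b = ℤ.∣ coeff m (poly r₂) ∣

 eliminate : Monomial → List Row → List Row
 eliminate m rs = List.filterᵇ (λ r → isZero (coeff m (poly r))) rs List.++
   List.concatMap (λ r → List.map (combine m r) neg) pos
   where
   pos = List.filterᵇ (λ r → isPos (coeff m (poly r))) rs
   neg = List.filterᵇ (λ r → isNeg (coeff m (poly r))) rs

 firstAbsurd : List Row → Maybe (List ℕ)
 firstAbsurd [] = nothing
 firstAbsurd (r ∷ rs) = if absurd r then just (cert r) else firstAbsurd rs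

 monomials : List Row → List Monomial
 monomials [] = []
 monomials (r ∷ rs) = List.foldr add (monomials rs) (List.map proj₁ (poly r))
   where
   add : Monomial → List Monomial → List Monomial
   add [] ms = ms
   add (x ∷ m) ms = if any ((x ∷ m) ==_) ms then ms else (x ∷ m) ∷ ms

 -- The number of new rows that eliminating `m` creates; `search` eliminates a monomial for which it
 -- is least.
 cost : List Row → Monomial → ℕ
 cost rs m = List.length (List.filterᵇ (λ r → isPos (coeff m (poly r))) rs) ℕ.*
   List.length (List.filterᵇ (λ r → isNeg (coeff m (poly r))) rs)

 cheapest : List Row → Monomial → List Monomial → Monomial
 cheapest rs m [] = m
 cheapest rs m (m′ ∷ ms) = cheapest rs (if cost rs m ≤ᵇ cost rs m′ then m else m′) ms

 search : ℕ → List Row → Maybe (List ℕ)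
 search′ : ℕ → List Row → List Monomial → Maybe (List ℕ)
 search fuel rs with firstAbsurd rs
 ... | just c = just c
 ... | nothing = search′ fuel rs (monomials rs)
 search′ zero _ _ = nothing
 search′ (suc fuel) rs [] = nothing
 search′ (suc fuel) rs (m ∷ ms) = search fuel (eliminate (cheapest rs m ms) rs)

-- Linear arithmetic over an ordered field, by reflection

module LinearArithmetic {ℓ : Level} (F : OrderedField ℓ) where

 import Algebra.Properties.Ring as RingProperties
 open import Algebra.Bundles using (CommutativeRing)
 import Algebra.Properties.Semiring.Mult as Mult
 import Algebra.Solver.Ring as RingSolver
 open import Algebra.Solver.Ring.AlmostCommutativeRing
   using (fromCommutativeRing; _-Raw-AlmostCommutative⟶_)
 open import Data.Bool.Base using (Bool; true; false; T; _∧_; _∨_; not; if_then_else_)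
 open import Data.Bool.ListAction using (any)
 open import Data.Integer.Base as ℤ using (ℤ; +_; -[1+_]; _⊖_)
 import Data.Integer.Properties as ℤ
 open import Data.Maybe.Base using (is-just)
 open import Data.Nat.Base using (_≡ᵇ_; _≤ᵇ_)
 open import Data.Unit.Base using (⊤; tt)
 open import Data.Vec.N-ary using (N-ary; _$ⁿ_)

 open OrderedField F public
 open FourierMotzkin
 open import Relation.Binary.Reasoning.Setoid setoid
 open Mult semiring using (×1-homo-*; ×-homo-+)
 open RingProperties ring
   using (-‿distribˡ-*; -‿distribʳ-*; -‿involutive; -‿+-comm; -0#≈0#)

 private module O = IsStrictTotalOrder isStrictTotalOrder

 <-trans : ∀ {x y z} → x < y → y < z → x < z
 <-trans = O.trans

 <-respʳ : ∀ {x y z} → y ≈ z → x < y → x < z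
 <-respʳ = O.<-respʳ-≈

 <-respˡ : ∀ {x y z} → y ≈ z → y < x → z < x
 <-respˡ = O.<-respˡ-≈

 <-irrefl : ∀ {x y} → x ≈ y → ¬ (x < y)
 <-irrefl = O.irrefl

 cmp : ∀ x y → Tri (x < y) (x ≈ y) (y < x)
 cmp = O.compare

 ≰⇒> : ∀ {x y} → ¬ (x ≤ y) → y < x
 ≰⇒> {x} {y} x≰y with cmp x y
 ... | tri< x<y _ _ = ⊥-elim (x≰y (inj₁ x<y))
 ... | tri≈ _ x≈y _ = ⊥-elim (x≰y (inj₂ x≈y))
 ... | tri> _ _ y<x = y<x

 ≮⇒≥ : ∀ {x y} → ¬ (x < y) → y ≤ x
 ≮⇒≥ {x} {y} x≮y with cmp x y
 ... | tri< x<y _ _ = ⊥-elim (x≮y x<y)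
 ... | tri≈ _ x≈y _ = inj₂ (sym x≈y)
 ... | tri> _ _ y<x = inj₁ y<x

 ≤⇒≯ : ∀ {x y} → x ≤ y → ¬ (y < x)
 ≤⇒≯ (inj₁ x<y) y<x = <-irrefl refl (<-trans x<y y<x)
 ≤⇒≯ (inj₂ x≈y) y<x = <-irrefl (sym x≈y) y<x

 ≤-antisym : ∀ {x y} → x ≤ y → y ≤ x → x ≈ y
 ≤-antisym (inj₁ x<y) y≤x = ⊥-elim (≤⇒≯ y≤x x<y)
 ≤-antisym (inj₂ x≈y) _ = x≈y

 private
   +-<ʳ : ∀ {x y} z → x < y → z + x < z + y
   +-<ʳ z x<y = <-respˡ (+-comm _ z) (<-respʳ (+-comm _ z) (+-monoˡ-< z x<y))

   x-x≈0 : ∀ x → x - x ≈ 0#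
   x-x≈0 = -‿inverseʳ

   <⇒0<- : ∀ {x y} → x < y → 0# < y - x
   <⇒0<- {x} x<y = <-respˡ (x-x≈0 x) (+-monoˡ-< (- x) x<y)

   ≤⇒0≤- : ∀ {x y} → x ≤ y → 0# ≤ y - x
   ≤⇒0≤- (inj₁ x<y) = inj₁ (<⇒0<- x<y)
   ≤⇒0≤- {x} {y} (inj₂ x≈y) = inj₂ (sym (trans (+-congʳ (sym x≈y)) (x-x≈0 x)))

   0<+ : ∀ {x y} → 0# < x → 0# < y → 0# < x + y
   0<+ {x} 0<x 0<y = <-trans 0<x (<-respˡ (+-identityʳ x) (+-<ʳ x 0<y))

   0≤+ : ∀ {x y} → 0# ≤ x → 0# ≤ y → 0# ≤ x + y
   0≤+ (inj₁ 0<x) (inj₁ 0<y) = inj₁ (0<+ 0<x 0<y)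
   0≤+ (inj₁ 0<x) (inj₂ 0≈y) = inj₁ (<-respʳ (trans (sym (+-identityʳ _)) (+-congˡ 0≈y)) 0<x)
   0≤+ (inj₂ 0≈x) (inj₁ 0<y) = inj₁ (<-respʳ (trans (sym (+-identityˡ _)) (+-congʳ 0≈x)) 0<y)
   0≤+ (inj₂ 0≈x) (inj₂ 0≈y) = inj₂ (trans (sym (+-identityˡ _)) (+-cong 0≈x 0≈y))

   <-≤-0+ : ∀ {x y} → 0# < x → 0# ≤ y → 0# < x + y
   <-≤-0+ 0<x (inj₁ 0<y) = 0<+ 0<x 0<y
   <-≤-0+ 0<x (inj₂ 0≈y) = <-respʳ (trans (sym (+-identityʳ _)) (+-congˡ 0≈y)) 0<x

 0<1 : 0# < 1#
 0<1 with cmp 0# 1#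
 ... | tri< 0<1 _ _ = 0<1
 ... | tri≈ _ 0≈1 _ = ⊥-elim (0≉1 0≈1)
 ... | tri> _ _ 1<0 = <-respʳ eq (*-pos 0<-1 0<-1)
   where
   0<-1 : 0# < - 1#
   0<-1 = <-respʳ (+-identityˡ _) (<⇒0<- 1<0)
   eq : (- 1#) * (- 1#) ≈ 1#
   eq = trans (sym (-‿distribˡ-* 1# (- 1#))) (trans (-‿cong (*-identityˡ _)) (-‿involutive 1#))

 fromℕ-nonneg : ∀ k → 0# ≤ fromℕ k
 fromℕ-nonneg zero = inj₂ refl
 fromℕ-nonneg (suc k) = 0≤+ (inj₁ 0<1) (fromℕ-nonneg k)

 fromℕ-pos : ∀ k → 0# < fromℕ (suc k)
 fromℕ-pos k = <-≤-0+ 0<1 (fromℕ-nonneg k)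

 private
   fromℤ : ℤ → Carrier
   fromℤ (+ k) = fromℕ k
   fromℤ -[1+ k ] = - fromℕ (suc k)

   cancel-1 : ∀ x y → x - y ≈ (1# + x) - (1# + y)
   cancel-1 x y = sym (begin (1# + x) + - (1# + y) ≈⟨ +-congˡ (-‿+-comm 1# y) ⟨
     (1# + x) + (- 1# + - y) ≈⟨ +-congʳ (+-comm 1# x) ⟩
     (x + 1#) + (- 1# + - y) ≈⟨ +-assoc x 1# _ ⟩
     x + (1# + (- 1# + - y)) ≈⟨ +-congˡ (+-assoc 1# (- 1#) (- y)) ⟨
     x + ((1# + - 1#) + - y) ≈⟨ +-congˡ (+-congʳ (-‿inverseʳ 1#)) ⟩
     x + (0# + - y) ≈⟨ +-congˡ (+-identityˡ _) ⟩
     x + - y ∎)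

   ⊖-homo : ∀ m n → fromℤ (m ⊖ n) ≈ fromℕ m - fromℕ n
   ⊖-homo m zero = begin fromℕ m ≈⟨ +-identityʳ _ ⟨ fromℕ m + 0# ≈⟨ +-congˡ -0#≈0# ⟨
     fromℕ m + - 0# ∎
   ⊖-homo zero (suc n) = sym (+-identityˡ _)
   ⊖-homo (suc m) (suc n) = begin fromℤ (suc m ⊖ suc n) ≡⟨ ≡.cong fromℤ (ℤ.[1+m]⊖[1+n]≡m⊖n m n) ⟩
     fromℤ (m ⊖ n) ≈⟨ ⊖-homo m n ⟩
     fromℕ m - fromℕ n ≈⟨ cancel-1 _ _ ⟩
     fromℕ (suc m) - fromℕ (suc n) ∎

   -ℤ-homo : ∀ a → fromℤ (ℤ.- a) ≈ - fromℤ a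
   -ℤ-homo (+ zero) = sym -0#≈0#
   -ℤ-homo (+ suc k) = refl
   -ℤ-homo -[1+ k ] = sym (-‿involutive _)

   +ℤ-homo : ∀ a b → fromℤ (a ℤ.+ b) ≈ fromℤ a + fromℤ b
   +ℤ-homo (+ m) (+ n) = ×-homo-+ 1# m n
   +ℤ-homo (+ m) -[1+ n ] = ⊖-homo m (suc n)
   +ℤ-homo -[1+ m ] (+ n) = trans (⊖-homo n (suc m)) (+-comm _ _)
   +ℤ-homo -[1+ m ] -[1+ n ] = begin - fromℕ (suc (suc (m ℕ.+ n)))
       ≡⟨ ≡.cong (-_ ∘ fromℕ) (≡.sym (ℕ-+-suc (suc m) n)) ⟩
     - fromℕ (suc m ℕ.+ suc n) ≈⟨ -‿cong (×-homo-+ 1# (suc m) (suc n)) ⟩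
     - (fromℕ (suc m) + fromℕ (suc n)) ≈⟨ -‿+-comm _ _ ⟨
     - fromℕ (suc m) + - fromℕ (suc n) ∎
     where open import Data.Nat.Properties using () renaming (+-suc to ℕ-+-suc)

   *ℤ-homo : ∀ a b → fromℤ (a ℤ.* b) ≈ fromℤ a * fromℤ b
   *ℤ-homo (+ m) (+ n) = begin fromℤ (+ m ℤ.* + n) ≡⟨ ≡.cong fromℤ (≡.sym (ℤ.pos-* m n)) ⟩
     fromℕ (m ℕ.* n) ≈⟨ ×1-homo-* m n ⟩
     fromℕ m * fromℕ n ∎
   *ℤ-homo (+ m) -[1+ n ] = begin
     fromℤ (+ m ℤ.* -[1+ n ]) ≡⟨ ≡.cong fromℤ (≡.sym (ℤ.neg-distribʳ-* (+ m) (+ suc n))) ⟩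
     fromℤ (ℤ.- (+ m ℤ.* + suc n)) ≈⟨ -ℤ-homo (+ m ℤ.* + suc n) ⟩
     - fromℤ (+ m ℤ.* + suc n) ≈⟨ -‿cong (*ℤ-homo (+ m) (+ suc n)) ⟩
     - (fromℕ m * fromℕ (suc n)) ≈⟨ -‿distribʳ-* _ _ ⟩
     fromℕ m * - fromℕ (suc n) ∎
   *ℤ-homo -[1+ m ] (+ n) = begin
     fromℤ (-[1+ m ] ℤ.* + n) ≡⟨ ≡.cong fromℤ (≡.sym (ℤ.neg-distribˡ-* (+ suc m) (+ n))) ⟩
     fromℤ (ℤ.- (+ suc m ℤ.* + n)) ≈⟨ -ℤ-homo (+ suc m ℤ.* + n) ⟩
     - fromℤ (+ suc m ℤ.* + n) ≈⟨ -‿cong (*ℤ-homo (+ suc m) (+ n)) ⟩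
     - (fromℕ (suc m) * fromℕ n) ≈⟨ -‿distribˡ-* _ _ ⟩
     - fromℕ (suc m) * fromℕ n ∎
   *ℤ-homo -[1+ m ] -[1+ n ] = begin fromℕ (suc m ℕ.* suc n) ≈⟨ ×1-homo-* (suc m) (suc n) ⟩
     fromℕ (suc m) * fromℕ (suc n) ≈⟨ -‿involutive _ ⟨
     - - (fromℕ (suc m) * fromℕ (suc n)) ≈⟨ -‿cong (-‿distribˡ-* _ _) ⟩
     - (- fromℕ (suc m) * fromℕ (suc n)) ≈⟨ -‿distribʳ-* _ _ ⟩
     - fromℕ (suc m) * - fromℕ (suc n) ∎

   ℤ-morphism : ℤ.+-*-rawRing -Raw-AlmostCommutative⟶ fromCommutativeRing commutativeRing
   ℤ-morphism = record
     { ⟦_⟧ = fromℤ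
     ; +-homo = +ℤ-homo
     ; *-homo = *ℤ-homo
     ; -‿homo = -ℤ-homo
     ; 0-homo = refl
     ; 1-homo = +-identityʳ 1#
     }

   ℤ≟ : ∀ a b → Maybe (fromℤ a ≈ fromℤ b)
   ℤ≟ a b with a ℤ.≟ b
   ... | yes a≡b = just (reflexive (≡.cong fromℤ a≡b))
   ... | no _ = nothing

   module S = RingSolver ℤ.+-*-rawRing (fromCommutativeRing commutativeRing)
                         ℤ-morphism ℤ≟

 infixl 8 _:*_
 infixl 7 _:+_ _:-_
 infix 9 :-_ #_
 infix 6 _:<_ _:≤_ _:≈_
 infixr 5 _⊢_ _∷_
 infix 5 ⊢_

 data Ex (n : ℕ) : Set where
   var : Fin n → Ex n
   #_ : ℕ → Ex n
   :0 :1 : Ex n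
   _:+_ _:*_ _:-_ : Ex n → Ex n → Ex n
   :-_ : Ex n → Ex n

 data Rel₂ : Set where
   :lt :le :eq : Rel₂

 data Atomic (n : ℕ) : Set where
   atomic : Rel₂ → Ex n → Ex n → Atomic n

 pattern _:<_ a b = atomic :lt a b
 pattern _:≤_ a b = atomic :le a b
 pattern _:≈_ a b = atomic :eq a b

 data Sequent (n : ℕ) : Set where
   ⊢_ : Atomic n → Sequent n
   _⊢_ : Atomic n → Atomic n → Sequent n
   _∷_ : Atomic n → Sequent n → Sequent n

 -- A record type, so that environments are inferred by unification.
 Env : ℕ → Set ℓ
 Env zero = Poly.⊤
   where import Data.Unit.Polymorphic as Poly
 Env (suc n) = Carrier × Env n

 at : ∀ {n} → Env n → Fin n → Carrier
 at ρ zero = proj₁ ρ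
 at ρ (suc i) = at (proj₂ ρ) i

 ⟦_⟧ : ∀ {n} → Ex n → Env n → Carrier
 ⟦ var i ⟧ ρ = at ρ i
 ⟦ # k ⟧ ρ = fromℕ k
 ⟦ :0 ⟧ ρ = 0#
 ⟦ :1 ⟧ ρ = 1#
 ⟦ a :+ b ⟧ ρ = ⟦ a ⟧ ρ + ⟦ b ⟧ ρ
 ⟦ a :* b ⟧ ρ = ⟦ a ⟧ ρ * ⟦ b ⟧ ρ
 ⟦ a :- b ⟧ ρ = ⟦ a ⟧ ρ - ⟦ b ⟧ ρ
 ⟦ :- a ⟧ ρ = - ⟦ a ⟧ ρ

 Holds : ∀ {n} → Atomic n → Env n → Set ℓ
 Holds (a :< b) ρ = ⟦ a ⟧ ρ < ⟦ b ⟧ ρ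
 Holds (a :≤ b) ρ = ⟦ a ⟧ ρ ≤ ⟦ b ⟧ ρ
 Holds (a :≈ b) ρ = ⟦ a ⟧ ρ ≈ ⟦ b ⟧ ρ

 Valid : ∀ {n} → Sequent n → Env n → Set ℓ
 Valid (⊢ g) ρ = Holds g ρ
 Valid (h ⊢ g) ρ = Holds h ρ → Holds g ρ
 Valid (h ∷ s) ρ = Holds h ρ → Valid s ρ

 private
   translate : ∀ {n} → Ex n → S.Polynomial n
   translate (var i) = S.var i
   translate (# k) = S.con (+ k)
   translate :0 = S.con (+ 0)
   translate :1 = S.con (+ 1)
   translate (a :+ b) = translate a S.:+ translate b
   translate (a :* b) = translate a S.:* translate b
   translate (a :- b) = translate a S.:- translate b
   translate (:- a) = S.:- translate a

   vec : ∀ {n} → Env n → Vec Carrier n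
   vec {zero} ρ = []
   vec {suc n} ρ = proj₁ ρ ∷ vec (proj₂ ρ)

   lookup-vec : ∀ {n} (ρ : Env n) i → Vec.lookup (vec ρ) i ≡ at ρ i
   lookup-vec ρ zero = ≡.refl
   lookup-vec ρ (suc i) = lookup-vec (proj₂ ρ) i

   translate-sound : ∀ {n} (a : Ex n) ρ → S.⟦ translate a ⟧ (vec ρ) ≈ ⟦ a ⟧ ρ
   translate-sound (var i) ρ = reflexive (lookup-vec ρ i)
   translate-sound (# k) ρ = refl
   translate-sound :0 ρ = refl
   translate-sound :1 ρ = +-identityʳ 1#
   translate-sound (a :+ b) ρ = +-cong (translate-sound a ρ) (translate-sound b ρ)
   translate-sound (a :* b) ρ = *-cong (translate-sound a ρ) (translate-sound b ρ)
   translate-sound (a :- b) ρ = +-cong (translate-sound a ρ) (-‿cong (translate-sound b ρ))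
   translate-sound (:- a) ρ = -‿cong (translate-sound a ρ)

   toPoly : ∀ {n} → Ex n → Poly
   toPoly (var i) = (toℕ i ∷ [] , + 1) ∷ []
   toPoly (# k) = addTerm ([] , + k) []
   toPoly :0 = []
   toPoly :1 = ([] , + 1) ∷ []
   toPoly (a :+ b) = toPoly a ⊕ toPoly b
   toPoly (a :* b) = toPoly a ⊗ toPoly b
   toPoly (a :- b) = scale -[1+ 0 ] (toPoly b) ⊕ toPoly a
   toPoly (:- a) = scale -[1+ 0 ] (toPoly a)

   -- (true , a) stands for 0 < a and (false , a) for 0 ≤ a.
   Signed : ℕ → Set
   Signed n = Bool × Ex n

   Sign : ∀ {n} → Signed n → Env n → Set ℓ
   Sign (true , a) ρ = 0# < ⟦ a ⟧ ρ
   Sign (false , a) ρ = 0# ≤ ⟦ a ⟧ ρ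

   AllSign : ∀ {n} → List (Signed n) → Env n → Set ℓ
   AllSign [] ρ = Poly.⊤
     where import Data.Unit.Polymorphic as Poly
   AllSign (h ∷ hs) ρ = Sign h ρ × AllSign hs ρ

   rows : ∀ {n} → ℕ → List (Signed n) → List Row
   rows k [] = []
   rows k ((s , a) ∷ hs) = row s (toPoly a) (List.replicate k 0 List.++ (1 ∷ [])) ∷ rows (suc k) hs

   combination : ∀ {n} → List (Signed n) → List ℕ → Ex n
   combination ((s , a) ∷ hs) (c ∷ cs) = (# c :* a) :+ combination hs cs
   combination _ _ = :0

   usesStrict : ∀ {n} → List (Signed n) → List ℕ → Bool
   usesStrict ((s , a) ∷ hs) (c ∷ cs) = (s ∧ not (c ≡ᵇ 0)) ∨ usesStrict hs cs
   usesStrict _ _ = false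

   constant : ℕ → ∀ {n} → S.Polynomial n
   constant k = S.con (ℤ.- (+ k))

   isConstant : ∀ {n} → Ex n → ℕ → Bool
   isConstant a k = is-just (S.normalise (translate a) S.≟N S.normalise (constant k))

   value : Poly → ℕ
   value (([] , c) ∷ _) = ℤ.∣ c ∣
   value _ = 0

   -- A combination of nonnegative quantities that normalises to `- k` is absurd if `k` is positive,
   -- and also for `k` zero if a positive quantity occurs in it with nonzero coefficient.
   check : ∀ {n} → List (Signed n) → Maybe (List ℕ) → Bool
   check hs nothing = false
   check hs (just cs) = isConstant (combination hs cs) k ∧ (usesStrict hs cs ∨ not (k ≡ᵇ 0))
     where k = value (toPoly (combination hs cs))

   0≤c* : ∀ c {x} → 0# ≤ x → 0# ≤ fromℕ c * x
   0≤c* zero {x} _ = inj₂ (sym (zeroˡ x))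
   0≤c* (suc c) (inj₁ 0<x) = inj₁ (*-pos (fromℕ-pos c) 0<x)
   0≤c* (suc c) (inj₂ 0≈x) = inj₂ (sym (trans (*-congˡ (sym 0≈x)) (zeroʳ _)))

   weaken : ∀ {n} (h : Signed n) ρ → Sign h ρ → 0# ≤ ⟦ proj₂ h ⟧ ρ
   weaken (true , a) ρ h = inj₁ h
   weaken (false , a) ρ h = h

   combination≥0 : ∀ {n} (hs : List (Signed n)) cs ρ → AllSign hs ρ → 0# ≤ ⟦ combination hs cs ⟧ ρ
   combination≥0 [] _ ρ _ = inj₂ refl
   combination≥0 (_ ∷ _) [] ρ _ = inj₂ refl
   combination≥0 (h ∷ hs) (c ∷ cs) ρ (p , ps) = 0≤+ (0≤c* c (weaken h ρ p)) (combination≥0 hs cs ρ ps)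

   combination>0 : ∀ {n} (hs : List (Signed n)) cs ρ → AllSign hs ρ →
                   T (usesStrict hs cs) → 0# < ⟦ combination hs cs ⟧ ρ
   combination>0 ((true , a) ∷ hs) (zero ∷ cs) ρ (p , ps) t =
     <-respʳ (+-comm _ _) (<-≤-0+ (combination>0 hs cs ρ ps t) (0≤c* 0 (inj₁ p)))
   combination>0 ((true , a) ∷ hs) (suc c ∷ cs) ρ (p , ps) t =
     <-≤-0+ (*-pos (fromℕ-pos c) p) (combination≥0 hs cs ρ ps)
   combination>0 ((false , a) ∷ hs) (c ∷ cs) ρ (p , ps) t =
     <-respʳ (+-comm _ _) (<-≤-0+ (combination>0 hs cs ρ ps t) (0≤c* c p))

   constant-value : ∀ {n} (a : Ex n) k ρ → T (isConstant a k) → ⟦ a ⟧ ρ ≈ - fromℕ k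
   constant-value a k ρ t
     with S.normalise (translate a) S.≟N S.normalise (constant k)
   ... | just p = begin ⟦ a ⟧ ρ ≈⟨ translate-sound a ρ ⟨
     S.⟦ translate a ⟧ (vec ρ) ≈⟨ S.prove (vec ρ) (translate a) (constant k) (S.⟦ p ⟧N-cong (vec ρ)) ⟩
     S.⟦ constant k ⟧ (vec ρ) ≈⟨ -ℤ-homo (+ k) ⟩
     - fromℕ k ∎

   T-∧ : ∀ {a b} → T (a ∧ b) → T a × T b
   T-∧ {true} t = tt , t

   -k≮0 : ∀ k {x} → x ≈ - fromℕ k → ¬ (0# < x)
   -k≮0 k x≈-k 0<x = <-irrefl refl (<-respʳ eq₁ (<-≤-0+ (<-respʳ x≈-k 0<x) (fromℕ-nonneg k)))
     where
     eq₁ : - fromℕ k + fromℕ k ≈ 0#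
     eq₁ = -‿inverseˡ _

   -k≱0 : ∀ k {x} → x ≈ - fromℕ (suc k) → ¬ (0# ≤ x)
   -k≱0 k x≈-k (inj₁ 0<x) = -k≮0 (suc k) x≈-k 0<x
   -k≱0 k x≈-k (inj₂ 0≈x) = <-irrefl refl (<-respʳ
     (trans (sym (-‿involutive _)) (trans (-‿cong (sym (trans 0≈x x≈-k))) -0#≈0#))
     (fromℕ-pos k))

   refute : ∀ {n} (hs : List (Signed n)) c ρ → AllSign hs ρ → T (check hs c) → ∀ {a} {A : Set a} → A
   refute hs (just cs) ρ ps t =
     contra k (constant-value (combination hs cs) k ρ (proj₁ (T-∧ {isConstant (combination hs cs) k} t))) (proj₂ (T-∧ {isConstant (combination hs cs) k} t))
     where
     k = value (toPoly (combination hs cs))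
     contra : ∀ k → ⟦ combination hs cs ⟧ ρ ≈ - fromℕ k →
              T (usesStrict hs cs ∨ not (k ≡ᵇ 0)) → ∀ {a} {A : Set a} → A
     contra k e u with usesStrict hs cs in eq′
     ... | true = ⊥-elim (-k≮0 k e (combination>0 hs cs ρ ps (≡.subst T (≡.sym eq′) tt)))
     contra (suc k) e u | false = ⊥-elim (-k≱0 k e (combination≥0 hs cs ρ ps))

   assume : ∀ {n} → Atomic n → List (Signed n) → List (Signed n)
   assume (a :< b) hs = (true , b :- a) ∷ hs
   assume (a :≤ b) hs = (false , b :- a) ∷ hs
   assume (a :≈ b) hs = (false , b :- a) ∷ (false , a :- b) ∷ hs

   signs : ∀ {n} → Sequent n → List (Signed n)
   signs (⊢ g) = []
   signs (h ⊢ g) = assume h []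
   signs (h ∷ s) = assume h (signs s)

   goal : ∀ {n} → Sequent n → Atomic n
   goal (⊢ g) = g
   goal (h ⊢ g) = g
   goal (h ∷ s) = goal s

   decide : ∀ {n} → List (Signed n) → Bool
   -- 40 is fuel, one unit for each eliminated monomial; if it runs out, the answer is just `false`.
   decide hs = check hs (search 40 (rows 0 hs))

 private
   refuteᵈ : ∀ {n} (hs : List (Signed n)) ρ → AllSign hs ρ → T (decide hs) → ∀ {a} {A : Set a} → A
   refuteᵈ hs = refute hs (search 40 (rows 0 hs))

 private
   implies : ∀ {n} → List (Signed n) → Atomic n → Bool
   implies hs (a :< b) = decide ((false , a :- b) ∷ hs)
   implies hs (a :≤ b) = decide ((true , a :- b) ∷ hs)
   implies hs (a :≈ b) = decide ((true , a :- b) ∷ hs) ∧ decide ((true , b :- a) ∷ hs)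

 provable : ∀ {n} → Sequent n → Bool
 provable s = implies (signs s) (goal s)

 private
   prove : ∀ {n} (hs : List (Signed n)) g ρ → T (implies hs g) → AllSign hs ρ → Holds g ρ
   prove hs (a :< b) ρ t ps with cmp (⟦ a ⟧ ρ) (⟦ b ⟧ ρ)
   ... | tri< a<b _ _ = a<b
   ... | tri≈ _ a≈b _ = refuteᵈ ((false , a :- b) ∷ hs) ρ (≤⇒0≤- (inj₂ (sym a≈b)) , ps) t
   ... | tri> _ _ b<a = refuteᵈ ((false , a :- b) ∷ hs) ρ (≤⇒0≤- (inj₁ b<a) , ps) t
   prove hs (a :≤ b) ρ t ps with cmp (⟦ a ⟧ ρ) (⟦ b ⟧ ρ)
   ... | tri< a<b _ _ = inj₁ a<b
   ... | tri≈ _ a≈b _ = inj₂ a≈b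
   ... | tri> _ _ b<a = refuteᵈ ((true , a :- b) ∷ hs) ρ (<⇒0<- b<a , ps) t
   prove hs (a :≈ b) ρ t ps with cmp (⟦ a ⟧ ρ) (⟦ b ⟧ ρ)
   ... | tri< a<b _ _ = refuteᵈ ((true , b :- a) ∷ hs) ρ (<⇒0<- a<b , ps)
                          (proj₂ (T-∧ {decide ((true , a :- b) ∷ hs)} t))
   ... | tri≈ _ a≈b _ = a≈b
   ... | tri> _ _ b<a = refuteᵈ ((true , a :- b) ∷ hs) ρ
                          (<⇒0<- b<a , ps) (proj₁ (T-∧ {decide ((true , a :- b) ∷ hs)} t))

   discharge : ∀ {n} h {hs : List (Signed n)} {ρ a} {A : Set a} →
               (AllSign (assume h hs) ρ → A) → Holds h ρ → AllSign hs ρ → A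
   discharge (a :< b) f h ps = f (<⇒0<- h , ps)
   discharge (a :≤ b) f h ps = f (≤⇒0≤- h , ps)
   discharge (a :≈ b) f h ps = f (≤⇒0≤- (inj₂ h) , ≤⇒0≤- (inj₂ (sym h)) , ps)

   curry′ : ∀ {n} (s : Sequent n) ρ → (AllSign (signs s) ρ → Holds (goal s) ρ) → Valid s ρ
   curry′ (⊢ g) ρ f = f _
   curry′ (h ⊢ g) ρ f p = discharge h f p _
   curry′ (h ∷ s) ρ f p = curry′ s ρ (discharge h f p)

   valid : ∀ {n} (s : Sequent n) → T (provable s) → ∀ ρ → Valid s ρ
   valid s t ρ = curry′ s ρ (prove (signs s) (goal s) ρ t)

 close : ∀ n → N-ary n (Ex n) (Sequent n) → Sequent n
 close n f = f $ⁿ Vec.map var (Vec.allFin n)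

 opaque
   -- The hidden argument is found by evaluation: its type reduces to the unit type when the search
   -- succeeds. Products of variables count as independent monomials, so every nonlinear fact has to
   -- be supplied as a hypothesis, multiplied out by the caller.
   lin : ∀ n (f : N-ary n (Ex n) (Sequent n)) {_ : T (provable (close n f))} → ∀ {ρ} → Valid (close n f) ρ
   lin n f {t} {ρ} = valid (close n f) t ρ

-- The weights of the colours and the bounds

module Constants where

 -- The ratio 9 has two uses. A condition that the product of a weight and a slope keep distance 1
 -- from a number `c ≥ 9` fails for at most one member (`far`), and a member exceeds 3 times any
 -- weight of a later colour by more than 1 (`dominates`).
 geometric : ℕ → ℕ → List ℕ
 geometric zero b = []
 geometric (suc k) b = 9 ℕ.* b ∷ geometric k (9 ℕ.* b)

 geometric-last : ℕ → ℕ → ℕ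
 geometric-last zero b = b
 geometric-last (suc k) b = geometric-last k (9 ℕ.* b)

 -- levels m i are the weights available to the colour i; the weights of
 -- a colour exceed those of the later colours.
 total top : ℕ → ℕ
 total zero = 0
 total (suc m) = suc (total m) ℕ.+ total m
 top zero = 1
 top (suc m) = geometric-last (suc (total m)) (top m)

 -- The first colour has `total m + 1` weights, one more than all later colours together. So each
 -- weight of a later colour may spoil one of them, and one is left.
 levels : ∀ m → Fin m → List ℕ
 levels (suc m) zero = geometric (suc (total m)) (top m)
 levels (suc m) (suc i) = levels m i

 ≤9* : ∀ b → b ℕ.≤ 9 ℕ.* b
 ≤9* b = ℕ.m≤n*m b 9

 geometric-≥ : ∀ k b → All (9 ℕ.* b ℕ.≤_) (geometric k b)
 geometric-≥ zero b = []
 geometric-≥ (suc k) b = ℕ.≤-refl ∷ All.map (ℕ.≤-trans (≤9* (9 ℕ.* b))) (geometric-≥ k (9 ℕ.* b))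

 ≤-geometric-last : ∀ k b → b ℕ.≤ geometric-last k b
 ≤-geometric-last zero b = ℕ.≤-refl
 ≤-geometric-last (suc k) b = ℕ.≤-trans (≤9* b) (≤-geometric-last k (9 ℕ.* b))

 geometric-≤ : ∀ k b → All (ℕ._≤ geometric-last k b) (geometric k b)
 geometric-≤ zero b = []
 geometric-≤ (suc k) b = ≤-geometric-last k (9 ℕ.* b) ∷ geometric-≤ k (9 ℕ.* b)

 geometric-pairs : ∀ k b → AllPairs (λ x y → 9 ℕ.* x ℕ.≤ y) (geometric k b)
 geometric-pairs zero b = []
 geometric-pairs (suc k) b = geometric-≥ k (9 ℕ.* b) ∷ geometric-pairs k (9 ℕ.* b)

 length-geometric : ∀ k b → List.length (geometric k b) ≡ k
 length-geometric zero b = ≡.refl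
 length-geometric (suc k) b = ≡.cong suc (length-geometric k (9 ℕ.* b))

 top≤ : ∀ m → top m ℕ.≤ top (suc m)
 top≤ m = ≤-geometric-last (suc (total m)) (top m)

 1≤top : ∀ m → 1 ℕ.≤ top m
 1≤top zero = ℕ.≤-refl
 1≤top (suc m) = ℕ.≤-trans (1≤top m) (top≤ m)

 level≤top : ∀ m i {b} → b ∈ levels m i → b ℕ.≤ top m
 level≤top (suc m) zero b∈ = All.lookup (geometric-≤ (suc (total m)) (top m)) b∈
 level≤top (suc m) (suc i) b∈ = ℕ.≤-trans (level≤top m i b∈) (top≤ m)

 level≥9 : ∀ m i {b} → b ∈ levels m i → 9 ℕ.≤ b
 level≥9 (suc m) zero b∈ = ℕ.≤-trans (ℕ.*-monoʳ-≤ 9 (1≤top m))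
   (All.lookup (geometric-≥ (suc (total m)) (top m)) b∈)
 level≥9 (suc m) (suc i) b∈ = level≥9 m i b∈

 -- A tie is an equation with Lipschitz constant `10 * top n`: two heights of constant 5, each with
 -- a weight up to `top n`. Solving it for a coordinate costs a factor 2.
 bound : ℕ → ℕ
 bound n = 20 ℕ.* top n

 -- An exchange substitutes a function with Lipschitz constant 3 into functions with Lipschitz
 -- constant `slopeBound m + 1`; hence the factor 1 + 3.
 slopeBound : ℕ → ℕ
 slopeBound zero = 3
 slopeBound (suc m) = (slopeBound m ℕ.+ 1) ℕ.* 4

 1≤slopeBound : ∀ m → 1 ℕ.≤ slopeBound m
 1≤slopeBound zero = ℕ.s≤s ℕ.z≤n
 1≤slopeBound (suc m) = ℕ.≤-trans (ℕ.m≤n+m 1 (slopeBound m)) (ℕ.m≤m*n _ 4)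

 slopeBound≤ : ∀ m → slopeBound m ℕ.≤ slopeBound (suc m)
 slopeBound≤ m = ℕ.≤-trans (ℕ.m≤m+n _ 1) (ℕ.m≤m*n _ 4)

 -- The price for passing from slopes in the ℓ¹ distance to squared Euclidean norms: a power of 2
 -- for comparing the norms, and a factor for the number of components.
 scale : ℕ → ℕ
 scale n = suc n ℕ.* 2 ℕ.^ n

 -- The successor makes the bound positive, as is demanded of the bound of an M-cell.
 finalBound : ℕ → ℕ
 finalBound n = suc (scale n ℕ.* (bound n ℕ.+ slopeBound n))

-- Every term of a parametrised module carries the parameters, hence one
-- record instead of four of them.
record Setting : Setω where
  field
    s ℓ : Level
    em : ∀ {a} → ExcludedMiddle a
    𝓚 : SaturatedOMinimalField s ℓ

module Rectification (𝓢 : Setting) where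

 open Setting 𝓢
 open import Data.Unit.Polymorphic.Base using (⊤; tt)

 open SaturatedOMinimalField 𝓚 using
   ( signature; structure; orderedField; eval; _⊨_; ⟦⟧ᶠ-cong; ⟦⟧ʳ-resp
   ; K^; Definable; Piece; point; interval; _∈ᴾ_; oMinimal; saturated) public
 open LinearArithmetic orderedField public hiding (⟦_⟧; Valid; Holds; Env; at; provable; close)
 open import Algebra.Properties.Semiring.Mult semiring using (×1-homo-*; ×-homo-+)

 -- Classical reasoning; formulas and renaming

 byContradiction : ∀ {a} {A : Set a} → ¬ ¬ A → A
 byContradiction {A = A} ¬¬a with em {P = A}
 ... | yes a = a
 ... | no ¬a = ⊥-elim (¬¬a ¬a)

 by-cases : ∀ {a b} (A : Set a) {B : Set b} → (A → B) → (¬ A → B) → B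
 by-cases A f g with em {P = A}
 ... | yes a = f a
 ... | no ¬a = g ¬a

 ≋-refl : ∀ {n} {x : K^ n} → x ≋ x
 ≋-refl i = refl

 ≋-sym : ∀ {n} {x y : K^ n} → x ≋ y → y ≋ x
 ≋-sym x≋y i = sym (x≋y i)

 ≋-trans : ∀ {n} {x y z : K^ n} → x ≋ y → y ≋ z → x ≋ z
 ≋-trans x≋y y≋z i = trans (x≋y i) (y≋z i)

 ∷-cong : ∀ {n a} {x y : K^ n} → x ≋ y → (a Vector.∷ x) ≋ (a Vector.∷ y)
 ∷-cong x≋y zero = refl
 ∷-cong x≋y (suc i) = x≋y i

 eval-cong : ∀ {m} (t : Term signature m) {ρ ρ′ : K^ m} → ρ ≋ ρ′ → eval t ρ ≈ eval t ρ′
 eval-cong (var i) e = e i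
 eval-cong 0′ e = refl
 eval-cong 1′ e = refl
 eval-cong (t +′ u) e = +-cong (eval-cong t e) (eval-cong u e)
 eval-cong (t *′ u) e = *-cong (eval-cong t e) (eval-cong u e)
 eval-cong (-′ t) e = -‿cong (eval-cong t e)
 eval-cong (fun f ts) e = ⟦⟧ᶠ-cong f (λ i → eval-cong (ts i) e)

 ⊨-cong : ∀ {m} (φ : Formula signature m) {ρ ρ′ : K^ m} → ρ ≋ ρ′ → ρ ⊨ φ → ρ′ ⊨ φ
 ⊨-cong (t ≐′ u) e p = trans (sym (eval-cong t e)) (trans p (eval-cong u e))
 ⊨-cong (t <′ u) e p = <-respˡ (eval-cong t e) (<-respʳ (eval-cong u e) p)
 ⊨-cong (rel R ts) e p = ⟦⟧ʳ-resp R (λ i → eval-cong (ts i) e) p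
 ⊨-cong (φ ∧′ ψ) e (p , q) = ⊨-cong φ e p , ⊨-cong ψ e q
 ⊨-cong (φ ∨′ ψ) e (inj₁ p) = inj₁ (⊨-cong φ e p)
 ⊨-cong (φ ∨′ ψ) e (inj₂ p) = inj₂ (⊨-cong ψ e p)
 ⊨-cong (φ ⇒′ ψ) e p q = ⊨-cong ψ e (p (⊨-cong φ (≋-sym e) q))
 ⊨-cong (∀′ φ) e p a = ⊨-cong φ (∷-cong e) (p a)
 ⊨-cong (∃′ φ) e (a , p) = a , ⊨-cong φ (∷-cong e) p

 extendᵛ : ∀ {m k} → (Fin m → Fin k) → Fin (suc m) → Fin (suc k)
 extendᵛ r zero = zero
 extendᵛ r (suc i) = suc (r i)

 renᵗ : ∀ {m k} → (Fin m → Fin k) → Term signature m → Term signature k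
 renᵗ r (var i) = var (r i)
 renᵗ r 0′ = 0′
 renᵗ r 1′ = 1′
 renᵗ r (t +′ u) = renᵗ r t +′ renᵗ r u
 renᵗ r (t *′ u) = renᵗ r t *′ renᵗ r u
 renᵗ r (-′ t) = -′ renᵗ r t
 renᵗ r (fun f ts) = fun f (λ i → renᵗ r (ts i))

 eval-ren : ∀ {m k} (r : Fin m → Fin k) t (ρ : K^ k) → eval (renᵗ r t) ρ ≈ eval t (ρ ∘ r)
 eval-ren r (var i) ρ = refl
 eval-ren r 0′ ρ = refl
 eval-ren r 1′ ρ = refl
 eval-ren r (t +′ u) ρ = +-cong (eval-ren r t ρ) (eval-ren r u ρ)
 eval-ren r (t *′ u) ρ = *-cong (eval-ren r t ρ) (eval-ren r u ρ)
 eval-ren r (-′ t) ρ = -‿cong (eval-ren r t ρ)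
 eval-ren r (fun f ts) ρ = ⟦⟧ᶠ-cong f (λ i → eval-ren r (ts i) ρ)

 extendᵛ-∷ : ∀ {m k} (r : Fin m → Fin k) a (ρ : K^ k) → ((a Vector.∷ ρ) ∘ extendᵛ r) ≋ (a Vector.∷ (ρ ∘ r))
 extendᵛ-∷ r a ρ zero = refl
 extendᵛ-∷ r a ρ (suc i) = refl

 ren : ∀ {m k} → (Fin m → Fin k) → Formula signature m → Formula signature k
 ren r (t ≐′ u) = renᵗ r t ≐′ renᵗ r u
 ren r (t <′ u) = renᵗ r t <′ renᵗ r u
 ren r (rel R ts) = rel R (λ i → renᵗ r (ts i))
 ren r false′ = false′
 ren r (φ ∧′ ψ) = ren r φ ∧′ ren r ψ
 ren r (φ ∨′ ψ) = ren r φ ∨′ ren r ψ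
 ren r (φ ⇒′ ψ) = ren r φ ⇒′ ren r ψ
 ren r (∀′ φ) = ∀′ ren (extendᵛ r) φ
 ren r (∃′ φ) = ∃′ ren (extendᵛ r) φ

 ⊨-ren : ∀ {m k} (r : Fin m → Fin k) φ (ρ : K^ k) → (ρ ⊨ ren r φ → (ρ ∘ r) ⊨ φ) × ((ρ ∘ r) ⊨ φ → ρ ⊨ ren r φ)
 ⊨-ren r (t ≐′ u) ρ = (λ p → trans (sym (eval-ren r t ρ)) (trans p (eval-ren r u ρ))) ,
   (λ p → trans (eval-ren r t ρ) (trans p (sym (eval-ren r u ρ))))
 ⊨-ren r (t <′ u) ρ = (λ p → <-respˡ (eval-ren r t ρ) (<-respʳ (eval-ren r u ρ) p)) ,
   (λ p → <-respˡ (sym (eval-ren r t ρ)) (<-respʳ (sym (eval-ren r u ρ)) p))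
 ⊨-ren r (rel R ts) ρ = ⟦⟧ʳ-resp R (λ i → eval-ren r (ts i) ρ) , ⟦⟧ʳ-resp R (λ i → sym (eval-ren r (ts i) ρ))
 ⊨-ren r false′ ρ = id , id
 ⊨-ren r (φ ∧′ ψ) ρ with ⊨-ren r φ ρ | ⊨-ren r ψ ρ
 ... | f , g | h , k = Prod.map f h , Prod.map g k
 ⊨-ren r (φ ∨′ ψ) ρ with ⊨-ren r φ ρ | ⊨-ren r ψ ρ
 ... | f , g | h , k = Sum.map f h , Sum.map g k
 ⊨-ren r (φ ⇒′ ψ) ρ with ⊨-ren r φ ρ | ⊨-ren r ψ ρ
 ... | f , g | h , k = (λ p → h ∘ p ∘ g) , (λ p → k ∘ p ∘ f)
 ⊨-ren r (∀′ φ) ρ = (λ p a → ⊨-cong φ (extendᵛ-∷ r a ρ) (proj₁ (⊨-ren (extendᵛ r) φ _) (p a))) ,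
   (λ p a → proj₂ (⊨-ren (extendᵛ r) φ _) (⊨-cong φ (≋-sym (extendᵛ-∷ r a ρ)) (p a)))
 ⊨-ren r (∃′ φ) ρ = (λ (a , p) → a , ⊨-cong φ (extendᵛ-∷ r a ρ) (proj₁ (⊨-ren (extendᵛ r) φ _) p)) ,
   (λ (a , p) → a , proj₂ (⊨-ren (extendᵛ r) φ _) (⊨-cong φ (≋-sym (extendᵛ-∷ r a ρ)) p))

 ∃^ : ∀ k {m} → Formula signature (k ℕ.+ m) → Formula signature m
 ∃^ zero φ = φ
 ∃^ (suc k) φ = ∃^ k (∃′ φ)

 ∷-++ : ∀ {k m} a (y : K^ k) (ρ : K^ m) → (a Vector.∷ (y Vector.++ ρ)) ≋ ((a Vector.∷ y) Vector.++ ρ)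
 ∷-++ a y ρ zero = refl
 ∷-++ {k} a y ρ (suc i) with splitAt k i
 ... | inj₁ _ = refl
 ... | inj₂ _ = refl

 ∷-tail : ∀ {k} (y : K^ (suc k)) → (y zero Vector.∷ (y ∘ suc)) ≋ y
 ∷-tail y zero = refl
 ∷-tail y (suc i) = refl

 ++-congˡ : ∀ {k m} {y z : K^ k} (ρ : K^ m) → y ≋ z → (y Vector.++ ρ) ≋ (z Vector.++ ρ)
 ++-congˡ {k} ρ y≋z i with splitAt k i
 ... | inj₁ j = y≋z j
 ... | inj₂ _ = refl

 ⊨-∃^ : ∀ k {m} φ (ρ : K^ m) → (ρ ⊨ ∃^ k φ → ∃ λ (y : K^ k) → (y Vector.++ ρ) ⊨ φ) ×
   ((y : K^ k) → (y Vector.++ ρ) ⊨ φ → ρ ⊨ ∃^ k φ)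
 ⊨-∃^ zero φ ρ = (λ p → Vector.[] , p) , (λ y p → p)
 ⊨-∃^ (suc k) φ ρ =
   (λ p → let y , a , q = proj₁ (⊨-∃^ k (∃′ φ) ρ) p in
     (a Vector.∷ y) , ⊨-cong φ (∷-++ a y ρ) q) ,
   (λ y p → proj₂ (⊨-∃^ k (∃′ φ) ρ) (y ∘ suc) (y zero , ⊨-cong φ (≋-trans (++-congˡ ρ (≋-sym (∷-tail y)))
                           (≋-sym (∷-++ (y zero) (y ∘ suc) ρ))) p))

 -- Contexts of scalar and vector variables

 data Sort : Set where
   scalar : Sort
   vec : ℕ → Sort

 infixl 5 _▸_

 data Ctx : Set where
   ∅ : Ctx
   _▸_ : Ctx → Sort → Ctx

 Val : Sort → Set ℓ
 Val scalar = Carrier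
 Val (vec n) = K^ n

 ⟪_⟫ : Ctx → Set ℓ
 ⟪ ∅ ⟫ = ⊤
 ⟪ Γ ▸ S ⟫ = ⟪ Γ ⟫ × Val S

 size : Sort → ℕ
 size scalar = 1
 size (vec n) = n

 entry : ∀ S → Val S → Fin (size S) → Carrier
 entry scalar a _ = a
 entry (vec n) x i = x i

 mk : ∀ S → K^ (size S) → Val S
 mk scalar y = y zero
 mk (vec n) y = y

 entry-mk : ∀ S y i → entry S (mk S y) i ≈ y i
 entry-mk scalar y zero = refl
 entry-mk (vec n) y i = refl

 data Var : Ctx → Set where
   here : ∀ {Γ S} → Fin (size S) → Var (Γ ▸ S)
   there : ∀ {Γ S} → Var Γ → Var (Γ ▸ S)

 look : ∀ {Γ} → Var Γ → ⟪ Γ ⟫ → Carrier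
 look (here {S = S} i) (_ , x) = entry S x i
 look (there v) (ρ , _) = look v ρ

 env : ∀ {Γ m} → (Fin m → Var Γ ⊎ Carrier) → ⟪ Γ ⟫ → K^ m
 env r ρ i = [ (λ v → look v ρ) , id ]′ (r i)

 -- A formula whose free variables are filled from the environment or by parameters. Contexts may
 -- contain vectors as well as scalars and predicates may live in any universe, so a proof of
 -- definability can copy the shape of the predicate.
 record Def {Γ a} (P : ⟪ Γ ⟫ → Set a) : Set (s ⊔ ℓ ⊔ a) where
   no-eta-equality
   pattern
   constructor def
   field
     {arity} : ℕ
     formula : Formula signature arity
     vars : Fin arity → Var Γ ⊎ Carrier
     to : ∀ ρ → P ρ → env vars ρ ⊨ formula
     from : ∀ ρ → env vars ρ ⊨ formula → P ρ

 DefF : ∀ {Γ} → (⟪ Γ ⟫ → Carrier) → Set (s ⊔ ℓ)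
 DefF {Γ} t = Def {Γ ▸ scalar} (λ ρ → proj₂ ρ ≈ t (proj₁ ρ))

 DefV : ∀ {Γ n} → (⟪ Γ ⟫ → K^ n) → Set (s ⊔ ℓ)
 DefV v = ∀ i → DefF (λ ρ → v ρ i)

 variable
   a b : Level
   Γ Δ : Ctx
   S : Sort
   c : Level
   n : ℕ

 -- Formulas respect the setoid equality of the field, hence so does everything definable;
 -- extensionality never has to be assumed separately.
 Def-resp : {P : ⟪ Γ ⟫ → Set a} → Def P → ∀ {ρ ρ′} → (∀ v → look v ρ ≈ look v ρ′) → P ρ → P ρ′
 Def-resp (def φ r to from) {ρ} {ρ′} e p = from ρ′ (⊨-cong φ (λ i → lemma (r i)) (to ρ p))
   where
   lemma : ∀ x → [ (λ v → look v ρ) , id ]′ x ≈ [ (λ v → look v ρ′) , id ]′ x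
   lemma (inj₁ v) = e v
   lemma (inj₂ c) = refl

 baseᵈ : ∀ {m} (φ : Formula signature m) (r : Fin m → Var Γ ⊎ Carrier) → Def {Γ} (λ ρ → env r ρ ⊨ φ)
 baseᵈ φ r = def φ r (λ _ → id) (λ _ → id)

 renᵈ : {P : ⟪ Δ ⟫ → Set a} → Def P → (f : Var Δ → Var Γ) →
        (σ : ⟪ Γ ⟫ → ⟪ Δ ⟫) → (∀ v ρ → look (f v) ρ ≈ look v (σ ρ)) →
        Def (P ∘ σ)
 renᵈ (def φ r to from) f σ e = def φ (Sum.map f id ∘ r)
     (λ ρ p → ⊨-cong φ (λ i → sym (lemma ρ (r i))) (to (σ ρ) p))
     (λ ρ p → from (σ ρ) (⊨-cong φ (λ i → lemma ρ (r i)) p))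
   where
   lemma : ∀ ρ x → [ (λ v → look v ρ) , id ]′ (Sum.map f id x) ≈ [ (λ v → look v (σ ρ)) , id ]′ x
   lemma ρ (inj₁ v) = e v ρ
   lemma ρ (inj₂ c) = refl

 -- Def puts no bound on the level of a predicate, Definable does.
 Shrink : {P : ⟪ Γ ⟫ → Set a} → Def P → ⟪ Γ ⟫ → Set ℓ
 Shrink dP ρ = env (Def.vars dP) ρ ⊨ Def.formula dP

 opaque
   shrinkᵈ : {P : ⟪ Γ ⟫ → Set a} (dP : Def P) → Def (Shrink dP)
   shrinkᵈ (def φ r to from) = def φ r (λ _ → id) (λ _ → id)

 opaque
   ⇔ᵈ : {P : ⟪ Γ ⟫ → Set a} {Q : ⟪ Γ ⟫ → Set b} → Def P → (∀ ρ → Q ρ → P ρ) → (∀ ρ → P ρ → Q ρ) → Def Q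
   ⇔ᵈ (def φ r to from) f g = def φ r (λ ρ → to ρ ∘ f ρ) (λ ρ → g ρ ∘ from ρ)

 module _ {P : ⟪ Γ ⟫ → Set a} {Q : ⟪ Γ ⟫ → Set b}
          (dP : Def P) (dQ : Def Q) where

   private
     module P = Def dP
     module Q = Def dQ

     vars : Fin (P.arity ℕ.+ Q.arity) → Var Γ ⊎ Carrier
     vars = P.vars Vector.++ Q.vars

     φ ψ : Formula signature (P.arity ℕ.+ Q.arity)
     φ = ren (_↑ˡ Q.arity) P.formula
     ψ = ren (P.arity ↑ʳ_) Q.formula

     φ-vars : ∀ ρ → (env vars ρ ∘ (_↑ˡ Q.arity)) ≋ env P.vars ρ
     φ-vars ρ i rewrite splitAt-↑ˡ P.arity i Q.arity = refl

     ψ-vars : ∀ ρ → (env vars ρ ∘ (P.arity ↑ʳ_)) ≋ env Q.vars ρ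
     ψ-vars ρ i rewrite splitAt-↑ʳ P.arity Q.arity i = refl

     φ-to : ∀ ρ → P ρ → env vars ρ ⊨ φ
     φ-to ρ p = proj₂ (⊨-ren _ P.formula _) (⊨-cong P.formula (≋-sym (φ-vars ρ)) (P.to ρ p))

     φ-from : ∀ ρ → env vars ρ ⊨ φ → P ρ
     φ-from ρ p = P.from ρ (⊨-cong P.formula (φ-vars ρ) (proj₁ (⊨-ren _ P.formula _) p))

     ψ-to : ∀ ρ → Q ρ → env vars ρ ⊨ ψ
     ψ-to ρ p = proj₂ (⊨-ren _ Q.formula _) (⊨-cong Q.formula (≋-sym (ψ-vars ρ)) (Q.to ρ p))

     ψ-from : ∀ ρ → env vars ρ ⊨ ψ → Q ρ
     ψ-from ρ p = Q.from ρ (⊨-cong Q.formula (ψ-vars ρ) (proj₁ (⊨-ren _ Q.formula _) p))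

   and : Def (λ ρ → P ρ × Q ρ)
   and = def (φ ∧′ ψ) vars (λ ρ → Prod.map (φ-to ρ) (ψ-to ρ)) (λ ρ → Prod.map (φ-from ρ) (ψ-from ρ))

   or : Def (λ ρ → P ρ ⊎ Q ρ)
   or = def (φ ∨′ ψ) vars (λ ρ → Sum.map (φ-to ρ) (ψ-to ρ)) (λ ρ → Sum.map (φ-from ρ) (ψ-from ρ))

   implies : Def (λ ρ → P ρ → Q ρ)
   implies = def (φ ⇒′ ψ) vars (λ ρ f → ψ-to ρ ∘ f ∘ φ-from ρ) (λ ρ f → ψ-from ρ ∘ f ∘ φ-to ρ)

 infixr 4 _→ᵈ_
 infixr 5 _⊎ᵈ_
 infixr 6 _×ᵈ_
 infix 7 ¬ᵈ_

 opaque
   _×ᵈ_ : {P : ⟪ Γ ⟫ → Set a} {Q : ⟪ Γ ⟫ → Set b} → Def P → Def Q → Def (λ ρ → P ρ × Q ρ)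
   _×ᵈ_ = and

 opaque
   _⊎ᵈ_ : {P : ⟪ Γ ⟫ → Set a} {Q : ⟪ Γ ⟫ → Set b} → Def P → Def Q → Def (λ ρ → P ρ ⊎ Q ρ)
   _⊎ᵈ_ = or

 opaque
   _→ᵈ_ : {P : ⟪ Γ ⟫ → Set a} {Q : ⟪ Γ ⟫ → Set b} → Def P → Def Q → Def (λ ρ → P ρ → Q ρ)
   _→ᵈ_ = implies

 opaque
   emptyᵈ : {P : ⟪ Γ ⟫ → Set a} → (∀ ρ → ¬ P ρ) → Def P
   emptyᵈ ¬p = def {arity = 0} false′ (λ ()) (λ ρ p → ⊥-elim (¬p ρ p)) (λ ρ ())

 opaque
   fullᵈ : {P : ⟪ Γ ⟫ → Set a} → (∀ ρ → P ρ) → Def P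
   fullᵈ p = def {arity = 0} (false′ ⇒′ false′) (λ ()) (λ ρ _ → id) (λ ρ _ → p ρ)

 opaque
   -- By excluded middle, a proposition in which no variable occurs is everywhere true or everywhere
   -- false.
   constᵖ : (P : Set a) → Def {Γ} (λ _ → P)
   constᵖ P with em {P = P}
   ... | yes p = fullᵈ (λ _ → p)
   ... | no ¬p = emptyᵈ (λ _ → ¬p)

 opaque
   ¬ᵈ_ : {P : ⟪ Γ ⟫ → Set a} → Def P → Def (λ ρ → ¬ P ρ)
   ¬ᵈ dP = dP →ᵈ emptyᵈ (λ _ ())

 module _ {P : ⟪ Γ ▸ S ⟫ → Set a} (dP : Def {Γ ▸ S} P) where

   private
     module P = Def dP

     index : Fin P.arity → Var (Γ ▸ S) ⊎ Carrier → Fin (size S ℕ.+ P.arity)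
     index i (inj₁ (here j)) = j ↑ˡ P.arity
     index i _ = size S ↑ʳ i

     strengthen : Var (Γ ▸ S) ⊎ Carrier → Var Γ ⊎ Carrier
     -- The default 0 is never read: `index` redirects the bound variables to the quantified block.
     strengthen (inj₁ (here _)) = inj₂ 0#
     strengthen (inj₁ (there v)) = inj₁ v
     strengthen (inj₂ c) = inj₂ c

     φ : Formula signature (size S ℕ.+ P.arity)
     φ = ren (λ i → index i (P.vars i)) P.formula

     φ-vars : ∀ ρ x y → (∀ i → entry S x i ≈ y i) →
       ((y Vector.++ env (strengthen ∘ P.vars) ρ) ∘ λ i → index i (P.vars i)) ≋ env P.vars (ρ , x)
     φ-vars ρ x y e i with P.vars i in eq
     ... | inj₁ (here j) rewrite splitAt-↑ˡ (size S) j P.arity = sym (e j)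
     ... | inj₁ (there v) rewrite splitAt-↑ʳ (size S) P.arity i | eq = refl
     ... | inj₂ c rewrite splitAt-↑ʳ (size S) P.arity i | eq = refl

   exists : Def {Γ} (λ ρ → ∃ λ x → P (ρ , x))
   exists = def (∃^ (size S) φ) (strengthen ∘ P.vars) (λ ρ (x , p) → proj₂ (⊨-∃^ (size S) φ _) (entry S x)
       (proj₂ (⊨-ren _ P.formula _) (⊨-cong P.formula
         (≋-sym (φ-vars ρ x (entry S x) (λ i → refl))) (P.to _ p))))
     (λ ρ q → let y , p = proj₁ (⊨-∃^ (size S) φ _) q in
       mk S y , P.from _ (⊨-cong P.formula (φ-vars ρ (mk S y) y (entry-mk S y))
         (proj₁ (⊨-ren _ P.formula _) p)))

 opaque
   ∃ᵈ : {P : ⟪ Γ ⟫ → Val S → Set a} → Def {Γ ▸ S} (λ ρ → P (proj₁ ρ) (proj₂ ρ)) → Def (λ ρ → ∃ λ x → P ρ x)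
   ∃ᵈ = exists

 opaque
   ∀ᵈ : {P : ⟪ Γ ⟫ → Val S → Set a} → Def {Γ ▸ S} (λ ρ → P (proj₁ ρ) (proj₂ ρ)) → Def (λ ρ → ∀ x → P ρ x)
   ∀ᵈ dP = ⇔ᵈ (¬ᵈ (exists (¬ᵈ dP))) (λ ρ p (x , ¬p) → ¬p (p x)) (λ ρ q x → byContradiction λ ¬p → q (x , ¬p))

 opaque
   wkᵖ : {P : ⟪ Γ ⟫ → Set a} → Def P → Def {Γ ▸ S} (P ∘ proj₁)
   wkᵖ dP = renᵈ dP there proj₁ (λ _ _ → refl)

 opaque
   wk : {t : ⟪ Γ ⟫ → Carrier} → DefF t → DefF {Γ ▸ S} (t ∘ proj₁)
   wk dt = renᵈ dt f (λ ρ → proj₁ (proj₁ ρ) , proj₂ ρ) λ { (here zero) _ → refl ; (there _) _ → refl }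
     where
     f : Var (Γ ▸ scalar) → Var ((Γ ▸ S) ▸ scalar)
     f (here i) = here i
     f (there v) = there (there v)

 wkᵛ : ∀ {n} {v : ⟪ Γ ⟫ → K^ n} → DefV v → DefV {Γ ▸ S} (v ∘ proj₁)
 wkᵛ dv i = wk (dv i)

 opaque
   underᵖ : ∀ {T} {P : ⟪ Γ ⟫ → Val S → Set a} → Def {Γ ▸ S} (λ ρ → P (proj₁ ρ) (proj₂ ρ)) →
            Def {Γ ▸ T ▸ S} (λ ρ → P (proj₁ (proj₁ ρ)) (proj₂ ρ))
   underᵖ {Γ = Γ} {S = S} {T = T} dP = renᵈ dP f (λ ρ → proj₁ (proj₁ ρ) , proj₂ ρ)
       λ { (here _) _ → refl ; (there _) _ → refl }
     where
     f : Var (Γ ▸ S) → Var (Γ ▸ T ▸ S)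
     f (here i) = here i
     f (there v) = there (there v)

 opaque
   underᶠ : ∀ {T} {t : ⟪ Γ ⟫ → Val S → Carrier} → DefF {Γ ▸ S} (λ ρ → t (proj₁ ρ) (proj₂ ρ)) →
            DefF {Γ ▸ T ▸ S} (λ ρ → t (proj₁ (proj₁ ρ)) (proj₂ ρ))
   underᶠ {Γ = Γ} {S = S} {T = T} dt =
     renᵈ dt f (λ ρ → (proj₁ (proj₁ (proj₁ ρ)) , proj₂ (proj₁ ρ)) , proj₂ ρ)
       λ { (here zero) _ → refl ; (there (here _)) _ → refl ; (there (there _)) _ → refl }
     where
     f : Var (Γ ▸ S ▸ scalar) → Var (Γ ▸ T ▸ S ▸ scalar)
     f (here i) = here i
     f (there (here i)) = there (here i)
     f (there (there v)) = there (there (there v))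

 equation : Var (Γ ▸ scalar) ⊎ Carrier → Fin 2 → Var (Γ ▸ scalar) ⊎ Carrier
 equation x zero = inj₁ (here zero)
 equation x (suc zero) = x

 opaque
   constᵈ : ∀ {c} → DefF {Γ} (λ _ → c)
   constᵈ {c = c} = baseᵈ (var zero ≐′ var (suc zero)) (equation (inj₂ c))

 opaque
   s₀ : DefF {Γ ▸ scalar} proj₂
   s₀ = baseᵈ (var zero ≐′ var (suc zero)) (equation (inj₁ (there (here zero))))

 opaque
   v₀ : ∀ {n} → DefV {Γ ▸ vec n} proj₂
   v₀ i = baseᵈ (var zero ≐′ var (suc zero)) (equation (inj₁ (there (here i))))

 s₁ : DefF {Γ ▸ scalar ▸ S} (proj₂ ∘ proj₁)
 s₁ = wk s₀

 s₂ : ∀ {S S′} → DefF {Γ ▸ scalar ▸ S ▸ S′} (proj₂ ∘ proj₁ ∘ proj₁)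
 s₂ = wk s₁

 s₃ : ∀ {S S′ S″} → DefF {Γ ▸ scalar ▸ S ▸ S′ ▸ S″} (proj₂ ∘ proj₁ ∘ proj₁ ∘ proj₁)
 s₃ = wk s₂

 v₁ : ∀ {n} → DefV {Γ ▸ vec n ▸ S} (proj₂ ∘ proj₁)
 v₁ = wkᵛ v₀

 v₂ : ∀ {n S S′} → DefV {Γ ▸ vec n ▸ S ▸ S′} (proj₂ ∘ proj₁ ∘ proj₁)
 v₂ = wkᵛ v₁

 v₃ : ∀ {n S S′ S″} → DefV {Γ ▸ vec n ▸ S ▸ S′ ▸ S″} (proj₂ ∘ proj₁ ∘ proj₁ ∘ proj₁)
 v₃ = wkᵛ v₂

 opaque
   ∀Finᵈ : ∀ {n} {P : Fin n → ⟪ Γ ⟫ → Set a} → (∀ i → Def (P i)) → Def (λ ρ → ∀ i → P i ρ)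
   ∀Finᵈ {n = zero} dP = fullᵈ (λ _ ())
   ∀Finᵈ {n = suc n} dP = ⇔ᵈ (dP zero ×ᵈ ∀Finᵈ (dP ∘ suc)) (λ ρ p → p zero , p ∘ suc)
     (λ ρ (p , q) → λ { zero → p ; (suc i) → q i })

 opaque
   ∃Finᵈ : ∀ {n} {P : Fin n → ⟪ Γ ⟫ → Set a} → (∀ i → Def (P i)) → Def (λ ρ → ∃ λ i → P i ρ)
   ∃Finᵈ {n = zero} dP = emptyᵈ (λ { _ (() , _) })
   ∃Finᵈ {n = suc n} dP = ⇔ᵈ (dP zero ⊎ᵈ ∃Finᵈ (dP ∘ suc))
     (λ ρ → λ { (zero , p) → inj₁ p ; (suc i , p) → inj₂ (i , p) })
     (λ ρ → [ (λ p → zero , p) , (λ (i , p) → suc i , p) ]′)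

 opaque
   Anyᵈ : ∀ {A : Set b} {P : A → ⟪ Γ ⟫ → Set a} cs → (∀ c → Def (P c)) → Def (λ ρ → Any (λ c → P c ρ) cs)
   Anyᵈ [] dP = emptyᵈ (λ _ ())
   Anyᵈ (c ∷ cs) dP = ⇔ᵈ (dP c ⊎ᵈ Anyᵈ cs dP) (λ _ → Any.toSum) (λ _ → Any.fromSum)

 -- `DefF` provides only the graphs of the functions `ts`, not terms; so their values are introduced
 -- by an existential quantifier.
 formulaᵈ : ∀ {m} (φ : Formula signature m) {ts : Fin m → ⟪ Γ ⟫ → Carrier} →
            (∀ i → DefF (ts i)) → Def (λ ρ → (λ i → ts i ρ) ⊨ φ)
 formulaᵈ {Γ = Γ} {m = m} φ {ts} dts = ⇔ᵈ (∃ᵈ {S = vec m} (∀Finᵈ (λ i → renᵈ (dts i) (f i)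
       (λ ρ → proj₁ ρ , proj₂ ρ i)
       λ { (here zero) _ → refl ; (there _) _ → refl }) ×ᵈ
     baseᵈ {Γ = Γ ▸ vec m} φ (inj₁ ∘ here)))
   (λ ρ p → (λ i → ts i ρ) , (λ i → refl) , p)
   (λ ρ (w , e , p) → ⊨-cong φ e p)
   where
   f : Fin m → Var (Γ ▸ scalar) → Var (Γ ▸ vec m)
   f i (here _) = here i
   f i (there v) = there v

 subᵈ : {P : ⟪ Δ ⟫ → Set a} {σ : ⟪ Γ ⟫ → ⟪ Δ ⟫} → Def P → (∀ v → DefF (look v ∘ σ)) → Def (P ∘ σ)
 subᵈ {Γ = Γ} {σ = σ} (def φ r to from) dσ = ⇔ᵈ (formulaᵈ φ {λ i ρ → env r (σ ρ) i} (λ i → lemma (r i)))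
   (λ ρ → to (σ ρ)) (λ ρ → from (σ ρ))
   where
   lemma : ∀ x → DefF {Γ} (λ ρ → [ (λ v → look v (σ ρ)) , id ]′ x)
   lemma (inj₁ v) = dσ v
   lemma (inj₂ c) = constᵈ

 two : (t u : ⟪ Γ ⟫ → Carrier) → Fin 2 → ⟪ Γ ⟫ → Carrier
 two t u zero = t
 two t u (suc zero) = u

 two-def : {t u : ⟪ Γ ⟫ → Carrier} → DefF t → DefF u → ∀ i → DefF (two t u i)
 two-def dt du zero = dt
 two-def dt du (suc zero) = du

 three : (t u v : ⟪ Γ ⟫ → Carrier) → Fin 3 → ⟪ Γ ⟫ → Carrier
 three t u v zero = t
 three t u v (suc zero) = u
 three t u v (suc (suc zero)) = v

 three-def : {t u v : ⟪ Γ ⟫ → Carrier} → DefF t → DefF u → DefF v → ∀ i → DefF (three t u v i)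
 three-def dt du dv zero = dt
 three-def dt du dv (suc zero) = du
 three-def dt du dv (suc (suc zero)) = dv

 infix 8 _<ᵈ_ _≈ᵈ_ _≤ᵈ_

 opaque
   _<ᵈ_ : {t u : ⟪ Γ ⟫ → Carrier} → DefF t → DefF u → Def (λ ρ → t ρ < u ρ)
   dt <ᵈ du = formulaᵈ (var zero <′ var (suc zero)) (two-def dt du)

 opaque
   _≈ᵈ_ : {t u : ⟪ Γ ⟫ → Carrier} → DefF t → DefF u → Def (λ ρ → t ρ ≈ u ρ)
   dt ≈ᵈ du = formulaᵈ (var zero ≐′ var (suc zero)) (two-def dt du)

 _≤ᵈ_ : {t u : ⟪ Γ ⟫ → Carrier} → DefF t → DefF u → Def (λ ρ → t ρ ≤ u ρ)
 dt ≤ᵈ du = dt <ᵈ du ⊎ᵈ dt ≈ᵈ du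

 infixl 10 _+ᵈ_ _-ᵈ_
 infixl 11 _*ᵈ_

 opaque
   _+ᵈ_ : {t u : ⟪ Γ ⟫ → Carrier} → DefF t → DefF u → DefF (λ ρ → t ρ + u ρ)
   dt +ᵈ du = formulaᵈ (var zero ≐′ (var (suc zero) +′ var (suc (suc zero)))) (three-def s₀ (wk dt) (wk du))

 opaque
   _*ᵈ_ : {t u : ⟪ Γ ⟫ → Carrier} → DefF t → DefF u → DefF (λ ρ → t ρ * u ρ)
   dt *ᵈ du = formulaᵈ (var zero ≐′ (var (suc zero) *′ var (suc (suc zero)))) (three-def s₀ (wk dt) (wk du))

 opaque
   _-ᵈ_ : {t u : ⟪ Γ ⟫ → Carrier} → DefF t → DefF u → DefF (λ ρ → t ρ - u ρ)
   dt -ᵈ du = formulaᵈ (var zero ≐′ (var (suc zero) +′ (-′ var (suc (suc zero)))))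
     (three-def s₀ (wk dt) (wk du))

 opaque
   -ᵈ_ : {t : ⟪ Γ ⟫ → Carrier} → DefF t → DefF (λ ρ → - t ρ)
   -ᵈ dt = formulaᵈ (var zero ≐′ (-′ var (suc zero))) (two-def s₀ (wk dt))

 opaque
   sumᵈ : ∀ {n} {t : ⟪ Γ ⟫ → K^ n} → DefV t → DefF (λ ρ → sum (t ρ))
   sumᵈ {n = zero} dt = constᵈ
   sumᵈ {n = suc n} dt = dt zero +ᵈ sumᵈ (dt ∘ suc)

 _≋ᵈ_ : ∀ {n} {v w : ⟪ Γ ⟫ → K^ n} → DefV v → DefV w → Def (λ ρ → v ρ ≋ w ρ)
 dv ≋ᵈ dw = ∀Finᵈ λ i → dv i ≈ᵈ dw i

 consᵈ : ∀ {n} {t : ⟪ Γ ⟫ → Carrier} {v : ⟪ Γ ⟫ → K^ n} → DefF t → DefV v → DefV (λ ρ → t ρ Vector.∷ v ρ)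
 consᵈ dt dv zero = dt
 consᵈ dt dv (suc i) = dv i

 -- Definable relations and functions

 Def₁ : (Carrier → Set a) → Set (s ⊔ ℓ ⊔ a)
 Def₁ P = Def {∅ ▸ scalar} (λ ρ → P (proj₂ ρ))

 Defⱽ : ∀ {n} → (K^ n → Set a) → Set (s ⊔ ℓ ⊔ a)
 Defⱽ {n = n} P = Def {∅ ▸ vec n} (λ ρ → P (proj₂ ρ))

 Def₂ : (Carrier → Carrier → Set a) → Set (s ⊔ ℓ ⊔ a)
 Def₂ P = Def {∅ ▸ scalar ▸ scalar} (λ ρ → P (proj₂ (proj₁ ρ)) (proj₂ ρ))

 Defᶠ : ∀ {n} → (K^ n → Carrier → Set a) → Set (s ⊔ ℓ ⊔ a)
 Defᶠ {n = n} P = Def {∅ ▸ vec n ▸ scalar} (λ ρ → P (proj₂ (proj₁ ρ)) (proj₂ ρ))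

 Fun₁ : (Carrier → Carrier) → Set (s ⊔ ℓ)
 Fun₁ f = DefF {∅ ▸ scalar} (λ ρ → f (proj₂ ρ))

 Funⱽ : ∀ {n} → (K^ n → Carrier) → Set (s ⊔ ℓ)
 Funⱽ {n} f = DefF {∅ ▸ vec n} (λ ρ → f (proj₂ ρ))

 opaque
   at₁ : {P : Carrier → Set a} → Def₁ P → {t : ⟪ Γ ⟫ → Carrier} → DefF t → Def (λ ρ → P (t ρ))
   at₁ dP {t} dt = subᵈ {σ = λ ρ → tt , t ρ} dP λ { (here zero) → dt }

 opaque
   atⱽ : ∀ {n} {P : K^ n → Set a} → Defⱽ P → {v : ⟪ Γ ⟫ → K^ n} → DefV v → Def (λ ρ → P (v ρ))
   atⱽ dP {v} dv = subᵈ {σ = λ ρ → tt , v ρ} dP λ { (here i) → dv i }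

 opaque
   at₂ : {P : Carrier → Carrier → Set a} → Def₂ P →
         {t u : ⟪ Γ ⟫ → Carrier} → DefF t → DefF u → Def (λ ρ → P (t ρ) (u ρ))
   at₂ dP {t} {u} dt du = subᵈ {σ = λ ρ → (tt , t ρ) , u ρ} dP
     λ { (here zero) → du ; (there (here zero)) → dt }

 opaque
   atᶠ : ∀ {n} {P : K^ n → Carrier → Set a} → Defᶠ P →
         {v : ⟪ Γ ⟫ → K^ n} {t : ⟪ Γ ⟫ → Carrier} → DefV v → DefF t →
         Def (λ ρ → P (v ρ) (t ρ))
   atᶠ dP {v} {t} dv dt = subᵈ {σ = λ ρ → (tt , v ρ) , t ρ} dP
     λ { (here zero) → dt ; (there (here i)) → dv i }

   atⱽⱽ : ∀ {m n} {P : K^ m → K^ n → Set a} → Def {∅ ▸ vec m ▸ vec n} (λ ρ → P (proj₂ (proj₁ ρ)) (proj₂ ρ)) →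
          {v : ⟪ Γ ⟫ → K^ m} {w : ⟪ Γ ⟫ → K^ n} → DefV v → DefV w → Def (λ ρ → P (v ρ) (w ρ))
   atⱽⱽ dP {v} {w} dv dw = subᵈ {σ = λ ρ → (tt , v ρ) , w ρ} dP
     λ { (here i) → dw i ; (there (here i)) → dv i }

 opaque
   app₁ : {f : Carrier → Carrier} → Fun₁ f → {t : ⟪ Γ ⟫ → Carrier} → DefF t → DefF (λ ρ → f (t ρ))
   app₁ df {t} dt = subᵈ {σ = λ ρ → (tt , t (proj₁ ρ)) , proj₂ ρ} df
     λ { (here zero) → s₀ ; (there (here zero)) → wk dt }

 opaque
   appⱽ : ∀ {n} {f : K^ n → Carrier} → Funⱽ f → {v : ⟪ Γ ⟫ → K^ n} → DefV v → DefF (λ ρ → f (v ρ))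
   appⱽ df {v} dv = subᵈ {σ = λ ρ → (tt , v (proj₁ ρ)) , proj₂ ρ} df
     λ { (here zero) → s₀ ; (there (here i)) → wk (dv i) }

 opaque
   -- The graph of `f` is `P` itself. Minima, suprema, derivatives and roots are picked by excluded
   -- middle or from an existence proof; this makes the picked functions definable.
   uniqueᵈ : {f : ⟪ Γ ⟫ → Carrier} {P : ⟪ Γ ⟫ → Carrier → Set a} →
             Def {Γ ▸ scalar} (λ ρ → P (proj₁ ρ) (proj₂ ρ)) →
             (∀ ρ → P ρ (f ρ)) → (∀ ρ {x y} → P ρ x → P ρ y → x ≈ y) → DefF f
   uniqueᵈ {f = f} dP Pf unique = ⇔ᵈ dP (λ (ρ , x) x≈fρ → Def-resp dP {ρ , f ρ} {ρ , x}
       (λ { (here zero) → sym x≈fρ ; (there v) → refl }) (Pf ρ))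
     (λ (ρ , x) p → unique ρ p (Pf ρ))

 If : (P : Set a) → Carrier → Carrier → Carrier
 If P x y with em {P = P}
 ... | yes _ = x
 ... | no _ = y

 If-yes : {P : Set a} → P → ∀ {x y} → If P x y ≈ x
 If-yes {P = P} p with em {P = P}
 ... | yes _ = refl
 ... | no ¬p = ⊥-elim (¬p p)

 If-no : {P : Set a} → ¬ P → ∀ {x y} → If P x y ≈ y
 If-no {P = P} ¬p with em {P = P}
 ... | yes p = ⊥-elim (¬p p)
 ... | no _ = refl

 opaque
   ifᵈ : {P : ⟪ Γ ⟫ → Set a} {t u : ⟪ Γ ⟫ → Carrier} → Def P → DefF t →
         DefF u → DefF (λ ρ → If (P ρ) (t ρ) (u ρ))
   ifᵈ {P = P} {t} {u} dP dt du = uniqueᵈ {P = λ ρ x → P ρ × x ≈ t ρ ⊎ ¬ P ρ × x ≈ u ρ}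
     (wkᵖ dP ×ᵈ s₀ ≈ᵈ wk dt ⊎ᵈ ¬ᵈ (wkᵖ dP) ×ᵈ s₀ ≈ᵈ wk du)
     (λ ρ → holds ρ) (λ ρ → unique ρ)
     where
     holds : ∀ ρ → P ρ × If (P ρ) (t ρ) (u ρ) ≈ t ρ ⊎ ¬ P ρ × If (P ρ) (t ρ) (u ρ) ≈ u ρ
     holds ρ with em {P = P ρ}
     ... | yes p = inj₁ (p , refl)
     ... | no ¬p = inj₂ (¬p , refl)
     unique : ∀ ρ {x y} → P ρ × x ≈ t ρ ⊎ ¬ P ρ × x ≈ u ρ → P ρ × y ≈ t ρ ⊎ ¬ P ρ × y ≈ u ρ → x ≈ y
     unique ρ (inj₁ (_ , e)) (inj₁ (_ , e′)) = trans e (sym e′)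
     unique ρ (inj₁ (p , _)) (inj₂ (¬p , _)) = ⊥-elim (¬p p)
     unique ρ (inj₂ (¬p , _)) (inj₁ (p , _)) = ⊥-elim (¬p p)
     unique ρ (inj₂ (_ , e)) (inj₂ (_ , e′)) = trans e (sym e′)

 varᵈ : (v : Var Γ) → DefF (look v)
 varᵈ v = baseᵈ (var zero ≐′ var (suc zero)) (equation (inj₁ (there v)))

 opaque
   instᵛ : ∀ {n} {P : ⟪ Γ ⟫ → K^ n → Set a} {v : ⟪ Γ ⟫ → K^ n} →
           Def {Γ ▸ vec n} (λ ρ → P (proj₁ ρ) (proj₂ ρ)) → DefV v →
           Def (λ ρ → P ρ (v ρ))
   instᵛ {v = v} dP dv = subᵈ {σ = λ ρ → ρ , v ρ} dP λ { (here i) → dv i ; (there v) → varᵈ v }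

 opaque
   resp₁ : {P : Carrier → Set a} → Def₁ P → ∀ {x y} → x ≈ y → P x → P y
   resp₁ dP e = Def-resp dP λ { (here zero) → e }

 opaque
   respⱽ : ∀ {n} {P : K^ n → Set a} → Defⱽ P → ∀ {x y} → x ≋ y → P x → P y
   respⱽ dP e = Def-resp dP λ { (here i) → e i }

 opaque
   respᶠ : ∀ {n} {P : K^ n → Carrier → Set a} → Defᶠ P → ∀ {x y t u} → x ≋ y → t ≈ u → P x t → P y u
   respᶠ dP e e′ = Def-resp dP λ { (here zero) → e′ ; (there (here i)) → e i }

 opaque
   cong₁ : {f : Carrier → Carrier} → Fun₁ f → ∀ {x y} → x ≈ y → f x ≈ f y
   cong₁ {f = f} df {x} {y} e = Def-resp df {(tt , x) , f x} {(tt , y) , f x}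
     (λ { (here zero) → refl ; (there (here zero)) → e }) refl

 opaque
   congⱽ : ∀ {n} {f : K^ n → Carrier} → Funⱽ f → ∀ {x y} → x ≋ y → f x ≈ f y
   congⱽ {f = f} df {x} {y} e = Def-resp df {(tt , x) , f x} {(tt , y) , f x}
     (λ { (here zero) → refl ; (there (here i)) → e i }) refl

 opaque
   Definable⇒Defⱽ : ∀ {n} {A : Pred (K^ n) ℓ} → Definable A → Defⱽ A
   Definable⇒Defⱽ {n} (k , p , φ , A⊆ , ⊆A) = def φ vars (λ (_ , x) a → ⊨-cong φ (≋-sym (lemma x)) (A⊆ a))
     (λ (_ , x) q → ⊆A (⊨-cong φ (lemma x) q))
     where
     vars : Fin (k ℕ.+ n) → Var (∅ ▸ vec n) ⊎ Carrier
     vars i = [ inj₂ ∘ p , inj₁ ∘ here ]′ (splitAt k i)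
     lemma : ∀ x → env vars (tt , x) ≋ (p Vector.++ x)
     lemma x i with splitAt k i
     ... | inj₁ _ = refl
     ... | inj₂ _ = refl

 opaque
   Defⱽ⇒Definable : ∀ {n} {A : Pred (K^ n) ℓ} → Defⱽ A → Definable A
   Defⱽ⇒Definable {n} (def {m} φ r to from) = m , p , ren (λ i → index i (r i)) φ ,
     (λ {x} a → proj₂ (⊨-ren _ φ _) (⊨-cong φ (lemma x) (to (tt , x) a))) ,
     (λ {x} q → from (tt , x) (⊨-cong φ (≋-sym (lemma x)) (proj₁ (⊨-ren _ φ _) q)))
     where
     parameter : Var (∅ ▸ vec n) ⊎ Carrier → Carrier
     parameter (inj₁ _) = 0#
     parameter (inj₂ c) = c
     p : K^ m
     p i = parameter (r i)
     index : Fin m → Var (∅ ▸ vec n) ⊎ Carrier → Fin (m ℕ.+ n)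
     index i (inj₁ (here j)) = m ↑ʳ j
     index i (inj₂ _) = i ↑ˡ n
     lemma : ∀ x → env r (tt , x) ≋ ((p Vector.++ x) ∘ λ i → index i (r i))
     lemma x i with r i in eq
     ... | inj₁ (here j) rewrite splitAt-↑ʳ m n j = refl
     ... | inj₂ c rewrite splitAt-↑ˡ m i n | eq = refl

 -- Elementary inequalities

 variable
   P Q : Carrier → Set a

 ≤-refl : ∀ {x} → x ≤ x
 ≤-refl = inj₂ refl

 *-nonneg : ∀ {x y} → 0# ≤ x → 0# ≤ y → 0# ≤ x * y
 *-nonneg (inj₁ 0<x) (inj₁ 0<y) = inj₁ (*-pos 0<x 0<y)
 *-nonneg {x} {y} (inj₂ 0≈x) _ = inj₂ (sym (trans (*-congʳ (sym 0≈x)) (zeroˡ y)))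
 *-nonneg {x} {y} (inj₁ _) (inj₂ 0≈y) = inj₂ (sym (trans (*-congˡ (sym 0≈y)) (zeroʳ x)))

 *-monoˡ-≤ : ∀ {x y z} → 0# ≤ z → x ≤ y → z * x ≤ z * y
 *-monoˡ-≤ {x} {y} {z} 0≤z x≤y = lin 3 (λ x y z → :0 :≤ z :* (y :- x) ⊢ z :* x :≤ z :* y)
   (*-nonneg 0≤z (lin 2 (λ x y → x :≤ y ⊢ :0 :≤ y :- x) x≤y))

 *-monoˡ-< : ∀ {x y z} → 0# < z → x < y → z * x < z * y
 *-monoˡ-< {x} {y} {z} 0<z x<y = lin 3 (λ x y z → :0 :< z :* (y :- x) ⊢ z :* x :< z :* y)
   (*-pos 0<z (lin 2 (λ x y → x :< y ⊢ :0 :< y :- x) x<y))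

 opaque
   inverse : ∀ {x} → 0# < x → ∃ λ y → 0# < y × x * y ≈ 1#
   inverse {x} 0<x with invertible {x} (λ x≈0 → <-irrefl (sym x≈0) 0<x)
   ... | y , _ , xy≈1 = y , 0<y , xy≈1
     where
     0<y : 0# < y
     0<y with cmp 0# y
     ... | tri< p _ _ = p
     ... | tri≈ _ p _ = ⊥-elim (0≉1 (trans (sym (zeroʳ x)) (trans (*-congˡ p) xy≈1)))
     ... | tri> _ _ p = ⊥-elim (<-irrefl refl (<-trans 0<1 1<0))
       where
       1<0 : 1# < 0#
       1<0 = lin 2 (λ x y → :0 :< x :* (:- y) ∷ x :* y :≈ :1 ⊢ :1 :< :0)
         (*-pos 0<x (lin 1 (λ y → y :< :0 ⊢ :0 :< :- y) p)) xy≈1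

   half : Carrier → Carrier
   half x = x * proj₁ (inverse (fromℕ-pos 1))

   half+half : ∀ x → half x + half x ≈ x
   half+half x = lin 2 (λ x h → (x :* (# 2 :* h) :≈ x :* :1) ⊢ x :* h :+ x :* h :≈ x)
     (*-congˡ (proj₂ (proj₂ (inverse (fromℕ-pos 1)))))

   halfᵈ : ∀ {Γ} {t : ⟪ Γ ⟫ → Carrier} → DefF t → DefF (λ ρ → half (t ρ))
   halfᵈ dt = dt *ᵈ constᵈ

 half-pos : ∀ {x} → 0# < x → 0# < half x
 half-pos {x} 0<x = lin 2 (λ x h → h :+ h :≈ x ∷ :0 :< x ⊢ :0 :< h) (half+half x) 0<x

 between : ∀ {x y} → x < y → ∃ λ z → x < z × z < y
 between {x} {y} x<y = half (x + y) ,
   lin 3 (λ x y h → h :+ h :≈ x :+ y ∷ x :< y ⊢ x :< h) (half+half (x + y)) x<y ,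
   lin 3 (λ x y h → h :+ h :≈ x :+ y ∷ x :< y ⊢ h :< y) (half+half (x + y)) x<y

 half-< : ∀ {x y z} → x ≈ z → y < z → half (x + y) < z
 half-< {x} {y} = lin 4 (λ x y z h → h :+ h :≈ x :+ y ∷ x :≈ z ∷ y :< z ⊢ h :< z) (half+half (x + y))

 <-half : ∀ {x y z} → y ≈ z → z < x → z < half (x + y)
 <-half {x} {y} = lin 4 (λ x y z h → h :+ h :≈ x :+ y ∷ y :≈ z ∷ z :< x ⊢ z :< h) (half+half (x + y))

 half-≈ : ∀ {x y z} → x ≈ z → y ≈ z → half (x + y) ≈ z
 half-≈ {x} {y} = lin 4 (λ x y z h → h :+ h :≈ x :+ y ∷ x :≈ z ∷ y :≈ z ⊢ h :≈ z) (half+half (x + y))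

 smaller : ∀ x y → ∃ λ m → m ≤ x × m ≤ y × (∀ {z} → z < x → z < y → z < m)
 smaller x y with cmp x y
 ... | tri< x<y _ _ = x , ≤-refl , inj₁ x<y , λ p _ → p
 ... | tri≈ _ x≈y _ = x , ≤-refl , inj₂ x≈y , λ p _ → p
 ... | tri> _ _ y<x = y , inj₁ y<x , ≤-refl , λ _ p → p

 larger : ∀ x y → ∃ λ m → x ≤ m × y ≤ m × (∀ {z} → x < z → y < z → m < z)
 larger x y with cmp x y
 ... | tri< x<y _ _ = y , inj₁ x<y , ≤-refl , λ _ p → p
 ... | tri≈ _ x≈y _ = y , inj₂ x≈y , ≤-refl , λ _ p → p
 ... | tri> _ _ y<x = x , ≤-refl , inj₁ y<x , λ p _ → p

 <-≤-trans : ∀ {x y z} → x < y → y ≤ z → x < z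
 <-≤-trans = lin 3 λ x y z → x :< y ∷ y :≤ z ⊢ x :< z

 ≤-<-trans : ∀ {x y z} → x ≤ y → y < z → x < z
 ≤-<-trans = lin 3 λ x y z → x :≤ y ∷ y :< z ⊢ x :< z

 ≤-trans : ∀ {x y z} → x ≤ y → y ≤ z → x ≤ z
 ≤-trans = lin 3 λ x y z → x :≤ y ∷ y :≤ z ⊢ x :≤ z

 x<x+1 : ∀ {x} → x < x + 1#
 x<x+1 {x} = lin 1 (λ x → :0 :< :1 ⊢ x :< x :+ :1) 0<1

 x-1<x : ∀ {x} → x - 1# < x
 x-1<x {x} = lin 1 (λ x → :0 :< :1 ⊢ x :- :1 :< x) 0<1

 positive-minimum : ∀ {x y} → 0# < x → 0# < y → ∃ λ m → 0# < m × m ≤ x × m ≤ y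
 positive-minimum {x} {y} 0<x 0<y with smaller x y
 ... | m , m≤x , m≤y , greatest = m , greatest 0<x 0<y , m≤x , m≤y

 -- O-minimality: definable subsets of K and their germs

 Lo Hi : Carrier ± → Carrier → Set ℓ
 Lo ⊥± x = ⊤
 Lo [ l ]± x = l < x
 Lo ⊤± x = Poly.⊥
 Hi ⊥± x = Poly.⊥
 Hi [ r ]± x = x < r
 Hi ⊤± x = ⊤

 toLo : ∀ l {x} → l <± [ x ]± → Lo l x
 toLo ⊥± _ = tt
 toLo [ l ]± Sup.[ Inf.[ p ] ] = p
 toLo ⊤± ()

 toHi : ∀ r {x} → [ x ]± <± r → Hi r x
 toHi ⊥± Sup.[ () ]
 toHi [ r ]± Sup.[ Inf.[ p ] ] = p
 toHi ⊤± _ = tt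

 fromLo : ∀ l {x} → Lo l x → l <± [ x ]±
 fromLo ⊥± _ = Sup.[ Inf.⊥₋<[ _ ] ]
 fromLo [ l ]± p = Sup.[ Inf.[ p ] ]

 fromHi : ∀ r {x} → Hi r x → [ x ]± <± r
 fromHi [ r ]± p = Sup.[ Inf.[ p ] ]
 fromHi ⊤± _ = Sup.[ _ ]<⊤⁺

 In : Piece → Carrier → Set ℓ
 In (point c) x = x ≈ c
 In (interval l r) x = Lo l x × Hi r x

 toIn : ∀ p {x} → x ∈ᴾ p → In p x
 toIn (point c) e = e
 toIn (interval l r) (p , q) = toLo l p , toHi r q

 fromIn : ∀ p {x} → In p x → x ∈ᴾ p
 fromIn (point c) e = e
 fromIn (interval l r) (p , q) = fromLo l p , fromHi r q

 pieces : Def₁ P → ∃ λ Ps → (∀ {x} → P x → Any (λ p → In p x) Ps) × (∀ {x} → Any (λ p → In p x) Ps → P x)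
 pieces dP =
   let Ps , A⊆ , ⊆A = oMinimal _ (Defⱽ⇒Definable (at₁ (shrinkᵈ dP) (v₀ zero))) in
   Ps ,
   (λ {x} p → Any.map (λ {p} → toIn p) (A⊆ {λ _ → x} (Def.to dP (tt , x) p))) ,
   (λ {x} p → Def.from dP (tt , x) (⊆A {λ _ → x} (Any.map (λ {q} → fromIn q) p)))

 All⟨_,_⟩ : Carrier → Carrier → (Carrier → Set a) → Set (ℓ ⊔ a)
 All⟨ x , y ⟩ P = ∀ t → x < t → t < y → P t

 Germ : Carrier → (Carrier → Set a) → Set (ℓ ⊔ a)
 Germ x P = ∃ λ y → x < y × (All⟨ x , y ⟩ P ⊎ All⟨ x , y ⟩ (λ t → ¬ P t))

 germ-point : ∀ x c → Germ x (_≈ c)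
 germ-point x c with cmp x c
 ... | tri< x<c _ _ = c , x<c , inj₂ λ t _ t<c t≈c → <-irrefl t≈c t<c
 ... | tri≈ _ x≈c _ = x + 1# , x<x+1 , inj₂ λ t x<t _ t≈c → <-irrefl (trans x≈c (sym t≈c)) x<t
 ... | tri> _ _ c<x = x + 1# , x<x+1 , inj₂ λ t x<t _ t≈c → <-irrefl (sym t≈c) (<-trans c<x x<t)

 germ-lo : ∀ x l → Germ x (Lo l)
 germ-lo x ⊥± = x + 1# , x<x+1 , inj₁ λ _ _ _ → tt
 germ-lo x ⊤± = x + 1# , x<x+1 , inj₂ λ _ _ _ ()
 germ-lo x [ l ]± with em {P = l ≤ x}
 ... | yes l≤x = x + 1# , x<x+1 , inj₁ λ t x<t _ → ≤-<-trans l≤x x<t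
 ... | no l≰x = l , ≰⇒> l≰x , inj₂ λ t _ t<l l<t → <-irrefl refl (<-trans t<l l<t)

 germ-hi : ∀ x r → Germ x (Hi r)
 germ-hi x ⊥± = x + 1# , x<x+1 , inj₂ λ _ _ _ ()
 germ-hi x ⊤± = x + 1# , x<x+1 , inj₁ λ _ _ _ → tt
 germ-hi x [ r ]± with em {P = r ≤ x}
 ... | yes r≤x = x + 1# , x<x+1 , inj₂ λ t x<t _ t<r → <-irrefl refl (≤-<-trans r≤x (<-trans x<t t<r))
 ... | no r≰x = r , ≰⇒> r≰x , inj₁ λ _ _ t<r → t<r

 germ-× : ∀ {x} → Germ x P → Germ x Q → Germ x (λ t → P t × Q t)
 germ-× (y , x<y , p) (z , x<z , q) with smaller y z
 ... | m , m≤y , m≤z , greatest = m , greatest x<y x<z , both p q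
   where
   both : _ → _ → _
   both (inj₁ p) (inj₁ q) = inj₁ λ t x<t t<m → p t x<t (<-≤-trans t<m m≤y) , q t x<t (<-≤-trans t<m m≤z)
   both (inj₂ p) _ = inj₂ λ t x<t t<m → p t x<t (<-≤-trans t<m m≤y) ∘ proj₁
   both (inj₁ _) (inj₂ q) = inj₂ λ t x<t t<m → q t x<t (<-≤-trans t<m m≤z) ∘ proj₂

 germ-⊎ : ∀ {x} → Germ x P → Germ x Q → Germ x (λ t → P t ⊎ Q t)
 germ-⊎ (y , x<y , p) (z , x<z , q) with smaller y z
 ... | m , m≤y , m≤z , greatest = m , greatest x<y x<z , either p q
   where
   either : _ → _ → _
   either (inj₁ p) _ = inj₁ λ t x<t t<m → inj₁ (p t x<t (<-≤-trans t<m m≤y))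
   either (inj₂ _) (inj₁ q) = inj₁ λ t x<t t<m → inj₂ (q t x<t (<-≤-trans t<m m≤z))
   either (inj₂ p) (inj₂ q) = inj₂ λ t x<t t<m →
     [ p t x<t (<-≤-trans t<m m≤y) , q t x<t (<-≤-trans t<m m≤z) ]′

 germ-map : ∀ {x} → (∀ {t} → P t → Q t) → (∀ {t} → Q t → P t) → Germ x P → Germ x Q
 germ-map f g (y , x<y , p) = y , x<y ,
   Sum.map (λ p t x<t t<y → f (p t x<t t<y)) (λ p t x<t t<y → p t x<t t<y ∘ g) p

 germ-any : ∀ x Ps → Germ x (λ t → Any (λ p → In p t) Ps)
 germ-any x [] = x + 1# , x<x+1 , inj₂ λ _ _ _ ()
 germ-any x (p ∷ Ps) = germ-map Any.fromSum Any.toSum (germ-⊎ (germ-in p) (germ-any x Ps))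
   where
   germ-in : ∀ p → Germ x (In p)
   germ-in (point c) = germ-point x c
   germ-in (interval l r) = germ-× (germ-lo x l) (germ-hi x r)

 right-germ : Def₁ P → ∀ x → ∃ λ y → x < y × (All⟨ x , y ⟩ P ⊎ All⟨ x , y ⟩ (λ t → ¬ P t))
 right-germ dP x with pieces dP
 ... | Ps , to , from = germ-map from to (germ-any x Ps)

 neg² : ∀ x → - (- x) ≈ x
 neg² x = lin 1 (λ x → ⊢ :- (:- x) :≈ x)

 neg-< : ∀ {x y} → x < y → - y < - x
 neg-< = lin 2 λ x y → x :< y ⊢ :- y :< :- x

 neg-<′ : ∀ {x y} → - x < y → - y < x
 neg-<′ = lin 2 λ x y → :- x :< y ⊢ :- y :< x

 neg-<″ : ∀ {x y} → x < - y → y < - x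
 neg-<″ = lin 2 λ x y → x :< :- y ⊢ y :< :- x

 negᵈ : Def₁ P → Def₁ (λ x → P (- x))
 negᵈ dP = at₁ dP (-ᵈ s₀)

 un-neg : Def₁ P → ∀ {x} → P (- (- x)) → P x
 un-neg dP = resp₁ dP (neg² _)

 left-germ : Def₁ P → ∀ x → ∃ λ y → y < x × (All⟨ y , x ⟩ P ⊎ All⟨ y , x ⟩ (λ t → ¬ P t))
 left-germ dP x with right-germ (negᵈ dP) (- x)
 ... | y , -x<y , inj₁ p = - y , neg-<′ -x<y , inj₁ λ t -y<t t<x →
         un-neg dP (p (- t) (neg-< t<x) (neg-<′ -y<t))
 ... | y , -x<y , inj₂ p = - y , neg-<′ -x<y , inj₂ λ t -y<t t<x q →
         p (- t) (neg-< t<x) (neg-<′ -y<t) (resp₁ dP (sym (neg² t)) q)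

 -- Completeness

 LowerBound UpperBound : (Carrier → Set a) → Carrier → Set (ℓ ⊔ a)
 LowerBound P c = ∀ x → P x → c ≤ x
 UpperBound P c = ∀ x → P x → x ≤ c

 IsInf IsSup : (Carrier → Set a) → Carrier → Set (ℓ ⊔ a)
 IsInf P c = LowerBound P c × (∀ d → LowerBound P d → d ≤ c)
 IsSup P c = UpperBound P c × (∀ d → UpperBound P d → c ≤ d)

 inf-piece : ∀ p m x → In p x → LowerBound (In p) m → ∃ (IsInf (In p))
 inf-piece (point c) m x e _ = c , (λ y y≈c → inj₂ (sym y≈c)) , (λ d lb → lb c refl)
 inf-piece (interval ⊥± r) m x (_ , x<r) lb with smaller m x
 ... | k , k≤m , k≤x , _ = ⊥-elim (≤⇒≯ (lb (k - 1#) (tt , hi r x<r)) (<-≤-trans x-1<x k≤m))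
   where
   hi : ∀ r → Hi r x → Hi r (k - 1#)
   hi [ r ]± x<r = <-≤-trans x-1<x (≤-trans k≤x (inj₁ x<r))
   hi ⊤± _ = tt
 inf-piece (interval [ l ]± r) m x (l<x , x<r) lb = l , (λ y (l<y , _) → inj₁ l<y) ,
   (λ d lb′ → ≮⇒≥ λ l<d → let z , l<z , z<d = between l<d in
     ≤⇒≯ (lb′ z (l<z , hi r z x<r (<-≤-trans z<d (lb′ x (l<x , x<r))))) z<d)
   where
   hi : ∀ r z → Hi r x → z < x → Hi r z
   hi [ r ]± z x<r z<x = <-trans z<x x<r
   hi ⊤± z _ _ = tt

 inf-any : ∀ Ps m x → Any (λ p → In p x) Ps → LowerBound (λ x → Any (λ p → In p x) Ps) m →
           ∃ (IsInf (λ x → Any (λ p → In p x) Ps))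
 inf-any (p ∷ Ps) m x x∈ lb with em {P = ∃ (In p)}
                               | em {P = ∃ λ x → Any (λ p → In p x) Ps}
 ... | no ¬p | no ¬q = ⊥-elim ([ (λ h → ¬p (x , h)) , (λ h → ¬q (x , h)) ]′ (Any.toSum x∈))
 ... | yes (y , q) | no ¬q
   with inf-piece p m y q (λ z h → lb z (here h))
 ... | c , lb₁ , g₁ = c , (λ { z (here h) → lb₁ z h ; z (there h) → ⊥-elim (¬q (z , h)) }) ,
   (λ d lb′ → g₁ d λ z h → lb′ z (here h))
 inf-any (p ∷ Ps) m x x∈ lb | no ¬p | yes (y , q)
   with inf-any Ps m y q (λ z h → lb z (there h))
 ... | c , lb₁ , g₁ = c , (λ { z (there h) → lb₁ z h ; z (here h) → ⊥-elim (¬p (z , h)) }) ,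
   (λ d lb′ → g₁ d λ z h → lb′ z (there h))
 inf-any (p ∷ Ps) m x x∈ lb | yes (y , q) | yes (y′ , q′)
   with inf-piece p m y q (λ z h → lb z (here h))
      | inf-any Ps m y′ q′ (λ z h → lb z (there h))
 ... | c , lb₁ , g₁ | c′ , lb₂ , g₂ with smaller c c′
 ... | k , k≤c , k≤c′ , greatest = k , (λ { z (here h) → ≤-trans k≤c (lb₁ z h)
      ; z (there h) → ≤-trans k≤c′ (lb₂ z h) }) ,
   (λ d lb′ → ≮⇒≥ λ k<d → <-irrefl refl (greatest (<-≤-trans k<d (g₁ d λ z h → lb′ z (here h)))
     (<-≤-trans k<d (g₂ d λ z h → lb′ z (there h)))))

 infimum : Def₁ P → ∃ P → ∃ (LowerBound P) → ∃ (IsInf P)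
 infimum dP (x , p) (m , lb) with pieces dP
 ... | Ps , to , from with inf-any Ps m x (to p) (λ z h → lb z (from h))
 ... | c , lb₁ , g = c , (λ z h → lb₁ z (to h)) , (λ d lb′ → g d λ z h → lb′ z (from h))

 supremum : Def₁ P → ∃ P → ∃ (UpperBound P) → ∃ (IsSup P)
 supremum dP (x , p) (m , ub)
   with infimum (negᵈ dP) (- x , resp₁ dP (sym (neg² x)) p)
     (- m , λ z h → lin 2 (λ z m → :- z :≤ m ⊢ :- m :≤ z) (ub (- z) h))
 ... | c , lb , g = - c , (λ z h → lin 2 (λ z c → c :≤ :- z ⊢ z :≤ :- c)
     (lb (- z) (resp₁ dP (sym (neg² z)) h))) ,
   (λ d ub′ → lin 2 (λ c d → :- d :≤ c ⊢ :- c :≤ d)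
     (g (- d) λ z h → lin 2 (λ z d → :- z :≤ d ⊢ :- d :≤ z) (ub′ (- z) h)))

 -- Otherwise the points of the interval where `P` fails have an infimum, which contradicts `closed`
 -- if `P` fails there and `open′` if `P` holds there. The start of the induction is `closed` at
 -- `x`, whose premise is empty.
 real-induction : Def₁ P → ∀ {x y} → x ≤ y → (∀ t → x ≤ t → t ≤ y → (∀ u → x ≤ u → u < t → P u) → P t) →
   (∀ t → x ≤ t → t < y → P t → ∃ λ u → t < u × All⟨ t , u ⟩ P) →
   P y
 real-induction {P = P} dP {x} {y} x≤y closed open′ = byContradiction λ ¬Py →
   let c , lb , g = infimum bad-def (y , x≤y , ≤-refl , ¬Py)
                      (x , λ _ → proj₁)
       x≤c = g x (λ _ → proj₁)
       c≤y = lb y (x≤y , ≤-refl , ¬Py)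
       Pc = closed c x≤c c≤y λ u x≤u u<c → byContradiction λ ¬Pu →
         ≤⇒≯ (lb u (x≤u , ≤-trans (inj₁ u<c) c≤y , ¬Pu)) u<c
       c<y = strict c≤y λ c≈y → ¬Py (resp₁ dP c≈y Pc)
       u , c<u , p = open′ c x≤c c<y Pc
       u≤ : LowerBound Bad u
       u≤ z h = ≮⇒≥ λ z<u → proj₂ (proj₂ h) (case cmp c z of λ
         { (tri< c<z _ _) → p z c<z z<u
         ; (tri≈ _ c≈z _) → resp₁ dP c≈z Pc
         ; (tri> _ _ z<c) → ⊥-elim (≤⇒≯ (lb z h) z<c) })
   in ≤⇒≯ (g u u≤) c<u
   where
   Bad : Carrier → Set _
   Bad t = x ≤ t × t ≤ y × ¬ P t
   bad-def : Def₁ Bad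
   bad-def = constᵈ ≤ᵈ s₀ ×ᵈ s₀ ≤ᵈ constᵈ ×ᵈ ¬ᵈ dP
   strict : ∀ {a b} → a ≤ b → ¬ (a ≈ b) → a < b
   strict (inj₁ a<b) _ = a<b
   strict (inj₂ a≈b) n = ⊥-elim (n a≈b)

 -- Almost all elements of K

 -- For definable P this says that P holds off a finite set.
 ∀* : (Carrier → Set a) → Set (ℓ ⊔ a)
 ∀* P = ∀ x y → x < y → ∃ λ t → x < t × t < y × P t

 ∀*ᵈ : ∀ {Γ} {P : ⟪ Γ ⟫ → Carrier → Set a} →
       Def {Γ ▸ scalar} (λ ρ → P (proj₁ ρ) (proj₂ ρ)) → Def (λ ρ → ∀* (P ρ))
 ∀*ᵈ dP = ∀ᵈ (∀ᵈ (s₁ <ᵈ s₀ →ᵈ ∃ᵈ (s₂ <ᵈ s₀ ×ᵈ s₀ <ᵈ s₁ ×ᵈ underᵖ (underᵖ dP))))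

 ∀*-all : (∀ t → P t) → ∀* P
 ∀*-all p x y x<y = let t , x<t , t<y = between x<y in t , x<t , t<y , p t

 ∀*-map : (∀ t → P t → Q t) → ∀* P → ∀* Q
 ∀*-map f p x y x<y = let t , x<t , t<y , q = p x y x<y in t , x<t , t<y , f t q

 ∀*-right : Def₁ P → ∀* P → ∀ x → ∃ λ y → x < y × All⟨ x , y ⟩ P
 ∀*-right dP p x with right-germ dP x
 ... | y , x<y , inj₁ q = y , x<y , q
 ... | y , x<y , inj₂ q = let t , x<t , t<y , r = p x y x<y in
         ⊥-elim (q t x<t t<y r)

 ∀*-× : Def₁ P → ∀* P → ∀* Q → ∀* (λ t → P t × Q t)
 ∀*-× dP p q x y x<y with ∀*-right dP p x
 ... | z , x<z , p′ with smaller y z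
 ... | m , m≤y , m≤z , greatest with q x m (greatest x<y x<z)
 ... | t , x<t , t<m , r = t , x<t , <-≤-trans t<m m≤y , p′ t x<t (<-≤-trans t<m m≤z) , r

 ¬∀*⇒interval : Def₁ P → ¬ ∀* (λ t → ¬ P t) → ∃₂ λ x y → x < y × All⟨ x , y ⟩ P
 ¬∀*⇒interval {P = P} dP ¬p = byContradiction λ none → ¬p λ x y x<y →
   byContradiction λ h → none (x , y , x<y , λ t x<t t<y → byContradiction λ ¬Pt → h (t , x<t , t<y , ¬Pt))

 interval⇒¬∀* : ∀ {x y} → x < y → All⟨ x , y ⟩ P → ¬ ∀* (λ t → ¬ P t)
 interval⇒¬∀* x<y p q = let t , x<t , t<y , ¬p = q _ _ x<y in ¬p (p t x<t t<y)

 ≉-∀* : ∀ c → ∀* (λ t → ¬ (t ≈ c))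
 ≉-∀* c x y x<y with between x<y
 ... | t , x<t , t<y with em {P = t ≈ c}
 ... | no t≉c = t , x<t , t<y , t≉c
 ... | yes t≈c with between x<t
 ... | u , x<u , u<t = u , x<u , <-trans u<t t<y , λ u≈c → <-irrefl (trans u≈c (sym t≈c)) u<t

 finite : Def₁ P → ∀* (λ t → ¬ P t) → ∃ λ cs → ∀ t → P t → Any (t ≈_) cs
 finite {P = P} dP p with pieces dP
 ... | Ps , to , from = points Ps from , λ t q → any-points Ps from (to q)
   where
   points : ∀ Ps → (∀ {x} → Any (λ p → In p x) Ps → P x) → List Carrier
   points [] f = []
   points (point c ∷ Ps) f = c ∷ points Ps (f ∘ there)
   points (interval l r ∷ Ps) f = points Ps (f ∘ there)
   no-interval : ∀ l r t → In (interval l r) t → ¬ (∀ {x} → In (interval l r) x → P x)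
   no-interval l r t (lo , hi) f = let x , x<t , p₁ = below l lo
                                       y , t<y , p₂ = above r hi in
     interval⇒¬∀* t<y (λ u t<u u<y → f (up l lo t<u , p₂ u u<y)) p
     where
     below : ∀ l → Lo l t → ∃ λ x → x < t × ⊤ {ℓ}
     below l _ = t - 1# , x-1<x , tt
     above : ∀ r → Hi r t → ∃ λ y → t < y × (∀ u → u < y → Hi r u)
     above [ r ]± t<r = r , t<r , λ u u<r → u<r
     above ⊤± _ = t + 1# , x<x+1 , λ _ _ → tt
     up : ∀ l {u} → Lo l t → t < u → Lo l u
     up ⊥± _ _ = tt
     up [ l ]± l<t t<u = <-trans l<t t<u
   any-points : ∀ Ps (f : ∀ {x} → Any (λ p → In p x) Ps → P x) {t} →
                Any (λ p → In p t) Ps → Any (t ≈_) (points Ps f)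
   any-points (point c ∷ Ps) f (here e) = here e
   any-points (point c ∷ Ps) f (there h) = there (any-points Ps (f ∘ there) h)
   any-points (interval l r ∷ Ps) f (here h) = ⊥-elim (no-interval l r _ h (f ∘ here))
   any-points (interval l r ∷ Ps) f (there h) = any-points Ps (f ∘ there) h

 ∀*-Any : ∀ {A : Set b} {R : A → Carrier → Set a} → (∀ c → Def₁ (R c)) →
          ∀ {cs} → All (λ c → ∀* (λ t → ¬ R c t)) cs →
          ∀* (λ t → ¬ Any (λ c → R c t) cs)
 ∀*-Any dR [] = ∀*-all λ _ ()
 ∀*-Any dR (h ∷ hs) = ∀*-map (λ { t (p , q) (here r) → p r ; t (p , q) (there r) → q r })
   (∀*-× (¬ᵈ dR _) h (∀*-Any dR hs))

 ∀*-≉list : ∀ cs → ∀* (λ t → ¬ Any (t ≈_) cs)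
 ∀*-≉list cs = ∀*-Any (λ c → s₀ ≈ᵈ constᵈ) (All.universal ≉-∀* cs)

 -- Boundary points of definable subsets of K

 Boundary : (Carrier → Set a) → Carrier → Set (ℓ ⊔ a)
 Boundary P t = ∀ x y → x < t → t < y → (∃ λ u → x < u × u < y × P u) × (∃ λ u → x < u × u < y × ¬ P u)

 ∀*-¬Boundary : Def₁ P → ∀* (λ t → ¬ Boundary P t)
 ∀*-¬Boundary dP x y x<y with right-germ dP x
 ... | z , x<z , g with smaller y z
 ... | m , m≤y , m≤z , greatest with between (greatest x<y x<z)
 ... | t , x<t , t<m = t , x<t , <-≤-trans t<m m≤y , λ b →
   let (u , x<u , u<z , p) , (u′ , x<u′ , u′<z , ¬p) = b x z x<t (<-≤-trans t<m m≤z) in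
   [ (λ g → ¬p (g u′ x<u′ u′<z)) , (λ g → g u x<u u<z p) ]′ g

 Above Below : (Carrier → Set a) → Carrier → Set (ℓ ⊔ a)
 Above P t = (∀ u → t ≤ u → P u) ⊎ (∃ λ y → t < y × Boundary P y × (∀ u → t ≤ u → u < y → P u))
 Below P t = (∀ u → u ≤ t → P u) ⊎ (∃ λ x → x < t × Boundary P x × (∀ u → x < u → u ≤ t → P u))

 above : Def₁ P → ∀ t → P t → ¬ Boundary P t → Above P t
 above {P = P} dP t Pt ¬bd with em {P = ∀ u → t ≤ u → P u}
 ... | yes all = inj₁ all
 ... | no ¬all = inj₂ (y , t<y , boundary , inside)
   where
   Bad : Carrier → Set _
   Bad u = t ≤ u × ¬ P u
   bad : ∃ Bad
   bad = byContradiction λ none → ¬all λ u t≤u → byContradiction λ ¬Pu → none (u , t≤u , ¬Pu)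
   inf : ∃ (IsInf Bad)
   inf = infimum (constᵈ ≤ᵈ s₀ ×ᵈ ¬ᵈ dP) bad (t , λ _ → proj₁)
   y = proj₁ inf
   inside : ∀ u → t ≤ u → u < y → P u
   inside u t≤u u<y = byContradiction λ ¬Pu → ≤⇒≯ (proj₁ (proj₂ inf) u (t≤u , ¬Pu)) u<y
   meets : ∀ v → y < v → ∃ λ u → y ≤ u × u < v × ¬ P u
   meets v y<v = byContradiction λ none → ≤⇒≯ (proj₂ (proj₂ inf) v λ u (t≤u , ¬Pu) → ≮⇒≥ λ u<v → none
       (u , proj₁ (proj₂ inf) u (t≤u , ¬Pu) , u<v , ¬Pu)) y<v
   t≤y : t ≤ y
   t≤y = proj₂ (proj₂ inf) t (λ _ → proj₁)
   t<y : t < y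
   t<y with t≤y
   ... | inj₁ t<y = t<y
   ... | inj₂ t≈y = ⊥-elim (¬bd λ v w v<t t<w → (t , v<t , t<w , Pt) ,
     (let u , y≤u , u<w , ¬Pu = meets w (<-respˡ t≈y t<w) in
      u , <-≤-trans v<t (≤-trans t≤y y≤u) , u<w , ¬Pu))
   boundary : Boundary P y
   boundary v w v<y y<w =
     (let k , t≤k , v≤k , least = larger t v
          u , k<u , u<y = between (least t<y v<y) in
      u , ≤-<-trans v≤k k<u , <-trans u<y y<w ,
      inside u (inj₁ (≤-<-trans t≤k k<u)) u<y) ,
     (let u , y≤u , u<w , ¬Pu = meets w y<w in
      u , <-≤-trans v<y y≤u , u<w , ¬Pu)

 Boundary-neg : Def₁ P → ∀ {t} → Boundary (λ x → P (- x)) t → Boundary P (- t)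
 Boundary-neg dP b v w v<-t -t<w with b (- w) (- v) (neg-<′ -t<w) (neg-<″ v<-t)
 ... | (u , p , q , r) , (u′ , p′ , q′ , r′) =
   (- u , neg-<″ q , neg-<′ p , r) , (- u′ , neg-<″ q′ , neg-<′ p′ , r′)

 below : Def₁ P → ∀ t → P t → ¬ Boundary P t → Below P t
 below {P = P} dP t Pt ¬bd with above (negᵈ dP) (- t)
   (resp₁ dP (sym (neg² t)) Pt) ¬bd′
   where
   ¬bd′ : ¬ Boundary (λ x → P (- x)) (- t)
   ¬bd′ b = ¬bd λ v w v<t t<w → Boundary-neg dP b v w
     (<-respʳ (sym (neg² t)) v<t) (<-respˡ (sym (neg² t)) t<w)
 ... | inj₁ all = inj₁ λ u u≤t → un-neg dP (all (- u) (lin 2 (λ u t → u :≤ t ⊢ :- t :≤ :- u) u≤t))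
 ... | inj₂ (y , -t<y , b , inside) = inj₂ (- y , neg-<′ -t<y , Boundary-neg dP b ,
   λ u -y<u u≤t → un-neg dP (inside (- u) (lin 2 (λ u t → u :≤ t ⊢ :- t :≤ :- u) u≤t) (neg-<′ -y<u)))

 -- Saturation

 module _ {E : ℕ → Carrier → Set a} (dE : ∀ k → Def₁ (E k))
          (shrinking : ∀ k x → E (suc k) x → E k x)
          (nonempty : ∀ k → ∃ (E k)) where

   private
     arity : ℕ → ℕ
     arity k = Def.arity (dE k)

     value : Var (∅ ▸ scalar) ⊎ Carrier → Carrier
     value (inj₁ _) = 0#
     value (inj₂ c) = c

     parameter : ∀ k → Fin (arity k) → Carrier
     parameter k i = value (Def.vars (dE k) i)

     offset : ℕ → ℕ
     offset zero = 0
     offset (suc k) = offset k ℕ.+ arity k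

     offset-mono : ∀ {j k} → j ℕ.≤′ k → offset j ℕ.≤ offset k
     offset-mono ℕ.≤′-refl = ℕ.≤-refl
     offset-mono (ℕ.≤′-step p) = ℕ.≤-trans (offset-mono p) (ℕ.m≤m+n _ _)

     separate : ∀ {j k} (i : Fin (arity j)) i′ → j ℕ.< k →
                ¬ (offset j ℕ.+ toℕ i ≡ offset k ℕ.+ toℕ {arity k} i′)
     separate {j} {k} i i′ j<k e = ℕ.<-irrefl e (ℕ.<-≤-trans (ℕ.+-monoʳ-< (offset j) (toℕ<n i))
       (ℕ.≤-trans (offset-mono (ℕ.≤⇒≤′ j<k)) (ℕ.m≤m+n _ _)))

     Code : ℕ → Set
     Code m = ∃₂ λ k (i : Fin (arity k)) → m ≡ offset k ℕ.+ toℕ i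

     -- All the parameters of all the E k, in one sequence.
     p : ℕ → Carrier
     p m with em {P = Code m}
     ... | yes (k , i , _) = parameter k i
     ... | no _ = 0#

     p-code : ∀ k i → p (offset k ℕ.+ toℕ i) ≈ parameter k i
     p-code k i with em {P = Code (offset k ℕ.+ toℕ i)}
     ... | no ¬c = ⊥-elim (¬c (k , i , ≡.refl))
     ... | yes (j , i′ , e) with ℕ.<-cmp j k
     ... | tri< j<k _ _ = ⊥-elim (separate i′ i j<k (≡.sym e))
     ... | tri> _ _ k<j = ⊥-elim (separate i i′ k<j e)
     ... | tri≈ _ ≡.refl _ with toℕ-injective (ℕ.+-cancelˡ-≡ (offset k) _ _ e)
     ... | ≡.refl = refl

     index : ∀ k → Fin (arity k) → Var (∅ ▸ scalar) ⊎ Carrier → Fin (suc (offset (suc k)))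
     index k i (inj₁ _) = zero
     index k i (inj₂ _) = suc (offset k ↑ʳ i)

     formula : ∀ k → Formula signature (suc (offset (suc k)))
     formula k = ren (λ i → index k i (Def.vars (dE k) i)) (Def.formula (dE k))

     vars≋ : ∀ k x → env (Def.vars (dE k)) (tt , x) ≋
       ((x Vector.∷ (λ i → p (toℕ i))) ∘ λ i → index k i (Def.vars (dE k) i))
     vars≋ k x i with Def.vars (dE k) i in eq
     ... | inj₁ (here zero) = refl
     ... | inj₂ c rewrite toℕ-↑ʳ (offset k) i =
       sym (trans (p-code k i) (reflexive (≡.cong value eq)))

     Theory : Pred (∃ λ k → Formula signature (suc k)) (s ⊔ ℓ)
     Theory φ = (∃ λ k → φ ≡ (offset (suc k) , formula k)) × ⊤ {ℓ}

     Realises : Carrier → Pred (∃ λ k → Formula signature (suc k)) ℓ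
     Realises x (k , φ) = (x Vector.∷ (λ (i : Fin k) → p (toℕ i))) ⊨ φ

     realises : ∀ k x → E k x → Realises x (offset (suc k) , formula k)
     realises k x e = proj₂ (⊨-ren _ (Def.formula (dE k)) _)
       (⊨-cong (Def.formula (dE k)) (vars≋ k x) (Def.to (dE k) (tt , x) e))

     realised : ∀ k x → Realises x (offset (suc k) , formula k) → E k x
     realised k x r = Def.from (dE k) (tt , x) (⊨-cong (Def.formula (dE k)) (≋-sym (vars≋ k x))
         (proj₁ (⊨-ren _ (Def.formula (dE k)) _) r))

     shrink : ∀ {j k} x → j ℕ.≤′ k → E k x → E j x
     shrink x ℕ.≤′-refl e = e
     shrink x (ℕ.≤′-step p) e = shrink x p (shrinking _ x e)

     bounded : ∀ Δ → All Theory Δ → ∃ λ k → ∀ x → E k x → All (Realises x) Δ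
     bounded [] [] = 0 , λ _ _ → []
     bounded (_ ∷ Δ) (((j , ≡.refl) , _) ∷ h) with bounded Δ h
     ... | k , f = j ℕ.⊔ k , λ x e → realises j x (shrink x (ℕ.≤⇒≤′ (ℕ.m≤m⊔n j k)) e) ∷
       f x (shrink x (ℕ.≤⇒≤′ (ℕ.m≤n⊔m j k)) e)

   -- Each `E k` has its own parameters; strung together they form one sequence, over which the
   -- formulas for all `k` are a type. It is finitely satisfiable because the sets decrease.
   compactness₁ : ∃ λ x → ∀ k → E k x
   compactness₁ with saturated p Theory (λ Δ h →
     let k , f = bounded Δ h ; x , e = nonempty k in x , f x e)
   ... | x , r = x , λ k → realised k x (r ((k , ≡.refl) , tt))

 -- Saturation speaks of one variable only. So the first coordinate is found for the projections of
 -- the sets, and then becomes a parameter.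
 compactness : {E : ℕ → K^ n → Set a} → (∀ k → Defⱽ (E k)) →
               (∀ k x → E (suc k) x → E k x) → (∀ k → ∃ (E k)) →
               ∃ λ x → ∀ k → E k x
 compactness {n = zero} dE shrinking nonempty = Vector.[] , λ k → respⱽ (dE k) (λ ()) (proj₂ (nonempty k))
 compactness {n = suc n} {E = E} dE shrinking nonempty =
   let x₀ , e₀ = compactness₁ {E = λ k x₀ → ∃ λ x → E k (x₀ Vector.∷ x)}
         (λ k → ∃ᵈ (atⱽ (dE k) (consᵈ s₁ v₀)))
         (λ k x₀ (x , e) → x , shrinking k _ e)
         (λ k → let x , e = nonempty k in
           x zero , x ∘ suc , respⱽ (dE k) (λ { zero → refl ; (suc i) → refl }) e)
       x , e = compactness {E = λ k x → E k (x₀ Vector.∷ x)}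
         (λ k → atⱽ (dE k) (consᵈ constᵈ v₀)) (λ k x → shrinking k _) e₀
   in x₀ Vector.∷ x , e

 -- Families of finite sets

 record DFun (n : ℕ) : Set (s ⊔ ℓ) where
   constructor dfun
   field
     fn : K^ n → Carrier
     fnᵈ : Funⱽ fn
 open DFun public

 IsMin : (Carrier → Set a) → Carrier → Set (ℓ ⊔ a)
 IsMin Q t = Q t × LowerBound Q t

 module Minima {S : K^ n → Carrier → Set a} (dS : Defᶠ S) where

   min : K^ n → Carrier
   min x with em {P = ∃ (IsMin (S x))}
   ... | yes (t , _) = t
   ... | no _ = 0#

   MinOr0 : K^ n → Carrier → Set _
   MinOr0 x t = IsMin (S x) t ⊎ ¬ ∃ (IsMin (S x)) × t ≈ 0#

   holds : ∀ x → MinOr0 x (min x)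
   holds x with em {P = ∃ (IsMin (S x))}
   ... | yes (t , m) = inj₁ m
   ... | no ¬m = inj₂ (¬m , refl)

   unique : ∀ x {t u} → MinOr0 x t → MinOr0 x u → t ≈ u
   unique x (inj₁ (p , lb)) (inj₁ (q , lb′)) = ≤-antisym (lb _ q) (lb′ _ p)
   unique x (inj₁ p) (inj₂ (¬m , _)) = ⊥-elim (¬m (_ , p))
   unique x (inj₂ (¬m , _)) (inj₁ p) = ⊥-elim (¬m (_ , p))
   unique x (inj₂ (_ , e)) (inj₂ (_ , e′)) = trans e (sym e′)

   isMin : ∀ x → ∃ (IsMin (S x)) → IsMin (S x) (min x)
   isMin x m with holds x
   ... | inj₁ p = p
   ... | inj₂ (¬m , _) = ⊥-elim (¬m m)

   isMinᵈ : ∀ {Γ} {v : ⟪ Γ ⟫ → K^ n} {t : ⟪ Γ ⟫ → Carrier} →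
            DefV v → DefF t → Def (λ ρ → IsMin (S (v ρ)) (t ρ))
   isMinᵈ dv dt = atᶠ dS dv dt ×ᵈ ∀ᵈ (atᶠ dS (wkᵛ dv) s₀ →ᵈ wk dt ≤ᵈ s₀)

   minᵈ : Funⱽ min
   minᵈ = uniqueᵈ (isMinᵈ v₁ s₀ ⊎ᵈ ¬ᵈ ∃ᵈ (isMinᵈ v₂ s₀) ×ᵈ s₀ ≈ᵈ constᵈ)
     (λ ρ → holds (proj₂ ρ)) (λ ρ → unique (proj₂ ρ))

   rest : K^ n → Carrier → Set _
   rest x t = S x t × ¬ (t ≈ min x)

   restᵈ : Defᶠ rest
   restᵈ = dS ×ᵈ ¬ᵈ (s₀ ≈ᵈ appⱽ minᵈ v₁)

   IsMin-cong : ∀ {x y} → (∀ t → (S x t → S y t) × (S y t → S x t)) → ∀ {t} → IsMin (S x) t → IsMin (S y) t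
   IsMin-cong e (p , lb) = proj₁ (e _) p , λ u q → lb u (proj₂ (e u) q)

   min-cong : ∀ {x y} → (∀ t → (S x t → S y t) × (S y t → S x t)) → min x ≈ min y
   min-cong {x} {y} e = unique y (transport (holds x)) (holds y)
     where
     transport : ∀ {t} → MinOr0 x t → MinOr0 y t
     transport (inj₁ m) = inj₁ (IsMin-cong e m)
     transport (inj₂ (¬m , t≈0)) = inj₂ (¬m ∘ Prod.map₂ (IsMin-cong (Prod.swap ∘ e)) , t≈0)

 finite-min : ∀ cs {Q : Carrier → Set a} → (∀ {t u} → t ≈ u → Q t → Q u) →
              (∀ t → Q t → Any (t ≈_) cs) → ∃ Q → ∃ (IsMin Q)
 finite-min [] resp sub (t , q) with sub t q
 ... | ()
 finite-min (c ∷ cs) {Q} resp sub (t , q)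
   with em {P = ∃ λ u → Q u × ¬ (u ≈ c)}
 ... | no none = t , q , λ u r → inj₂ (trans (≈c q) (sym (≈c r)))
   where
   ≈c : ∀ {u} → Q u → u ≈ c
   ≈c r = byContradiction λ u≉c → none (_ , r , u≉c)
 ... | yes some with finite-min cs {λ u → Q u × ¬ (u ≈ c)}
         (λ e (r , n) → resp e r , n ∘ trans e)
         (λ u (r , n) → case sub u r of λ { (here e) → ⊥-elim (n e) ; (there h) → h })
         some
 ... | m , (Qm , m≉c) , lb with em {P = Q c}
 ... | no ¬Qc = m , Qm , λ u r → lb u (r , λ u≈c → ¬Qc (resp u≈c r))
 ... | yes Qc with cmp m c
 ...     | tri< m<c _ _ = m , Qm , λ u r → case em {P = u ≈ c} of λ
             { (yes u≈c) → inj₁ (<-respʳ (sym u≈c) m<c)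
             ; (no u≉c) → lb u (r , u≉c) }
 ... | tri≈ _ m≈c _ = ⊥-elim (m≉c m≈c)
 ...     | tri> _ _ c<m = c , Qc , λ u r → case em {P = u ≈ c} of λ
             { (yes u≈c) → inj₂ (sym u≈c)
             ; (no u≉c) → ≤-trans (inj₁ c<m) (lb u (r , u≉c)) }

 remove : ∀ cs {m} → Any (m ≈_) cs → ∃ λ cs′ → List.length cs ≡ suc (List.length cs′) ×
          (∀ t → Any (t ≈_) cs → ¬ (t ≈ m) → Any (t ≈_) cs′)
 remove (c ∷ cs) (here m≈c) = cs , ≡.refl , λ { t (here t≈c) t≉m → ⊥-elim (t≉m (trans t≈c (sym m≈c)))
   ; t (there h) _ → h }
 remove (c ∷ cs) (there p) with remove cs p
 ... | cs′ , e , f = c ∷ cs′ , ≡.cong suc e , λ { t (here t≈c) _ → here t≈c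
   ; t (there h) t≉m → there (f t h t≉m) }

 -- The value of `f` is determined by the fibre. If the fibres depend on some of the coordinates
 -- only, so does `f`; this is how sections of projections arise.
 Canonical : (K^ n → Carrier → Set a) → DFun n → Set (ℓ ⊔ a)
 Canonical S f = ∀ x y → (∀ t → (S x t → S y t) × (S y t → S x t)) → fn f x ≈ fn f y

 module _ {S : K^ n → Carrier → Set a} (dS : Defᶠ S)
          (small : ∀ x → ∀* (λ t → ¬ S x t)) where

    record Family : Set (s ⊔ Level.suc (ℓ ⊔ a)) where
      field
        set : K^ n → Carrier → Set (ℓ ⊔ a)
        setᵈ : Defᶠ set
        cong : ∀ {x y} → (∀ t → (S x t → S y t) × (S y t → S x t)) → ∀ t → (set x t → set y t)
    open Family

    -- The fibres of `S` with their `k` least elements removed.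
    iter : ℕ → Family
    iter zero .set x t = S x t × ⊤ {ℓ}
    iter zero .setᵈ = dS ×ᵈ fullᵈ (λ _ → tt)
    iter zero .Family.cong e t (p , _) = proj₁ (e t) p , tt
    iter (suc k) .set = Minima.rest (setᵈ (iter k))
    iter (suc k) .setᵈ = Minima.restᵈ (setᵈ (iter k))
    iter (suc k) .Family.cong e t (p , n) = Family.cong (iter k) e t p ,
      λ t≈m → n (trans t≈m (Minima.min-cong (setᵈ (iter k))
        λ u → Family.cong (iter k) (Prod.swap ∘ e) u , Family.cong (iter k) e u))

    minimum : ℕ → DFun n
    minimum k = dfun (Minima.min (setᵈ (iter k))) (Minima.minᵈ (setᵈ (iter k)))

    minimum-canonical : ∀ k → Canonical S (minimum k)
    minimum-canonical k x y e = Minima.min-cong (setᵈ (iter k)) λ t →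
      Family.cong (iter k) e t , Family.cong (iter k) (Prod.swap ∘ e) t

    exhaust : ∀ x k j cs → List.length cs ≡ k → (∀ t → set (iter j) x t → Any (t ≈_) cs) →
              ∃ λ i → ∀ t → ¬ set (iter i) x t
    exhaust x zero    j []       e sub = j , λ t p → case sub t p of λ ()
    exhaust x (suc k) j cs e sub with em {P = ∃ (set (iter j) x)}
    ... | no ¬p = j , λ t p → ¬p (t , p)
    ... | yes p
      with Minima.isMin (setᵈ (iter j)) x (finite-min cs
             (respᶠ (setᵈ (iter j)) ≋-refl) sub p)
    ... | Qm , _ with remove cs (sub _ Qm)
    ... | cs′ , e′ , f = exhaust x k (suc j) cs′ (ℕ.suc-injective (≡.trans (≡.sym e′) e))
      (λ t (q , t≉m) → f t (sub t q) t≉m)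

    opaque
     -- If for every `k` some fibre had elements left, then by saturation a single fibre would have
     -- elements left for all `k`; but it is finite.
     exhaustion : ∃ λ k → ∀ x t → ¬ set (iter k) x t
     exhaustion = byContradiction λ unbounded →
       let x , e = compactness {E = λ k x → ∃ (set (iter k) x)}
             (λ k → ∃ᵈ (atᶠ (setᵈ (iter k)) v₁ s₀))
             (λ k x (t , p , _) → t , p)
             (λ k → byContradiction λ empty → unbounded (k , λ x t p → empty (x , t , p)))
           cs , sub = finite {P = S x} (atᶠ dS (λ i → constᵈ) s₀) (small x)
           i , none = exhaust x _ 0 cs ≡.refl (λ t p → sub t (proj₁ p))
       in none _ (proj₂ (e i))

    private
     minima : ℕ → List (DFun n)
     minima zero = []
     minima (suc k) = minimum k ∷ minima k

     covers : ∀ k x t → S x t → set (iter k) x t ⊎ Any (λ f → t ≈ fn f x) (minima k)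
     covers zero x t p = inj₁ (p , tt)
     covers (suc k) x t p with covers k x t p
     ... | inj₂ h = inj₂ (there h)
     ... | inj₁ q with em {P = t ≈ fn (minimum k) x}
     ... | yes t≈m = inj₂ (here t≈m)
     ... | no t≉m = inj₁ (q , t≉m)

     canonical : ∀ k → All (Canonical S) (minima k)
     canonical zero = []
     canonical (suc k) = minimum-canonical k ∷ canonical k

    opaque
     uniform-finiteness : ∃ λ (fs : List (DFun n)) → All (Canonical S) fs ×
                          (∀ x t → S x t → Any (λ f → t ≈ fn f x) fs)
     uniform-finiteness = minima (proj₁ exhaustion) , canonical (proj₁ exhaustion) ,
       λ x t p → [ (λ q → ⊥-elim (proj₂ exhaustion x t q)) , id ]′ (covers (proj₁ exhaustion) x t p)

 Boundaryᵈ : ∀ {Γ} {P : ⟪ Γ ⟫ → Carrier → Set a} {t : ⟪ Γ ⟫ → Carrier} →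
             Def {Γ ▸ scalar} (λ ρ → P (proj₁ ρ) (proj₂ ρ)) → DefF t →
             Def (λ ρ → Boundary (P ρ) (t ρ))
 Boundaryᵈ dP dt = ∀ᵈ (∀ᵈ (s₁ <ᵈ wk (wk dt) →ᵈ wk (wk dt) <ᵈ s₀ →ᵈ
   ∃ᵈ (s₂ <ᵈ s₀ ×ᵈ s₀ <ᵈ s₁ ×ᵈ underᵖ (underᵖ dP)) ×ᵈ
   ∃ᵈ (s₂ <ᵈ s₀ ×ᵈ s₀ <ᵈ s₁ ×ᵈ ¬ᵈ underᵖ (underᵖ dP))))

 -- Definable choice

 module _ {S : K^ n → Carrier → Set a} (dS : Defᶠ S) where

    private
     fibreᵈ : ∀ x → Def₁ (S x)
     fibreᵈ x = atᶠ dS (λ i → constᵈ) s₀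

    opaque
     boundaries : ∃ λ (fs : List (DFun n)) → ∀ x t → Boundary (S x) t → Any (λ f → t ≈ fn f x) fs
     boundaries = Prod.map₂ proj₂ (uniform-finiteness {S = λ x → Boundary (S x)}
       (Boundaryᵈ (atᶠ dS v₂ s₀) s₀) (λ x → ∀*-¬Boundary (fibreᵈ x)))

    private
     fs : List (DFun n)
     fs = proj₁ boundaries

     up down : DFun n → DFun n
     up f = dfun (λ x → fn f x + 1#) (fnᵈ f +ᵈ constᵈ)
     down f = dfun (λ x → fn f x - 1#) (fnᵈ f -ᵈ constᵈ)

     middle : DFun n → DFun n → DFun n
     middle f g = dfun (λ x → half (fn f x + fn g x)) (halfᵈ (fnᵈ f +ᵈ fnᵈ g))

     -- A nonempty subset of K contains one of these: 0 if it is all of K, a boundary point shifted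
     -- by 1 if it contains a ray, the midpoint of two boundary points if it contains a bounded
     -- interval between them. A boundary point that belongs to the set is the midpoint of itself
     -- and itself.
     candidates : List (DFun n)
     candidates = dfun (λ _ → 0#) constᵈ ∷ List.map up fs List.++
       List.map down fs List.++ List.concatMap (λ f → List.map (middle f) fs) fs

     pick : List (DFun n) → DFun n
     pick [] = dfun (λ _ → 0#) constᵈ
     pick (f ∷ fs) = dfun (λ x → If (S x (fn f x)) (fn f x) (fn (pick fs) x))
       (ifᵈ (atᶠ dS v₀ (fnᵈ f)) (fnᵈ f) (fnᵈ (pick fs)))

     pick-spec : ∀ x fs → Any (λ f → S x (fn f x)) fs → S x (fn (pick fs) x)
     pick-spec x (f ∷ fs) h with em {P = S x (fn f x)}
     ... | yes p = p
     ... | no ¬p = case h of λ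
       { (here p) → ⊥-elim (¬p p) ; (there h) → pick-spec x fs h }

     module _ (x : K^ n) where

       Chosen : DFun n → Set a
       Chosen f = S x (fn f x)

       boundary-fs : ∀ {y} → Boundary (S x) y → Any (λ f → y ≈ fn f x) fs
       boundary-fs bd = proj₂ boundaries x _ bd

       up-chosen : Any (λ f → S x (fn f x + 1#)) fs → Any Chosen candidates
       up-chosen h = there (Any.++⁺ˡ {xs = List.map up fs} (Any.map⁺ {P = Chosen} h))

       down-chosen : Any (λ f → S x (fn f x - 1#)) fs → Any Chosen candidates
       down-chosen h = there (Any.++⁺ʳ (List.map up fs) (Any.++⁺ˡ {xs = List.map down fs} (Any.map⁺ {P = Chosen} h)))

       middle-chosen : Any (λ f → Any (λ g → S x (half (fn f x + fn g x))) fs) fs → Any Chosen candidates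
       middle-chosen h = there (Any.++⁺ʳ (List.map up fs) (Any.++⁺ʳ (List.map down fs)
           (Any.concatMap⁺ (λ f → List.map (middle f) fs) (Any.map (Any.map⁺ {P = Chosen}) h))))

       chosen-above-below : ∀ {t} → Above (S x) t → Below (S x) t → Any Chosen candidates
       chosen-above-below {t} (inj₁ all) (inj₁ all′) = by-cases (t ≤ 0#)
         (λ t≤0 → here (all 0# t≤0)) (λ t≰0 → here (all′ 0# (inj₁ (≰⇒> t≰0))))
       chosen-above-below {t} (inj₁ all) (inj₂ (y , y<t , bd , inside)) =
         up-chosen (Any.map (λ {f} y≈f → by-cases (t ≤ fn f x + 1#) (all _)
           (λ q → inside _ (<-respˡ (sym y≈f) x<x+1) (inj₁ (≰⇒> q))))
           (boundary-fs bd))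
       chosen-above-below {t} (inj₂ (y , t<y , bd , inside)) (inj₁ all) =
         down-chosen (Any.map (λ {f} y≈f → by-cases (t ≤ fn f x - 1#)
           (λ q → inside _ q (<-respʳ (sym y≈f) x-1<x))
           (λ q → all _ (inj₁ (≰⇒> q)))) (boundary-fs bd))
       chosen-above-below {t} (inj₂ (y , t<y , bd , inside)) (inj₂ (z , z<t , bd′ , inside′)) =
         middle-chosen (Any.map (λ {f} y≈f → Any.map (λ {g} z≈g → by-cases (t ≤ half (fn f x + fn g x))
               (λ q → inside _ q (half-< (sym y≈f) (<-respˡ z≈g (<-trans z<t t<y))))
               (λ q → inside′ _ (<-half (sym z≈g) (<-respʳ y≈f (<-trans z<t t<y))) (inj₁ (≰⇒> q))))
           (boundary-fs bd′)) (boundary-fs bd))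

       nonempty⇒candidate : ∀ t → S x t → Any Chosen candidates
       nonempty⇒candidate t p = by-cases (Boundary (S x) t)
         (λ bd → middle-chosen (Any.map (λ t≈f → Any.map (λ t≈g →
             respᶠ dS ≋-refl (sym (half-≈ (sym t≈f) (sym t≈g))) p)
           (boundary-fs bd)) (boundary-fs bd)))
         (λ ¬bd → chosen-above-below (above (fibreᵈ x) t p ¬bd) (below (fibreᵈ x) t p ¬bd))

    opaque
     definable-choice : ∃ λ (f : DFun n) → ∀ x t → S x t → S x (fn f x)
     definable-choice = pick candidates , λ x t p → pick-spec x candidates (nonempty⇒candidate x t p)

 -- Quantifiers over almost all elements commute

 module _ {f : Carrier → Carrier} (df : Fun₁ f) where

   private
     Flat : Carrier → Set ℓ
     Flat x = ∃₂ λ u v → u < x × x < v × All⟨ u , v ⟩ (λ t → f t ≈ f x)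

     flatᵈ : Def₁ Flat
     flatᵈ = ∃ᵈ (∃ᵈ (s₁ <ᵈ s₂ ×ᵈ s₂ <ᵈ s₀ ×ᵈ ∀ᵈ (s₂ <ᵈ s₀ →ᵈ s₀ <ᵈ s₁ →ᵈ app₁ df s₀ ≈ᵈ app₁ df s₃)))

     flat⇒constant : ∀ {x y} → x ≤ y → (∀ t → x ≤ t → t ≤ y → Flat t) → f y ≈ f x
     flat⇒constant {x} {y} x≤y flat = real-induction {P = λ t → f t ≈ f x} (app₁ df s₀ ≈ᵈ constᵈ) x≤y
       (λ t x≤t t≤y h → closed t x≤t (flat t x≤t t≤y) h)
       (λ t x≤t t<y e → let _ , v , _ , t<v , c = flat t x≤t (inj₁ t<y) in
         v , t<v , λ u t<u u<v → trans (c u (<-trans (proj₁ (proj₂ (proj₂ (flat t x≤t (inj₁ t<y))))) t<u) u<v) e)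
       where
       closed : ∀ t → x ≤ t → Flat t → (∀ u → x ≤ u → u < t → f u ≈ f x) → f t ≈ f x
       closed t (inj₂ x≈t) _ _ = cong₁ df (sym x≈t)
       closed t (inj₁ x<t) (u , v , u<t , t<v , c) h =
         let k , u≤k , x≤k , least = larger u x
             w , k<w , w<t = between (least u<t x<t)
         in trans (sym (c w (≤-<-trans u≤k k<w) (<-trans w<t t<v)))
                  (h w (inj₁ (≤-<-trans x≤k k<w)) w<t)

     piece-constant : ∀ p → (∀ {x} → In p x → Flat x) → ∀ {x y} → In p x → In p y → x ≤ y → f y ≈ f x
     piece-constant (point c) flat e e′ _ = cong₁ df (trans e′ (sym e))
     piece-constant (interval l r) flat (lo , _) (_ , hi) x≤y =
       flat⇒constant x≤y λ t x≤t t≤y → flat (up l lo x≤t , down r hi t≤y)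
       where
       up : ∀ l {x t} → Lo l x → x ≤ t → Lo l t
       up ⊥± _ _ = tt
       up [ l ]± p q = <-≤-trans p q
       down : ∀ r {x t} → Hi r x → t ≤ x → Hi r t
       down ⊤± _ _ = tt
       down [ r ]± p q = ≤-<-trans q p

     values : List Piece → List Carrier
     values [] = []
     values (p ∷ Ps) with em {P = ∃ (In p)}
     ... | yes (x , _) = f x ∷ values Ps
     ... | no _ = values Ps

     value-of : ∀ Ps → (∀ {x} → Any (λ p → In p x) Ps → Flat x) →
                ∀ {x} → Any (λ p → In p x) Ps → Any (f x ≈_) (values Ps)
     value-of (p ∷ Ps) flat {x} h with em {P = ∃ (In p)} | h
     ... | yes (y , q) | here q′ = here (case em {P = x ≤ y} of λ
             { (yes x≤y) → sym (piece-constant p (flat ∘ here) q′ q x≤y)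
             ; (no x≰y) → piece-constant p (flat ∘ here) q q′ (inj₁ (≰⇒> x≰y)) })
     ... | yes (y , q) | there h′ = there (value-of Ps (flat ∘ there) h′)
     ... | no ¬q | here q′ = ⊥-elim (¬q (_ , q′))
     ... | no ¬q       | there h′ = value-of Ps (flat ∘ there) h′

   -- Since an interval on which f is constant lies in a piece of the set of
   -- points near which f is constant, only finitely many values y occur.
   ∀*-fibre : ∀* λ y → ∀* λ x → ¬ (y ≈ f x)
   ∀*-fibre with pieces flatᵈ
   ... | Ps , to , from = ∀*-map (λ y y∉ → byContradiction λ ¬p →
     let u , v , u<v , c = ¬∀*⇒interval (constᵈ ≈ᵈ app₁ df s₀) ¬p
         x , u<x , x<v = between u<v
         y≈fx = c x u<x x<v
     in y∉ (Any.map (trans y≈fx) (value-of Ps from (to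
       (u , v , u<x , x<v , λ t u<t t<v → trans (sym (c t u<t t<v)) y≈fx)))))
     (∀*-≉list (values Ps))

 module _ {R : Carrier → Carrier → Set a} (dR : Def₂ R) where

   fᵈ : ∀ {Γ} (f : DFun 1) → DefF {Γ ▸ scalar} (λ ρ → fn f (λ _ → proj₂ ρ))
   fᵈ f = appⱽ (fnᵈ f) (λ _ → s₀)

   Exception : K^ 1 → Carrier → Set _
   Exception x y = ¬ R (x zero) y × ∀* (R (x zero))

   exceptionᵈ : Defᶠ Exception
   exceptionᵈ = ¬ᵈ at₂ dR (v₁ zero) s₀ ×ᵈ ∀*ᵈ (at₂ dR (v₂ zero) s₀)

   exceptions : ∃ λ (fs : List (DFun 1)) → All (Canonical Exception) fs ×
                (∀ x y → Exception x y → Any (λ f → y ≈ fn f x) fs)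
   exceptions = uniform-finiteness exceptionᵈ λ x → by-cases (∀* (R (x zero)))
     (λ p → ∀*-map (λ y r (¬r , _) → ¬r r) p)
     (λ ¬p → ∀*-all λ y (_ , p) → ¬p p)

   fs : List (DFun 1)
   fs = proj₁ exceptions

   Thick : DFun 1 → Carrier → Set ℓ
   Thick f y = ¬ ∀* (λ x → ¬ (y ≈ fn f (λ _ → x)))

   thin : ∀* λ y → ¬ Any (λ f → Thick f y) fs
   thin = ∀*-Any {R = Thick} (λ f → ¬ᵈ ∀*ᵈ (¬ᵈ (s₁ ≈ᵈ fᵈ f)))
     (All.universal (λ f → ∀*-map (λ y p ¬p → ¬p p) (∀*-fibre (fᵈ f))) fs)

   row : ∀ y → ¬ Any (λ f → Thick f y) fs → ∀* λ x → ¬ Any (λ f → y ≈ fn f (λ _ → x)) fs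
   row y y∉ = ∀*-Any {R = λ f x → y ≈ fn f (λ _ → x)} (λ f → constᵈ ≈ᵈ fᵈ f)
     (All.map byContradiction (All.¬Any⇒All¬ fs y∉))

   opaque
     -- For almost every `x` the exceptional `y` are finite in number, hence values at `x` of
     -- finitely many functions `f`. By `∀*-fibre` almost every `y` is taken by each `f` on a finite
     -- set only, and off these sets `y` is no exception.
     ∀*-comm : (∀* λ x → ∀* λ y → R x y) → ∀* λ y → ∀* λ x → R x y
     ∀*-comm h = ∀*-map (λ y y∉ → ∀*-map (λ x (¬any , p) → byContradiction λ ¬r →
           ¬any (proj₂ (proj₂ exceptions) (λ _ → x) y (¬r , p)))
         (∀*-× (¬ᵈ Anyᵈ fs λ f → constᵈ ≈ᵈ fᵈ f) (row y y∉) h))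
       thin

 -- Absolute values and the ℓ¹ distance

 opaque
   ∣_∣ : Carrier → Carrier
   ∣ x ∣ = If (0# ≤ x) x (- x)

   ∣∣-≤ : ∀ {x c} → x ≤ c → - x ≤ c → ∣ x ∣ ≤ c
   ∣∣-≤ {x} p q = by-cases (0# ≤ x) (λ h → ≤-trans (inj₂ (If-yes h)) p) (λ h → ≤-trans (inj₂ (If-no h)) q)

   ∣∣-< : ∀ {x c} → x < c → - x < c → ∣ x ∣ < c
   ∣∣-< {x} p q = by-cases (0# ≤ x) (λ h → <-respˡ (sym (If-yes h)) p) (λ h → <-respˡ (sym (If-no h)) q)

   x≤∣x∣ : ∀ x → x ≤ ∣ x ∣
   x≤∣x∣ x = by-cases (0# ≤ x) (λ h → inj₂ (sym (If-yes h)))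
     (λ h → lin 2 (λ x y → y :≈ :- x ∷ x :< :0 ⊢ x :≤ y) (If-no h) (≰⇒> h))

   -x≤∣x∣ : ∀ x → - x ≤ ∣ x ∣
   -x≤∣x∣ x = by-cases (0# ≤ x) (λ h → lin 2 (λ x y → y :≈ x ∷ :0 :≤ x ⊢ :- x :≤ y) (If-yes h) h)
     (λ h → inj₂ (sym (If-no h)))

   ∣_∣ᵈ : {t : ⟪ Γ ⟫ → Carrier} → DefF t → DefF (λ ρ → ∣ t ρ ∣)
   ∣ dt ∣ᵈ = ifᵈ (constᵈ ≤ᵈ dt) dt (-ᵈ dt)

 ∣∣-pos : ∀ {x} → 0# ≤ x → ∣ x ∣ ≈ x
 ∣∣-pos {x} 0≤x = ≤-antisym (∣∣-≤ ≤-refl (lin 1 (λ x → :0 :≤ x ⊢ :- x :≤ x) 0≤x)) (x≤∣x∣ x)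

 ∣∣-neg : ∀ {x} → x ≤ 0# → ∣ x ∣ ≈ - x
 ∣∣-neg {x} x≤0 = ≤-antisym (∣∣-≤ (lin 1 (λ x → x :≤ :0 ⊢ x :≤ :- x) x≤0) ≤-refl) (-x≤∣x∣ x)

 ∣∣≤⇒≤ : ∀ {x c} → ∣ x ∣ ≤ c → x ≤ c
 ∣∣≤⇒≤ = ≤-trans (x≤∣x∣ _)

 ∣∣≤⇒-≤ : ∀ {x c} → ∣ x ∣ ≤ c → - x ≤ c
 ∣∣≤⇒-≤ = ≤-trans (-x≤∣x∣ _)

 0≤∣_∣ : ∀ x → 0# ≤ ∣ x ∣
 0≤∣ x ∣ = lin 2 (λ x y → x :≤ y ∷ :- x :≤ y ⊢ :0 :≤ y) (x≤∣x∣ x) (-x≤∣x∣ x)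

 ∣∣-cong : ∀ {x y} → x ≈ y → ∣ x ∣ ≈ ∣ y ∣
 ∣∣-cong {x} {y} x≈y = ≤-antisym
   (∣∣-≤ (≤-trans (inj₂ x≈y) (x≤∣x∣ y)) (≤-trans (inj₂ (-‿cong x≈y)) (-x≤∣x∣ y)))
   (∣∣-≤ (≤-trans (inj₂ (sym x≈y)) (x≤∣x∣ x)) (≤-trans (inj₂ (-‿cong (sym x≈y))) (-x≤∣x∣ x)))

 ∣0∣ : ∣ 0# ∣ ≈ 0#
 ∣0∣ = ≤-antisym (∣∣-≤ ≤-refl (lin 0 (⊢ :- :0 :≤ :0))) (0≤∣ 0# ∣)

 ∣∣-zero : ∀ {x} → x ≈ 0# → ∣ x ∣ ≈ 0#
 ∣∣-zero x≈0 = trans (∣∣-cong x≈0) ∣0∣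

 ∣-∣ : ∀ x y → ∣ x - y ∣ ≈ ∣ y - x ∣
 ∣-∣ x y = ≤-antisym (∣∣-≤ (≤-trans (lin 2 (λ x y → ⊢ x :- y :≤ :- (y :- x))) (-x≤∣x∣ _))
     (≤-trans (lin 2 (λ x y → ⊢ :- (x :- y) :≤ y :- x)) (x≤∣x∣ _)))
   (∣∣-≤ (≤-trans (lin 2 (λ x y → ⊢ y :- x :≤ :- (x :- y))) (-x≤∣x∣ _))
     (≤-trans (lin 2 (λ x y → ⊢ :- (y :- x) :≤ x :- y)) (x≤∣x∣ _)))

 ∣∣-triangle : ∀ x y z → ∣ x - z ∣ ≤ ∣ x - y ∣ + ∣ y - z ∣
 ∣∣-triangle x y z = ∣∣-≤ (lin 5 (λ x y z p q → x :- y :≤ p ∷ y :- z :≤ q ⊢ x :- z :≤ p :+ q)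
     (x≤∣x∣ (x - y)) (x≤∣x∣ (y - z)))
   (lin 5 (λ x y z p q → :- (x :- y) :≤ p ∷ :- (y :- z) :≤ q ⊢ :- (x :- z) :≤ p :+ q)
     (-x≤∣x∣ (x - y)) (-x≤∣x∣ (y - z)))

 sum-cong : ∀ {x y : K^ n} → x ≋ y → sum x ≈ sum y
 sum-cong {n = zero} e = refl
 sum-cong {n = suc n} e = +-cong (e zero) (sum-cong (e ∘ suc))

 sum-mono : ∀ {x y : K^ n} → (∀ i → x i ≤ y i) → sum x ≤ sum y
 sum-mono {n = zero} e = ≤-refl
 sum-mono {n = suc n} e = lin 4 (λ a b c d → a :≤ b ∷ c :≤ d ⊢ a :+ c :≤ b :+ d)
   (e zero) (sum-mono (e ∘ suc))

 sum-nonneg : ∀ {x : K^ n} → (∀ i → 0# ≤ x i) → 0# ≤ sum x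
 sum-nonneg {n = zero} e = ≤-refl
 sum-nonneg {n = suc n} e = lin 2 (λ a b → :0 :≤ a ∷ :0 :≤ b ⊢ :0 :≤ a :+ b) (e zero) (sum-nonneg (e ∘ suc))

 sum-+ : ∀ (x y : K^ n) → sum (λ i → x i + y i) ≈ sum x + sum y
 sum-+ {n = zero} x y = lin 0 (⊢ :0 :≈ :0 :+ :0)
 sum-+ {n = suc n} x y = lin 5 (λ a b s c d → s :≈ c :+ d ⊢ a :+ b :+ s :≈ a :+ c :+ (b :+ d))
   (sum-+ (x ∘ suc) (y ∘ suc))

 ≤-sum : ∀ {x : K^ n} → (∀ i → 0# ≤ x i) → ∀ i → x i ≤ sum x
 ≤-sum h zero = lin 2 (λ a b → :0 :≤ b ⊢ a :≤ a :+ b) (sum-nonneg (h ∘ suc))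
 ≤-sum h (suc i) = lin 3 (λ a b c → :0 :≤ a ∷ c :≤ b ⊢ c :≤ a :+ b) (h zero) (≤-sum (h ∘ suc) i)

 opaque
   -- The ℓ¹ distance is additive in the coordinates, so that `lin` can deal with it. The Euclidean
   -- norm of the statement is compared with it only at the end.
   dist : K^ n → K^ n → Carrier
   dist x y = sum (λ i → ∣ x i - y i ∣)

   distᵈ : {v w : ⟪ Γ ⟫ → K^ n} → DefV v → DefV w → DefF (λ ρ → dist (v ρ) (w ρ))
   distᵈ dv dw = sumᵈ λ i → ∣ dv i -ᵈ dw i ∣ᵈ

   0≤dist : ∀ (x y : K^ n) → 0# ≤ dist x y
   0≤dist x y = sum-nonneg {x = λ i → ∣ x i - y i ∣} λ i → 0≤∣ x i - y i ∣

   dist-cong : ∀ {x x′ y y′ : K^ n} → x ≋ x′ → y ≋ y′ → dist x y ≈ dist x′ y′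
   dist-cong e e′ = sum-cong λ i → ∣∣-cong (+-cong (e i) (-‿cong (e′ i)))

   dist-pointwise : ∀ {x y u v : K^ n} → (∀ i → ∣ x i - u i ∣ ≈ ∣ y i - v i ∣) → dist x u ≈ dist y v
   dist-pointwise e = sum-cong e

   dist-sym : ∀ (x y : K^ n) → dist x y ≈ dist y x
   dist-sym x y = sum-cong λ i → ∣-∣ (x i) (y i)

   dist-triangle : ∀ (x y z : K^ n) → dist x z ≤ dist x y + dist y z
   dist-triangle x y z = ≤-trans (sum-mono λ i → ∣∣-triangle (x i) (y i) (z i))
     (inj₂ (sum-+ (λ i → ∣ x i - y i ∣) (λ i → ∣ y i - z i ∣)))

   coord≤dist : ∀ (x y : K^ n) i → ∣ x i - y i ∣ ≤ dist x y
   coord≤dist x y = ≤-sum {x = λ i → ∣ x i - y i ∣} (λ i → 0≤∣ x i - y i ∣)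

   dist-≋ : ∀ {x y : K^ n} → x ≋ y → dist x y ≈ 0#
   dist-≋ {n = zero} e = refl
   dist-≋ {n = suc n} {x} {y} e = trans (+-cong
     (∣∣-zero (trans (+-congʳ (e zero)) (-‿inverseʳ _))) (dist-≋ (e ∘ suc)))
     (+-identityˡ 0#)

   dist-∷ : ∀ (x y : K^ (suc n)) → dist x y ≈ ∣ x zero - y zero ∣ + dist (x ∘ suc) (y ∘ suc)
   dist-∷ x y = refl

   dist-[] : ∀ (x y : K^ 0) → dist x y ≈ 0#
   dist-[] x y = refl

 infix 9 _[_≔_]

 _[_≔_] : K^ n → Fin n → Carrier → K^ n
 x [ i ≔ t ] = updateAt x i (λ _ → t)

 upd-same : ∀ (x : K^ n) i {t} → (x [ i ≔ t ]) i ≈ t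
 upd-same x i = reflexive (updateAt-updates i x)

 upd-other : ∀ (x : K^ n) {i j t} → j ≢ i → (x [ i ≔ t ]) j ≈ x j
 upd-other x {i} {j} j≢i = reflexive (updateAt-minimal j i x j≢i)

 upd-self : ∀ (x : K^ n) i {t} → t ≈ x i → (x [ i ≔ t ]) ≋ x
 upd-self {n = suc n} x zero e zero = e
 upd-self {n = suc n} x zero e (suc j) = refl
 upd-self {n = suc n} x (suc i) e zero = refl
 upd-self {n = suc n} x (suc i) e (suc j) = upd-self (x ∘ suc) i e j

 upd-cong : ∀ {x y : K^ n} i {t u} → x ≋ y → t ≈ u → (x [ i ≔ t ]) ≋ (y [ i ≔ u ])
 upd-cong {n = suc n} zero e e′ zero = e′
 upd-cong {n = suc n} zero e e′ (suc j) = e (suc j)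
 upd-cong {n = suc n} (suc i) e e′ zero = e zero
 upd-cong {n = suc n} (suc i) e e′ (suc j) = upd-cong i (e ∘ suc) e′ j

 upd-upd : ∀ (x : K^ n) i {t u} → (x [ i ≔ t ] [ i ≔ u ]) ≋ (x [ i ≔ u ])
 upd-upd {n = suc n} x zero zero = refl
 upd-upd {n = suc n} x zero (suc j) = refl
 upd-upd {n = suc n} x (suc i) zero = refl
 upd-upd {n = suc n} x (suc i) (suc j) = upd-upd (x ∘ suc) i j

 upd-comm : ∀ (x : K^ n) {i j t u} → i ≢ j → (x [ i ≔ t ] [ j ≔ u ]) ≋ (x [ j ≔ u ] [ i ≔ t ])
 upd-comm {n = suc n} x {zero} {zero} i≢j k = ⊥-elim (i≢j ≡.refl)
 upd-comm {n = suc n} x {zero} {suc j} i≢j zero = refl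
 upd-comm {n = suc n} x {zero} {suc j} i≢j (suc k) = refl
 upd-comm {n = suc n} x {suc i} {zero} i≢j zero = refl
 upd-comm {n = suc n} x {suc i} {zero} i≢j (suc k) = refl
 upd-comm {n = suc n} x {suc i} {suc j} i≢j zero = refl
 upd-comm {n = suc n} x {suc i} {suc j} i≢j (suc k) = upd-comm (x ∘ suc) (i≢j ∘ ≡.cong suc) k

 updᵈ : {v : ⟪ Γ ⟫ → K^ n} {t : ⟪ Γ ⟫ → Carrier} → DefV v → ∀ i → DefF t → DefV (λ ρ → v ρ [ i ≔ t ρ ])
 updᵈ {n = suc n} dv zero dt zero = dt
 updᵈ {n = suc n} dv zero dt (suc j) = dv (suc j)
 updᵈ {n = suc n} dv (suc i) dt zero = dv zero
 updᵈ {n = suc n} dv (suc i) dt (suc j) = updᵈ (dv ∘ suc) i dt j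

 opaque
   unfolding dist

   dist-upd : ∀ (x : K^ n) i s t → dist (x [ i ≔ s ]) (x [ i ≔ t ]) ≈ ∣ s - t ∣
   dist-upd {n = suc n} x zero s t = trans (+-congˡ (dist-≋ {x = x ∘ suc} ≋-refl)) (+-identityʳ _)
   dist-upd {n = suc n} x (suc i) s t = trans (+-cong (∣∣-zero (-‿inverseʳ _))
     (dist-upd (x ∘ suc) i s t)) (+-identityˡ _)

   dist-upd≤ : ∀ (x y : K^ n) i s t → dist (x [ i ≔ s ]) (y [ i ≔ t ]) ≤ dist x y + ∣ s - t ∣
   dist-upd≤ {n = suc n} x y zero s t =
     lin 3 (λ a d e → :0 :≤ a ⊢ e :+ d :≤ a :+ d :+ e) (0≤∣ x zero - y zero ∣)
   dist-upd≤ {n = suc n} x y (suc i) s t = lin 4 (λ a d e f → f :≤ d :+ e ⊢ a :+ f :≤ a :+ d :+ e)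
       (dist-upd≤ (x ∘ suc) (y ∘ suc) i s t)

 -- Almost all points of K^ n

 Almost : ∀ n → (K^ n → Set a) → Set (ℓ ⊔ a)
 Almost zero P = P Vector.[] × ⊤ {ℓ}
 Almost (suc n) P = Almost n λ x → ∀* λ t → P (t Vector.∷ x)

 -- A record, so that n and P can be inferred.
 record ∀*ⁿ (P : K^ n → Set a) : Set (ℓ ⊔ a) where
   constructor almost
   field
     get : Almost n P
 open ∀*ⁿ

 pack : {P : K^ (suc n) → Set a} → ∀*ⁿ (λ x → ∀* λ t → P (t Vector.∷ x)) → ∀*ⁿ P
 pack (almost p) = almost p

 unpack : {P : K^ (suc n) → Set a} → ∀*ⁿ P → ∀*ⁿ (λ x → ∀* λ t → P (t Vector.∷ x))
 unpack (almost p) = almost p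

 ∷-η : ∀ (x : K^ (suc n)) → (x zero Vector.∷ (x ∘ suc)) ≋ x
 ∷-η x zero = refl
 ∷-η x (suc i) = refl

 ∷ᵖ : {P : ⟪ Γ ⟫ → K^ (suc n) → Set a} → Def {Γ ▸ vec (suc n)} (λ ρ → P (proj₁ ρ) (proj₂ ρ)) →
      Def {Γ ▸ vec n ▸ scalar} (λ ρ → P (proj₁ (proj₁ ρ)) (proj₂ ρ Vector.∷ proj₂ (proj₁ ρ)))
 ∷ᵖ {P = P} dP = instᵛ {P = λ ρ → P (proj₁ (proj₁ ρ))} (underᵖ (underᵖ dP)) (consᵈ s₀ v₁)

 ∀*ⁿ-all : {P : K^ n → Set a} → (∀ x → P x) → ∀*ⁿ P
 ∀*ⁿ-all {n = zero} p = almost (p _ , tt)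
 ∀*ⁿ-all {n = suc n} p = pack $ ∀*ⁿ-all λ x → ∀*-all λ t → p _

 ∀*ⁿ-map : {P : K^ n → Set a} {Q : K^ n → Set b} → (∀ x → P x → Q x) → ∀*ⁿ P → ∀*ⁿ Q
 ∀*ⁿ-map {n = zero} f (almost (p , _)) = almost (f _ p , tt)
 ∀*ⁿ-map {n = suc n} f p = pack (∀*ⁿ-map (λ x → ∀*-map λ t → f _) (unpack p))

 ∀*ⁿ-× : {P : K^ n → Set a} {Q : K^ n → Set b} → Defⱽ P → ∀*ⁿ P → ∀*ⁿ Q → ∀*ⁿ (λ x → P x × Q x)
 ∀*ⁿ-× {n = zero} dP (almost (p , _)) (almost (q , _)) = almost ((p , q) , tt)
 ∀*ⁿ-× {n = suc n} {P = P} dP p q = pack $ ∀*ⁿ-map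
   (λ x (p , q) → ∀*-× (atⱽ dP (consᵈ s₀ (λ i → constᵈ))) p q)
   (∀*ⁿ-× (∀*ᵈ (∷ᵖ {P = λ _ → P} dP)) (unpack p) (unpack q))

 ∀*ⁿ-map₂ : ∀ {c} {P : K^ n → Set a} {Q : K^ n → Set b} {R : K^ n → Set c} →
            Defⱽ P → (∀ x → P x → Q x → R x) → ∀*ⁿ P → ∀*ⁿ Q → ∀*ⁿ R
 ∀*ⁿ-map₂ dP f p q = ∀*ⁿ-map (λ x (p , q) → f x p q) (∀*ⁿ-× dP p q)

 ∀*-∀*ⁿ-comm : {R : Carrier → K^ n → Set a} →
   Def {∅ ▸ scalar ▸ vec n} (λ ρ → R (proj₂ (proj₁ ρ)) (proj₂ ρ)) →
   (∀* λ c → ∀*ⁿ λ x → R c x) → ∀*ⁿ λ x → ∀* λ c → R c x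
 ∀*-∀*ⁿ-comm {n = zero} dR h = almost (∀*-map (λ c (almost (p , _)) → p) h , tt)
 ∀*-∀*ⁿ-comm {n = suc n} {R = R} dR h = pack $ ∀*ⁿ-map (λ x → ∀*-comm (instᵛ {P = λ ρ → R (proj₂ (proj₁ ρ))}
     (underᵖ dR) (consᵈ s₀ (λ i → constᵈ))))
   (∀*-∀*ⁿ-comm (∀*ᵈ (∷ᵖ {P = R ∘ proj₂} dR)) (∀*-map (λ c → unpack) h))

 Nbhd : (K^ n → Set a) → K^ n → Set (ℓ ⊔ a)
 Nbhd P x = ∃ λ δ → 0# < δ × (∀ y → dist x y < δ → P y)

 Nbhdᵈ : {P : ⟪ Γ ⟫ → K^ n → Set a} {v : ⟪ Γ ⟫ → K^ n} →
         Def {Γ ▸ vec n} (λ ρ → P (proj₁ ρ) (proj₂ ρ)) → DefV v →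
         Def (λ ρ → Nbhd (P ρ) (v ρ))
 Nbhdᵈ dP dv = ∃ᵈ (constᵈ <ᵈ s₀ ×ᵈ ∀ᵈ (distᵈ (wkᵛ (wkᵛ dv)) v₀ <ᵈ s₁ →ᵈ underᵖ dP))

 Nbhd-map : {P : K^ n → Set a} {Q : K^ n → Set b} {x : K^ n} → (∀ y → P y → Q y) → Nbhd P x → Nbhd Q x
 Nbhd-map f (δ , 0<δ , h) = δ , 0<δ , λ y d → f y (h y d)

 Nbhd-× : {P : K^ n → Set a} {Q : K^ n → Set b} {x : K^ n} → Nbhd P x → Nbhd Q x → Nbhd (λ y → P y × Q y) x
 Nbhd-× (δ , 0<δ , p) (δ′ , 0<δ′ , q) with positive-minimum 0<δ 0<δ′
 ... | m , 0<m , m≤δ , m≤δ′ = m , 0<m , λ y d → p y (<-≤-trans d m≤δ) , q y (<-≤-trans d m≤δ′)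

 Nbhd-centre : {P : K^ n → Set a} {x : K^ n} → Nbhd P x → P x
 Nbhd-centre {x = x} (δ , 0<δ , h) = h x (<-respˡ (sym (dist-≋ {x = x} ≋-refl)) 0<δ)

 ∀*ⁿ-meets : {P : K^ n → Set a} {Q : K^ n → Set b} {x : K^ n} → ∀*ⁿ P → Nbhd Q x → ∃ λ y → P y × Q y
 ∀*ⁿ-meets {P = P} {Q} {x} p (δ , 0<δ , h) =
   let y , d , q = go x p 0<δ in y , q , h y d
   where
   go : ∀ {n c} {P : K^ n → Set c} x → ∀*ⁿ P → ∀ {δ} → 0# < δ → ∃ λ y → dist x y < δ × P y
   go {zero} x (almost (p , _)) 0<δ = Vector.[] , <-respˡ (sym (dist-[] x Vector.[])) 0<δ , p
   go {suc n} x p {δ} 0<δ with go (x ∘ suc) (unpack p) (half-pos 0<δ)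
   ... | y , d , q with q (x zero) (x zero + half δ)
         (lin 2 (λ x h → :0 :< h ⊢ x :< x :+ h) (half-pos 0<δ))
   ... | t , x<t , t<x+h , r = (t Vector.∷ y) ,
     lin 5 (λ m d h δ e → m :< h ∷ d :< h ∷ h :+ h :≈ δ ∷ e :≈ m :+ d ⊢ e :< δ)
       (∣∣-< (lin 3 (λ x t h → x :< t ∷ :0 :< h ⊢ x :- t :< h) x<t (half-pos 0<δ))
             (lin 3 (λ x t h → t :< x :+ h ⊢ :- (x :- t) :< h) t<x+h))
       d (half+half δ) (dist-∷ x (t Vector.∷ y)) , r

 -- Together with its converse below, a Fubini theorem: as quantifiers commute, any coordinate may
 -- be quantified innermost. This turns facts about functions of one variable into facts about
 -- almost all points.
 ∀*ⁿ-update : {P : K^ n → Set a} → Defⱽ P → ∀ i → ∀*ⁿ P → ∀*ⁿ λ x → ∀* λ t → P (x [ i ≔ t ])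
 ∀*ⁿ-update {n = suc n} dP zero p = pack $ ∀*ⁿ-map
   (λ x q → ∀*-all λ a → ∀*-map (λ t → respⱽ dP λ { zero → refl ; (suc i) → refl }) q)
   (unpack p)
 ∀*ⁿ-update {n = suc n} {P = P} dP (suc i) p = pack $ ∀*ⁿ-map
   (λ x q → ∀*-map (λ a → ∀*-map λ t → respⱽ dP λ { zero → refl ; (suc i) → refl })
     (∀*-comm (atⱽ dP (consᵈ s₀ (updᵈ (λ i → constᵈ) i s₁))) q))
   (∀*ⁿ-update (∀*ᵈ (∷ᵖ {P = λ _ → P} dP)) i (unpack p))

 ∀*ⁿ-update⁻ : {P : K^ n → Set a} → Defⱽ P → ∀ i → ∀*ⁿ (λ x → ∀* λ t → P (x [ i ≔ t ])) → ∀*ⁿ P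
 ∀*ⁿ-update⁻ {n = suc n} {P = P} dP zero p = pack $ ∀*ⁿ-map
   {P = λ x → ∀* λ a → ∀* λ t → P ((a Vector.∷ x) [ zero ≔ t ])}
   (λ x q → let _ , _ , _ , r = q 0# 1# 0<1 in
     ∀*-map (λ t → respⱽ dP λ { zero → refl ; (suc i) → refl }) r) (unpack p)
 ∀*ⁿ-update⁻ {n = suc n} {P = P} dP (suc i) p = pack $ ∀*ⁿ-update⁻ (∀*ᵈ (∷ᵖ {P = λ _ → P} dP)) i (∀*ⁿ-map
     (λ x q → ∀*-comm (atⱽ dP (consᵈ s₁ (updᵈ (λ i → constᵈ) i s₀)))
       (∀*-map (λ a → ∀*-map λ t → respⱽ dP λ { zero → refl ; (suc i) → refl }) q)) (unpack p))

 ∀*ⁿ-reindex : ∀ {d} {P : K^ d → Set a} → Defⱽ P → (J : Fin d → Fin n) → (∀ {i j} → J i ≡ J j → i ≡ j) →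
               (∀*ⁿ (λ (x : K^ n) → P (x ∘ J)) → ∀*ⁿ P) ×
               (∀*ⁿ P → ∀*ⁿ (λ (x : K^ n) → P (x ∘ J)))
 ∀*ⁿ-reindex {d = zero} dP J inj = (λ p → almost (respⱽ dP (λ ()) (proj₁ (proj₂ (∀*ⁿ-meets {x = λ _ → 0#} p
     (1# , 0<1 , λ _ _ → tt {ℓ})))) , tt)) ,
   (λ (almost (p , _)) → ∀*ⁿ-all λ x → respⱽ dP (λ ()) p)
 ∀*ⁿ-reindex {n = n} {d = suc d} {P} dP J inj =
   (λ p → pack $ proj₁ IH (∀*ⁿ-map (λ x → ∀*-map λ t → respⱽ dP (split x t))
     (∀*ⁿ-update (atⱽ dP (v₀ ∘ J)) (J zero) p))) ,
   (λ p → ∀*ⁿ-update⁻ (atⱽ dP (v₀ ∘ J)) (J zero)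
     (∀*ⁿ-map (λ x → ∀*-map λ t → respⱽ dP (≋-sym (split x t))) (proj₂ IH (unpack p))))
   where
   IH = ∀*ⁿ-reindex {n = n} (∀*ᵈ (∷ᵖ {P = λ _ → P} dP)) (J ∘ suc)
     (λ e → case inj e of λ { ≡.refl → ≡.refl })
   split : ∀ x t → ((x [ J zero ≔ t ]) ∘ J) ≋ (t Vector.∷ (x ∘ J ∘ suc))
   split x t zero = upd-same x (J zero)
   split x t (suc i) = upd-other x λ e → case inj e of λ ()

 -- Interior points and continuity

 inner-interval : {P : Carrier → Set a} → Def₁ P → ∀ t → P t → ¬ Boundary P t →
                  ∃₂ λ u v → u < t × t < v × All⟨ u , v ⟩ P
 inner-interval dP t p ¬bd with above dP t p ¬bd | below dP t p ¬bd
 ... | A | B = lo B , hi A , lo< B , <hi A , λ u l r → by-cases (t ≤ u)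
     (λ t≤u → in-hi A u t≤u r) (λ t≰u → in-lo B u (inj₁ (≰⇒> t≰u)) l)
   where
   hi : Above _ t → Carrier
   hi (inj₁ _) = t + 1#
   hi (inj₂ (y , _)) = y
   lo : Below _ t → Carrier
   lo (inj₁ _) = t - 1#
   lo (inj₂ (y , _)) = y
   <hi : ∀ A → t < hi A
   <hi (inj₁ _) = x<x+1
   <hi (inj₂ (y , p , _)) = p
   lo< : ∀ B → lo B < t
   lo< (inj₁ _) = x-1<x
   lo< (inj₂ (y , p , _)) = p
   in-hi : ∀ A u → t ≤ u → u < hi A → _
   in-hi (inj₁ h) u p _ = h u p
   in-hi (inj₂ (y , _ , _ , h)) u p q = h u p q
   in-lo : ∀ B u → u ≤ t → lo B < u → _
   in-lo (inj₁ h) u p _ = h u p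
   in-lo (inj₂ (y , _ , _ , h)) u p q = h u q p

 module Interior {P : K^ (suc n) → Set a} (dP : Defⱽ P) where

   Z : Carrier → Carrier → K^ n → Set _
   Z c d x = All⟨ c , d ⟩ (λ t → P (t Vector.∷ x))

   Zᵈ : {c d : ⟪ Γ ⟫ → Carrier} {v : ⟪ Γ ⟫ → K^ n} → DefF c → DefF d →
        DefV v → Def (λ ρ → Z (c ρ) (d ρ) (v ρ))
   Zᵈ dc dd dv = ∀ᵈ (wk dc <ᵈ s₀ →ᵈ s₀ <ᵈ wk dd →ᵈ atⱽ dP (consᵈ s₀ (wkᵛ dv)))

   Good : Carrier → Carrier → K^ n → Set _
   Good c d x = Z c d x → Nbhd (Z c d) x

   Goodᵈ : {c d : ⟪ Γ ⟫ → Carrier} {v : ⟪ Γ ⟫ → K^ n} → DefF c → DefF d →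
           DefV v → Def (λ ρ → Good (c ρ) (d ρ) (v ρ))
   Goodᵈ dc dd dv = Zᵈ dc dd dv →ᵈ Nbhdᵈ (Zᵈ (wk dc) (wk dd) v₀) dv

   all-good : (∀ c d → ∀*ⁿ (Good c d)) → ∀*ⁿ λ x → ∀* λ c → ∀* λ d → Good c d x
   all-good h = ∀*-∀*ⁿ-comm {R = λ c x → ∀* λ d → Good c d x} (∀*ᵈ (Goodᵈ s₂ s₀ v₁))
     (∀*-all λ c → ∀*-∀*ⁿ-comm {R = λ d x → Good c d x} (Goodᵈ constᵈ s₁ v₀) (∀*-all (h c)))

   -- A point `t` inside the fibre lies in some `(c, d)` contained in the fibre, and `c`, `d` can be
   -- moved slightly to be good. Then the fibres over a whole neighbourhood of `x` contain `(c, d)`,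
   -- which yields a box around the point.
   final : ∀ x → (∀* λ c → ∀* λ d → Good c d x) → ∀* λ t → P (t Vector.∷ x) → Nbhd P (t Vector.∷ x)
   final x good = ∀*-map (λ t ¬bd p → neighbourhood t p ¬bd) (∀*-¬Boundary fibreᵈ)
     where
     fibreᵈ : Def₁ (λ t → P (t Vector.∷ x))
     fibreᵈ = atⱽ dP (consᵈ s₀ (λ i → constᵈ))
     neighbourhood : ∀ t → P (t Vector.∷ x) → ¬ Boundary (λ t → P (t Vector.∷ x)) t → Nbhd P (t Vector.∷ x)
     neighbourhood t p ¬bd =
       let u , v , u<t , t<v , inside = inner-interval fibreᵈ t p ¬bd
           c , u<c , c<t , q = good u t u<t
           d , t<d , d<v , r = q t v t<v
           δ , 0<δ , h = r λ w c<w w<d → inside w (<-trans u<c c<w) (<-trans w<d d<v)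
           k , 0<k , k≤ , k≤′ = positive-minimum (lin 2 (λ c t → c :< t ⊢ :0 :< t :- c) c<t)
             (lin 2 (λ d t → t :< d ⊢ :0 :< d :- t) t<d)
           m , 0<m , m≤δ , m≤k = positive-minimum 0<δ 0<k
       in m , 0<m , λ y y∈′ →
         let e = 0≤dist x (y ∘ suc)
             y∈ = <-respˡ (dist-∷ (t Vector.∷ x) y) y∈′ in
         respⱽ dP (∷-η y) (h (y ∘ suc) (lin 4 (λ a e m δ → a :+ e :< m ∷ :0 :≤ a ∷ m :≤ δ ⊢ e :< δ)
             y∈ (0≤∣ t - y zero ∣) m≤δ)
           (y zero)
           (lin 7 (λ a e m k t y c → a :+ e :< m ∷ :0 :≤ e ∷ m :≤ k ∷ k :≤ t :- c ∷ t :- y :≤ a ⊢ c :< y)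
             y∈ e m≤k k≤ (x≤∣x∣ (t - y zero)))
           (lin 7 (λ a e m k t y d → a :+ e :< m ∷ :0 :≤ e ∷ m :≤ k ∷ k :≤ d :- t ∷ :- (t :- y) :≤ a ⊢ y :< d)
             y∈ e m≤k k≤′ (-x≤∣x∣ (t - y zero))))

 opaque
   ∀*ⁿ-interior : {P : K^ n → Set a} → Defⱽ P → ∀*ⁿ λ x → P x → Nbhd P x
   ∀*ⁿ-interior {n = zero} dP = almost ((λ p → 1# , 0<1 , λ y _ → respⱽ dP (λ ()) p) , tt)
   ∀*ⁿ-interior {n = suc n} {P = P} dP = pack $ ∀*ⁿ-map final
       (all-good λ c d → ∀*ⁿ-interior (Zᵈ constᵈ constᵈ v₀))
     where open Interior dP

 ContinuousAt : (K^ n → Carrier) → K^ n → Set ℓ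
 ContinuousAt f x = ∀ ε → 0# < ε → Nbhd (λ y → ∣ f x - f y ∣ < ε) x

 ContinuousAtᵈ : {f : K^ n → Carrier} → Funⱽ f → Defⱽ (ContinuousAt f)
 ContinuousAtᵈ df = ∀ᵈ (constᵈ <ᵈ s₀ →ᵈ Nbhdᵈ (∣ appⱽ df v₂ -ᵈ appⱽ df v₀ ∣ᵈ <ᵈ s₁) v₁)

 opaque
   -- As for interior points: at almost every `x`, for almost all `c` and `d`, the condition
   -- `c < f < d` is open if it holds; such `c` and `d` can be found within `ε` of the value.
   ∀*ⁿ-continuous : {f : K^ n → Carrier} → Funⱽ f → ∀*ⁿ (ContinuousAt f)
   ∀*ⁿ-continuous {n = n} {f = f} df = ∀*ⁿ-map final
     (∀*-∀*ⁿ-comm {R = λ c x → ∀* λ d → Good c d x} (∀*ᵈ (Goodᵈ s₂ s₀ v₁))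
       (∀*-all λ c → ∀*-∀*ⁿ-comm {R = λ d x → Good c d x} (Goodᵈ constᵈ s₁ v₀)
         (∀*-all λ d → ∀*ⁿ-interior (Betweenᵈ constᵈ constᵈ v₀))))
     where
     Between : Carrier → Carrier → K^ n → Set ℓ
     Between c d x = c < f x × f x < d
     Good : Carrier → Carrier → K^ n → Set ℓ
     Good c d x = Between c d x → Nbhd (Between c d) x
     Betweenᵈ : {c d : ⟪ Γ ⟫ → Carrier} {v : ⟪ Γ ⟫ → K^ n} → DefF c → DefF d →
                DefV v → Def (λ ρ → Between (c ρ) (d ρ) (v ρ))
     Betweenᵈ dc dd dv = dc <ᵈ appⱽ df dv ×ᵈ appⱽ df dv <ᵈ dd
     Goodᵈ : {c d : ⟪ Γ ⟫ → Carrier} {v : ⟪ Γ ⟫ → K^ n} → DefF c → DefF d →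
             DefV v → Def (λ ρ → Good (c ρ) (d ρ) (v ρ))
     Goodᵈ dc dd dv = Betweenᵈ dc dd dv →ᵈ Nbhdᵈ (Betweenᵈ (wk dc) (wk dd) v₀) dv
     final : ∀ x → (∀* λ c → ∀* λ d → Good c d x) → ContinuousAt f x
     final x good ε 0<ε =
       let c , p , p′ , q = good (f x - ε) (f x)
             (lin 2 (λ x e → :0 :< e ⊢ x :- e :< x) 0<ε)
           d , r , r′ , g = q (f x) (f x + ε) (lin 2 (λ x e → :0 :< e ⊢ x :< x :+ e) 0<ε)
       in Nbhd-map (λ y (c<fy , fy<d) → ∣∣-<
            (lin 4 (λ x y c e → x :- e :< c ∷ c :< y ⊢ x :- y :< e) p c<fy)
            (lin 4 (λ x y d e → d :< x :+ e ∷ y :< d ⊢ :- (x :- y) :< e) r′ fy<d))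
          (g (p′ , r))

 -- Derivatives of functions of one variable

 Near₁ : (Carrier → Carrier) → Carrier → Carrier → Carrier → Set ℓ
 Near₁ g t q c = ∃ λ δ → 0# < δ × (∀ v → ∣ v - t ∣ < δ → ∣ (g v - g t) - q * (v - t) ∣ ≤ c * ∣ v - t ∣)

 HasDeriv : (Carrier → Carrier) → Carrier → Carrier → Set ℓ
 HasDeriv g t p = ∀ ε → 0# < ε → Near₁ g t p ε

 module _ {g : Carrier → Carrier} (dg : Fun₁ g) where

   SlopeR SlopeL : Carrier → Carrier → Set ℓ
   SlopeR t q = ∃ λ u → t < u × All⟨ t , u ⟩ (λ v → g v - g t ≤ q * (v - t))
   SlopeL t q = ∃ λ u → u < t × All⟨ u , t ⟩ (λ v → g t - g v ≤ q * (t - v))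

   -- In the real induction the slopes to the left carry the estimate up to `t`, those to the right
   -- carry it beyond `t`.
   slope-bound : ∀ {x y q} → x ≤ y → (∀ t → x ≤ t → t ≤ y → SlopeR t q × SlopeL t q) →
                 g y - g x ≤ q * (y - x)
   slope-bound {x} {y} {q} x≤y slopes = real-induction {P = λ t → g t - g x ≤ q * (t - x)}
     ((app₁ dg s₀ -ᵈ constᵈ) ≤ᵈ (constᵈ *ᵈ (s₀ -ᵈ constᵈ))) x≤y
     (λ t x≤t t≤y h → closed t x≤t (proj₂ (slopes t x≤t t≤y)) h)
     (λ t x≤t t<y h → let u , t<u , k = proj₁ (slopes t x≤t (inj₁ t<y)) in
       u , t<u , λ v t<v v<u → lin 7 (λ gv gt gx q v t x →
             gv :- gt :≤ q :* (v :- t) ∷ gt :- gx :≤ q :* (t :- x) ⊢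
             gv :- gx :≤ q :* (v :- x)) (k v t<v v<u) h)
     where
     closed : ∀ t → x ≤ t → SlopeL t q → (∀ u → x ≤ u → u < t → g u - g x ≤ q * (u - x)) →
              g t - g x ≤ q * (t - x)
     closed t (inj₂ x≈t) _ _ = inj₂ (trans (lin 2 (λ gt gx → gt :≈ gx ⊢ gt :- gx :≈ :0) (cong₁ dg (sym x≈t)))
       (sym (trans (*-congˡ (lin 2 (λ t x → x :≈ t ⊢ t :- x :≈ :0) x≈t)) (zeroʳ q))))
     closed t (inj₁ x<t) (u , u<t , k) h =
       let m , u≤m , x≤m , least = larger u x
           v , m<v , v<t = between (least u<t x<t)
       in lin 7 (λ gv gt gx q v t x →
             gt :- gv :≤ q :* (t :- v) ∷ gv :- gx :≤ q :* (v :- x) ⊢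
             gt :- gx :≤ q :* (t :- x))
           (k v (≤-<-trans u≤m m<v) v<t) (h v (inj₁ (≤-<-trans x≤m m<v)) v<t)

   near⇒slopes : ∀ {t q c} → Near₁ g t q c → SlopeR t (q + c) × SlopeL t (q + c)
   near⇒slopes {t} {q} {c} (δ , 0<δ , h) =
     (t + δ , lin 2 (λ t δ → :0 :< δ ⊢ t :< t :+ δ) 0<δ , λ v t<v v<t+δ →
       let 0≤v-t = lin 2 (λ t v → t :< v ⊢ :0 :≤ v :- t) t<v
           e = ∣∣-pos 0≤v-t in
       lin 6 (λ gv gt q c v t → (gv :- gt) :- q :* (v :- t) :≤ c :* (v :- t) ⊢
           gv :- gt :≤ (q :+ c) :* (v :- t))
         (∣∣≤⇒≤ (≤-trans (h v (<-respˡ (sym e) (lin 3 (λ t v δ → v :< t :+ δ ⊢ v :- t :< δ) v<t+δ)))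
           (inj₂ (*-congˡ e))))) ,
     (t - δ , lin 2 (λ t δ → :0 :< δ ⊢ t :- δ :< t) 0<δ , λ v t-δ<v v<t →
       let v-t≤0 = lin 2 (λ t v → v :< t ⊢ v :- t :≤ :0) v<t
           e = ∣∣-neg v-t≤0 in
       lin 6 (λ gv gt q c v t → :- ((gv :- gt) :- q :* (v :- t)) :≤ c :* (:- (v :- t)) ⊢
           gt :- gv :≤ (q :+ c) :* (t :- v))
         (∣∣≤⇒-≤ (≤-trans (h v (<-respˡ (sym e) (lin 3 (λ t v δ → t :- δ :< v ⊢ :- (v :- t) :< δ) t-δ<v)))
           (inj₂ (*-congˡ e)))))

 Near₁-neg : ∀ {g t q c} → Near₁ g t q c → Near₁ (λ x → - g x) t (- q) c
 Near₁-neg (δ , 0<δ , h) = δ , 0<δ , λ v d → ≤-trans (∣∣-≤ (≤-trans (lin 5 (λ gv gt q v t → ⊢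
         ((:- gv :- :- gt) :- (:- q) :* (v :- t)) :≤ :- ((gv :- gt) :- q :* (v :- t)))) (-x≤∣x∣ _))
     (≤-trans (lin 5 (λ gv gt q v t → ⊢
         :- ((:- gv :- :- gt) :- (:- q) :* (v :- t)) :≤ ((gv :- gt) :- q :* (v :- t)))) (x≤∣x∣ _)))
   (h v d)

 mean-value : ∀ {g} → Fun₁ g → ∀ {x y q c} → x ≤ y → (∀ t → x ≤ t → t ≤ y → Near₁ g t q c) →
   ∣ (g y - g x) - q * (y - x) ∣ ≤ c * (y - x)
 mean-value {g} dg {x} {y} {q} {c} x≤y near = ∣∣-≤
   (lin 6 (λ gy gx q c y x → gy :- gx :≤ (q :+ c) :* (y :- x) ⊢ (gy :- gx) :- q :* (y :- x) :≤ c :* (y :- x))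
     (slope-bound dg x≤y λ t p r → near⇒slopes dg (near t p r)))
   (lin 6 (λ gy gx q c y x → (:- gy) :- (:- gx) :≤ (:- q :+ c) :* (y :- x) ⊢
       :- ((gy :- gx) :- q :* (y :- x)) :≤ c :* (y :- x))
     (slope-bound dg′ x≤y λ t p r → near⇒slopes dg′ (Near₁-neg {g} (near t p r))))
   where
   dg′ : Fun₁ (λ t → - g t)
   dg′ = -ᵈ dg

 module _ {A : Carrier → Carrier → Set a} {B : Carrier → Carrier → Set b}
          (dA : Def₂ A) (dB : Def₂ B) where

   -- If A t v for v slightly above t, and B v t for v slightly below t,
   -- then "slightly" is uniform for t in a smaller interval.
   overlapping : ∀ {c d} → c < d → All⟨ c , d ⟩ (λ t → (∃ λ u → t < u × All⟨ t , u ⟩ (λ v → A t v)) ×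
                         (∃ λ u → u < t × All⟨ u , t ⟩ (λ v → B v t))) →
     ∃₂ λ t s → t < s × A t s × B t s
   overlapping {c} {d} c<d h = byContradiction λ none →
     let t , c<t , t<d , q = ∀*-comm (¬ᵈ Wᵈ s₁ s₀)
           (∀*-all λ e → byContradiction λ ¬p → none (meet e ¬p)) c d c<d
     in small t c<t t<d q
     where
     W : Carrier → Carrier → Set _
     W e t = 0# < e × All⟨ t , t + e ⟩ (λ v → A t v) × All⟨ t - e , t ⟩ (λ v → B v t)
     Wᵈ : {e t : ⟪ Γ ⟫ → Carrier} → DefF e → DefF t → Def (λ ρ → W (e ρ) (t ρ))
     Wᵈ de dt = constᵈ <ᵈ de ×ᵈ ∀ᵈ (wk dt <ᵈ s₀ →ᵈ s₀ <ᵈ (wk dt +ᵈ wk de) →ᵈ at₂ dA (wk dt) s₀) ×ᵈ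
       ∀ᵈ ((wk dt -ᵈ wk de) <ᵈ s₀ →ᵈ s₀ <ᵈ wk dt →ᵈ at₂ dB s₀ (wk dt))
     meet : ∀ e → ¬ ∀* (λ t → ¬ W e t) → ∃₂ λ t s → t < s × A t s × B t s
     meet e ¬p =
       let x , y , x<y , w = ¬∀*⇒interval (Wᵈ constᵈ s₀) ¬p
           t , x<t , t<y = between x<y
           0<e , Ats , _ = w t x<t t<y
           m , m≤y , m≤t+e , greatest = smaller y (t + e)
           s , t<s , s<m = between (greatest t<y (lin 2 (λ t e → :0 :< e ⊢ t :< t :+ e) 0<e))
           _ , _ , Bts = w s (<-trans x<t t<s) (<-≤-trans s<m m≤y)
           s<t+e = <-≤-trans s<m m≤t+e
       in t , s , t<s , Ats s t<s s<t+e ,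
          Bts t (lin 3 (λ s t e → s :< t :+ e ⊢ s :- e :< t) s<t+e) t<s
     small : ∀ t → c < t → t < d → ¬ ∀* (λ e → ¬ W e t)
     small t c<t t<d q =
       let (u , t<u , f) , (w , w<t , g) = h t c<t t<d
           k , 0<k , k≤ , k≤′ = positive-minimum (lin 2 (λ t u → t :< u ⊢ :0 :< u :- t) t<u)
             (lin 2 (λ t w → w :< t ⊢ :0 :< t :- w) w<t)
           e , 0<e , e<k , ¬w = q 0# k 0<k
       in ¬w (0<e ,
         (λ v t<v v<t+e → f v t<v (lin 5
           (λ v t e k u → v :< t :+ e ∷ e :< k ∷ k :≤ u :- t ⊢ v :< u) v<t+e e<k k≤)) ,
         (λ v t-e<v v<t → g v (lin 5
           (λ v t e k w → t :- e :< v ∷ e :< k ∷ k :≤ t :- w ⊢ w :< v) t-e<v e<k k≤′) v<t))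

 HasDerivᵈ : {g : ⟪ Γ ⟫ → Carrier → Carrier} {t p : ⟪ Γ ⟫ → Carrier} →
   DefF {Γ ▸ scalar} (λ ρ → g (proj₁ ρ) (proj₂ ρ)) →
   DefF {Γ} (λ ρ → g ρ (t ρ)) → DefF t → DefF p →
   Def (λ ρ → HasDeriv (g ρ) (t ρ) (p ρ))
 HasDerivᵈ {Γ} {g} {t} {p} dg dgt dt dp = ∀ᵈ (constᵈ <ᵈ s₀ →ᵈ ∃ᵈ (constᵈ <ᵈ s₀ ×ᵈ
   ∀ᵈ (∣ s₀ -ᵈ wk (wk (wk dt)) ∣ᵈ <ᵈ s₁ →ᵈ
     ∣ (dg″ -ᵈ wk (wk (wk dgt))) -ᵈ (wk (wk (wk dp)) *ᵈ (s₀ -ᵈ wk (wk (wk dt)))) ∣ᵈ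
       ≤ᵈ (s₂ *ᵈ ∣ s₀ -ᵈ wk (wk (wk dt)) ∣ᵈ))))
   where
   dg″ : DefF {Γ ▸ scalar ▸ scalar ▸ scalar} (λ ρ → g (proj₁ (proj₁ (proj₁ ρ))) (proj₂ ρ))
   dg″ = under (under dg)
     where
     under : ∀ {Γ} {g : ⟪ Γ ⟫ → Carrier → Carrier} → DefF {Γ ▸ scalar} (λ ρ → g (proj₁ ρ) (proj₂ ρ)) →
             DefF {Γ ▸ scalar ▸ scalar} (λ ρ → g (proj₁ (proj₁ ρ)) (proj₂ ρ))
     under dg = underᶠ dg

 module _ {g : Carrier → Carrier} (dg : Fun₁ g) where

   private
     R L : Carrier → Carrier → Set ℓ
     R t q = ∃ λ u → t < u × All⟨ t , u ⟩ (λ v → q * (v - t) < g v - g t)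
     L t q = ∃ λ u → u < t × All⟨ u , t ⟩ (λ v → q * (t - v) < g t - g v)

     Rᵈ : {t q : ⟪ Γ ⟫ → Carrier} → DefF t → DefF q → Def (λ ρ → R (t ρ) (q ρ))
     Rᵈ dt dq = ∃ᵈ (wk dt <ᵈ s₀ ×ᵈ ∀ᵈ (wk (wk dt) <ᵈ s₀ →ᵈ s₀ <ᵈ s₁ →ᵈ
       (wk (wk dq) *ᵈ (s₀ -ᵈ wk (wk dt))) <ᵈ (app₁ dg s₀ -ᵈ app₁ dg (wk (wk dt)))))

     Lᵈ : {t q : ⟪ Γ ⟫ → Carrier} → DefF t → DefF q → Def (λ ρ → L (t ρ) (q ρ))
     Lᵈ dt dq = ∃ᵈ (s₀ <ᵈ wk dt ×ᵈ ∀ᵈ (s₁ <ᵈ s₀ →ᵈ s₀ <ᵈ wk (wk dt) →ᵈ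
       (wk (wk dq) *ᵈ (wk (wk dt) -ᵈ s₀)) <ᵈ (app₁ dg (wk (wk dt)) -ᵈ app₁ dg s₀)))

     aboveᵈ : ∀ q → Def₂ (λ t v → q * (v - t) < g v - g t)
     aboveᵈ q = (constᵈ *ᵈ (s₀ -ᵈ s₁)) <ᵈ (app₁ dg s₀ -ᵈ app₁ dg s₁)

     belowᵈ : ∀ q → Def₂ (λ t v → g v - g t ≤ q * (v - t))
     belowᵈ q = (app₁ dg s₀ -ᵈ app₁ dg s₁) ≤ᵈ (constᵈ *ᵈ (s₀ -ᵈ s₁))

     ¬R⇒ : ∀ {t q} → ¬ R t q → ∃ λ u → t < u × All⟨ t , u ⟩ (λ v → g v - g t ≤ q * (v - t))
     ¬R⇒ {t} {q} ¬R with right-germ {P = λ v → q * (v - t) < g v - g t}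
       ((constᵈ *ᵈ (s₀ -ᵈ constᵈ)) <ᵈ (app₁ dg s₀ -ᵈ constᵈ)) t
     ... | u , t<u , inj₁ h = ⊥-elim (¬R (u , t<u , h))
     ... | u , t<u , inj₂ h = u , t<u , λ v p r → ≮⇒≥ (h v p r)

     ¬L⇒ : ∀ {t q} → ¬ L t q → ∃ λ u → u < t × All⟨ u , t ⟩ (λ v → g t - g v ≤ q * (t - v))
     ¬L⇒ {t} {q} ¬L with left-germ {P = λ v → q * (t - v) < g t - g v}
       ((constᵈ *ᵈ (constᵈ -ᵈ s₀)) <ᵈ (constᵈ -ᵈ app₁ dg s₀)) t
     ... | u , u<t , inj₁ h = ⊥-elim (¬L (u , u<t , h))
     ... | u , u<t , inj₂ h = u , u<t , λ v p r → ≮⇒≥ (h v p r)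

     *-mono : ∀ {q q′ x y z} → q ≤ q′ → x < y → q′ * (y - x) < z → q * (y - x) < z
     *-mono {q} {q′} {x} {y} q≤q′ x<y h = lin 5
       (λ q q′ x y z → :0 :≤ (q′ :- q) :* (y :- x) ∷ q′ :* (y :- x) :< z ⊢ q :* (y :- x) :< z)
       (*-nonneg (lin 2 (λ q q′ → q :≤ q′ ⊢ :0 :≤ q′ :- q) q≤q′)
                 (lin 2 (λ x y → x :< y ⊢ :0 :≤ y :- x) x<y)) h

     R-down : ∀ {t q q′} → q ≤ q′ → R t q′ → R t q
     R-down q≤q′ (u , t<u , h) = u , t<u , λ v t<v v<u → *-mono q≤q′ t<v (h v t<v v<u)

     L-down : ∀ {t q q′} → q ≤ q′ → L t q′ → L t q
     L-down q≤q′ (u , u<t , h) = u , u<t , λ v u<v v<t → *-mono q≤q′ v<t (h v u<v v<t)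

     -- Otherwise, throughout some interval, `g` runs above slope `q` to the right of each point and
     -- not above it to the left. By `overlapping` some two points would be compared in both ways.
     R⇒L : ∀ q → ∀* (λ t → R t q → L t q)
     R⇒L q = ∀*-map (λ t h r → byContradiction λ ¬l → h (r , ¬l)) (byContradiction λ ¬p →
       let x , y , x<y , h = ¬∀*⇒interval (Rᵈ s₀ constᵈ ×ᵈ ¬ᵈ Lᵈ s₀ constᵈ) ¬p
           t , s , _ , p , r = overlapping (aboveᵈ q) (belowᵈ q) x<y
             λ t x<t t<y → Prod.map₂ ¬L⇒ (h t x<t t<y)
       in ≤⇒≯ r p)

     L⇒R : ∀ q → ∀* (λ t → L t q → R t q)
     L⇒R q = ∀*-map (λ t h l → byContradiction λ ¬r → h (l , ¬r)) (byContradiction λ ¬p →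
       let x , y , x<y , h = ¬∀*⇒interval (Lᵈ s₀ constᵈ ×ᵈ ¬ᵈ Rᵈ s₀ constᵈ) ¬p
           t , s , _ , p , r = overlapping (belowᵈ q) (aboveᵈ q) x<y
             λ t x<t t<y → Prod.swap (Prod.map₂ ¬R⇒ (h t x<t t<y))
       in ≤⇒≯ p r)

     -- Both conditions are monotone in `q`, so this says that the one-sided derivatives, as suprema
     -- of the admissible `q`, coincide.
     Balanced : Carrier → Set ℓ
     Balanced t = ∀* (λ q → R t q → L t q) × ∀* (λ q → L t q → R t q)

     balancedᵈ : Def₁ Balanced
     balancedᵈ = ∀*ᵈ (Rᵈ s₁ s₀ →ᵈ Lᵈ s₁ s₀) ×ᵈ ∀*ᵈ (Lᵈ s₁ s₀ →ᵈ Rᵈ s₁ s₀)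

     balanced : ∀* Balanced
     balanced = ∀*-× (∀*ᵈ (Rᵈ s₁ s₀ →ᵈ Lᵈ s₁ s₀)) (∀*-comm (Rᵈ s₀ s₁ →ᵈ Lᵈ s₀ s₁) (∀*-all R⇒L))
       (∀*-comm (Lᵈ s₀ s₁ →ᵈ Rᵈ s₀ s₁) (∀*-all L⇒R))

     balanced-L : ∀ {t q q′} → Balanced t → q < q′ → R t q′ → L t q
     balanced-L (b , _) q<q′ r = let q″ , q<q″ , q″<q′ , f = b _ _ q<q′ in
       L-down (inj₁ q<q″) (f (R-down (inj₁ q″<q′) r))

     balanced-R : ∀ {t q q′} → Balanced t → q < q′ → L t q′ → R t q
     balanced-R (_ , b) q<q′ l = let q″ , q<q″ , q″<q′ , f = b _ _ q<q′ in
       R-down (inj₁ q<q″) (f (L-down (inj₁ q″<q′) l))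

     steep : ∀ {x y} → x < y → ∃ λ q → g y - g x < q * (y - x)
     steep {x} {y} x<y =
       let k , _ , e = inverse (lin 2 (λ x y → x :< y ⊢ :0 :< y :- x) x<y) in
       (g y - g x + 1#) * k , lin 6 (λ a x y k q z →
           z :≈ (a :+ :1) :* ((y :- x) :* k) ∷ (a :+ :1) :* ((y :- x) :* k) :≈ (a :+ :1) :* :1 ∷ :0 :< :1 ∷ q :≈ z ⊢ a :< q)
         refl (*-congˡ e) 0<1
         (lin 4 (λ a x y k → ⊢ (a :+ :1) :* k :* (y :- x) :≈ (a :+ :1) :* ((y :- x) :* k)))

     subinterval : ∀ {x y} → x < y →
       ∃₂ λ x′ y′ → x < x′ × x′ < y′ × y′ < y × (∀ t → x′ ≤ t → t ≤ y′ → Balanced t)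
     subinterval {x} {y} x<y =
       let z , x<z , b = ∀*-right balancedᵈ balanced x
           m , m≤y , m≤z , greatest = smaller y z
           x′ , x<x′ , x′<m = between (greatest x<y x<z)
           y′ , x′<y′ , y′<m = between x′<m
       in x′ , y′ , x<x′ , x′<y′ , <-≤-trans y′<m m≤y ,
          λ t x′≤t t≤y′ → b t (<-≤-trans x<x′ x′≤t) (≤-<-trans t≤y′ (<-≤-trans y′<m m≤z))

     -- The derivative is not +∞ throughout an interval: for `q` larger than the mean slope,
     -- `slope-bound` for the negative of `g` would make the mean slope at least `q`.
     not-all : ∀* (λ t → ¬ (∀ q → R t q))
     not-all = byContradiction λ ¬p →
       let x , y , x<y , h = ¬∀*⇒interval {P = λ t → ∀ q → R t q} (∀ᵈ (Rᵈ s₁ s₀)) ¬p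
           x′ , y′ , x<x′ , x′<y′ , y′<y , b = subinterval x<y
           q , steep-q = steep x′<y′
           all-R : ∀ t → x′ ≤ t → t ≤ y′ → ∀ q → R t q
           all-R t x′≤t t≤y′ = h t (<-≤-trans x<x′ x′≤t) (≤-<-trans t≤y′ y′<y)
       in ≤⇒≯ (slope-bound {g = λ t → - g t} (-ᵈ dg) {q = - q} (inj₁ x′<y′) λ t p r →
           (let u , t<u , f = all-R t p r q in u , t<u , λ v t<v v<u → lin 5
             (λ gv gt q v t → q :* (v :- t) :< gv :- gt ⊢
               (:- gv) :- (:- gt) :≤ (:- q) :* (v :- t)) (f v t<v v<u)) ,
           (let u , u<t , f = balanced-L (b t p r) x<x+1 (all-R t p r (q + 1#)) in
            u , u<t , λ v u<v v<t → lin 5 (λ gv gt q v t → q :* (t :- v) :< gt :- gv ⊢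
               (:- gt) :- (:- gv) :≤ (:- q) :* (t :- v)) (f v u<v v<t)))
         (lin 5 (λ gy gx q y x → gy :- gx :< q :* (y :- x) ⊢
           (:- q) :* (y :- x) :< (:- gy) :- (:- gx)) steep-q)

     -- The derivative is not -∞ throughout an interval, by the same argument with a `q` smaller
     -- than the mean slope.
     not-none : ∀* (λ t → ¬ (∀ q → ¬ R t q))
     not-none = byContradiction λ ¬p →
       let x , y , x<y , h = ¬∀*⇒interval {P = λ t → ∀ q → ¬ R t q} (∀ᵈ (¬ᵈ Rᵈ s₁ s₀)) ¬p
           x′ , y′ , x<x′ , x′<y′ , y′<y , b = subinterval x<y
           k , _ , e = inverse (lin 2 (λ x y → x :< y ⊢ :0 :< y :- x) x′<y′)
           q = (g y′ - g x′ - 1#) * k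
           none-R : ∀ t → x′ ≤ t → t ≤ y′ → ∀ q → ¬ R t q
           none-R t x′≤t t≤y′ = h t (<-≤-trans x<x′ x′≤t) (≤-<-trans t≤y′ y′<y)
       in ≤⇒≯ (slope-bound dg {q = q} (inj₁ x′<y′) λ t p r →
           ¬R⇒ (none-R t p r q) ,
           ¬L⇒ (λ l → none-R t p r (q - 1#) (balanced-R (b t p r) x-1<x l)))
         (lin 2 (λ a w → w :≈ (a :- :1) :* :1 ∷ :0 :< :1 ⊢ w :< a)
           (trans (lin 4 (λ a k x y → ⊢ (a :- :1) :* k :* (y :- x) :≈ (a :- :1) :* ((y :- x) :* k))) (*-congˡ e)) 0<1)

     near-above : ∀ {t p ε v} → t < v → (p - ε) * (v - t) < g v - g t → g v - g t ≤ (p + ε) * (v - t) →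
                  ∣ (g v - g t) - p * (v - t) ∣ ≤ ε * ∣ v - t ∣
     near-above {t} {p} {ε} {v} t<v lo hi = ≤-trans (∣∣-≤
         (lin 6 (λ gv gt p ε v t → gv :- gt :≤ (p :+ ε) :* (v :- t) ⊢
           (gv :- gt) :- p :* (v :- t) :≤ ε :* (v :- t)) hi)
         (lin 6 (λ gv gt p ε v t → (p :- ε) :* (v :- t) :< gv :- gt ⊢
           :- ((gv :- gt) :- p :* (v :- t)) :≤ ε :* (v :- t)) lo))
       (inj₂ (*-congˡ (sym (∣∣-pos (lin 2 (λ t v → t :< v ⊢ :0 :≤ v :- t) t<v)))))

     near-below : ∀ {t p ε v} → v < t → (p - ε) * (t - v) < g t - g v → g t - g v ≤ (p + ε) * (t - v) →
                  ∣ (g v - g t) - p * (v - t) ∣ ≤ ε * ∣ v - t ∣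
     near-below {t} {p} {ε} {v} v<t lo hi = ≤-trans (∣∣-≤
         (lin 6 (λ gv gt p ε v t → (p :- ε) :* (t :- v) :< gt :- gv ⊢
           (gv :- gt) :- p :* (v :- t) :≤ ε :* (:- (v :- t))) lo)
         (lin 6 (λ gv gt p ε v t → gt :- gv :≤ (p :+ ε) :* (t :- v) ⊢
           :- ((gv :- gt) :- p :* (v :- t)) :≤ ε :* (:- (v :- t))) hi))
       (inj₂ (*-congˡ (sym (∣∣-neg (lin 2 (λ t v → v :< t ⊢ v :- t :≤ :0) v<t)))))

     near-at : ∀ {t p ε v} → 0# < ε → v ≈ t → ∣ (g v - g t) - p * (v - t) ∣ ≤ ε * ∣ v - t ∣
     near-at {t} {p} {ε} {v} 0<ε v≈t = ≤-trans (inj₂ (∣∣-zero (lin 5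
         (λ gv gt p v t → gv :≈ gt ∷ p :* (v :- t) :≈ p :* :0 ⊢ (gv :- gt) :- p :* (v :- t) :≈ :0)
         (cong₁ dg v≈t) (*-congˡ (lin 2 (λ v t → v :≈ t ⊢ v :- t :≈ :0) v≈t)))))
       (*-nonneg (inj₁ 0<ε) (0≤∣ v - t ∣))

     germs⇒near : ∀ {t p ε} → 0# < ε → R t (p - ε) → L t (p - ε) →
       (∃ λ u → t < u × All⟨ t , u ⟩ (λ v → g v - g t ≤ (p + ε) * (v - t))) →
       (∃ λ u → u < t × All⟨ u , t ⟩ (λ v → g t - g v ≤ (p + ε) * (t - v))) →
       Near₁ g t p ε
     germs⇒near {t} {p} {ε} 0<ε (u₁ , t<u₁ , f₁) (u₂ , u₂<t , f₂) (u₃ , t<u₃ , f₃) (u₄ , u₄<t , f₄) = radius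
       where
       near : ∀ {u w} → t < u → w < t → u ≤ u₁ → u ≤ u₃ → u₂ ≤ w → u₄ ≤ w → Near₁ g t p ε
       near {u} {w} t<u w<t u≤u₁ u≤u₃ u₂≤w u₄≤w =
         let δ , 0<δ , δ≤ , δ≤′ = positive-minimum
               (lin 2 (λ t u → t :< u ⊢ :0 :< u :- t) t<u)
               (lin 2 (λ t w → w :< t ⊢ :0 :< t :- w) w<t)
         in δ , 0<δ , λ v v∈ → bound v
           (lin 5 (λ m v t δ u → m :< δ ∷ v :- t :≤ m ∷ δ :≤ u :- t ⊢ v :< u) v∈ (x≤∣x∣ (v - t)) δ≤)
           (lin 5 (λ m v t δ w → m :< δ ∷ :- (v :- t) :≤ m ∷ δ :≤ t :- w ⊢ w :< v) v∈ (-x≤∣x∣ (v - t)) δ≤′)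
         where
         bound : ∀ v → v < u → w < v → ∣ (g v - g t) - p * (v - t) ∣ ≤ ε * ∣ v - t ∣
         bound v v<u w<v with cmp v t
         ... | tri> _ _ t<v = near-above t<v (f₁ v t<v (<-≤-trans v<u u≤u₁)) (f₃ v t<v (<-≤-trans v<u u≤u₃))
         ... | tri≈ _ v≈t _ = near-at 0<ε v≈t
         ... | tri< v<t _ _ = near-below v<t (f₂ v (≤-<-trans u₂≤w w<v) v<t) (f₄ v (≤-<-trans u₄≤w w<v) v<t)
       radius : Near₁ g t p ε
       radius =
         let u , u≤u₁ , u≤u₃ , t<u = smaller u₁ u₃
             w , u₂≤w , u₄≤w , w<t = larger u₂ u₄
         in near (t<u t<u₁ t<u₃) (w<t u₂<t u₄<t) u≤u₁ u≤u₃ u₂≤w u₄≤w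

     -- The derivative is the supremum of the `q` with `R t q`; that it is finite is what the two
     -- negated hypotheses say.
     derivative : ∀ t → Balanced t → ¬ (∀ q → R t q) → ¬ (∀ q → ¬ R t q) → ∃ (HasDeriv g t)
     derivative t b ¬all ¬none = p , λ ε 0<ε →
       let q , p-h<q , r = near-sup ε 0<ε
           p-ε<q = p-ε< 0<ε p-h<q
       in germs⇒near 0<ε (R-down (inj₁ p-ε<q) r) (balanced-L b p-ε<q r)
         (¬R⇒ (¬r (p + ε) (lin 2 (λ p h → :0 :< h ⊢ p :< p :+ h) 0<ε)))
         (¬L⇒ (λ l → ¬r (p + half ε) (lin 2 (λ p h → :0 :< h ⊢ p :< p :+ h) (half-pos 0<ε))
           (balanced-R b (lin 3 (λ p h ε → h :+ h :≈ ε ∷ :0 :< ε ⊢ p :+ h :< p :+ ε) (half+half ε) 0<ε) l)))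
       where
       some-R : ∃ (R t)
       some-R = byContradiction λ h → ¬none λ q r → h (q , r)
       some-¬R : ∃ λ q → ¬ R t q
       some-¬R = byContradiction λ h → ¬all λ q → byContradiction λ ¬r → h (q , ¬r)
       sup : ∃ (IsSup (R t))
       sup = supremum (Rᵈ constᵈ s₀) some-R (proj₁ some-¬R ,
         λ q r → ≮⇒≥ λ q₀<q → proj₂ some-¬R (R-down (inj₁ q₀<q) r))
       p : Carrier
       p = proj₁ sup
       isSup : IsSup (R t) p
       isSup = proj₂ sup
       p-ε< : ∀ {ε q} → 0# < ε → p - half ε < q → p - ε < q
       p-ε< {ε} 0<ε h = lin 4 (λ p h ε q → p :- h :< q ∷ h :+ h :≈ ε ∷ :0 :< ε ⊢ p :- ε :< q)
         h (half+half ε) 0<ε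
       ¬r : ∀ q → p < q → ¬ R t q
       ¬r q p<q r = ≤⇒≯ (proj₁ isSup q r) p<q
       near-sup : ∀ ε → 0# < ε → ∃ λ q → p - half ε < q × R t q
       near-sup ε 0<ε = byContradiction λ h → ≤⇒≯
         (proj₂ isSup (p - half ε) λ q r → ≮⇒≥ λ lt → h (q , lt , r))
         (lin 2 (λ p h → :0 :< h ⊢ p :- h :< p) (half-pos 0<ε))

   opaque
     ∀*-differentiable : ∀* λ t → ∃ (HasDeriv g t)
     ∀*-differentiable = ∀*-map (λ t (b , ¬all , ¬none) → derivative t b ¬all ¬none)
       (∀*-× balancedᵈ balanced (∀*-× (¬ᵈ ∀ᵈ (Rᵈ s₁ s₀)) not-all not-none))

 ∣+∣ : ∀ x y → ∣ x + y ∣ ≤ ∣ x ∣ + ∣ y ∣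
 ∣+∣ x y = ∣∣-≤ (lin 4 (λ x y a b → x :≤ a ∷ y :≤ b ⊢ x :+ y :≤ a :+ b) (x≤∣x∣ x) (x≤∣x∣ y))
   (lin 4 (λ x y a b → :- x :≤ a ∷ :- y :≤ b ⊢ :- (x :+ y) :≤ a :+ b) (-x≤∣x∣ x) (-x≤∣x∣ y))

 ∣*∣ : ∀ x y → ∣ x * y ∣ ≈ ∣ x ∣ * ∣ y ∣
 ∣*∣ x y = by-cases (0# ≤ x) (λ 0≤x → by-cases (0# ≤ y) (λ 0≤y → trans (∣∣-pos (*-nonneg 0≤x 0≤y))
       (sym (*-cong (∣∣-pos 0≤x) (∣∣-pos 0≤y))))
     (λ 0≰y → trans (∣∣-neg (lin 2 (λ x y → :0 :≤ x :* (:- y) ⊢ x :* y :≤ :0) (*-nonneg 0≤x (flip′ 0≰y))))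
       (trans (lin 2 (λ x y → ⊢ :- (x :* y) :≈ x :* (:- y)))
         (sym (*-cong (∣∣-pos 0≤x) (∣∣-neg (inj₁ (≰⇒> 0≰y))))))))
   (λ 0≰x → by-cases (0# ≤ y) (λ 0≤y → trans (∣∣-neg (lin 2 (λ x y → :0 :≤ (:- x) :* y ⊢ x :* y :≤ :0)
         (*-nonneg (flip′ 0≰x) 0≤y)))
       (trans (lin 2 (λ x y → ⊢ :- (x :* y) :≈ (:- x) :* y))
         (sym (*-cong (∣∣-neg (inj₁ (≰⇒> 0≰x))) (∣∣-pos 0≤y)))))
     (λ 0≰y → trans (∣∣-pos (lin 2 (λ x y → :0 :≤ (:- x) :* (:- y) ⊢ :0 :≤ x :* y)
         (*-nonneg (flip′ 0≰x) (flip′ 0≰y))))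
       (trans (lin 2 (λ x y → ⊢ x :* y :≈ (:- x) :* (:- y)))
         (sym (*-cong (∣∣-neg (inj₁ (≰⇒> 0≰x))) (∣∣-neg (inj₁ (≰⇒> 0≰y))))))))
   where
   flip′ : ∀ {x} → ¬ (0# ≤ x) → 0# ≤ - x
   flip′ h = lin 1 (λ x → x :< :0 ⊢ :0 :≤ :- x) (≰⇒> h)

 *-monoʳ-≤ : ∀ {x y z} → 0# ≤ z → x ≤ y → x * z ≤ y * z
 *-monoʳ-≤ {x} {y} {z} 0≤z x≤y = ≤-trans (inj₂ (*-comm x z))
   (≤-trans (*-monoˡ-≤ 0≤z x≤y) (inj₂ (*-comm z y)))

 HasDeriv-cong : ∀ {g g′ t t′ p p′} → (∀ v → g v ≈ g′ v) → g t ≈ g′ t′ → t ≈ t′ →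
                 p ≈ p′ → HasDeriv g t p → HasDeriv g′ t′ p′
 HasDeriv-cong {g} {g′} {t} {t′} e eₜ t≈t′ p≈p′ h ε 0<ε =
   let δ , 0<δ , k = h ε 0<ε in δ , 0<δ , λ v v∈ →
     let d : v - t ≈ v - t′
         d = +-congˡ (-‿cong t≈t′)
         m = k v (<-respˡ (∣∣-cong (sym d)) v∈)
     in ≤-trans (inj₂ (∣∣-cong (sym (+-cong (+-cong (e v) (-‿cong eₜ)) (-‿cong (*-cong p≈p′ d))))))
       (≤-trans m (inj₂ (*-congˡ (∣∣-cong d))))

 slope-≤ : ∀ {x p p′ h ε} → 0# < h → ∣ x - p * h ∣ ≤ ε * h → ∣ x - p′ * h ∣ ≤ ε * h → p′ ≤ p + (ε + ε)
 slope-≤ {x} {p} {p′} {h} {ε} 0<h a b = ≮⇒≥ λ lt → ≤⇒≯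
   (lin 5 (λ x p q h ε → x :- p :* h :≤ ε :* h ∷ :- (x :- q :* h) :≤ ε :* h ⊢ h :* q :≤ h :* (p :+ (ε :+ ε)))
     (∣∣≤⇒≤ a) (∣∣≤⇒-≤ b)) (*-monoˡ-< 0<h lt)

 small-increment : ∀ {δ δ′} t → 0# < δ → 0# < δ′ → ∃ λ v → 0# < v - t ×
                   ∣ v - t ∣ ≈ v - t × ∣ v - t ∣ < δ × ∣ v - t ∣ < δ′
 small-increment {δ} {δ′} t 0<δ 0<δ′ =
   let m , m≤δ , m≤δ′ , greatest = smaller δ δ′
       h , 0<h , h<m = between (greatest 0<δ 0<δ′)
       v-t≈h : (t + h) - t ≈ h
       v-t≈h = lin 2 (λ t h → ⊢ (t :+ h) :- t :≈ h)
       0<v-t = <-respʳ (sym v-t≈h) 0<h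
       e = ∣∣-pos (inj₁ 0<v-t)
       lt = <-respˡ (sym (trans e v-t≈h)) h<m
   in t + h , 0<v-t , e , <-≤-trans lt m≤δ , <-≤-trans lt m≤δ′

 HasDeriv-≤ : ∀ {g t p p′} → HasDeriv g t p → HasDeriv g t p′ → p′ ≤ p
 HasDeriv-≤ {g} {t} {p} {p′} h h′ = ≮⇒≥ λ p<p′ →
   let 0<d = lin 2 (λ p q → p :< q ⊢ :0 :< q :- p) p<p′
       ε = half (half (p′ - p))
       0<ε = half-pos (half-pos 0<d)
       δ , 0<δ , k = h ε 0<ε
       δ′ , 0<δ′ , k′ = h′ ε 0<ε
       v , 0<v-t , e , v∈ , v∈′ = small-increment t 0<δ 0<δ′
   in ≤⇒≯ (slope-≤ 0<v-t (≤-trans (k v v∈) (inj₂ (*-congˡ e)))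
                         (≤-trans (k′ v v∈′) (inj₂ (*-congˡ e))))
     (lin 4 (λ p q m ε → m :+ m :≈ q :- p ∷ ε :+ ε :≈ m ∷ :0 :< ε ⊢ p :+ (ε :+ ε) :< q)
       (half+half (p′ - p)) (half+half (half (p′ - p))) 0<ε)

 HasDeriv-unique : ∀ {g t p p′} → HasDeriv g t p → HasDeriv g t p′ → p ≈ p′
 HasDeriv-unique h h′ = ≤-antisym (HasDeriv-≤ h′ h) (HasDeriv-≤ h h′)

 HasDeriv⇒Near₁ : ∀ {g t p q c} → ∣ p - q ∣ < c → HasDeriv g t p → Near₁ g t q c
 HasDeriv⇒Near₁ {g} {t} {p} {q} {c} lt h =
   let δ , 0<δ , k = h (c - ∣ p - q ∣) (lin 2 (λ m c → m :< c ⊢ :0 :< c :- m) lt)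
   in δ , 0<δ , λ v v∈ → ≤-trans
     (≤-trans (inj₂ (∣∣-cong (lin 5 (λ gv gt p q d → ⊢
         (gv :- gt) :- q :* d :≈ ((gv :- gt) :- p :* d) :+ (p :- q) :* d))))
       (∣+∣ _ _))
     (lin 5 (λ a b c m d → a :≤ (c :- m) :* d ∷ b :≈ m :* d ⊢ a :+ b :≤ c :* d)
       (k v v∈) (∣*∣ (p - q) (v - t)))

 mean-value′ : ∀ {g} → Fun₁ g → ∀ {x y q c} → (∀ t → ∣ x - t ∣ ≤ ∣ x - y ∣ → Near₁ g t q c) →
   ∣ (g y - g x) - q * (y - x) ∣ ≤ c * ∣ x - y ∣
 mean-value′ {g} dg {x} {y} {q} {c} near = by-cases (x ≤ y) (λ x≤y →
     let e : ∣ x - y ∣ ≈ y - x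
         e = trans (∣-∣ x y) (∣∣-pos (lin 2 (λ x y → x :≤ y ⊢ :0 :≤ y :- x) x≤y))
     in ≤-trans (mean-value dg x≤y λ t x≤t t≤y → near t (∣∣-≤
         (lin 4 (λ x y t m → x :≤ t ∷ t :≤ y ∷ y :- x :≤ m ⊢ x :- t :≤ m) x≤t t≤y (inj₂ (sym e)))
         (lin 4 (λ x y t m → t :≤ y ∷ y :- x :≤ m ⊢ :- (x :- t) :≤ m)
           t≤y (inj₂ (sym e))))) (inj₂ (*-congˡ (sym e))))
   (λ x≰y →
     let y≤x = inj₁ (≰⇒> x≰y)
         e : ∣ x - y ∣ ≈ x - y
         e = ∣∣-pos (lin 2 (λ x y → y :≤ x ⊢ :0 :≤ x :- y) y≤x)
         m = mean-value dg y≤x λ t y≤t t≤x → near t (∣∣-≤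
           (lin 4 (λ x y t m → y :≤ t ∷ x :- y :≤ m ⊢ x :- t :≤ m) y≤t (inj₂ (sym e)))
           (lin 4 (λ x y t m → y :≤ t ∷ t :≤ x ∷ x :- y :≤ m ⊢ :- (x :- t) :≤ m) y≤t t≤x (inj₂ (sym e))))
     in ∣∣-≤
       (lin 6 (λ gy gx q y x w → :- ((gx :- gy) :- q :* (x :- y)) :≤ w ⊢ (gy :- gx) :- q :* (y :- x) :≤ w)
         (≤-trans (∣∣≤⇒-≤ m) (inj₂ (*-congˡ (sym e)))))
       (lin 6 (λ gy gx q y x w → (gx :- gy) :- q :* (x :- y) :≤ w ⊢ :- ((gy :- gx) :- q :* (y :- x)) :≤ w)
         (≤-trans (∣∣≤⇒≤ m) (inj₂ (*-congˡ (sym e))))))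

 -- Differentiability in several variables

 dot : K^ n → K^ n → Carrier
 dot q x = sum (λ i → q i * x i)

 Near : (K^ n → Carrier) → K^ n → K^ n → Carrier → Set ℓ
 Near f x q c = Nbhd (λ y → ∣ (f y - f x) - dot q (λ i → y i - x i) ∣ ≤ c * dist x y) x

 Lip : (K^ n → Carrier) → Carrier → K^ n → Set ℓ
 Lip f c x = Nbhd (λ y → ∣ f y - f x ∣ ≤ c * dist x y) x

 HasPartial : (K^ n → Carrier) → Fin n → K^ n → Carrier → Set ℓ
 HasPartial f i x p = HasDeriv (λ t → f (x [ i ≔ t ])) (x i) p

 HasPartialᵈ : {f : K^ n → Carrier} → Funⱽ f → ∀ i {v : ⟪ Γ ⟫ → K^ n}
   {p : ⟪ Γ ⟫ → Carrier} → DefV v → DefF p → Def (λ ρ → HasPartial f i (v ρ) (p ρ))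
 HasPartialᵈ df i dv dp = HasDerivᵈ (appⱽ df (updᵈ (wkᵛ dv) i s₀)) (appⱽ df (updᵈ dv i (dv i))) (dv i) dp

 constant⇒HasDeriv : ∀ {g a b c t} → a < t → t < b → All⟨ a , b ⟩ (λ v → g v ≈ c) → HasDeriv g t 0#
 constant⇒HasDeriv {a = a} {b} {t = t} a<t t<b h ε 0<ε =
   let δ , 0<δ , δ≤ , δ≤′ = positive-minimum
         (lin 2 (λ t u → u :< t ⊢ :0 :< t :- u) a<t)
         (lin 2 (λ t v → t :< v ⊢ :0 :< v :- t) t<b)
   in δ , 0<δ , λ w w∈ → ≤-trans
     (inj₂ (∣∣-zero (lin 4 (λ a b c d → a :≈ c ∷ b :≈ c ⊢ (a :- b) :- :0 :* d :≈ :0)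
       (h w (lin 5 (λ m δ w t u → m :< δ ∷ δ :≤ t :- u ∷ :- (w :- t) :≤ m ⊢ u :< w) w∈ δ≤ (-x≤∣x∣ (w - t)))
            (lin 5 (λ m δ w t v → m :< δ ∷ δ :≤ v :- t ∷ w :- t :≤ m ⊢ w :< v) w∈ δ≤′ (x≤∣x∣ (w - t))))
       (h t a<t t<b))))
     (*-nonneg (inj₁ 0<ε) (0≤∣ _ ∣))

 constant⇒HasPartial : ∀ {f : K^ n → Carrier} → Funⱽ f → ∀ i x {a b c t} → a < t → t < b →
   All⟨ a , b ⟩ (λ v → f (x [ i ≔ v ]) ≈ c) → HasPartial f i (x [ i ≔ t ]) 0#
 constant⇒HasPartial df i x a<t t<b h = HasDeriv-cong (λ v → congⱽ df (≋-sym (upd-upd x i)))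
   (congⱽ df (≋-trans (upd-cong i ≋-refl (sym (upd-same x i))) (≋-sym (upd-upd x i))))
   (sym (upd-same x i)) refl (constant⇒HasDeriv a<t t<b h)

 Differentiable : (K^ n → Carrier) → Fin n → K^ n → Set ℓ
 Differentiable f i x = ∃ (HasPartial f i x)

 ∀*ⁿ-differentiable : {f : K^ n → Carrier} → Funⱽ f → ∀ i → ∀*ⁿ (Differentiable f i)
 ∀*ⁿ-differentiable {n = n} {f = f} df i = ∀*ⁿ-update⁻ (∃ᵈ (HasPartialᵈ df i v₁ s₀)) i
   (∀*ⁿ-all λ x → ∀*-map (λ t (p , h) → p , HasDeriv-cong (λ v → congⱽ df (≋-sym (upd-upd x i)))
       (congⱽ df (≋-sym (upd-self (x [ i ≔ t ]) i refl)))
       (sym (upd-same x i)) refl h)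
     (∀*-differentiable (appⱽ df (updᵈ (λ j → constᵈ) i s₀))))

 module _ (f : DFun n) (i : Fin n) where

   PartialOr0 : K^ n → Carrier → Set ℓ
   PartialOr0 x p = HasPartial (fn f) i x p ⊎ ¬ Differentiable (fn f) i x × p ≈ 0#

   ∂′ : K^ n → Carrier
   ∂′ x = by-cases (Differentiable (fn f) i x) proj₁ (λ _ → 0#)

   ∂′-spec : ∀ x → PartialOr0 x (∂′ x)
   ∂′-spec x with em {P = Differentiable (fn f) i x}
   ... | yes (p , h) = inj₁ h
   ... | no ¬d = inj₂ (¬d , refl)

   PartialOr0-unique : ∀ x {p q} → PartialOr0 x p → PartialOr0 x q → p ≈ q
   PartialOr0-unique x (inj₁ h) (inj₁ k) = HasDeriv-unique h k
   PartialOr0-unique x (inj₁ h) (inj₂ (¬d , _)) = ⊥-elim (¬d (_ , h))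
   PartialOr0-unique x (inj₂ (¬d , _)) (inj₁ h) = ⊥-elim (¬d (_ , h))
   PartialOr0-unique x (inj₂ (_ , e)) (inj₂ (_ , e′)) = trans e (sym e′)

 opaque
   ∂ : DFun n → Fin n → DFun n
   ∂ f i = dfun (∂′ f i) (uniqueᵈ (HasPartialᵈ (fnᵈ f) i v₁ s₀ ⊎ᵈ
       ¬ᵈ (∃ᵈ (HasPartialᵈ (fnᵈ f) i v₂ s₀)) ×ᵈ s₀ ≈ᵈ constᵈ)
     (λ ρ → ∂′-spec f i (proj₂ ρ)) (λ ρ → PartialOr0-unique f i (proj₂ ρ)))

   ∂-spec : ∀ (f : DFun n) i {x} → Differentiable (fn f) i x → HasPartial (fn f) i x (fn (∂ f i) x)
   ∂-spec f i {x} d = [ id , (λ (¬d , _) → ⊥-elim (¬d d)) ]′ (∂′-spec f i x)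

   ∂-default : ∀ (f : DFun n) i {x} → ¬ Differentiable (fn f) i x → fn (∂ f i) x ≈ 0#
   ∂-default f i {x} ¬d = [ (λ h → ⊥-elim (¬d (_ , h))) , proj₂ ]′ (∂′-spec f i x)

 C¹At : DFun n → K^ n → Set ℓ
 C¹At f x = ∀ i → Differentiable (fn f) i x × ContinuousAt (fn (∂ f i)) x

 C¹Atᵈ : (f : DFun n) → Defⱽ (C¹At f)
 C¹Atᵈ f = ∀Finᵈ λ i → ∃ᵈ (HasPartialᵈ (fnᵈ f) i v₁ s₀) ×ᵈ ContinuousAtᵈ (fnᵈ (∂ f i))

 Regular : DFun n → K^ n → Set ℓ
 Regular f = Nbhd (C¹At f)

 Regularᵈ : (f : DFun n) → Defⱽ (Regular f)
 Regularᵈ f = Nbhdᵈ {P = λ _ → C¹At f} (atⱽ (C¹Atᵈ f) v₀) v₀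

 ∀*ⁿ-Fin : ∀ {m} {P : Fin m → K^ n → Set a} → (∀ i → Defⱽ (P i)) →
           (∀ i → ∀*ⁿ (P i)) → ∀*ⁿ (λ x → ∀ i → P i x)
 ∀*ⁿ-Fin {m = zero} dP h = ∀*ⁿ-all λ x ()
 ∀*ⁿ-Fin {m = suc m} dP h = ∀*ⁿ-map₂ (dP zero)
   (λ x p q → λ { zero → p ; (suc i) → q i }) (h zero) (∀*ⁿ-Fin (dP ∘ suc) (h ∘ suc))

 ∀*ⁿ-regular : (f : DFun n) → ∀*ⁿ (Regular f)
 ∀*ⁿ-regular f = ∀*ⁿ-map₂ (C¹Atᵈ f) (λ x p h → h p)
   (∀*ⁿ-Fin (λ i → ∃ᵈ (HasPartialᵈ (fnᵈ f) i v₁ s₀) ×ᵈ ContinuousAtᵈ (fnᵈ (∂ f i)))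
     (λ i → ∀*ⁿ-× (∃ᵈ (HasPartialᵈ (fnᵈ f) i v₁ s₀))
       (∀*ⁿ-differentiable (fnᵈ f) i) (∀*ⁿ-continuous (fnᵈ (∂ f i)))))
   (∀*ⁿ-interior (C¹Atᵈ f))

 Nbhd-Fin : ∀ {m} {P : Fin m → K^ n → Set a} {x} → (∀ i → Nbhd (P i) x) → Nbhd (λ y → ∀ i → P i y) x
 Nbhd-Fin {m = zero} h = 1# , 0<1 , λ y _ ()
 Nbhd-Fin {m = suc m} h = Nbhd-map (λ y (p , q) → λ { zero → p ; (suc i) → q i })
   (Nbhd-× (h zero) (Nbhd-Fin (h ∘ suc)))

 -- The coordinates are moved one at a time. Every intermediate point stays in the ball, and the
 -- mean value theorem applies with a slope within `ε` of `q i`.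
 increment : ∀ {f : K^ n → Carrier} → Funⱽ f → ∀ {x q ε δ} →
   (∀ z → dist x z < δ → ∀ i → ∃ λ p → HasPartial f i z p × ∣ p - q i ∣ < ε) →
   ∀ y → dist x y < δ →
   ∣ (f y - f x) - dot q (λ i → y i - x i) ∣ ≤ ε * dist x y
 increment {n = zero} {f} df {x} {ε = ε} h y y∈ = inj₂ (trans
   (∣∣-zero (lin 2 (λ fy fx → fy :≈ fx ⊢ (fy :- fx) :- :0 :≈ :0) (congⱽ df {y} {x} (λ ()))))
   (sym (trans (*-congˡ (dist-[] x y)) (zeroʳ ε))))
 increment {n = suc n} {f} df {x} {q} {ε} {δ} h y y∈ = ≤-trans (≤-trans (inj₂ (∣∣-cong split)) (∣+∣ _ _))
     (lin 6 (λ a b ε d e m → a :≤ ε :* d ∷ b :≤ ε :* e ∷ ε :* m :≈ ε :* (d :+ e) ⊢ a :+ b :≤ ε :* m)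
       first second (*-congˡ (dist-∷ x y)))
   where
   x₀ = x zero
   y₀ = y zero
   x′ y′ : K^ n
   x′ = x ∘ suc
   y′ = y ∘ suc
   g : Carrier → Carrier
   g t = f (t Vector.∷ y′)
   f′ : K^ n → Carrier
   f′ z = f (x₀ Vector.∷ z)
   split : (f y - f x) - (q zero * (y₀ - x₀) + dot (q ∘ suc) (λ i → y′ i - x′ i)) ≈
           ((g y₀ - g x₀) - q zero * (y₀ - x₀)) +
           ((f′ y′ - f′ x′) - dot (q ∘ suc) (λ i → y′ i - x′ i))
   split = lin 7 (λ fy fx gy gx fx′ a b → fy :≈ gy ∷ fx :≈ fx′ ⊢
       (fy :- fx) :- (a :+ b) :≈ ((gy :- gx) :- a) :+ ((gx :- fx′) :- b))
     (congⱽ df (≋-sym (∷-η y))) (congⱽ df (≋-sym (∷-η x)))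
   dist-x-∷ : ∀ t z → dist x (t Vector.∷ z) ≈ ∣ x₀ - t ∣ + dist x′ z
   dist-x-∷ t z = dist-∷ x (t Vector.∷ z)
   first : ∣ (g y₀ - g x₀) - q zero * (y₀ - x₀) ∣ ≤ ε * ∣ x₀ - y₀ ∣
   first = mean-value′ (appⱽ df (consᵈ s₀ λ i → constᵈ)) λ t t∈ →
     let p , hp , p≈q = h (t Vector.∷ y′)
           (lin 6 (λ d a b e m δ → d :≈ a :+ b ∷ a :≤ e ∷ m :≈ e :+ b ∷ m :< δ ⊢ d :< δ)
             (dist-x-∷ t y′) t∈ (dist-∷ x y) y∈) zero
     in HasDeriv⇒Near₁ p≈q (HasDeriv-cong
       (λ v → congⱽ df λ { zero → refl ; (suc i) → refl })
       (congⱽ df λ { zero → refl ; (suc i) → refl }) refl refl hp)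
   second : ∣ (f′ y′ - f′ x′) - dot (q ∘ suc) (λ i → y′ i - x′ i) ∣ ≤ ε * dist x′ y′
   second = increment (appⱽ df (consᵈ constᵈ v₀)) {δ = δ}
     (λ z z∈ i → let p , hp , p≈q = h (x₀ Vector.∷ z)
                       (<-respˡ (sym (trans (dist-x-∷ x₀ z)
                         (trans (+-congʳ (∣∣-zero (-‿inverseʳ x₀))) (+-identityˡ _)))) z∈) (suc i)
       in p , HasDeriv-cong
         (λ v → congⱽ df λ { zero → refl ; (suc i) → refl })
         (congⱽ df λ { zero → refl ; (suc i) → refl }) refl refl hp , p≈q)
     y′ (lin 4 (λ m e b δ → m :≈ e :+ b ∷ :0 :≤ e ∷ m :< δ ⊢ b :< δ) (dist-∷ x y) (0≤∣ x₀ - y₀ ∣) y∈)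

 gradient : DFun n → K^ n → K^ n
 gradient f x i = fn (∂ f i) x

 regular⇒near : ∀ (f : DFun n) {x} → Regular f x → ∀ ε → 0# < ε → Near (fn f) x (gradient f x) ε
 regular⇒near f {x} r ε 0<ε =
   let δ , 0<δ , h = Nbhd-× r (Nbhd-Fin λ i → proj₂ (Nbhd-centre r i) ε 0<ε) in
   δ , 0<δ , increment (fnᵈ f) {q = gradient f x} λ z z∈ i →
     let c , k = h z z∈ in
     _ , ∂-spec f i (proj₁ (c i)) , <-respˡ (∣-∣ _ _) (k i)

 dot-bound : ∀ {q x y : K^ n} {B} → (∀ i → ∣ q i ∣ ≤ B) → ∣ dot q (λ i → y i - x i) ∣ ≤ B * dist x y
 dot-bound {n = zero} {x = x} {y} {B} h = inj₂ (trans ∣0∣ (sym (trans (*-congˡ (dist-[] x y)) (zeroʳ B))))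
 dot-bound {n = suc n} {q} {x} {y} {B} h = ≤-trans (∣+∣ _ _)
   (lin 6 (λ a b d e m B → a :≤ B :* d ∷ b :≤ B :* e ∷ B :* m :≈ B :* (d :+ e) ⊢ a :+ b :≤ B :* m)
     (≤-trans (inj₂ (trans (∣*∣ _ _) (*-congˡ (∣-∣ (y zero) (x zero)))))
       (*-monoʳ-≤ (0≤∣ x zero - y zero ∣) (h zero)))
     (dot-bound {q = q ∘ suc} {x ∘ suc} {y ∘ suc} (h ∘ suc)) (*-congˡ (dist-∷ x y)))

 near⇒lip : ∀ {f : K^ n → Carrier} {x q c B} → (∀ i → ∣ q i ∣ ≤ B) → Near f x q c → Lip f (B + c) x
 near⇒lip {x = x} {q} h = Nbhd-map λ y k → ≤-trans
   (≤-trans (inj₂ (∣∣-cong (lin 3 (λ a b c → ⊢ a :- b :≈ ((a :- b) :- c) :+ c)))) (∣+∣ _ _))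
   (lin 5 (λ a b c B d → a :≤ c :* d ∷ b :≤ B :* d ⊢ a :+ b :≤ (B :+ c) :* d)
     k (dot-bound {q = q} {x} {y} h))

 lip⇒partial : ∀ {f : K^ n → Carrier} → Funⱽ f → ∀ {x c i p} → Lip f c x → HasPartial f i x p → ∣ p ∣ ≤ c
 lip⇒partial {f = f} df {x} {c} {i} {p} (δ , 0<δ , h) hp = ≮⇒≥ λ c<∣p∣ →
   let ε = half (∣ p ∣ - c)
       0<d = lin 2 (λ p c → c :< p ⊢ :0 :< p :- c) c<∣p∣
       δ′ , 0<δ′ , k = hp ε (half-pos 0<d)
       v , 0<w , e , v∈ , v∈′ = small-increment (x i) 0<δ 0<δ′
       w = v - x i
       d : dist x (x [ i ≔ v ]) ≈ w
       d = trans (dist-cong (≋-sym (upd-self x i refl)) ≋-refl)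
         (trans (dist-upd x i (x i) v) (trans (∣-∣ _ _) e))
       A = f (x [ i ≔ v ]) - f (x [ i ≔ x i ])
       bound₁ : ∣ A ∣ ≤ c * w
       bound₁ = ≤-trans (inj₂ (∣∣-cong (+-congˡ (-‿cong (congⱽ df (upd-self x i refl))))))
         (≤-trans (h (x [ i ≔ v ]) (<-respˡ (trans e (sym d)) v∈)) (inj₂ (*-congˡ d)))
       bound₂ : ∣ p ∣ * w ≤ (c + ε) * w
       bound₂ = ≤-trans (inj₂ (trans (*-congˡ (sym e)) (sym (∣*∣ p w))))
         (≤-trans (≤-trans (inj₂ (∣∣-cong (lin 2 (λ A b → ⊢ b :≈ A :+ (:- (A :- b)))))) (∣+∣ A _))
         (lin 5 (λ A B c ε w → A :≤ c :* w ∷ B :≤ ε :* w ⊢ A :+ B :≤ (c :+ ε) :* w)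
           bound₁ (≤-trans (∣∣-≤ (-x≤∣x∣ _) (≤-trans (lin 1 (λ x → ⊢ :- (:- x) :≤ x)) (x≤∣x∣ _)))
             (≤-trans (k v v∈′) (inj₂ (*-congˡ e))))))
   in ≤⇒≯ bound₂ (lin 4 (λ p c w ε → w :* (c :+ ε) :< w :* p ⊢ (c :+ ε) :* w :< p :* w)
        (*-monoˡ-< 0<w (lin 3 (λ p c ε → ε :+ ε :≈ p :- c ∷ c :< p ⊢ c :+ ε :< p)
          (half+half (∣ p ∣ - c)) c<∣p∣)))

 Lip-weaken : ∀ {f : K^ n → Carrier} {x c c′} → c ≤ c′ → Lip f c x → Lip f c′ x
 Lip-weaken {x = x} c≤c′ = Nbhd-map λ y k → ≤-trans k (*-monoʳ-≤ (0≤dist x y) c≤c′)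

 -- Dependence on some of the coordinates

 record Agree {n r} (J : Fin r → Fin n) (x y : K^ n) : Set ℓ where
   constructor agree
   field
     on : ∀ k → x (J k) ≈ y (J k)
 open Agree public

 DependsF : ∀ {r} → (Fin r → Fin n) → (K^ n → Carrier) → Set ℓ
 DependsF J f = ∀ {x y} → Agree J x y → f x ≈ f y

 DependsP : ∀ {r} → (Fin r → Fin n) → (K^ n → Set a) → Set (ℓ ⊔ a)
 DependsP J P = ∀ {x y} → Agree J x y → P x → P y

 Agree-sym : ∀ {r} {J : Fin r → Fin n} {x y} → Agree J x y → Agree J y x
 Agree-sym e = agree λ k → sym (on e k)

 Agree-upd : ∀ {r} {J : Fin r → Fin n} {j} → (∀ k → J k ≢ j) → ∀ x {t} → Agree J (x [ j ≔ t ]) x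
 Agree-upd j∉J x = agree λ k → upd-other x (j∉J k)

 -- Cells in K^ n, over some of the coordinates

 Side : ℕ → Set (s ⊔ ℓ)
 Side n = Maybe (DFun n)

 -- The coordinate added last comes first in the list.
 data Cell {n : ℕ} : ∀ {r} → Vec (Fin n) r → Set (s ⊔ ℓ) where
   whole : Cell []
   band : ∀ {r j} {js : Vec (Fin n) r} → Cell js → Side n → Side n → Cell (j ∷ js)

 OverSide UnderSide : Side n → K^ n → Carrier → Set ℓ
 OverSide nothing x t = ⊤
 OverSide (just f) x t = fn f x < t
 UnderSide nothing x t = ⊤
 UnderSide (just g) x t = t < fn g x

 SidesOrdered : Side n → Side n → K^ n → Set ℓ
 SidesOrdered (just f) (just g) x = fn f x < fn g x
 SidesOrdered _ _ x = ⊤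

 _∈ᶜ_ : ∀ {r} {js : Vec (Fin n) r} → K^ n → Cell js → Set ℓ
 x ∈ᶜ whole = ⊤
 x ∈ᶜ band {j = j} C f g = x ∈ᶜ C × OverSide f x (x j) × UnderSide g x (x j)

 Good : Carrier → DFun n → K^ n → Set ℓ
 Good B f x = Regular f x × (∀ i → ∣ fn (∂ f i) x ∣ ≤ B)

 Goodᵈ : ∀ B (f : DFun n) → Defⱽ (Good B f)
 Goodᵈ B f = Regularᵈ f ×ᵈ ∀Finᵈ λ i → ∣ fnᵈ (∂ f i) ∣ᵈ ≤ᵈ constᵈ

 data GoodSide {n r} (B : Carrier) (js : Vec (Fin n) r) (C : Cell js) :
               Side n → Set (s ⊔ ℓ) where
   none : GoodSide B js C nothing
   some : ∀ {f} → DependsF (lookup js) (fn f) → (∀ x → x ∈ᶜ C → Good B f x) → GoodSide B js C (just f)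

 data Valid {n} (B : Carrier) : ∀ {r} {js : Vec (Fin n) r} → Cell js → Set (s ⊔ ℓ) where
   whole : Valid B whole
   band : ∀ {r j} {js : Vec (Fin n) r} {C : Cell js} {f g} → Valid B C →
           (∀ k → lookup js k ≢ j) → GoodSide B js C f → GoodSide B js C g →
           (∀ x → x ∈ᶜ C → SidesOrdered f g x) → Valid B (band {j = j} C f g)

 overᵈ : ∀ f {t : ⟪ Γ ⟫ → Carrier} {v : ⟪ Γ ⟫ → K^ n} → DefV v → DefF t → Def (λ ρ → OverSide f (v ρ) (t ρ))
 overᵈ nothing dv dt = fullᵈ (λ _ → tt)
 overᵈ (just f) dv dt = appⱽ (fnᵈ f) dv <ᵈ dt

 underᵈ : ∀ f {t : ⟪ Γ ⟫ → Carrier} {v : ⟪ Γ ⟫ → K^ n} → DefV v → DefF t →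
         Def (λ ρ → UnderSide f (v ρ) (t ρ))
 underᵈ nothing dv dt = fullᵈ (λ _ → tt)
 underᵈ (just f) dv dt = dt <ᵈ appⱽ (fnᵈ f) dv

 ∈ᶜᵈ : ∀ {r} {js : Vec (Fin n) r} (C : Cell js) → Defⱽ (_∈ᶜ C)
 ∈ᶜᵈ whole = fullᵈ (λ _ → tt)
 ∈ᶜᵈ (band {j = j} C f g) = ∈ᶜᵈ C ×ᵈ overᵈ f v₀ (v₀ j) ×ᵈ underᵈ g v₀ (v₀ j)

 over-resp : ∀ {r B} {js : Vec (Fin n) r} {C : Cell js} {f} → GoodSide B js C f →
             ∀ {x y t u} → Agree (lookup js) x y → t ≈ u → OverSide f x t → OverSide f y u
 over-resp none e t≈u p = tt
 over-resp (some d _) e t≈u p = <-respʳ t≈u (<-respˡ (d e) p)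

 under-resp : ∀ {r B} {js : Vec (Fin n) r} {C : Cell js} {f} → GoodSide B js C f →
              ∀ {x y t u} → Agree (lookup js) x y → t ≈ u → UnderSide f x t → UnderSide f y u
 under-resp none e t≈u p = tt
 under-resp (some d _) e t≈u p = <-respˡ t≈u (<-respʳ (d e) p)

 ∈ᶜ-depends : ∀ {r B} {js : Vec (Fin n) r} {C : Cell js} → Valid B C → DependsP (lookup js) (_∈ᶜ C)
 ∈ᶜ-depends whole e _ = tt
 ∈ᶜ-depends (band v _ gf gg _) e (p , q , r) = ∈ᶜ-depends v (agree (on e ∘ suc)) p ,
   over-resp gf (agree (on e ∘ suc)) (on e zero) q ,
   under-resp gg (agree (on e ∘ suc)) (on e zero) r

 good⇒lip : ∀ {B} {f : DFun n} {x} → Good B f x → Lip (fn f) (B + 1#) x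
 good⇒lip {f = f} {x} (r , b) = near⇒lip {q = gradient f x} b (regular⇒near f r 1# 0<1)

 -- Functions with bounded slopes on a cell are Lipschitz

 scaled : ∀ {δ K} → 0# < δ → 0# ≤ K → ∃ λ δ′ → 0# < δ′ × δ′ + K * δ′ ≤ δ
 scaled {δ} {K} 0<δ 0≤K =
   let k , 0<k , e = inverse {1# + K} (lin 1 (λ K → :0 :≤ K ∷ :0 :< :1 ⊢ :0 :< :1 :+ K) 0≤K 0<1)
   in δ * k , *-pos 0<δ 0<k ,
      lin 3 (λ δ k K → δ :* ((:1 :+ K) :* k) :≈ δ :* :1 ⊢ δ :* k :+ K :* (δ :* k) :≤ δ) (*-congˡ e)

 lip-substitute : ∀ {F h : K^ n → Carrier} {c K j x} → 0# ≤ c → 0# ≤ K →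
   Lip h K x → Lip F c (x [ j ≔ h x ]) → Lip (λ z → F (z [ j ≔ h z ])) (c * (1# + K)) x
 lip-substitute {F = F} {h} {c} {K} {j} {x} 0≤c 0≤K (δ , 0<δ , p) (δ′ , 0<δ′ , q) =
   let η , 0<η , η≤ = scaled 0<δ′ 0≤K
       m , 0<m , m≤δ , m≤η = positive-minimum 0<δ 0<η
   in m , 0<m , λ y y∈ →
     let hp = p y (<-≤-trans y∈ m≤δ)
         moved = ≤-trans (dist-upd≤ x y j (h x) (h y))
           (lin 4 (λ d m K e → m :≤ K :* d ∷ e :≈ m ⊢ d :+ e :≤ d :+ K :* d) hp (∣-∣ (h x) (h y)))
         Kd = *-monoˡ-≤ 0≤K (inj₁ (<-≤-trans y∈ m≤η))
         k = q (y [ j ≔ h y ]) (lin 6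
           (λ w d K m η δ → w :≤ d :+ K :* d ∷ d :< m ∷ m :≤ η ∷ K :* d :≤ K :* η ∷ η :+ K :* η :≤ δ ⊢ w :< δ)
           moved y∈ m≤η Kd η≤)
     in ≤-trans k (lin 4 (λ w d K c → c :* w :≤ c :* (d :+ K :* d) ⊢ c :* w :≤ c :* (:1 :+ K) :* d)
          (*-monoˡ-≤ 0≤c moved))

 lip⇒near₁ : ∀ {F : K^ n → Carrier} → Funⱽ F → ∀ {c j} x → 0# ≤ c → Lip F c x →
             Near₁ (λ t → F (x [ j ≔ t ])) (x j) 0# c
 lip⇒near₁ {F = F} dF {c} {j} x 0≤c (δ , 0<δ , h) = δ , 0<δ , λ v v∈ →
   let e : dist x (x [ j ≔ v ]) ≈ ∣ v - x j ∣
       e = trans (dist-cong (≋-sym (upd-self x j refl)) ≋-refl) (trans (dist-upd x j (x j) v) (∣-∣ _ _))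
   in ≤-trans (inj₂ (∣∣-cong (lin 4 (λ fv fx fx′ d → fx :≈ fx′ ⊢
         (fv :- fx) :- :0 :* d :≈ fv :- fx′) (congⱽ dF (upd-self x j refl)))))
     (≤-trans (h (x [ j ≔ v ]) (<-respˡ (sym e) v∈)) (inj₂ (*-congˡ e)))

 -- Through every point of a band passes the graph of a function with
 -- bounded slopes between the two sides.
 record Section {r} {js : Vec (Fin n) r} (C : Cell js) (f g : Side n) (K : Carrier)
                (x : K^ n) (t : Carrier) : Set (s ⊔ ℓ) where
   field
     section : DFun n
     depends : DependsF (lookup js) (fn section)
     lip : ∀ z → z ∈ᶜ C → Lip (fn section) K z
     over : ∀ z → z ∈ᶜ C → OverSide f z (fn section z)
     under : ∀ z → z ∈ᶜ C → UnderSide g z (fn section z)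
     through : fn section x ≈ t

 module _ {n r} {js : Vec (Fin n) r} {C : Cell js} {B : Carrier} (0≤B : 0# ≤ B) where

   translate : DFun n → Carrier → DFun n
   translate f c = dfun (λ z → fn f z + c) (fnᵈ f +ᵈ constᵈ)

   translate-lip : ∀ {f c K z} → Lip (fn f) K z → Lip (fn (translate f c)) K z
   translate-lip = Nbhd-map λ y h →
     ≤-trans (inj₂ (∣∣-cong (lin 3 (λ a b c → ⊢ (a :+ c) :- (b :+ c) :≈ a :- b)))) h

   mix : Carrier → DFun n → DFun n → DFun n
   mix μ f g = dfun (λ z → fn f z + μ * (fn g z - fn f z)) (fnᵈ f +ᵈ (constᵈ *ᵈ (fnᵈ g -ᵈ fnᵈ f)))

   mix-lip : ∀ {f g μ K z} → 0# ≤ μ → μ ≤ 1# → Lip (fn f) K z → Lip (fn g) K z → Lip (fn (mix μ f g)) K z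
   mix-lip {f} {g} {μ} {K} {z} 0≤μ μ≤1 p q = Nbhd-map (λ y (a , b) →
     ≤-trans (≤-trans (inj₂ (∣∣-cong (lin 5 (λ fy fz gy gz μ → ⊢
         (fy :+ μ :* (gy :- fy)) :- (fz :+ μ :* (gz :- fz)) :≈
         (:1 :- μ) :* (fy :- fz) :+ μ :* (gy :- gz)))))
       (∣+∣ _ _))
     (lin 8 (λ A B a b μ K d m → A :≈ m :* a ∷ B :≈ μ :* b ∷ m :* a :≤ m :* (K :* d) ∷
           μ :* b :≤ μ :* (K :* d) ∷ m :* (K :* d) :≈ (:1 :- μ) :* (K :* d) ⊢ A :+ B :≤ K :* d)
       (trans (∣*∣ _ _) (*-congʳ (∣∣-pos 0≤1-μ)))
       (trans (∣*∣ _ _) (*-congʳ (∣∣-pos 0≤μ)))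
       (*-monoˡ-≤ 0≤1-μ a) (*-monoˡ-≤ 0≤μ b) refl)) (Nbhd-× p q)
     where
     0≤1-μ : 0# ≤ 1# - μ
     0≤1-μ = lin 1 (λ μ → μ :≤ :1 ⊢ :0 :≤ :1 :- μ) μ≤1

   -- Without sides a constant, with one side a translate of it, with two sides the convex
   -- combination in the ratio in which `t` divides the fibre over `x`. Convexity keeps the
   -- Lipschitz constant of the sides.
   sections : ∀ {f g} → GoodSide B js C f → GoodSide B js C g →
     (∀ x → x ∈ᶜ C → SidesOrdered f g x) → ∀ {x t} → x ∈ᶜ C →
     OverSide f x t → UnderSide g x t → Section C f g (B + 1#) x t
   sections none none _ {x} {t} _ _ _ = record
     { section = dfun (λ _ → t) constᵈ ; depends = λ _ → refl
     ; lip = λ z _ → 1# , 0<1 , λ y _ → ≤-trans (inj₂ (∣∣-zero (-‿inverseʳ t)))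
         (*-nonneg (lin 1 (λ B → :0 :≤ B ∷ :0 :< :1 ⊢ :0 :≤ B :+ :1) 0≤B 0<1) (0≤dist z y))
     ; over = λ _ _ → tt ; under = λ _ _ → tt ; through = refl }
   sections (some {f} d h) none _ {x} {t} x∈ f<t _ = record
     { section = translate f (t - fn f x)
     ; depends = λ e → +-congʳ (d e)
     ; lip = λ z z∈ → translate-lip {f = f} (good⇒lip (h z z∈))
     ; over = λ z _ → lin 3 (λ fz fx t → fx :< t ⊢ fz :< fz :+ (t :- fx)) f<t
     ; under = λ _ _ → tt
     ; through = lin 2 (λ fx t → ⊢ fx :+ (t :- fx) :≈ t) }
   sections none (some {g} d h) _ {x} {t} x∈ _ t<g = record
     { section = translate g (t - fn g x)
     ; depends = λ e → +-congʳ (d e)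
     ; lip = λ z z∈ → translate-lip {f = g} (good⇒lip (h z z∈))
     ; over = λ _ _ → tt
     ; under = λ z _ → lin 3 (λ gz gx t → t :< gx ⊢ gz :+ (t :- gx) :< gz) t<g
     ; through = lin 2 (λ gx t → ⊢ gx :+ (t :- gx) :≈ t) }
   sections (some {f} d h) (some {g} d′ h′) f<g {x} {t} x∈ f<t t<g =
     let k , 0<k , e = inverse {fn g x - fn f x}
           (lin 2 (λ f g → f :< g ⊢ :0 :< g :- f) (f<g x x∈))
         μ = (t - fn f x) * k
         0<μ = *-pos (lin 2 (λ f t → f :< t ⊢ :0 :< t :- f) f<t) 0<k
         μ<1 = lin 5 (λ f g t k z → k :* (t :- f) :< k :* (g :- f) ∷ (g :- f) :* k :≈ :1 ⊢
             (t :- f) :* k :< :1)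
           {ρ = fn f x , fn g x , t , k , 0# , tt}
           (*-monoˡ-< 0<k (lin 3 (λ f g t → t :< g ⊢ t :- f :< g :- f) t<g)) e
     in record
     { section = mix μ f g
     ; depends = λ e → +-cong (d e) (*-congˡ (+-cong (d′ e) (-‿cong (d e))))
     ; lip = λ z z∈ → mix-lip {f} {g} (inj₁ 0<μ) (inj₁ μ<1) (good⇒lip (h z z∈)) (good⇒lip (h′ z z∈))
     ; over = λ z z∈ → lin 3 (λ f g μ → :0 :< μ :* (g :- f) ⊢ f :< f :+ μ :* (g :- f))
         (*-pos 0<μ (lin 2 (λ f g → f :< g ⊢ :0 :< g :- f) (f<g z z∈)))
     ; under = λ z z∈ → lin 3 (λ f g μ → :0 :< (:1 :- μ) :* (g :- f) ⊢ f :+ μ :* (g :- f) :< g)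
         (*-pos (lin 1 (λ μ → μ :< :1 ⊢ :0 :< :1 :- μ) μ<1)
                (lin 2 (λ f g → f :< g ⊢ :0 :< g :- f) (f<g z z∈)))
     ; through = lin 4 (λ f g t k → (t :- f) :* ((g :- f) :* k) :≈ (t :- f) :* :1 ⊢
         f :+ (t :- f) :* k :* (g :- f) :≈ t) (*-congˡ e) }

 Betw : Carrier → Carrier → Carrier → Set ℓ
 Betw x y t = (x ≤ t × t ≤ y) ⊎ (y ≤ t × t ≤ x)

 between-over : ∀ f {x : K^ n} {t u v} → OverSide f x t → OverSide f x u → Betw t u v → OverSide f x v
 between-over nothing p q h = tt
 between-over (just f) p q (inj₁ (t≤v , _)) = <-≤-trans p t≤v
 between-over (just f) p q (inj₂ (u≤v , _)) = <-≤-trans q u≤v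

 between-under : ∀ f {x : K^ n} {t u v} → UnderSide f x t → UnderSide f x u → Betw t u v → UnderSide f x v
 between-under nothing p q h = tt
 between-under (just f) p q (inj₁ (_ , v≤u)) = ≤-<-trans v≤u q
 between-under (just f) p q (inj₂ (_ , v≤t)) = ≤-<-trans v≤t p

 segment-lip : ∀ {g} → Fun₁ g → ∀ {x y c} → (∀ t → Betw x y t → Near₁ g t 0# c) →
               ∣ g y - g x ∣ ≤ c * ∣ y - x ∣
 segment-lip {g} dg {x} {y} {c} near = by-cases (x ≤ y) (λ x≤y → ≤-trans (≤-trans
     (inj₂ (∣∣-cong (lin 3 (λ a b d → ⊢ a :- b :≈ (a :- b) :- :0 :* d))))
     (mean-value dg x≤y λ t p q → near t (inj₁ (p , q))))
     (inj₂ (*-congˡ (sym (∣∣-pos (lin 2 (λ x y → x :≤ y ⊢ :0 :≤ y :- x) x≤y))))))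
   (λ x≰y →
     let y≤x = inj₁ (≰⇒> x≰y) in
     ≤-trans (≤-trans (inj₂ (trans (∣-∣ _ _) (∣∣-cong (lin 3 (λ a b d → ⊢ a :- b :≈ (a :- b) :- :0 :* d)))))
       (mean-value dg y≤x λ t p q → near t (inj₂ (p , q))))
       (inj₂ (*-congˡ (sym (trans (∣-∣ y x) (∣∣-pos (lin 2 (λ x y → y :≤ x ⊢ :0 :≤ x :- y) y≤x)))))))

 Near₁-cong : ∀ {g g′ t t′ q c} → (∀ v → g v ≈ g′ v) → g t ≈ g′ t′ → t ≈ t′ → Near₁ g t q c → Near₁ g′ t′ q c
 Near₁-cong {g} {g′} {t} {t′} e eₜ t≈t′ (δ , 0<δ , k) = δ , 0<δ , λ v v∈ →
   let d : v - t ≈ v - t′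
       d = +-congˡ (-‿cong t≈t′)
   in ≤-trans (inj₂ (∣∣-cong (sym (+-cong (+-cong (e v) (-‿cong eₜ)) (-‿cong (*-congˡ d))))))
     (≤-trans (k v (<-respˡ (∣∣-cong (sym d)) v∈)) (inj₂ (*-congˡ (∣∣-cong d))))

 Clip : Carrier → ℕ → Carrier
 Clip B zero = 0#
 Clip B (suc r) = Clip B r * (1# + (B + 1#)) + (Clip B r * (B + 1#) + 1#)

 final-estimate : ∀ {a b C c K d e f} → 0# ≤ c → a ≤ C * (c * (1# + K)) * d →
   b ≤ c * e → e ≤ f + d → f ≤ C * K * d → a + b ≤ (C * (1# + K) + (C * K + 1#)) * c * d
 final-estimate {a} {b} {C} {c} {K} {d} {e} {f} 0≤c a≤ b≤ e≤ f≤ = lin 7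
   (λ a b C c K d e → a :≤ C :* (c :* (:1 :+ K)) :* d ∷ b :≤ c :* e ∷ c :* e :≤ c :* (C :* K :* d :+ d) ⊢
       a :+ b :≤ (C :* (:1 :+ K) :+ (C :* K :+ :1)) :* c :* d)
   a≤ b≤ (*-monoˡ-≤ 0≤c (lin 4 (λ e f d m → e :≤ f :+ d ∷ f :≤ m ⊢ e :≤ m :+ d) e≤ f≤))

 -- The path from `x` follows the section `h` through `x` as far as the fibre of `y`, then runs
 -- inside that fibre. The induction applies to `F` along the section, and also to `h` itself, which
 -- bounds the second part. A straight segment would not do, as it may leave the cell.
 cell-lipschitz : ∀ {B} → 0# ≤ B → ∀ {r} {js : Vec (Fin n) r} {C : Cell js} →
   Valid B C → ∀ {F} → Funⱽ F → DependsF (lookup js) F → ∀ {c} → 0# ≤ c →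
   (∀ x → x ∈ᶜ C → Lip F c x) → ∀ x y → x ∈ᶜ C → y ∈ᶜ C →
   ∣ F x - F y ∣ ≤ Clip B r * c * dist x y
 cell-lipschitz 0≤B whole dF dep {c} 0≤c lip x y _ _ = inj₂ (trans
   (∣∣-zero (lin 2 (λ a b → a :≈ b ⊢ a :- b :≈ :0) (dep (agree λ ()))))
   (lin 2 (λ c d → ⊢ :0 :≈ :0 :* c :* d)))
 cell-lipschitz {n = n} {B} 0≤B {suc r} {j ∷ js} {band C f g} (band v j∉ gf gg f<g) {F} dF dep {c} 0≤c lip
                x y (x∈ , fx , xg) (y∈ , fy , yg) =
   ≤-trans (≤-trans (∣∣-triangle (F x) (F̂ y) (F y))
     (lin 4 (λ a b c d → a :≈ c ⊢ a :+ b :≤ c :+ b) {ρ = _ , _ , _ , 0# , tt}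
       (∣∣-cong (+-congʳ (congⱽ dF (≋-sym (upd-self x j through)))))))
     (final-estimate 0≤c (cell-lipschitz 0≤B v F̂ᵈ F̂-depends 0≤c′ F̂-lip x y x∈ y∈) vertical
       (≤-trans (∣∣-triangle (h y) (h x) (y j))
         (lin 5 (λ a b m n d → a :≈ m ∷ b :≈ n ∷ n :≤ d ⊢ a :+ b :≤ m :+ d)
           (∣-∣ (h y) (h x)) (∣∣-cong (+-congʳ through)) (coord≤dist x y j)))
       (cell-lipschitz 0≤B v (fnᵈ section) depends 0≤K sec-lip x y x∈ y∈))
   where
   open Section (sections 0≤B gf gg f<g x∈ fx xg) renaming (lip to sec-lip)
   h : K^ n → Carrier
   h = fn section
   0≤K : 0# ≤ B + 1#
   0≤K = lin 1 (λ B → :0 :≤ B ∷ :0 :< :1 ⊢ :0 :≤ B :+ :1) 0≤B 0<1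
   0≤c′ : 0# ≤ c * (1# + (B + 1#))
   0≤c′ = *-nonneg 0≤c (lin 1 (λ K → :0 :≤ K ∷ :0 :< :1 ⊢ :0 :≤ :1 :+ K) 0≤K 0<1)
   F̂ : K^ n → Carrier
   F̂ z = F (z [ j ≔ h z ])
   F̂ᵈ : Funⱽ F̂
   F̂ᵈ = appⱽ dF (updᵈ v₀ j (fnᵈ section))
   F̂-depends : DependsF (lookup js) F̂
   F̂-depends {z} {z′} e = dep $ agree λ
     { zero → trans (upd-same z j) (trans (depends e) (sym (upd-same z′ j)))
     ; (suc k) → trans (upd-other z (j∉ k)) (trans (on e k) (sym (upd-other z′ (j∉ k)))) }
   inside : ∀ z t → z ∈ᶜ C → OverSide f z t → UnderSide g z t → (z [ j ≔ t ]) ∈ᶜ band {j = j} C f g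
   inside z t z∈ p q =
     let e : Agree (lookup js) z (z [ j ≔ t ])
         e = agree λ k → sym (upd-other z (j∉ k)) in
     ∈ᶜ-depends v e z∈ , over-resp gf e (sym (upd-same z j)) p ,
     under-resp gg e (sym (upd-same z j)) q
   F̂-lip : ∀ z → z ∈ᶜ C → Lip F̂ (c * (1# + (B + 1#))) z
   F̂-lip z z∈ = lip-substitute {F = F} 0≤c 0≤K (sec-lip z z∈)
     (lip _ (inside z (h z) z∈ (over z z∈) (under z z∈)))
   vertical : ∣ F̂ y - F y ∣ ≤ c * ∣ h y - y j ∣
   vertical = ≤-trans (inj₂ (∣∣-cong (+-congˡ (-‿cong (congⱽ dF (≋-sym (upd-self y j refl)))))))
     (segment-lip (appⱽ dF (updᵈ (λ i → constᵈ) j s₀)) λ t t∈ → Near₁-cong (λ v → congⱽ dF (upd-upd y j))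
         (congⱽ dF (upd-self (y [ j ≔ t ]) j refl)) (upd-same y j)
         (lip⇒near₁ dF (y [ j ≔ t ]) 0≤c (lip _ (inside y t y∈
           (between-over f fy (over y y∈) t∈) (between-under g yg (under y y∈) t∈)))))

 -- Extension of Lipschitz functions

 module Extend {r} {J : Fin r → Fin n} {U : K^ n → Set a} (dU : Defⱽ U)
               (U-depends : DependsP J U) (f : DFun n) (f-depends : DependsF J (fn f))
               {L} (0≤L : 0# ≤ L)
               (lip : ∀ x y → U x → U y → ∣ fn f x - fn f y ∣ ≤ L * dist x y)
               (u₀ : K^ n) (u₀∈ : U u₀) where

   private
     Values : K^ n → Carrier → Set _
     Values x t = ∃ λ u → U u × t ≈ fn f u - L * dist x u

     Valuesᵈ : {v : ⟪ Γ ⟫ → K^ n} {t : ⟪ Γ ⟫ → Carrier} → DefV v → DefF t → Def (λ ρ → Values (v ρ) (t ρ))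
     Valuesᵈ dv dt = ∃ᵈ (atⱽ dU v₀ ×ᵈ wk dt ≈ᵈ (appⱽ (fnᵈ f) v₀ -ᵈ (constᵈ *ᵈ distᵈ (wkᵛ dv) v₀)))

     values-bounded : ∀ x → UpperBound (Values x) (fn f u₀ + L * dist x u₀)
     values-bounded x t (u , u∈ , e) = lin 7
       (λ t fu fu₀ L d d₀ d′ → t :≈ fu :- L :* d ∷ fu :- fu₀ :≤ L :* d′ ∷
           L :* d′ :≤ L :* (d :+ d₀) ⊢ t :≤ fu₀ :+ L :* d₀)
       e (∣∣≤⇒≤ (lip u u₀ u∈ u₀∈))
       (*-monoˡ-≤ 0≤L (≤-trans (dist-triangle u x u₀) (inj₂ (+-congʳ (dist-sym u x)))))

     sup : ∀ x → ∃ (IsSup (Values x))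
     sup x = supremum (Valuesᵈ (λ i → constᵈ) s₀) (_ , u₀ , u₀∈ , refl) (_ , values-bounded x)

     IsSup-unique : ∀ {b} {P : Carrier → Set b} {c d} → IsSup P c → IsSup P d → c ≈ d
     IsSup-unique (ub , g) (ub′ , g′) = ≤-antisym (g _ ub′) (g′ _ ub)

   extension : DFun n
   extension = dfun (λ x → proj₁ (sup x)) (uniqueᵈ (∀ᵈ (Valuesᵈ v₂ s₀ →ᵈ s₀ ≤ᵈ s₁) ×ᵈ
      ∀ᵈ (∀ᵈ (Valuesᵈ v₃ s₀ →ᵈ s₀ ≤ᵈ s₁) →ᵈ s₁ ≤ᵈ s₀))
     (λ ρ → proj₂ (sup (proj₂ ρ))) (λ ρ → IsSup-unique))

   private
     ≤-extension : ∀ x u → U u → fn f u - L * dist x u ≤ fn extension x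
     ≤-extension x u u∈ = proj₁ (proj₂ (sup x)) _ (u , u∈ , refl)

   extension-lip : ∀ x y → ∣ fn extension x - fn extension y ∣ ≤ L * dist x y
   extension-lip x y = ∣∣-≤ (lin 3 (λ a b m → a :≤ b :+ m ⊢ a :- b :≤ m) (half-lip x y (dist-sym y x)))
     (lin 3 (λ a b m → b :≤ a :+ m ⊢ :- (a :- b) :≤ m) (half-lip y x refl))
     where
     half-lip : ∀ z w {d} → dist w z ≈ d → fn extension z ≤ fn extension w + L * d
     half-lip z w {d} e = proj₂ (proj₂ (sup z)) (fn extension w + L * d) λ t (u , u∈ , t≈) →
       lin 7 (λ t fu L zu wu e d → t :≈ fu :- L :* zu ∷ fu :- L :* wu :≤ e ∷
           L :* wu :≤ L :* (d :+ zu) ⊢ t :≤ e :+ L :* d)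
         {ρ = t , fn f u , L , dist z u , dist w u , fn extension w , d , tt} t≈ (≤-extension w u u∈)
         (*-monoˡ-≤ 0≤L (≤-trans (dist-triangle w z u) (inj₂ (+-congʳ e))))

   extension-agrees : ∀ x → U x → fn extension x ≈ fn f x
   extension-agrees x x∈ = ≤-antisym (proj₂ (proj₂ (sup x)) _ λ t (u , u∈ , e) →
       lin 5 (λ t fu fx L d → t :≈ fu :- L :* d ∷ :- (fx :- fu) :≤ L :* d ⊢ t :≤ fx)
         e (∣∣≤⇒-≤ (lip x u x∈ u∈)))
     (lin 4 (λ fx L d e → fx :- L :* d :≤ e ∷ L :* d :≈ L :* :0 ⊢ fx :≤ e)
       (≤-extension x x x∈) (*-congˡ (dist-≋ {x = x} ≋-refl)))

   -- A change of `x` off the coordinates `J` is compensated by moving `u` by the same vector: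
   -- neither `U` nor `f` notices, and the distance is preserved.
   extension-depends : DependsF J (fn extension)
   extension-depends e = ≤-antisym (one e) (one (Agree-sym e))
     where
     one : ∀ {x y} → Agree J x y → fn extension x ≤ fn extension y
     one {x} {y} e = proj₂ (proj₂ (sup x)) _ λ t (u , u∈ , t≈) →
       let u′ : K^ n
           u′ i = u i + (y i - x i)
           same : Agree J u u′
           same = agree λ k → lin 3 (λ u x y → x :≈ y ⊢ u :≈ u :+ (y :- x)) (on e k)
           d : dist x u ≈ dist y u′
           d = dist-pointwise λ i → ∣∣-cong (lin 3 (λ u x y → ⊢ x :- u :≈ y :- (u :+ (y :- x))))
       in ≤-trans (inj₂ (trans t≈ (+-cong (f-depends same) (-‿cong (*-congˡ d)))))
            (≤-extension y u′ (U-depends same u∈))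

 fromℕ-mono : ∀ {m k} → m ℕ.≤ k → fromℕ m ≤ fromℕ k
 fromℕ-mono {k = k} ℕ.z≤n = fromℕ-nonneg k
 fromℕ-mono (ℕ.s≤s p) = lin 2 (λ a b → a :≤ b ⊢ :1 :+ a :≤ :1 :+ b) (fromℕ-mono p)

 -- The choice of the weights

 open Constants

 Constraint : Set ℓ
 Constraint = ℕ × Carrier

 Satisfies : ℕ → Constraint → Set ℓ
 Satisfies θ (b , y) = 1# ≤ ∣ fromℕ b - fromℕ θ * y ∣

 Admissible : Constraint → Set ℓ
 Admissible (b , y) = 9 ℕ.≤ b × 0# ≤ y

 9* : ∀ θ → fromℕ (9 ℕ.* θ) ≈ fromℕ 9 * fromℕ θ
 9* = ×1-homo-* 9

 -- If `θ y` is within 1 of `b`, it exceeds `b - 1`; so `θ′ y` exceeds `9 b - 9`, which is more than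
 -- `b + 1` since `b` is at least 9.
 far : ∀ {θ θ′} c → Admissible c → ¬ Satisfies θ c → 9 ℕ.* θ ℕ.≤ θ′ → Satisfies θ′ c
 far {θ} {θ′} (b , y) (9≤b , 0≤y) bad grows = ≤-trans
   (lin 6 (λ b θ θ′ n m y → b :- θ :* y :< :1 ∷ # 9 :≤ b ∷ y :* n :≤ y :* θ′ ∷
        y :* n :≈ y :* (# 9 :* θ) ⊢ :1 :≤ :- (b :- θ′ :* y))
     {ρ = fromℕ b , fromℕ θ , fromℕ θ′ , fromℕ (9 ℕ.* θ) , 0# , y , tt}
     (≤-<-trans (x≤∣x∣ _) (≰⇒> bad)) (fromℕ-mono 9≤b)
     (*-monoˡ-≤ 0≤y (fromℕ-mono grows)) (*-congˡ (9* θ)))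
   (-x≤∣x∣ _)

 discard : ∀ c → Admissible c → ∀ θs → AllPairs (λ x y → 9 ℕ.* x ℕ.≤ y) θs →
   ∃ λ θs′ → AllPairs (λ x y → 9 ℕ.* x ℕ.≤ y) θs′ × (∀ θ → θ ∈ θs′ → θ ∈ θs) ×
             List.length θs ℕ.≤ suc (List.length θs′) × All (λ θ → Satisfies θ c) θs′
 discard c adm [] [] = [] , [] , (λ _ ()) , ℕ.z≤n , []
 discard c adm (θ ∷ θs) (p ∷ ps) = by-cases (Satisfies θ c)
   (λ ok → let θs′ , ps′ , sub , len , oks = discard c adm θs ps in
     θ ∷ θs′ , All.tabulate (λ θ′∈ → All.lookup p (sub _ θ′∈)) ∷ ps′ ,
     (λ { _ (here e) → here e ; θ (there h) → there (sub θ h) }) , ℕ.s≤s len , ok ∷ oks)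
   (λ bad → θs , ps , (λ _ → there) , ℕ.≤-refl , All.map (far {θ} c adm bad) p)

 -- Pigeonhole: by `far`, each constraint rules out at most one candidate.
 select : ∀ cs → All Admissible cs → ∀ θs → AllPairs (λ x y → 9 ℕ.* x ℕ.≤ y) θs →
   List.length cs ℕ.< List.length θs → ∃ λ θ → θ ∈ θs × All (Satisfies θ) cs
 select [] [] (θ ∷ θs) _ _ = θ , here ≡.refl , []
 select (c ∷ cs) (adm ∷ adms) θs ps len =
   let θs′ , ps′ , sub , len′ , oks = discard c adm θs ps
       θ , θ∈ , ok = select cs adms θs′ ps′ (ℕ.≤-pred (ℕ.≤-trans len len′))
   in θ , sub θ θ∈ , All.lookup oks θ∈ ∷ ok

 constraints : ∀ m → (Fin m → Carrier) → List Constraint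
 constraints zero y = []
 constraints (suc m) y = List.map (_, y zero) (levels (suc m) zero) List.++ constraints m (y ∘ suc)

 length-constraints : ∀ m y → List.length (constraints m y) ≡ total m
 length-constraints zero y = ≡.refl
 length-constraints (suc m) y = ≡.trans (length-++ (List.map (_, y zero) (levels (suc m) zero)))
   (≡.cong₂ ℕ._+_ (≡.trans (length-map (_, y zero) (levels (suc m) zero))
     (length-geometric (suc (total m)) (top m))) (length-constraints m (y ∘ suc)))

 ∈-constraints : ∀ m y j {b} → b ∈ levels m j → (b , y j) ∈ constraints m y
 ∈-constraints (suc m) y zero b∈ = ∈-++⁺ˡ (∈-map⁺ (_, y zero) b∈)
 ∈-constraints (suc m) y (suc j) b∈ =
   ∈-++⁺ʳ (List.map (_, y zero) (levels (suc m) zero)) (∈-constraints m (y ∘ suc) j b∈)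

 admissible : ∀ m y → (∀ j → 0# ≤ y j) → All Admissible (constraints m y)
 admissible zero y h = []
 admissible (suc m) y h = All.++⁺ (All.map⁺ (All.tabulate λ {b} b∈ → level≥9 (suc m) zero b∈ , h zero))
   (admissible m (y ∘ suc) (h ∘ suc))

 dominates : ∀ {b θ y} → 9 ℕ.* θ ℕ.≤ b → 9 ℕ.≤ θ → 0# ≤ y → y ≤ fromℕ 3 → 1# ≤ ∣ fromℕ b - fromℕ θ * y ∣
 dominates {b} {θ} {y} grows 9≤θ 0≤y y≤3 = ≤-trans
   (lin 4 (λ b θ n y → n :≤ b ∷ n :≈ # 9 :* θ ∷ # 9 :≤ θ ∷ θ :* y :≤ θ :* # 3 ⊢ :1 :≤ b :- θ :* y)
     (fromℕ-mono grows) (9* θ) (fromℕ-mono 9≤θ) (*-monoˡ-≤ (fromℕ-nonneg θ) y≤3))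
   (x≤∣x∣ _)

 grows-over : ∀ m i {b θ} → b ∈ levels (suc m) zero → θ ∈ levels m i → 9 ℕ.* θ ℕ.≤ b
 grows-over m i b∈ θ∈ = ℕ.≤-trans (ℕ.*-monoʳ-≤ 9 (level≤top m i θ∈))
   (All.lookup (geometric-≥ (suc (total m)) (top m)) b∈)

 -- Weights of earlier colours are out of reach, because slopes are at most 3 (`dominates`). Each of
 -- the `total m` weights of later colours gives one constraint, and the colour has one weight more
 -- than that.
 choose-weight : ∀ m (i : Fin m) (y : Fin m → Carrier) → (∀ j → 0# ≤ y j) →
   (∀ j → y j ≤ fromℕ 3) → ∃ λ θ → θ ∈ levels m i ×
   (∀ j → j ≢ i → ∀ {b} → b ∈ levels m j → 1# ≤ ∣ fromℕ b - fromℕ θ * y j ∣)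
 choose-weight (suc m) zero y 0≤y y≤3 =
   let θ , θ∈ , ok = select (constraints m (y ∘ suc)) (admissible m (y ∘ suc) (0≤y ∘ suc))
         (levels (suc m) zero) (geometric-pairs (suc (total m)) (top m))
         (≡.subst₂ ℕ._<_ (≡.sym (length-constraints m (y ∘ suc)))
           (≡.sym (length-geometric (suc (total m)) (top m))) ℕ.≤-refl)
   in θ , θ∈ , λ
     { zero j≢ _ → ⊥-elim (j≢ ≡.refl)
     ; (suc j) _ b∈ → All.lookup ok (∈-constraints m (y ∘ suc) j b∈) }
 choose-weight (suc m) (suc i) y 0≤y y≤3 =
   let θ , θ∈ , ok = choose-weight m i (y ∘ suc) (0≤y ∘ suc) (y≤3 ∘ suc) in
   θ , θ∈ , λ { zero _ b∈ → dominates (grows-over m i b∈ θ∈) (level≥9 m i θ∈) (0≤y zero) (y≤3 zero)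
     ; (suc j) j≢ b∈ → ok j (j≢ ∘ ≡.cong suc) b∈ }

 argmax : ∀ (v : K^ n) c → (∀ m → v m ≤ c) ⊎ ∃ λ l → c < v l × (∀ m → v m ≤ v l)
 argmax {n = zero} v c = inj₁ λ ()
 argmax {n = suc n} v c with argmax (v ∘ suc) c
 ... | inj₁ h = by-cases (v zero ≤ c) (λ v₀≤c → inj₁ λ { zero → v₀≤c ; (suc m) → h m })
   (λ v₀≰c → inj₂ (zero , ≰⇒> v₀≰c , λ { zero → ≤-refl ; (suc m) → ≤-trans (h m) (inj₁ (≰⇒> v₀≰c)) }))
 ... | inj₂ (l , c<vl , h) = by-cases (v zero ≤ v (suc l))
   (λ v₀≤ → inj₂ (suc l , c<vl , λ { zero → v₀≤ ; (suc m) → h m }))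
   (λ v₀≰ → inj₂ (zero , <-trans c<vl (≰⇒> v₀≰) , λ
     { zero → ≤-refl ; (suc m) → ≤-trans (h m) (inj₁ (≰⇒> v₀≰)) }))

 -- Steep functions and the exchange of coordinates

 Steep : DFun n → Fin n → K^ n → Set ℓ
 Steep β l x = Regular β x × 1# < ∣ fn (∂ β l) x ∣ × (∀ m → ∣ fn (∂ β m) x ∣ ≤ ∣ fn (∂ β l) x ∣)

 Steepᵈ : ∀ (β : DFun n) l → Defⱽ (Steep β l)
 Steepᵈ β l = Regularᵈ β ×ᵈ constᵈ <ᵈ ∣ fnᵈ (∂ β l) ∣ᵈ ×ᵈ ∀Finᵈ λ m → ∣ fnᵈ (∂ β m) ∣ᵈ ≤ᵈ ∣ fnᵈ (∂ β l) ∣ᵈ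

 flat⊎steep : ∀ (β : DFun n) {x} → Regular β x → Good 1# β x ⊎ ∃ λ l → Steep β l x
 flat⊎steep β {x} r with argmax (λ m → ∣ fn (∂ β m) x ∣) 1#
 ... | inj₁ h = inj₁ (r , h)
 ... | inj₂ (l , p , h) = inj₂ (l , r , p , h)

 dot-upd : ∀ (q x y : K^ n) l {s t} → x l ≈ y l → dot q (λ i → (x [ l ≔ s ]) i - (y [ l ≔ t ]) i) ≈
           dot q (λ i → x i - y i) + q l * (s - t)
 dot-upd {n = suc n} q x y zero {s} {t} e = lin 5 (λ q₀ x₀ y₀ w st → q₀ :* (x₀ :- y₀) :≈ q₀ :* :0 ⊢
     q₀ :* st :+ w :≈ q₀ :* (x₀ :- y₀) :+ w :+ q₀ :* st)
   (*-congˡ (lin 2 (λ a b → a :≈ b ⊢ a :- b :≈ :0) e))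
 dot-upd {n = suc n} q x y (suc l) e = trans (+-congˡ (dot-upd (q ∘ suc) (x ∘ suc) (y ∘ suc) l e))
   (sym (+-assoc _ _ _))

 -- Exchanging the roles of the coordinates x j = β x and x l.
 module Swap (β : DFun n) (j l : Fin n) (j≢l : j ≢ l)
             {S : K^ n → Set a} (dS : Defⱽ S) (steep : ∀ x → S x → Steep β l x)
             (β-free : ∀ x t → fn β (x [ j ≔ t ]) ≈ fn β x)
             (S-free : ∀ x t → S x → S (x [ j ≔ t ])) where

   LevelSet : K^ n → Carrier → Carrier → Set (ℓ ⊔ a)
   LevelSet x c t = S (x [ l ≔ t ]) × c ≈ fn β (x [ l ≔ t ])

   -- On an interval inside a level set the derivative in direction `l` would vanish, but where `S`
   -- holds its absolute value exceeds 1.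
   small : ∀ x c → ∀* (λ t → ¬ LevelSet x c t)
   small x c = byContradiction λ ¬p →
     let u , v , u<v , h = ¬∀*⇒interval
           {P = LevelSet x c}
           (atⱽ dS (updᵈ (λ i → constᵈ) l s₀) ×ᵈ constᵈ ≈ᵈ appⱽ (fnᵈ β) (updᵈ (λ i → constᵈ) l s₀)) ¬p
         t , u<t , t<v = between u<v
     in contradict t u v u<t t<v h
     where
     contradict : ∀ t u v → u < t → t < v → All⟨ u , v ⟩ (LevelSet x c) → _
     contradict t u v u<t t<v h =
       let z = x [ l ≔ t ]
           St , _ = h t u<t t<v
           r , 1<∂ , _ = steep z St
           ∂-is-0 : fn (∂ β l) z ≈ 0#
           ∂-is-0 = HasDeriv-unique (∂-spec β l (proj₁ (Nbhd-centre r l)))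
             (constant⇒HasPartial (fnᵈ β) l x u<t t<v λ w u<w w<v → sym (proj₂ (h w u<w w<v)))
       in <-irrefl refl (<-trans 0<1 (<-respʳ (∣∣-zero ∂-is-0) 1<∂))

   Swapped : K^ n → Carrier → Set (ℓ ⊔ a)
   Swapped y t = LevelSet y (y j) t

   Swappedᵈ : {v : ⟪ Γ ⟫ → K^ n} {t : ⟪ Γ ⟫ → Carrier} → DefV v → DefF t → Def (λ ρ → Swapped (v ρ) (t ρ))
   Swappedᵈ dv dt = atⱽ dS (updᵈ dv l dt) ×ᵈ dv j ≈ᵈ appⱽ (fnᵈ β) (updᵈ dv l dt)

   private
     finiteness : ∃ λ (fs : List (DFun n)) → All (Canonical Swapped) fs ×
                  (∀ x t → Swapped x t → Any (λ f → t ≈ fn f x) fs)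
     finiteness = uniform-finiteness {S = Swapped} (Swappedᵈ v₁ s₀) (λ y → small y (y j))

   branches : List (DFun n)
   branches = proj₁ finiteness

   branches-canonical : All (Canonical Swapped) branches
   branches-canonical = proj₁ (proj₂ finiteness)

   On : DFun n → K^ n → Set (ℓ ⊔ a)
   On δ y = Swapped y (fn δ y)

   Onᵈ : ∀ δ → Defⱽ (On δ)
   Onᵈ δ = Swappedᵈ v₀ (fnᵈ δ)

   on-branch : ∀ x → S x → Any (λ δ → (x [ j ≔ fn β x ]) l ≈ fn δ (x [ j ≔ fn β x ]) ×
                                      On δ (x [ j ≔ fn β x ])) branches
   on-branch x Sx = Any.map (λ {δ} e → e , respᶠ (Swappedᵈ v₁ s₀) ≋-refl e swapped)
     (proj₂ (proj₂ finiteness) y (y l) swapped)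
     where
     y : K^ n
     y = x [ j ≔ fn β x ]
     y≋ : y ≋ (y [ l ≔ y l ])
     y≋ = ≋-sym (upd-self y l refl)
     swapped : Swapped y (y l)
     swapped = respⱽ dS y≋ (S-free x (fn β x) Sx) ,
       trans (upd-same x j) (trans (sym (β-free x (fn β x))) (congⱽ (fnᵈ β) y≋))

   private
     -- Dividing by `Q > 1` gives `σ ≤ 2 d + (d + σ) / 4`, that is `3 σ / 4 ≤ 9 d / 4`. The error
     -- 1/4 is chosen to make the constant exactly 3.
     estimate : ∀ {Q d σ e} → 1# < Q → 0# ≤ d → 0# ≤ σ →
       Q * σ ≤ d + Q * d + e → fromℕ 4 * e ≤ d + σ → σ ≤ fromℕ 3 * d
     estimate {Q} {d} {σ} {e} 1<Q 0≤d 0≤σ p q = ≮⇒≥ λ 3d<σ → ≤⇒≯ {Q * (fromℕ 3 * σ)} {Q * (fromℕ 9 * d)}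
       (lin 4 (λ Q d σ e → Q :* σ :≤ d :+ Q :* d :+ e ∷ # 4 :* e :≤ d :+ σ ∷
           :0 :≤ (Q :- :1) :* d ∷ :0 :≤ (Q :- :1) :* σ ⊢ Q :* (# 3 :* σ) :≤ Q :* (# 9 :* d))
         p q (*-nonneg 0≤Q-1 0≤d) (*-nonneg 0≤Q-1 0≤σ))
       (*-monoˡ-< (<-trans 0<1 1<Q) (lin 2 (λ d σ → # 3 :* d :< σ ⊢ # 9 :* d :< # 3 :* σ) 3d<σ))
       where
       0≤Q-1 : 0# ≤ Q - 1#
       0≤Q-1 = lin 1 (λ Q → :1 :< Q ⊢ :0 :≤ Q :- :1) 1<Q

   -- The equation satisfied by `δ` is linearised at `y`. The slope of `β` in direction `l`
   -- dominates all its other slopes and exceeds 1, so that dividing by it leaves absolute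
   -- constants. Continuity of `δ` keeps the point where `β` is evaluated inside the range of the
   -- linearisation.
   branch-lip : ∀ δ → ∀*ⁿ λ y → On δ y → Lip (fn δ) (fromℕ 3) y
   branch-lip δ = ∀*ⁿ-map₂ (ContinuousAtᵈ (fnᵈ δ)) (λ y cont near on → lipschitz y cont (near on))
       (∀*ⁿ-continuous (fnᵈ δ)) (∀*ⁿ-interior (Onᵈ δ))
     where
     lipschitz : ∀ y → ContinuousAt (fn δ) y → Nbhd (On δ) y → Lip (fn δ) (fromℕ 3) y
     lipschitz y cont near = Nbhd-map close (Nbhd-× near (Nbhd-× (cont _ 0<ρ/2) (ball ρ/2 0<ρ/2)))
       where
       on-y : On δ y
       on-y = Nbhd-centre near
       z : K^ n
       z = y [ l ≔ fn δ y ]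
       st : Steep β l z
       st = steep z (proj₁ on-y)
       q : K^ n
       q = gradient β z
       quarter : Carrier
       quarter = half (half 1#)
       nb : Near (fn β) z q quarter
       nb = regular⇒near β (proj₁ st) quarter (half-pos (half-pos 0<1))
       ρ/2 : Carrier
       ρ/2 = half (proj₁ nb)
       0<ρ/2 : 0# < ρ/2
       0<ρ/2 = half-pos (proj₁ (proj₂ nb))
       ball : ∀ r → 0# < r → Nbhd (λ w → dist y w < r) y
       ball r 0<r = r , 0<r , λ w w∈ → w∈
       close : ∀ w → On δ w × ∣ fn δ y - fn δ w ∣ < ρ/2 × dist y w < ρ/2 →
               ∣ fn δ w - fn δ y ∣ ≤ fromℕ 3 * dist y w
       close w (on-w , δ-near , w-near) = estimate {e = quarter * dist z z′}
           (proj₁ (proj₂ st)) (0≤dist y w) (0≤∣ _ ∣)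
           (≤-trans (inj₂ (sym (∣*∣ (q l) σ))) (≤-trans (≤-trans (inj₂ (∣∣-cong rewritten))
             (≤-trans (∣+∣ _ _) (lin 4 (λ a b c m → m :≤ a :+ b ⊢ m :+ c :≤ a :+ b :+ c)
               {ρ = _ , _ , _ , _ , tt} (∣+∣ _ _))))
             (lin 6 (λ a b c d Q e → a :≤ d ∷ b :≤ Q :* d ∷ c :≤ e ⊢ a :+ b :+ c :≤ d :+ Q :* d :+ e)
               (≤-trans (inj₂ (∣-∣ _ _)) (coord≤dist y w j))
               (≤-trans (∣-∣-neg _) (≤-trans (dot-bound {q = q} {y} {w°} (proj₂ (proj₂ st)))
                 (*-monoˡ-≤ (0≤∣ q l ∣) w°-near)))
               (≤-trans (∣-∣-neg _) near-β))))
           (lin 5 (λ Z d σ h k → k :≤ d :+ σ ∷ # 4 :* (h :* k) :≈ k ⊢ # 4 :* (h :* k) :≤ d :+ σ)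
             {ρ = 0# , dist y w , _ , quarter , dist z z′ , tt}
             z-near quarter*)
         where
         z′ w° : K^ n
         z′ = w [ l ≔ fn δ w ]
         w° = w [ l ≔ y l ]
         σ : Carrier
         σ = fn δ w - fn δ y
         ∣-∣-neg : ∀ x → ∣ - x ∣ ≤ ∣ x ∣
         ∣-∣-neg x = ∣∣-≤ (-x≤∣x∣ x) (≤-trans (lin 1 (λ x → ⊢ :- (:- x) :≤ x)) (x≤∣x∣ x))
         w°-near : dist y w° ≤ dist y w
         w°-near = ≤-trans (inj₂ (dist-cong (≋-sym (upd-self y l refl)) ≋-refl))
           (≤-trans (dist-upd≤ y w l (y l) (y l))
             (lin 2 (λ d m → m :≈ :0 ⊢ d :+ m :≤ d) (∣∣-zero (-‿inverseʳ (y l)))))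
         z-near : dist z z′ ≤ dist y w + ∣ σ ∣
         z-near = ≤-trans (dist-upd≤ y w l (fn δ y) (fn δ w)) (inj₂ (+-congˡ (∣-∣ _ _)))
         quarter* : fromℕ 4 * (quarter * dist z z′) ≈ dist z z′
         quarter* = lin 4 (λ q h o k → k :* (q :+ q) :≈ k :* h ∷ k :* (h :+ h) :≈ k :* :1 ⊢
             # 4 :* (q :* k) :≈ k)
           {ρ = quarter , half 1# , 0# , dist z z′ , tt}
           (*-congˡ (half+half (half 1#))) (*-congˡ (half+half 1#))
         near-β : ∣ (fn β z′ - fn β z) - dot q (λ i → z′ i - z i) ∣ ≤ quarter * dist z z′
         near-β = proj₂ (proj₂ nb) z′ (lin 5
           (λ Z d m h ρ → Z :≤ d :+ m ∷ d :< h ∷ m :< h ∷ h :+ h :≈ ρ ⊢ Z :< ρ)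
           (dist-upd≤ y w l (fn δ y) (fn δ w)) w-near δ-near (half+half (proj₁ nb)))
         z′≋ : z′ ≋ (w° [ l ≔ fn δ w ])
         z′≋ = ≋-sym (upd-upd w l)
         dots : dot q (λ i → z′ i - z i) ≈ dot q (λ i → w° i - y i) + q l * σ
         dots = trans (sum-cong λ i → *-congˡ (+-congʳ (z′≋ i))) (dot-upd q w° y l (upd-same w l))
         rewritten : q l * σ ≈ (w j - y j) + - dot q (λ i → w° i - y i) +
                     - ((fn β z′ - fn β z) - dot q (λ i → z′ i - z i))
         rewritten = lin 7 (λ qs wj yj d D b′ b → D :≈ d :+ qs ∷ wj :≈ b′ ∷ yj :≈ b ⊢
             qs :≈ (wj :- yj) :+ (:- d) :+ (:- ((b′ :- b) :- D)))
           dots (proj₂ on-w) (proj₂ on-y)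

   -- A small set of values y yields a small set of points x, because the
   -- l-th coordinate can be recovered up to finitely many possibilities.
   transfer : {N : K^ n → Set b} → Defⱽ N → (∀ y t → N (y [ l ≔ t ]) → N y) →
              ∀*ⁿ (λ y → ¬ N y) → ∀*ⁿ λ x → S x → ¬ N (x [ j ≔ fn β x ])
   transfer {N = N} dN N-free h = ∀*ⁿ-update⁻ (dS →ᵈ ¬ᵈ atⱽ dN (updᵈ v₀ j (fnᵈ β))) l
       (∀*ⁿ-map (λ x few → fibre x (finite (atⱽ dN (updᵈ (λ i → constᵈ) j s₀)) few))
         (∀*ⁿ-update (¬ᵈ dN) j h))
     where
     fibre : ∀ x → (∃ λ cs → ∀ s → N (x [ j ≔ s ]) → Any (s ≈_) cs) →
             ∀* λ t → S (x [ l ≔ t ]) → ¬ N (x [ l ≔ t ] [ j ≔ fn β (x [ l ≔ t ]) ])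
     fibre x (cs , listed) = ∀*-map (λ t none St Nt → none (Any.map (λ e → St , sym e)
         (listed _ (N-free _ t (respⱽ dN (upd-comm x (j≢l ∘ ≡.sym)) Nt)))))
       (∀*-Any {R = λ c → LevelSet x c} (λ c → atⱽ dS (updᵈ (λ i → constᵈ) l s₀) ×ᵈ
                constᵈ ≈ᵈ appⱽ (fnᵈ β) (updᵈ (λ i → constᵈ) l s₀))
         (All.universal (small x) cs))

 -- Derivatives of functions of some of the coordinates

 module _ {r} {J : Fin r → Fin n} where

   shift : K^ n → K^ n → K^ n → K^ n
   shift x y z i = x i + (z i - y i)

   shift-dist : ∀ x y z → dist x (shift x y z) ≈ dist y z
   shift-dist x y z = dist-pointwise λ i → ∣∣-cong (lin 3 (λ x y z → ⊢ x :- (x :+ (z :- y)) :≈ y :- z))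

   shift-agree : ∀ {x y} → Agree J x y → ∀ z → Agree J (shift x y z) z
   shift-agree e z = agree λ k → lin 3 (λ x y z → x :≈ y ⊢ x :+ (z :- y) :≈ z) (on e k)

   -- Translation carries a neighbourhood of `x` to one of `y`, and when `x` and `y` agree on `J`,
   -- it moves points off `J` only.
   Nbhd-depends : {P : K^ n → K^ n → Set a} → (∀ {x y x′ y′} → Agree J x y → Agree J x′ y′ →
       (∀ i → x′ i - x i ≈ y′ i - y i) → P x x′ → P y y′) →
     ∀ {x y} → Agree J x y → Nbhd (P x) x → Nbhd (P y) y
   Nbhd-depends dep {x} {y} e (δ , 0<δ , h) = δ , 0<δ , λ z z∈ → dep e (shift-agree e z)
       (λ i → lin 3 (λ x y z → ⊢ (x :+ (z :- y)) :- x :≈ z :- y))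
       (h (shift x y z) (<-respˡ (sym (shift-dist x y z)) z∈))

   module _ (f : DFun n) (dep : DependsF J (fn f)) where

     free⇒∂≈0 : ∀ {i x} → (∀ k → J k ≢ i) → HasPartial (fn f) i x 0#
     free⇒∂≈0 {i} {x} i∉J ε 0<ε = 1# , 0<1 , λ v v∈ → ≤-trans
       (inj₂ (∣∣-zero (lin 3 (λ a b d → a :≈ b ⊢ (a :- b) :- :0 :* d :≈ :0)
         (dep $ agree λ k → trans (upd-other x (i∉J k)) (sym (upd-other x (i∉J k)))))))
       (*-nonneg (inj₁ 0<ε) (0≤∣ _ ∣))

     HasPartial-depends : ∀ i {x y p} → Agree J x y → HasPartial (fn f) i x p → HasPartial (fn f) i y p
     HasPartial-depends i {x} {y} {p} e h = by-cases (∃ λ k → J k ≡ i)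
       (λ { (k , ≡.refl) → HasDeriv-cong (λ v → dep (updated v v refl))
              (dep (updated (x (J k)) (y (J k)) (on e k))) (on e k) refl h })
       (λ i∉J → let i∉ = λ k e → i∉J (k , e) in
         HasDeriv-cong (λ _ → refl) refl refl (HasDeriv-unique (free⇒∂≈0 i∉) h) (free⇒∂≈0 i∉))
       where
       updated : ∀ u v → u ≈ v → Agree J (x [ i ≔ u ]) (y [ i ≔ v ])
       updated u v u≈v = agree λ k → by-cases (J k ≡ i)
         (λ { ≡.refl → trans (upd-same x i) (trans u≈v (sym (upd-same y i))) })
         (λ k≢ → trans (upd-other x k≢) (trans (on e k) (sym (upd-other y k≢))))

     ∂-free : ∀ {i x} → (∀ k → J k ≢ i) → Differentiable (fn f) i x → fn (∂ f i) x ≈ 0#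
     ∂-free i∉J d = HasDeriv-unique (∂-spec f _ d) (free⇒∂≈0 i∉J)

     ∂-depends : ∀ i → DependsF J (fn (∂ f i))
     ∂-depends i {x} {y} e = by-cases (Differentiable (fn f) i x)
       (λ (p , h) → HasDeriv-unique (HasPartial-depends i e (∂-spec f i (p , h)))
         (∂-spec f i (p , HasPartial-depends i e h)))
       (λ ¬d → trans (∂-default f i ¬d) (sym (∂-default f i λ (p , h) →
         ¬d (p , HasPartial-depends i (Agree-sym e) h))))

     Regular-depends : DependsP J (Regular f)
     Regular-depends = Nbhd-depends {P = λ _ → C¹At f} λ _ e′ _ c i →
       Prod.map₂ (HasPartial-depends i e′) (proj₁ (c i)) ,
       λ ε 0<ε → Nbhd-depends {P = λ x y → ∣ fn (∂ f i) x - fn (∂ f i) y ∣ < ε}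
         (λ e e′ _ → <-respˡ (∣∣-cong (+-cong (∂-depends i e) (-‿cong (∂-depends i e′)))))
         e′ (proj₂ (c i) ε 0<ε)

     Good-depends : ∀ {B} → DependsP J (Good B f)
     Good-depends e (r , b) = Regular-depends e r , λ i →
       ≤-trans (inj₂ (∣∣-cong (sym (∂-depends i e)))) (b i)

     Steep-depends : ∀ {l} → DependsP J (Steep f l)
     Steep-depends {l} e (r , p , h) = Regular-depends e r , <-respʳ (∣∣-cong (∂-depends l e)) p ,
       λ m → ≤-trans (inj₂ (∣∣-cong (sym (∂-depends m e)))) (≤-trans (h m) (inj₂ (∣∣-cong (∂-depends l e))))

     Near-depends : ∀ {q c} → DependsP J (λ x → Near (fn f) x q c)
     Near-depends {q} {c} = Nbhd-depends
       {P = λ x y → ∣ (fn f y - fn f x) - dot q (λ i → y i - x i) ∣ ≤ c * dist x y}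
       λ {x} {y} {x′} {y′} e e′ d h → ≤-trans
         (≤-trans (inj₂ (∣∣-cong (sym (+-cong (+-cong (dep e′) (-‿cong (dep e)))
           (-‿cong (sum-cong λ i → *-congˡ (d i))))))) h)
         (inj₂ (*-congˡ (dist-pointwise λ i → trans (∣-∣ (x i) (x′ i))
           (trans (∣∣-cong (d i)) (∣-∣ (y′ i) (y i))))))

 good-lip⇒good : ∀ {c} (f : DFun n) {x} → Regular f x → Lip (fn f) c x → Good c f x
 good-lip⇒good f r lip = r , λ i → lip⇒partial (fnᵈ f) lip (∂-spec f i (proj₁ (Nbhd-centre r i)))

 Good-weaken : ∀ {B B′} {f : DFun n} {x} → B ≤ B′ → Good B f x → Good B′ f x
 Good-weaken B≤B′ (r , b) = r , λ i → ≤-trans (b i) B≤B′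

 -- Finite choices and the grid of slopes

 choices : ∀ {A : Set a} {m} → (Fin m → List A) → List (Fin m → A)
 choices {m = zero} L = (λ ()) ∷ []
 choices {m = suc m} L = List.concatMap (λ x → List.map (x Vector.∷_) (choices (L ∘ suc))) (L zero)

 ∈-choices : ∀ {A : Set a} {m} {L : Fin m → List A} {P : Fin m → A → Set b} →
             (∀ i → Any (P i) (L i)) → Any (λ v → ∀ i → P i (v i)) (choices L)
 ∈-choices {m = zero} h = here λ ()
 ∈-choices {m = suc m} {L} {P} h = Any.concatMap⁺ (λ x → List.map (x Vector.∷_) (choices (L ∘ suc)))
   (Any.map (λ {x} p → Any.map⁺ {f = x Vector.∷_} {P = λ v → ∀ i → P i (v i)}
       (Any.map (λ q → λ { zero → p ; (suc i) → q i }) (∈-choices {P = P ∘ suc} (h ∘ suc))))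
     (h zero))

 steps : Carrier → ℕ → Carrier → List Carrier
 steps η zero b = b ∷ []
 steps η (suc N) b = b ∷ steps η N (b + η)

 ∈-steps : ∀ {η} → 0# < η → ∀ N b {y} → b ≤ y → y ≤ b + fromℕ N * η →
           Any (λ g → b ≤ g × g ≤ y × y ≤ g + η) (steps η N b)
 ∈-steps 0<η zero b b≤y y≤ = here (≤-refl , b≤y ,
   lin 3 (λ y b η → y :≤ b :+ :0 :* η ∷ :0 :< η ⊢ y :≤ b :+ η) y≤ 0<η)
 ∈-steps {η} 0<η (suc N) b {y} b≤y y≤ = by-cases (y ≤ b + η) (λ y≤b+η → here (≤-refl , b≤y , y≤b+η))
   (λ y≰b+η → there (Any.map (λ (p , q) → ≤-trans b≤b+η p , q) (∈-steps 0<η N (b + η) (inj₁ (≰⇒> y≰b+η))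
       (lin 4 (λ y b η N → y :≤ b :+ (:1 :+ N) :* η ⊢ y :≤ b :+ η :+ N :* η) y≤))))
   where
   b≤b+η : b ≤ b + η
   b≤b+η = lin 2 (λ b η → :0 :< η ⊢ b :≤ b :+ η) 0<η

 -- Slopes of absolute value at most 3, up to an error 1/E.
 grid : Carrier → ℕ → List Carrier
 grid η E = steps η (6 ℕ.* E) (- fromℕ 3)

 ∈-grid : ∀ {η E} → 0# < η → fromℕ E * η ≈ 1# → ∀ {y} → ∣ y ∣ ≤ fromℕ 3 →
          Any (λ g → ∣ g ∣ ≤ fromℕ 3 × ∣ y - g ∣ ≤ η) (grid η E)
 ∈-grid {η} {E} 0<η e {y} y≤3 = Any.map (λ {g} (p , q , r) →
     ∣∣-≤ (≤-trans q (∣∣≤⇒≤ y≤3)) (lin 1 (λ g → :- # 3 :≤ g ⊢ :- g :≤ # 3) p) ,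
     ∣∣-≤ (lin 3 (λ y g η → y :≤ g :+ η ⊢ y :- g :≤ η) r)
          (lin 3 (λ y g η → g :≤ y ∷ :0 :< η ⊢ :- (y :- g) :≤ η) q 0<η))
   (∈-steps 0<η (6 ℕ.* E) (- fromℕ 3) (lin 1 (λ y → :- y :≤ # 3 ⊢ :- # 3 :≤ y) (∣∣≤⇒-≤ y≤3))
     (lin 4 (λ y E N η → y :≤ # 3 ∷ N :* η :≈ (# 6 :* E) :* η ∷ E :* η :≈ :1 ⊢ y :≤ :- # 3 :+ N :* η)
       (∣∣≤⇒≤ y≤3) (*-congʳ (×1-homo-* 6 E)) e))

 -- Collecting finitely many lists into one

 module Collect {w} {W : Set w} (p : Level) where

   Monotone : (List W → Set b) → Set (w ⊔ b ⊔ Level.suc p)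
   Monotone Q = ∀ {ws ws′} → (∀ {P : W → Set p} → Any P ws → Any P ws′) → Q ws → Q ws′

   collect-list : ∀ {A : Set a} {Q : A → List W → Set b} → (∀ x → Monotone (Q x)) →
                  (∀ x → ∃ (Q x)) → ∀ xs → ∃ λ ws → All (λ x → Q x ws) xs
   collect-list mono f [] = [] , []
   collect-list mono f (x ∷ xs) =
     let ws , q = f x ; ws′ , qs = collect-list mono f xs in
     ws List.++ ws′ , mono x Any.++⁺ˡ q ∷ All.map (mono _ (Any.++⁺ʳ ws)) qs

   collect-Fin : ∀ {m} {Q : Fin m → List W → Set b} → (∀ i → Monotone (Q i)) →
                 (∀ i → ∃ (Q i)) → ∃ λ ws → ∀ i → Q i ws
   collect-Fin {m = zero} mono f = [] , λ ()
   collect-Fin {m = suc m} mono f =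
     let ws , q = f zero ; ws′ , qs = collect-Fin (mono ∘ suc) (f ∘ suc) in
     ws List.++ ws′ , λ { zero → mono zero Any.++⁺ˡ q ; (suc i) → mono (suc i) (Any.++⁺ʳ ws) (qs i) }

 Allᵈ : ∀ {A : Set b} {P : A → ⟪ Γ ⟫ → Set a} cs → (∀ c → Def (P c)) → Def (λ ρ → All (λ c → P c ρ) cs)
 Allᵈ [] dP = fullᵈ (λ _ → [])
 Allᵈ (c ∷ cs) dP = ⇔ᵈ (dP c ×ᵈ Allᵈ cs dP) (λ { _ (p ∷ ps) → p , ps }) (λ _ (p , ps) → p ∷ ps)

 ∀*ⁿ-All : ∀ {A : Set b} {P : A → K^ n → Set a} → (∀ c → Defⱽ (P c)) →
           ∀ {cs} → All (λ c → ∀*ⁿ (P c)) cs → ∀*ⁿ (λ x → All (λ c → P c x) cs)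
 ∀*ⁿ-All dP [] = ∀*ⁿ-all λ x → []
 ∀*ⁿ-All dP (h ∷ hs) = ∀*ⁿ-map₂ (dP _) (λ x p ps → p ∷ ps) h (∀*ⁿ-All dP hs)

 Injective : ∀ {r} → (Fin r → Fin n) → Set
 Injective J = ∀ {i j} → J i ≡ J j → i ≡ j

 -- A cell over the coordinates in the image of J, in some order.
 record CellOver {n r} (B : Carrier) (J : Fin r → Fin n) : Set (s ⊔ ℓ) where
   field
     {order} : Vec (Fin n) r
     cell : Cell order
     valid : Valid B cell
     order⊆J : ∀ m → ∃ λ k → lookup order m ≡ J k
     J⊆order : ∀ k → ∃ λ m → J k ≡ lookup order m
 open CellOver public

 infix 4 _∈ₒ_
 _∈ₒ_ : ∀ {r B} {J : Fin r → Fin n} → K^ n → CellOver B J → Set ℓ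
 x ∈ₒ C = x ∈ᶜ cell C

 ∈ₒ-depends : ∀ {r B} {J : Fin r → Fin n} (C : CellOver B J) → DependsP J (_∈ₒ C)
 ∈ₒ-depends C {x} {y} e = ∈ᶜ-depends (valid C) $ agree λ m →
   let k , m≡k = order⊆J C m in ≡.subst (λ i → x i ≈ y i) (≡.sym m≡k) (on e k)

 depends-order : ∀ {r B} {J : Fin r → Fin n} (C : CellOver B J) {f} →
                 DependsF J f → DependsF (lookup (order C)) f
 depends-order C dep {x} {y} e = dep $ agree λ k →
   let m , k≡m = J⊆order C k in ≡.subst (λ i → x i ≈ y i) (≡.sym k≡m) (on e m)

 Agree-off : ∀ {n r} (J : Fin (suc r) → Fin n) {k x y} → Agree (J ∘ punchIn k) x y →
             ∀ i → i ≢ k → x (J i) ≈ y (J i)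
 Agree-off J {k} {x} {y} e i i≢k = ≡.subst (λ i → x (J i) ≈ y (J i))
   (punchIn-punchOut (i≢k ∘ ≡.sym)) (on e (punchOut (i≢k ∘ ≡.sym)))

 Agree-upd⁺ : ∀ {n r} {J : Fin (suc r) → Fin n} → Injective J → ∀ k {x y} →
              Agree (J ∘ punchIn k) x y → ∀ t → Agree J (x [ J k ≔ t ]) (y [ J k ≔ t ])
 Agree-upd⁺ {J = J} J-inj k {x} {y} e t = agree λ i → by-cases (i ≡ k)
   (λ { ≡.refl → trans (upd-same x (J k)) (sym (upd-same y (J k))) })
   (λ i≢k → trans (upd-other x (i≢k ∘ J-inj)) (trans (Agree-off J e i i≢k)
     (sym (upd-other y (i≢k ∘ J-inj)))))

 punch≢ : ∀ {r} {J : Fin (suc r) → Fin n} → Injective J → ∀ k m → J (punchIn k m) ≢ J k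
 punch≢ J-inj k m e = punchInᵢ≢i k m (J-inj e)

 -- The steep parts of the graph of β are graphs in other directions.
 module SwapOver {n r : ℕ} (J : Fin (suc r) → Fin n) (J-inj : Injective J)
   (k k′ : Fin (suc r)) (k≢k′ : k ≢ k′) (β : DFun n)
   (β-dep : DependsF (J ∘ punchIn k) (fn β)) where

   private
     j l : Fin n
     j = J k
     l = J k′

   J-free : ∀ x t → Agree (J ∘ punchIn k) x (x [ j ≔ t ])
   J-free x t = agree λ m → sym (upd-other x (punch≢ J-inj k m))

   open Swap β j l (k≢k′ ∘ J-inj) (Steepᵈ β l) (λ x st → st)
     (λ x t → β-dep (Agree-sym (J-free x t)))
     (λ x t → Steep-depends β β-dep (J-free x t)) public

   agree-upd : ∀ {x y} → Agree (J ∘ punchIn k′) x y → ∀ t → Agree (J ∘ punchIn k) (x [ l ≔ t ]) (y [ l ≔ t ])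
   agree-upd {x} {y} e t = agree λ m → on (Agree-upd⁺ J-inj k′ e t) (punchIn k m)

   private
     swapped-dep : ∀ {x y} → Agree (J ∘ punchIn k′) x y → ∀ t → Swapped x t → Swapped y t
     swapped-dep {x} {y} e t (st , eq) = Steep-depends β β-dep (agree-upd e t) st ,
       trans (sym (Agree-off J e k k≢k′)) (trans eq (β-dep (agree-upd e t)))

   canonical⇒dep : ∀ {δ} → Canonical Swapped δ → DependsF (J ∘ punchIn k′) (fn δ)
   canonical⇒dep c e = c _ _ λ t → swapped-dep e t , swapped-dep (Agree-sym e) t

   On-dep : ∀ δ → DependsF (J ∘ punchIn k′) (fn δ) → DependsP (J ∘ punchIn k′) (On δ)
   On-dep δ dep e h = respᶠ (Swappedᵈ v₁ s₀) ≋-refl (dep e) (swapped-dep e _ h)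

 record Decomposition {n r} (B : Carrier) (J : Fin r → Fin n) (X : K^ n → Set a) :
                      Set (s ⊔ ℓ ⊔ a) where
   field
     cells : List (CellOver B J)
     inside : All (λ C → ∀ x → x ∈ₒ C → X x) cells
     disjoint : AllPairs (λ C D → ∀ x → x ∈ₒ C → ¬ (x ∈ₒ D)) cells
     covers : ∀*ⁿ λ x → X x → Any (x ∈ₒ_) cells
 open Decomposition public

 Decomposable : ∀ n → ℕ → Carrier → Set (Level.suc ℓ ⊔ s)
 Decomposable n r B = ∀ (J : Fin r → Fin n) → Injective J → ∀ {X : K^ n → Set ℓ} →
                      Defⱽ X → DependsP J X → Decomposition B J X

 -- `Decomposable` speaks of one universe; a definable set of any level is first replaced by the
 -- formula that defines it.
 decompose : ∀ {r B} → Decomposable n r B → ∀ {J : Fin r → Fin n} → Injective J →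
             ∀ {X : K^ n → Set a} → Defⱽ X → DependsP J X → Decomposition B J X
 decompose IH {J} inj dX dep =
   let D = IH J inj {X = λ x → Shrink dX (tt , x)} (atⱽ (shrinkᵈ dX) v₀)
             (λ e p → Def.to dX _ (dep e (Def.from dX _ p)))
   in record
   { cells = cells D
   ; inside = All.map (λ h x x∈ → Def.from dX _ (h x x∈)) (inside D)
   ; disjoint = disjoint D
   ; covers = ∀*ⁿ-map (λ x h p → h (Def.to dX _ p)) (covers D)
   }

 clipℕ : ℕ → ℕ → ℕ
 clipℕ b zero = 0
 clipℕ b (suc r) = clipℕ b r ℕ.* (1 ℕ.+ (b ℕ.+ 1)) ℕ.+ (clipℕ b r ℕ.* (b ℕ.+ 1) ℕ.+ 1)

 Clip≈ : ∀ b r → Clip (fromℕ b) r ≈ fromℕ (clipℕ b r)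
 Clip≈ b zero = refl
 Clip≈ b (suc r) = sym (trans (×-homo-+ 1# (cl ℕ.* (1 ℕ.+ (b ℕ.+ 1))) (cl ℕ.* (b ℕ.+ 1) ℕ.+ 1))
   (+-cong (trans (×1-homo-* cl (1 ℕ.+ (b ℕ.+ 1))) (*-cong (sym (Clip≈ b r)) (+-congˡ b+1)))
           (trans (×-homo-+ 1# (cl ℕ.* (b ℕ.+ 1)) 1)
             (+-cong (trans (×1-homo-* cl (b ℕ.+ 1)) (*-cong (sym (Clip≈ b r)) b+1)) (+-identityʳ 1#)))))
   where
   cl = clipℕ b r
   b+1 : fromℕ (b ℕ.+ 1) ≈ fromℕ b + 1#
   b+1 = trans (×-homo-+ 1# b 1) (+-congˡ (+-identityʳ 1#))

 Clip-nonneg : ∀ b r → 0# ≤ Clip (fromℕ b) r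
 Clip-nonneg b r = ≤-trans (fromℕ-nonneg (clipℕ b r)) (inj₂ (sym (Clip≈ b r)))

 -- Walls: nearly affine hypersurfaces x (J colour) = γ x, defined everywhere

 module WallStep {n r} (b : ℕ) (J : Fin (suc r) → Fin n) (J-inj : Injective J)
                 (IH : Decomposable n r (fromℕ b)) where

   private
     E : ℕ
     -- Chosen so that `4 * top n * δ₀`, which is `8 * top n * clipℕ b r * η`, stays below
     -- `E * η = 1`.
     E = suc (8 ℕ.* (top n ℕ.* clipℕ b r))

     1/E : ∃ λ η → 0# < η × fromℕ E * η ≈ 1#
     1/E = inverse (fromℕ-pos (8 ℕ.* (top n ℕ.* clipℕ b r)))

   -- The grid of slopes has width `η`; `ε` allows another `η` for the error of linearisation. On a
   -- cell with bound `b`, slopes up to `ε` give the Lipschitz constant `δ₀`.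
   η ε δ₀ : Carrier
   η = proj₁ 1/E
   ε = η + η
   δ₀ = Clip (fromℕ b) r * ε

   0<η : 0# < η
   0<η = proj₁ (proj₂ 1/E)

   0<ε : 0# < ε
   0<ε = lin 1 (λ η → :0 :< η ⊢ :0 :< η :+ η) 0<η

   0≤δ₀ : 0# ≤ δ₀
   0≤δ₀ = *-nonneg (Clip-nonneg b r) (inj₁ 0<ε)

   -- The error is negligible, even after multiplication by the weights.
   δ₀-small : fromℕ 4 * (fromℕ (top n) * δ₀) ≤ 1#
   δ₀-small = lin 6 (λ T C η e E t → C :≈ e ∷ E :* η :≈ :1 ∷ T :* (C :* (η :+ η)) :≈ T :* (e :* (η :+ η)) ∷
       E :* η :≈ (:1 :+ # 8 :* (T :* e)) :* η ∷ :0 :< η ⊢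
       # 4 :* (T :* (C :* (η :+ η))) :≤ :1)
     {ρ = fromℕ (top n) , Clip (fromℕ b) r , η , fromℕ (clipℕ b r) , fromℕ E , 0# , tt}
     (Clip≈ b r) (proj₂ (proj₂ 1/E)) (*-congˡ (*-congʳ (Clip≈ b r)))
     (*-congʳ (+-congˡ (trans (×1-homo-* 8 (top n ℕ.* clipℕ b r))
       (*-congˡ (×1-homo-* (top n) (clipℕ b r)))))) 0<η

   -- `γ` is defined everywhere, and not only near the piece of boundary from which it comes,
   -- because the heights of all walls are compared at every point. `separate` concerns every weight
   -- that a wall of another colour could have, so no two walls need to be chosen together.
   record Wall : Set (s ⊔ ℓ) where
     field
       colour : Fin (suc r)
       γ : DFun n
       slope : K^ n
       weight : ℕ
       γ-dep : DependsF (J ∘ punchIn colour) (fn γ)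
       slope≤3 : ∀ m → ∣ slope m ∣ ≤ fromℕ 3
       affine : ∀ x y → ∣ (fn γ x - fn γ y) - dot slope (λ i → x i - y i) ∣ ≤ δ₀ * dist x y
       weight∈ : weight ∈ levels n (J colour)
       separate : ∀ j → j ≢ J colour → ∀ {c} → c ∈ levels n j → 1# ≤ ∣ fromℕ c - fromℕ weight * ∣ slope j ∣ ∣
   open Wall public

   height : Wall → K^ n → Carrier
   height w x = x (J (colour w)) - fn (γ w) x

   heightᵈ : ∀ w → Funⱽ (height w)
   heightᵈ w = v₀ (J (colour w)) -ᵈ fnᵈ (γ w)

   punch-inj : ∀ k → Injective (J ∘ punchIn k)
   punch-inj k e = punchIn-injective k _ _ (J-inj e)

   weigh : ∀ k (q : K^ n) → (∀ m → ∣ q m ∣ ≤ fromℕ 3) → ∃ λ θ → θ ∈ levels n (J k) ×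
     (∀ j → j ≢ J k → ∀ {c} → c ∈ levels n j → 1# ≤ ∣ fromℕ c - fromℕ θ * ∣ q j ∣ ∣)
   weigh k q q≤3 = choose-weight n (J k) (λ j → ∣ q j ∣) (λ j → 0≤∣ q j ∣) q≤3

   module _ (k : Fin (suc r)) (δ : DFun n) (δ-dep : DependsF (J ∘ punchIn k) (fn δ)) where

     private
       J′ : Fin r → Fin n
       J′ = J ∘ punchIn k

       -- Slopes off the coordinates `J′` are set to 0, so that the affine part depends on `J′`
       -- only, as `δ` does.
       mask : K^ n → K^ n
       mask q m = If (∃ λ i → J′ i ≡ m) (q m) 0#

       mask-∈ : ∀ q i → mask q (J′ i) ≈ q (J′ i)
       mask-∈ q i = If-yes (i , ≡.refl)

       mask-∉ : ∀ q {m} → (∀ i → J′ i ≢ m) → mask q m ≈ 0#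
       mask-∉ q m∉ = If-no λ (i , e) → m∉ i e

       dot-mask-dep : ∀ q {x y} → Agree J′ x y → dot (mask q) x ≈ dot (mask q) y
       dot-mask-dep q {x} {y} e = sum-cong λ m → by-cases (∃ λ i → J′ i ≡ m)
         (λ { (i , ≡.refl) → *-congˡ (on e i) })
         (λ m∉ → trans (*-congʳ (zero-at m m∉)) (trans (trans (zeroˡ _) (sym (zeroˡ _)))
           (sym (*-congʳ (zero-at m m∉)))))
         where
         zero-at : ∀ m → ¬ (∃ λ i → J′ i ≡ m) → mask q m ≈ 0#
         zero-at m m∉ = mask-∉ q λ i e → m∉ (i , e)

     Piece-of : K^ n → (X : K^ n → Set a) → K^ n → Set (ℓ ⊔ a)
     Piece-of q X x = X x × Near (fn δ) x (mask q) ε × (∀ m → ∣ mask q m ∣ ≤ fromℕ 3)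

     private
       dot-sub : ∀ {n} (q x y : K^ n) → dot q (λ i → x i - y i) ≈ dot q x - dot q y
       dot-sub {zero} q x y = lin 0 (⊢ :0 :≈ :0 :- :0)
       dot-sub {suc n} q x y = lin 6 (λ q x y s a b → s :≈ a :- b ⊢
           q :* (x :- y) :+ s :≈ (q :* x :+ a) :- (q :* y :+ b))
         (dot-sub (q ∘ suc) (x ∘ suc) (y ∘ suc))

       dot-subˡ : ∀ {n} (p q x : K^ n) → dot (λ i → p i - q i) x ≈ dot p x - dot q x
       dot-subˡ {zero} p q x = lin 0 (⊢ :0 :≈ :0 :- :0)
       dot-subˡ {suc n} p q x = lin 6 (λ p q x s a b → s :≈ a :- b ⊢
           (p :- q) :* x :+ s :≈ (p :* x :+ a) :- (q :* x :+ b))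
         (dot-subˡ (p ∘ suc) (q ∘ suc) (x ∘ suc))

       module _ {X : K^ n → Set a} (q : K^ n) (U : CellOver (fromℕ b) J′)
                (U⊂ : ∀ x → x ∈ₒ U → Piece-of q X x) (u₀ : K^ n) (u₀∈ : u₀ ∈ₒ U) where

         -- What remains of `δ` after its affine part is removed has slopes at most `ε` on the cell.
         -- Only this part is extended, so the extension is affine up to `δ₀` on the whole space.
         residue : DFun n
         residue = dfun (λ x → fn δ x - dot (mask q) x) (fnᵈ δ -ᵈ sumᵈ λ i → constᵈ *ᵈ v₀ i)

         residue-dep : DependsF J′ (fn residue)
         residue-dep e = +-cong (δ-dep e) (-‿cong (dot-mask-dep q e))

         residue-lip : ∀ x → x ∈ₒ U → Lip (fn residue) ε x
         residue-lip x x∈ = Nbhd-map (λ y h → ≤-trans (inj₂ (∣∣-cong (lin 5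
             (λ dy dx my mx d → d :≈ my :- mx ⊢ (dy :- my) :- (dx :- mx) :≈ (dy :- dx) :- d)
             (dot-sub (mask q) y x)))) h)
           (proj₁ (proj₂ (U⊂ x x∈)))

         lipschitz : ∀ x y → x ∈ₒ U → y ∈ₒ U → ∣ fn residue x - fn residue y ∣ ≤ δ₀ * dist x y
         lipschitz = cell-lipschitz (fromℕ-nonneg b) (valid U) (fnᵈ residue) (depends-order U residue-dep)
           (inj₁ 0<ε) residue-lip

         open Extend {U = _∈ₒ U} (∈ᶜᵈ (cell U)) (∈ₒ-depends U)
           residue residue-dep 0≤δ₀ lipschitz u₀ u₀∈

         q≤3 : ∀ m → ∣ mask q m ∣ ≤ fromℕ 3
         q≤3 = proj₂ (proj₂ (U⊂ u₀ u₀∈))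

         wall : Wall
         wall = record
           { colour = k
           ; γ = dfun (λ x → fn extension x + dot (mask q) x) (fnᵈ extension +ᵈ sumᵈ λ i → constᵈ *ᵈ v₀ i)
           ; slope = mask q
           ; weight = proj₁ (weigh k (mask q) q≤3)
           ; γ-dep = λ e → +-cong (extension-depends e) (dot-mask-dep q e)
           ; slope≤3 = q≤3
           ; affine = λ x y → ≤-trans (inj₂ (∣∣-cong (lin 5 (λ ex ey mx my d → d :≈ mx :- my ⊢
                 ((ex :+ mx) :- (ey :+ my)) :- d :≈ ex :- ey)
               (dot-sub (mask q) x y)))) (extension-lip x y)
           ; weight∈ = proj₁ (proj₂ (weigh k (mask q) q≤3))
           ; separate = proj₂ (proj₂ (weigh k (mask q) q≤3))
           }

         wall-on : ∀ x → x ∈ₒ U → fn (γ wall) x ≈ fn δ x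
         wall-on x x∈ = trans (+-congʳ (extension-agrees x x∈)) (lin 2 (λ d m → ⊢ d :- m :+ m :≈ d))

     Carries : K^ n → Wall → Set ℓ
     Carries x w = colour w ≡ k × fn (γ w) x ≈ fn δ x

     open Collect {W = Wall} ℓ

     -- The induction hypothesis is needed because nearly constant slopes make a function nearly
     -- affine only on a set whose points can be joined by short paths: cells with bounded slopes
     -- are such sets, by `cell-lipschitz`.
     walls-through : ∀ {X : K^ n → Set a} → Defⱽ X → DependsP J′ X →
       (∀*ⁿ λ x → X x → Lip (fn δ) (fromℕ 3) x) →
       ∃ λ ws → ∀*ⁿ λ x → X x → Any (Carries x) ws
     walls-through {X = X} dX X-dep lip = ws , ∀*ⁿ-map₂ (Allᵈ slopes λ q → pieceᵈ q →ᵈ Anyᵈ ws carriesᵈ)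
         (λ x h g p → let f , piece = All.lookupAny h (g p) in f piece)
         (∀*ⁿ-All (λ q → pieceᵈ q →ᵈ Anyᵈ ws carriesᵈ) (proj₂ by-grid))
         (∀*ⁿ-map₂ (Regularᵈ δ) (λ x r l p → in-grid x r p (l p)) (∀*ⁿ-regular δ) lip)
       where
       slopes : List (K^ n)
       slopes = choices (λ _ → grid η E)

       pieceᵈ : ∀ q → Defⱽ (Piece-of q X)
       pieceᵈ q = dX ×ᵈ
         Nbhdᵈ (∣ (appⱽ (fnᵈ δ) v₀ -ᵈ appⱽ (fnᵈ δ) v₁) -ᵈ (sumᵈ λ i → constᵈ *ᵈ (v₀ i -ᵈ v₁ i)) ∣ᵈ
           ≤ᵈ (constᵈ *ᵈ distᵈ v₁ v₀)) v₀ ×ᵈ constᵖ _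

       carriesᵈ : ∀ w → Defⱽ (λ x → Carries x w)
       carriesᵈ w = constᵖ _ ×ᵈ fnᵈ (γ w) ≈ᵈ fnᵈ δ

       piece-dep : ∀ q → DependsP J′ (Piece-of q X)
       piece-dep q e (p , near , c) = X-dep e p , Near-depends δ δ-dep e near , c

       CarriedOn : K^ n → CellOver (fromℕ b) J′ → List Wall → Set _
       CarriedOn q U ws = (∀ x → x ∈ₒ U → Piece-of q X x) → ∀ x → x ∈ₒ U → Any (Carries x) ws

       on-cell : ∀ q U → ∃ (CarriedOn q U)
       -- An empty cell needs no wall, and has no point `u` to bound the values in the extension
       -- formula.
       on-cell q U = by-cases ((∃ λ u → u ∈ₒ U) × (∀ x → x ∈ₒ U → Piece-of q X x)) known
         (λ ¬h → [] , λ U⊂ x x∈ → ⊥-elim (¬h ((x , x∈) , U⊂)))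
         where
         known : (∃ λ u → u ∈ₒ U) × (∀ x → x ∈ₒ U → Piece-of q X x) → ∃ (CarriedOn q U)
         known ((u , u∈) , U⊂) = wall q U U⊂ u u∈ ∷ [] , λ _ x x∈ → here (≡.refl , wall-on q U U⊂ u u∈ x x∈)

       CarriedAlmost : K^ n → List Wall → Set _
       CarriedAlmost q ws = ∀*ⁿ λ x → Piece-of q X x → Any (Carries x) ws

       on-piece : ∀ q → ∃ (CarriedAlmost q)
       on-piece q = ws , ∀*ⁿ-map (λ x cov p →
           let (h , U⊂) , x∈ = All.lookupAny both (cov p) in h U⊂ x x∈) (covers D)
         where
         D : Decomposition (fromℕ b) J′ (Piece-of q X)
         D = decompose IH (punch-inj k) (pieceᵈ q) (piece-dep q)
         collected : ∃ λ ws → All (λ U → CarriedOn q U ws) (cells D)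
         collected = collect-list {Q = CarriedOn q} (λ U mono h U⊂ x x∈ → mono (h U⊂ x x∈)) (on-cell q) (cells D)
         ws : List Wall
         ws = proj₁ collected
         both : All (λ U → CarriedOn q U ws × (∀ x → x ∈ₒ U → Piece-of q X x)) (cells D)
         both = All.zip (proj₂ collected , inside D)

       by-grid : ∃ λ ws → All (λ q → CarriedAlmost q ws) slopes
       by-grid = collect-list {Q = CarriedAlmost} (λ q mono → ∀*ⁿ-map λ x h p → mono (h p)) on-piece slopes

       ws : List Wall
       ws = proj₁ by-grid

       in-grid : ∀ x → Regular δ x → X x → Lip (fn δ) (fromℕ 3) x → Any (λ q → Piece-of q X x) slopes
       in-grid x reg p l = Any.map (λ {q} close → p , near q close , bounded q close)
         (∈-choices {P = λ m g → ∣ g ∣ ≤ fromℕ 3 × ∣ gradient δ x m - g ∣ ≤ η}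
           λ m → ∈-grid {E = E} 0<η (proj₂ (proj₂ 1/E)) (slopes≤3 m))
         where
         diff : ∀ m → Differentiable (fn δ) m x
         diff m = proj₁ (Nbhd-centre reg m)
         slopes≤3 : ∀ m → ∣ gradient δ x m ∣ ≤ fromℕ 3
         slopes≤3 m = lip⇒partial (fnᵈ δ) l (∂-spec δ m (diff m))
         Close : K^ n → Set ℓ
         Close q = ∀ m → ∣ q m ∣ ≤ fromℕ 3 × ∣ gradient δ x m - q m ∣ ≤ η
         bounded : ∀ q → Close q → ∀ m → ∣ mask q m ∣ ≤ fromℕ 3
         bounded q close m = by-cases (∃ λ i → J′ i ≡ m)
           (λ { (i , ≡.refl) → ≤-trans (inj₂ (∣∣-cong (mask-∈ q i))) (proj₁ (close m)) })
           (λ m∉ → ≤-trans (inj₂ (∣∣-zero (mask-∉ q λ i e → m∉ (i , e)))) (fromℕ-nonneg 3))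
         masked-close : ∀ q → Close q → ∀ m → ∣ gradient δ x m - mask q m ∣ ≤ η
         masked-close q close m = by-cases (∃ λ i → J′ i ≡ m)
           (λ { (i , ≡.refl) → ≤-trans (inj₂ (∣∣-cong (+-congˡ (-‿cong (mask-∈ q i))))) (proj₂ (close m)) })
           (λ m∉ → ≤-trans (inj₂ (∣∣-zero (lin 2 (λ a b → a :≈ :0 ∷ b :≈ :0 ⊢ a :- b :≈ :0)
               (∂-free δ δ-dep (λ i e → m∉ (i , e)) (diff m)) (mask-∉ q λ i e → m∉ (i , e)))))
             (inj₁ 0<η))
         near : ∀ q → Close q → Near (fn δ) x (mask q) ε
         near q close = Nbhd-map (λ y h → ≤-trans (≤-trans (inj₂ (∣∣-cong (lin 4 (λ A D M e → e :≈ D :- M ⊢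
                 A :- M :≈ (A :- D) :+ e) (dot-subˡ (gradient δ x) (mask q) _))))
               (∣+∣ _ _))
             (lin 4 (λ a b η d → a :≤ η :* d ∷ b :≤ η :* d ⊢ a :+ b :≤ (η :+ η) :* d)
               h (dot-bound {q = λ m → gradient δ x m - mask q m} {x} {y} (masked-close q close))))
           (regular⇒near δ reg η 0<η)

   module _ (k k′ : Fin (suc r)) (k≢k′ : k ≢ k′) (β : DFun n)
            (β-dep : DependsF (J ∘ punchIn k) (fn β)) where

     private
       open SwapOver J J-inj k k′ k≢k′ β β-dep

       l : Fin n
       l = J k′

       open Collect {W = Wall} ℓ

       Covered : DFun n → List Wall → K^ n → Set (s ⊔ ℓ)
       Covered δ ws y = On δ y → Any (λ w → colour w ≡ k′ × fn (γ w) y ≈ fn δ y) ws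

       Coveredᵈ : ∀ δ ws → Defⱽ (Covered δ ws)
       Coveredᵈ δ ws = Onᵈ δ →ᵈ Anyᵈ ws λ w → constᵖ _ ×ᵈ fnᵈ (γ w) ≈ᵈ fnᵈ δ

       opaque
        covering : ∀ δ → DependsF (J ∘ punchIn k′) (fn δ) → ∃ λ ws → ∀*ⁿ (Covered δ ws)
        covering δ dep = walls-through k′ δ dep {X = On δ} (Onᵈ δ) (On-dep δ dep) (branch-lip δ)

       Canonical′ : DFun n → Set ℓ
       Canonical′ δ = ∀ x y → Agree (J ∘ punchIn k′) x y → fn δ x ≈ fn δ y

       CoveredIfDep : DFun n → List Wall → Set (s ⊔ ℓ)
       CoveredIfDep δ ws = Canonical′ δ → ∀*ⁿ (Covered δ ws)

       covering′ : ∀ δ → ∃ (CoveredIfDep δ)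
       covering′ δ = by-cases (Canonical′ δ) (λ dep → Prod.map₂ (λ h _ → h) (covering δ (dep _ _)))
         (λ ¬dep → [] , λ dep → ⊥-elim (¬dep dep))

       collected : ∃ λ ws → All (λ δ → CoveredIfDep δ ws) branches
       collected = collect-list (λ δ mono h dep → ∀*ⁿ-map (λ y h y∈ → mono (h y∈)) (h dep))
         covering′ branches

       ws : List Wall
       ws = proj₁ collected

       all-covered : ∀*ⁿ λ y → All (λ δ → Covered δ ws y) branches
       all-covered = ∀*ⁿ-All (λ δ → Coveredᵈ δ ws)
         (All.zipWith (λ {δ} (h , c) → h λ x y → canonical⇒dep {δ} c) (proj₂ collected , branches-canonical))

       covered-free : All (Canonical Swapped) branches → ∀ y t →
         All (λ δ → Covered δ ws y) branches → All (λ δ → Covered δ ws (y [ l ≔ t ])) branches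
       covered-free canonical y t hs = All.zipWith (λ {δ} (c , h) y∈ → Any.map
           (λ { {w} (≡.refl , eq) → ≡.refl , trans (γ-dep w free)
                 (trans eq (canonical⇒dep {δ} c (Agree-sym free))) })
           (h (On-dep δ (canonical⇒dep {δ} c) free y∈)))
         (canonical , hs)
         where
         free : Agree (J ∘ punchIn k′) (y [ l ≔ t ]) y
         free = agree λ m → upd-other y (punch≢ J-inj k′ m)

     Meets : List Wall → K^ n → Set (s ⊔ ℓ)
     Meets ws y = Any (λ w → colour w ≡ k′ × height w y ≈ 0#) ws

     -- The branches of the exchanged graph have Lipschitz constant 3 and are covered by walls over
     -- almost all `y`. As these covers do not depend on the coordinate `l` of `y`, `transfer`
     -- brings the statement back to almost all `x`.
     steep⇒wall : ∃ λ ws → ∀*ⁿ λ x → Steep β l x → Meets ws (x [ J k ≔ fn β x ])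
     steep⇒wall = ws , ∀*ⁿ-map (λ x h st → meet x st (byContradiction (h st)))
       (transfer {N = λ y → ¬ All (λ δ → Covered δ ws y) branches} (¬ᵈ Allᵈ branches λ δ → Coveredᵈ δ ws)
         (λ y t n h → n (covered-free branches-canonical y t h))
         (∀*ⁿ-map (λ y h n → n h) all-covered))
       where
       meet : ∀ x → Steep β l x → All (λ δ → Covered δ ws (x [ J k ≔ fn β x ])) branches →
              Meets ws (x [ J k ≔ fn β x ])
       meet x st hs =
         let h , e , on = All.lookupAny hs (on-branch x st) in
         Any.map (λ { (≡.refl , eq) → ≡.refl ,
           lin 3 (λ y g d → y :≈ d ∷ g :≈ d ⊢ y :- g :≈ :0) e eq }) (h on)

 -- Properties that hold near a point of K

 Ev : (Carrier → Set a) → Carrier → Set (ℓ ⊔ a)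
 Ev P t = ∃ λ δ → 0# < δ × (∀ s → ∣ s - t ∣ < δ → P s)

 Ev-map : {P : Carrier → Set a} {Q : Carrier → Set b} {t : Carrier} → (∀ s → P s → Q s) → Ev P t → Ev Q t
 Ev-map f (δ , 0<δ , h) = δ , 0<δ , λ s s∈ → f s (h s s∈)

 Ev-× : {P : Carrier → Set a} {Q : Carrier → Set b} {t : Carrier} → Ev P t → Ev Q t → Ev (λ s → P s × Q s) t
 Ev-× (δ , 0<δ , h) (δ′ , 0<δ′ , h′) =
   let m , 0<m , m≤δ , m≤δ′ = positive-minimum 0<δ 0<δ′ in
   m , 0<m , λ s s∈ → h s (<-≤-trans s∈ m≤δ) , h′ s (<-≤-trans s∈ m≤δ′)

 Ev-All : ∀ {A : Set b} {P : A → Carrier → Set a} {t} cs →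
          All (λ c → Ev (P c) t) cs → Ev (λ s → All (λ c → P c s) cs) t
 Ev-All [] [] = 1# , 0<1 , λ s _ → []
 Ev-All (c ∷ cs) (h ∷ hs) = Ev-map (λ s (p , ps) → p ∷ ps) (Ev-× h (Ev-All cs hs))

 near-window : ∀ {x y t δ} → x < t → t < y → 0# < δ → ∃₂ λ x′ y′ → x′ < t × t < y′ ×
               x ≤ x′ × y′ ≤ y × (∀ u → x′ < u → u < y′ → ∣ u - t ∣ < δ)
 near-window {x} {y} {t} {δ} x<t t<y 0<δ =
   let x′ , x≤ , t-δ≤ , x′< = larger x (t - δ)
       y′ , ≤y , ≤t+δ , <y′ = smaller y (t + δ)
   in x′ , y′ , x′< x<t (lin 2 (λ t δ → :0 :< δ ⊢ t :- δ :< t) 0<δ) ,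
      <y′ t<y (lin 2 (λ t δ → :0 :< δ ⊢ t :< t :+ δ) 0<δ) , x≤ , ≤y ,
      λ u x′<u u<y′ → ∣∣-< (lin 4 (λ t δ y u → y :≤ t :+ δ ∷ u :< y ⊢ u :- t :< δ) ≤t+δ u<y′)
        (lin 4 (λ t δ x u → t :- δ :≤ x ∷ x :< u ⊢ :- (u :- t) :< δ) t-δ≤ x′<u)

 Boundary-Ev : {P : Carrier → Set a} {Q : Carrier → Set b} {t : Carrier} →
               Ev (λ s → (P s → Q s) × (Q s → P s)) t → Boundary P t → Boundary Q t
 Boundary-Ev (δ , 0<δ , h) bd x y x<t t<y =
   let x′ , y′ , x′<t , t<y′ , x≤ , ≤y , close = near-window x<t t<y 0<δ
       (u , x′<u , u<y′ , p) , (w , x′<w , w<y′ , ¬p) = bd x′ y′ x′<t t<y′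
   in (u , ≤-<-trans x≤ x′<u , <-≤-trans u<y′ ≤y , proj₁ (h u (close u x′<u u<y′)) p) ,
      (w , ≤-<-trans x≤ x′<w , <-≤-trans w<y′ ≤y , λ q → ¬p (proj₂ (h w (close w x′<w w<y′)) q))

 Boundary-¬Ev : {P : Carrier → Set a} {t : Carrier} → Ev (λ s → ¬ P s) t → ¬ Boundary P t
 Boundary-¬Ev {t = t} (δ , 0<δ , h) bd =
   let x′ , y′ , x′<t , t<y′ , _ , _ , close = near-window {t - 1#} {t + 1#} x-1<x x<x+1 0<δ
       (u , x′<u , u<y′ , p) , _ = bd x′ y′ x′<t t<y′
   in h u (close u x′<u u<y′) p

 -- The zero set of a function that is steep in one coordinate

 module Root (F : DFun n) (j : Fin n) {M} (0≤M : 0# ≤ M)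
   (lower : ∀ x s t → ∣ s - t ∣ ≤ fromℕ 2 * ∣ fn F (x [ j ≔ s ]) - fn F (x [ j ≔ t ]) ∣)
   (upper : ∀ x y → ∣ fn F x - fn F y ∣ ≤ M * dist x y) where

   Zero : K^ n → Carrier → Set ℓ
   Zero x t = fn F (x [ j ≔ t ]) ≈ 0#

   zero-unique : ∀ {x s t} → Zero x s → Zero x t → s ≈ t
   zero-unique {x} {s} {t} p q = ≤-antisym
     (lin 3 (λ s t m → s :- t :≤ m ∷ m :≤ :0 ⊢ s :≤ t) (x≤∣x∣ (s - t)) vanish)
     (lin 3 (λ s t m → :- (s :- t) :≤ m ∷ m :≤ :0 ⊢ t :≤ s) (-x≤∣x∣ (s - t)) vanish)
     where
     vanish : ∣ s - t ∣ ≤ 0#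
     vanish = ≤-trans (lower x s t) (lin 1 (λ m → m :≈ :0 ⊢ # 2 :* m :≤ :0)
       (∣∣-zero (lin 2 (λ a b → a :≈ :0 ∷ b :≈ :0 ⊢ a :- b :≈ :0) p q)))

   private
     ZeroOr0 : K^ n → Carrier → Set ℓ
     ZeroOr0 x t = Zero x t ⊎ ¬ ∃ (Zero x) × t ≈ 0#

     Zeroᵈ : {v : ⟪ Γ ⟫ → K^ n} {t : ⟪ Γ ⟫ → Carrier} → DefV v → DefF t → Def (λ ρ → Zero (v ρ) (t ρ))
     Zeroᵈ dv dt = appⱽ (fnᵈ F) (updᵈ dv j dt) ≈ᵈ constᵈ

     value : ∀ x → ∃ (ZeroOr0 x)
     value x = by-cases (∃ (Zero x)) (λ (t , z) → t , inj₁ z) (λ ∄z → 0# , inj₂ (∄z , refl))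

     unique : ∀ x {s t} → ZeroOr0 x s → ZeroOr0 x t → s ≈ t
     unique x (inj₁ p) (inj₁ q) = zero-unique {x} p q
     unique x {s} (inj₁ p) (inj₂ (∄z , _)) = ⊥-elim (∄z (s , p))
     unique x {s} {t} (inj₂ (∄z , _)) (inj₁ q) = ⊥-elim (∄z (t , q))
     unique x (inj₂ (_ , e)) (inj₂ (_ , e′)) = trans e (sym e′)

   root : DFun n
   root = dfun (λ x → proj₁ (value x)) (uniqueᵈ (Zeroᵈ v₁ s₀ ⊎ᵈ ¬ᵈ (∃ᵈ (Zeroᵈ v₂ s₀)) ×ᵈ s₀ ≈ᵈ constᵈ)
     (λ ρ → proj₂ (value (proj₂ ρ))) (λ ρ {s} {t} → unique (proj₂ ρ) {s} {t}))

   root-spec : ∀ {x t} → Zero x t → t ≈ fn root x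
   root-spec {x} {t} z = unique x {t} (inj₁ z) (proj₂ (value x))

   root-zero : ∀ {x} → ∃ (Zero x) → Zero x (fn root x)
   root-zero {x} (t , z) = trans (congⱽ (fnᵈ F) (upd-cong j ≋-refl (sym (root-spec {x} {t} z)))) z

   root-depends : ∀ {r} {J : Fin r → Fin n} →
     (∀ x y t → Agree J x y → fn F (x [ j ≔ t ]) ≈ fn F (y [ j ≔ t ])) → DependsF J (fn root)
   root-depends F-dep {x} {y} e = unique y {fn root x} {fn root y} (move {fn root x} (proj₂ (value x))) (proj₂ (value y))
     where
     move : ∀ {t} → ZeroOr0 x t → ZeroOr0 y t
     move {t} (inj₁ z) = inj₁ (trans (sym (F-dep x y t e)) z)
     move {t} (inj₂ (∄z , e′)) = inj₂ ((λ (t , z) → ∄z (t , trans (F-dep x y t e) z)) , e′)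

   -- Both roots are compared at `y`: there `F` vanishes at its own root, and at the root of `x` it
   -- is at most `M * dist x y`, by comparison with its value 0 at `x`. Then `lower` costs the
   -- factor 2.
   root-lip : ∀ {x} → Nbhd (λ y → ∃ (Zero y)) x → Lip (fn root) (fromℕ 2 * M) x
   root-lip {x} near = Nbhd-map (λ y z → lipschitz y z) near
     where
     zx : Zero x (fn root x)
     zx = root-zero (Nbhd-centre near)
     lipschitz : ∀ y → ∃ (Zero y) → ∣ fn root y - fn root x ∣ ≤ fromℕ 2 * M * dist x y
     lipschitz y z = ≤-trans (lower y (fn root y) (fn root x))
       (lin 5 (λ a b M d e → a :≤ b ∷ b :≤ M :* e ∷ M :* e :≤ M :* d ⊢ # 2 :* a :≤ # 2 :* M :* d)
         (inj₂ (∣∣-cong (lin 3 (λ a b c → a :≈ :0 ∷ c :≈ :0 ⊢ a :- b :≈ c :- b) (root-zero z) zx)))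
         (upper _ _)
         (*-monoˡ-≤ 0≤M (≤-trans (dist-upd≤ x y j (fn root x) (fn root x))
           (lin 2 (λ d m → m :≈ :0 ⊢ d :+ m :≤ d) (∣∣-zero (-‿inverseʳ (fn root x)))))))

   root-good : ∀*ⁿ λ x → ∃ (Zero x) → Good (fromℕ 2 * M) root x
   root-good = ∀*ⁿ-map₂ (Regularᵈ root) (λ x r near z → good-lip⇒good root r (root-lip (near z)))
     (∀*ⁿ-regular root) (∀*ⁿ-interior (∃ᵈ (Zeroᵈ v₁ s₀)))

   zeros-small : ∀*ⁿ λ x → ¬ (fn F x ≈ 0#)
   zeros-small = ∀*ⁿ-update⁻ (¬ᵈ (fnᵈ F ≈ᵈ constᵈ)) j
     (∀*ⁿ-all λ x → ∀*-map (λ t t≉ z → t≉ (root-spec z)) (≉-∀* (fn root x)))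

 -- Points at which two walls have the same weighted height

 module Ties {n r} (b : ℕ) (J : Fin (suc r) → Fin n) (J-inj : Injective J)
             (IH : Decomposable n r (fromℕ b)) (b-large : 20 ℕ.* top n ℕ.≤ b) where

   open WallStep b J J-inj IH public

   private
     T : Carrier
     T = fromℕ (top n)

     1≤T : 1# ≤ T
     1≤T = ≤-trans (inj₂ (sym (+-identityʳ 1#))) (fromℕ-mono (1≤top n))

     0≤T : 0# ≤ T
     0≤T = fromℕ-nonneg (top n)

     δ₀≤1 : δ₀ ≤ 1#
     δ₀≤1 = lin 2 (λ T d → # 4 :* (T :* d) :≤ :1 ∷ :0 :≤ (T :- :1) :* d ∷ :0 :≤ d ⊢ d :≤ :1)
       δ₀-small (*-nonneg (lin 1 (λ T → :1 :≤ T ⊢ :0 :≤ T :- :1) 1≤T) 0≤δ₀) 0≤δ₀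

   height-dep : ∀ w → DependsF J (height w)
   height-dep w e = +-cong (on e (colour w)) (-‿cong (γ-dep w (agree λ m → on e (punchIn (colour w) m))))

   -- 5 = 1 + 1 + 3: the coordinate itself, the deviation of `γ` from its affine part (`δ₀ ≤ 1`),
   -- and the slopes of the affine part.
   height-lip : ∀ w x y → ∣ height w x - height w y ∣ ≤ fromℕ 5 * dist x y
   height-lip w x y = ≤-trans (≤-trans (inj₂ (∣∣-cong (lin 5 (λ xj yj gx gy D → ⊢
         (xj :- gx) :- (yj :- gy) :≈ (xj :- yj) :+ (:- ((gx :- gy) :- D) :+ :- D)))))
       (≤-trans (∣+∣ _ _) (lin 3 (λ a b m → m :≤ b ⊢ a :+ m :≤ a :+ b)
         {ρ = ∣ x (J (colour w)) - y (J (colour w)) ∣ , _ , _ , tt} (∣+∣ _ _))))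
     (lin 5 (λ a b c d m → a :≤ d ∷ b :≤ d ∷ c :≤ # 3 :* d ⊢ a :+ (b :+ c) :≤ # 5 :* d)
       {ρ = _ , _ , _ , dist x y , 0# , tt}
       (coord≤dist x y (J (colour w)))
       (≤-trans (neg _) (≤-trans (affine w x y)
         (≤-trans (*-monoʳ-≤ (0≤dist x y) δ₀≤1) (inj₂ (*-identityˡ _)))))
       (≤-trans (neg _) (≤-trans (dot-bound {q = slope w} {y} {x} (slope≤3 w))
         (inj₂ (*-congˡ (dist-sym y x))))))
     where
     neg : ∀ z → ∣ - z ∣ ≤ ∣ z ∣
     neg z = ∣∣-≤ (-x≤∣x∣ z) (≤-trans (lin 1 (λ x → ⊢ :- (:- x) :≤ x)) (x≤∣x∣ z))

   Wt : Wall → Carrier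
   Wt w = fromℕ (weight w)

   Wt≤T : ∀ w → Wt w ≤ T
   Wt≤T w = fromℕ-mono (level≤top n (J (colour w)) (weight∈ w))

   0≤Wt : ∀ w → 0# ≤ Wt w
   0≤Wt w = fromℕ-nonneg (weight w)

   0<Wt : ∀ w → 0# < Wt w
   0<Wt w = <-≤-trans (fromℕ-pos 8) (fromℕ-mono (level≥9 n (J (colour w)) (weight∈ w)))

   -- Equal scores mean that the weighted heights agree up to sign; `σ` takes care of the sign.
   module Tie (v w : Wall) (v≢w : colour w ≢ colour v) {σ} (σ=±1 : σ ≈ 1# ⊎ σ ≈ - 1#) where

     private
       j : Fin n
       j = J (colour v)

       p q : Carrier
       p = Wt v
       q = σ * Wt w

       ∣σ∣ : ∀ z → ∣ σ * z ∣ ≈ ∣ z ∣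
       ∣σ∣ z = trans (∣*∣ σ z) (trans (*-congʳ (unit σ=±1)) (*-identityˡ _))
         where
         unit : σ ≈ 1# ⊎ σ ≈ - 1# → ∣ σ ∣ ≈ 1#
         unit (inj₁ e) = trans (∣∣-cong e) (∣∣-pos (inj₁ 0<1))
         unit (inj₂ e) = trans (trans (∣∣-cong e) (∣∣-neg (lin 0 (:0 :< :1 ⊢ :- :1 :≤ :0) 0<1)))
           (lin 0 (⊢ :- (:- :1) :≈ :1))

     tie : DFun n
     tie = dfun (λ x → p * height v x + q * height w x) ((constᵈ *ᵈ heightᵈ v) +ᵈ (constᵈ *ᵈ heightᵈ w))

     private
       M : Carrier
       M = fromℕ 10 * T

       0≤M : 0# ≤ M
       0≤M = *-nonneg (fromℕ-nonneg 10) 0≤T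

       upper : ∀ x y → ∣ fn tie x - fn tie y ∣ ≤ M * dist x y
       upper x y = ≤-trans (≤-trans (inj₂ (∣∣-cong (lin 6 (λ p q a b c d → ⊢
           (p :* a :+ q :* b) :- (p :* c :+ q :* d) :≈ p :* (a :- c) :+ q :* (b :- d)))))
           (∣+∣ _ _))
         (lin 4 (λ a b T d → a :≤ T :* (# 5 :* d) ∷ b :≤ T :* (# 5 :* d) ⊢ a :+ b :≤ # 10 :* T :* d)
           (bound-p) (bound-q))
         where
         bound-p : ∣ p * (height v x - height v y) ∣ ≤ T * (fromℕ 5 * dist x y)
         bound-p = ≤-trans (inj₂ (trans (∣*∣ p _) (*-congʳ (∣∣-pos (0≤Wt v)))))
           (≤-trans (*-monoˡ-≤ (0≤Wt v) (height-lip v x y))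
             (*-monoʳ-≤ (*-nonneg (fromℕ-nonneg 5) (0≤dist x y)) (Wt≤T v)))
         bound-q : ∣ q * (height w x - height w y) ∣ ≤ T * (fromℕ 5 * dist x y)
         bound-q = ≤-trans (inj₂ (trans (∣*∣ q _) (*-congʳ (trans (∣σ∣ (Wt w)) (∣∣-pos (0≤Wt w))))))
           (≤-trans (*-monoˡ-≤ (0≤Wt w) (height-lip w x y))
             (*-monoʳ-≤ (*-nonneg (fromℕ-nonneg 5) (0≤dist x y)) (Wt≤T w)))

       -- `q * y` is `Wt w * ∣ y ∣` up to sign. With sign plus this is the hypothesis; with sign
       -- minus two nonnegative terms are added, and their sum is no smaller than the absolute value
       -- of their difference.
       separated : ∀ y → 1# ≤ ∣ p - Wt w * ∣ y ∣ ∣ → 1# ≤ ∣ p - q * y ∣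
       separated y h = go σ=±1 (by-cases (0# ≤ y) inj₁ (λ n → inj₂ (inj₁ (≰⇒> n))))
         where
         minus : ∀ {u} → p - q * y ≈ u → 1# ≤ ∣ u ∣ → 1# ≤ ∣ p - q * y ∣
         minus e k = ≤-trans k (inj₂ (∣∣-cong (sym e)))
         plus : 1# ≤ ∣ p + Wt w * ∣ y ∣ ∣
         plus = ≤-trans h (≤-trans (∣∣-≤
             (lin 2 (λ p m → :0 :≤ m ⊢ p :- m :≤ p :+ m) (*-nonneg (0≤Wt w) (0≤∣ y ∣)))
             (lin 2 (λ p m → :0 :≤ p ⊢ :- (p :- m) :≤ p :+ m) (0≤Wt v)))
           (x≤∣x∣ _))
         go : σ ≈ 1# ⊎ σ ≈ - 1# → 0# ≤ y ⊎ y ≤ 0# → 1# ≤ ∣ p - q * y ∣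
         go (inj₁ e) (inj₁ y≥0) = minus (+-congˡ (-‿cong (*-cong
           (trans (*-congʳ e) (*-identityˡ _)) (sym (∣∣-pos y≥0))))) h
         go (inj₁ e) (inj₂ y≤0) = minus (lin 5 (λ p s W y m →
             s :* W :* y :≈ :1 :* W :* y ∷ W :* m :≈ W :* (:- y) ⊢ p :- s :* W :* y :≈ p :+ W :* m)
           (*-congʳ (*-congʳ e)) (*-congˡ (∣∣-neg y≤0))) plus
         go (inj₂ e) (inj₁ y≥0) = minus (lin 5 (λ p s W y m →
             s :* W :* y :≈ (:- :1) :* W :* y ∷ W :* m :≈ W :* y ⊢ p :- s :* W :* y :≈ p :+ W :* m)
           (*-congʳ (*-congʳ e)) (*-congˡ (∣∣-pos y≥0))) plus
         go (inj₂ e) (inj₂ y≤0) = minus (lin 5 (λ p s W y m →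
             s :* W :* y :≈ (:- :1) :* W :* y ∷ W :* m :≈ W :* (:- y) ⊢ p :- s :* W :* y :≈ p :- W :* m)
           (*-congʳ (*-congʳ e)) (*-congˡ (∣∣-neg y≤0))) h

       -- Along the axis of `v` its height changes by exactly `s - t`, since `γ v` ignores this
       -- axis, and the height of `w` by its slope times that, up to `δ₀`. So the tie changes at
       -- rate `slant`, at least 1 in absolute value, with an error of at most 1/4; the constant 2
       -- leaves room.
       lower : ∀ x s t → ∣ s - t ∣ ≤ fromℕ 2 * ∣ fn tie (x [ j ≔ s ]) - fn tie (x [ j ≔ t ]) ∣
       lower x s t = estimate
         where
         y z : K^ n
         y = x [ j ≔ s ]
         z = x [ j ≔ t ]
         A err slant : Carrier
         A = fn tie y - fn tie z
         slant = p - q * slope w j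
         err = (fn (γ w) y - fn (γ w) z) - dot (slope w) (λ i → y i - z i)
         dot≈ : dot (slope w) (λ i → y i - z i) ≈ slope w j * (s - t)
         dot≈ = trans (dot-upd (slope w) x x j refl)
           (trans (+-congʳ (trans (sum-cong λ i → trans (*-congˡ (-‿inverseʳ (x i))) (zeroʳ _)) (sum-0 {n})))
             (+-identityˡ _))
           where
           sum-0 : ∀ {m} → sum {m} (λ _ → 0#) ≈ 0#
           sum-0 {zero} = refl
           sum-0 {suc m} = trans (+-identityˡ _) (sum-0 {m})
         hv : height v y - height v z ≈ s - t
         hv = lin 6 (λ yj zj gy gz s t → yj :≈ s ∷ zj :≈ t ∷ gy :≈ gz ⊢ (yj :- gy) :- (zj :- gz) :≈ s :- t)
           (upd-same x j) (upd-same x j)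
           (γ-dep v (agree λ m → trans (upd-other x (punch≢ J-inj (colour v) m))
             (sym (upd-other x (punch≢ J-inj (colour v) m)))))
         hw : height w y - height w z ≈ - (slope w j * (s - t) + err)
         hw = lin 6 (λ yj zj gy gz D S → yj :≈ zj ∷ D :≈ S ⊢
             (yj :- gy) :- (zj :- gz) :≈ :- (S :+ ((gy :- gz) :- D)))
           (trans (upd-other x (v≢w ∘ J-inj)) (sym (upd-other x (v≢w ∘ J-inj)))) dot≈
         A≈ : slant * (s - t) ≈ A + q * err
         A≈ = lin 10 (λ p q a b c d S st err z →
             p :* (a :- c) :≈ p :* st ∷ q :* (b :- d) :≈ q :* (:- (S :* st :+ err)) ⊢
             (p :- q :* S) :* st :≈ ((p :* a :+ q :* b) :- (p :* c :+ q :* d)) :+ q :* err)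
           {ρ = p , q , height v y , height w y , height v z , height w z , slope w j , s - t , err , 0# , tt}
           (*-congˡ hv) (*-congˡ hw)
         err≤ : ∣ q * err ∣ ≤ T * (δ₀ * ∣ s - t ∣)
         err≤ = ≤-trans (inj₂ (trans (∣*∣ q err) (*-congʳ (trans (∣σ∣ (Wt w)) (∣∣-pos (0≤Wt w))))))
           (≤-trans (*-monoˡ-≤ (0≤Wt w) (≤-trans (affine w y z) (inj₂ (*-congˡ (dist-upd x j s t)))))
             (*-monoʳ-≤ (*-nonneg 0≤δ₀ (0≤∣ s - t ∣)) (Wt≤T w)))
         1≤slant : 1# ≤ ∣ slant ∣
         1≤slant = separated (slope w j) (separate w j (v≢w ∘ J-inj ∘ ≡.sym) (weight∈ v))
         estimate : ∣ s - t ∣ ≤ fromℕ 2 * ∣ A ∣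
         estimate = lin 7 (λ C m A e T d n → C :* m :≤ A :+ e ∷ e :≤ T :* (d :* m) ∷ :0 :≤ (C :- :1) :* m ∷
             m :* (# 4 :* (T :* d)) :≤ m :* :1 ∷ :0 :≤ m ⊢ m :≤ # 2 :* A)
           {ρ = ∣ slant ∣ , ∣ s - t ∣ , ∣ A ∣ , ∣ q * err ∣ , T , δ₀ , 0# , tt}
           (≤-trans (inj₂ (trans (sym (∣*∣ slant (s - t))) (∣∣-cong A≈))) (∣+∣ A (q * err)))
           err≤ (*-nonneg (lin 1 (λ c → :1 :≤ c ⊢ :0 :≤ c :- :1) 1≤slant) (0≤∣ s - t ∣))
           (*-monoˡ-≤ (0≤∣ s - t ∣) δ₀-small) (0≤∣ s - t ∣)

     open Root tie j 0≤M lower upper public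

     root-dep : DependsF (J ∘ punchIn (colour v)) (fn root)
     root-dep = root-depends λ x y t e → let e′ = Agree-upd⁺ J-inj (colour v) e t in
       +-cong (*-congˡ (height-dep v e′)) (*-congˡ (height-dep w e′))

     root-bounded : ∀*ⁿ λ x → ∃ (Zero x) → Good (fromℕ b) root x
     root-bounded = ∀*ⁿ-map (λ x h z → Good-weaken {f = root} {x = x} 2M≤b (h z)) root-good
       where
       2M≤b : fromℕ 2 * M ≤ fromℕ b
       2M≤b = ≤-trans (lin 2 (λ T m → m :≈ # 20 :* T ⊢ # 2 :* (# 10 :* T) :≤ m)
         (×1-homo-* 20 (top n))) (fromℕ-mono b-large)

 -- Unions and refinements of decompositions

 module _ {a′ b′ p q r : Level} {A : Set a′} {B : Set b′} {P : A → Set p} {f : ∀ {x} → P x → B} where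

   reduce-All : {Q : A → Set q} {R : B → Set r} → (∀ {x} (p : P x) → Q x → R (f p)) →
                ∀ {xs} (ps : All P xs) → All Q xs → All R (All.reduce f ps)
   reduce-All g [] [] = []
   reduce-All g (p ∷ ps) (q ∷ qs) = g p q ∷ reduce-All g ps qs

   reduce-Any : {Q : A → Set q} {R : B → Set r} → (∀ {x} (p : P x) → Q x → R (f p)) →
                ∀ {xs} (ps : All P xs) → Any Q xs → Any R (All.reduce f ps)
   reduce-Any g (p ∷ ps) (here q) = here (g p q)
   reduce-Any g (p ∷ ps) (there h) = there (reduce-Any g ps h)

   reduce-AllPairs : {S : A → A → Set q} {R : B → B → Set r} →
     (∀ {x y} (p : P x) (p′ : P y) → S x y → R (f p) (f p′)) →
     ∀ {xs} (ps : All P xs) → AllPairs S xs → AllPairs R (All.reduce f ps)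
   reduce-AllPairs g [] [] = []
   reduce-AllPairs {S = S} {R} g (p ∷ ps) (h ∷ hs) = one p ps h ∷ reduce-AllPairs g ps hs
     where
     one : ∀ {x} (p : P x) {xs} (ps : All P xs) → All (S x) xs → All (R (f p)) (All.reduce f ps)
     one p [] [] = []
     one p (p′ ∷ ps) (h ∷ hs) = g p p′ h ∷ one p ps hs

 module _ {n r : ℕ} {B : Carrier} {J : Fin r → Fin n} where

   Covered : List (CellOver B J) → K^ n → Set (s ⊔ ℓ)
   Covered Cs x = Any (x ∈ₒ_) Cs

   Coveredᵈ : ∀ Cs → Defⱽ (Covered Cs)
   Coveredᵈ Cs = Anyᵈ Cs λ C → ∈ᶜᵈ (cell C)

   ∅-decomposition : {X : K^ n → Set a} → (∀ x → ¬ X x) → Decomposition B J X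
   ∅-decomposition empty = record
     { cells = [] ; inside = [] ; disjoint = []
     ; covers = ∀*ⁿ-all λ x x∈ → ⊥-elim (empty x x∈) }

   Decomposition-refine : {X : K^ n → Set a} {Y : K^ n → Set b} → Defⱽ X →
     Decomposition B J X → (∀ x → X x → Y x) → ∀*ⁿ (λ x → Y x → X x) → Decomposition B J Y
   Decomposition-refine dX D X⊂Y Y⊂X = record
     { cells = cells D
     ; inside = All.map (λ h x x∈ → X⊂Y x (h x x∈)) (inside D)
     ; disjoint = disjoint D
     ; covers = ∀*ⁿ-map₂ (dX →ᵈ Coveredᵈ (cells D)) (λ x h k p → h (k p)) (covers D) Y⊂X
     }

   Decomposition-∪ : ∀ {c} {X : K^ n → Set a} {X′ : K^ n → Set b} {Z : K^ n → Set c} → Defⱽ X →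
     Decomposition B J X → Decomposition B J X′ → (∀ x → X x → ¬ X′ x) →
     (∀ x → X x → Z x) → (∀ x → X′ x → Z x) → (∀ x → Z x → X x ⊎ X′ x) →
     Decomposition B J Z
   Decomposition-∪ dX D D′ X∩X′ X⊂Z X′⊂Z Z⊂ = record
     { cells = cells D List.++ cells D′
     ; inside = All.++⁺ (All.map (λ h x x∈ → X⊂Z x (h x x∈)) (inside D))
                        (All.map (λ h x x∈ → X′⊂Z x (h x x∈)) (inside D′))
     ; disjoint = AllPairs.++⁺ (disjoint D) (disjoint D′)
         (All.map (λ h → All.map (λ h′ x x∈ x∈′ → X∩X′ x (h x x∈) (h′ x x∈′)) (inside D′)) (inside D))
     ; covers = ∀*ⁿ-map₂ (dX →ᵈ Coveredᵈ (cells D))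
         (λ x h h′ z → [ Any.++⁺ˡ ∘ h , Any.++⁺ʳ (cells D) ∘ h′ ]′ (Z⊂ x z))
         (covers D) (covers D′)
     }

 record JFun {n r : ℕ} (J : Fin r → Fin n) : Set (s ⊔ ℓ) where
   field
     func : DFun n
     dep : DependsF J (fn func)
 open JFun public

 Fibre : (K^ n → Set a) → Fin n → K^ n → Carrier → Set a
 Fibre Y j x t = Y (x [ j ≔ t ])

 fibreᵈ : ∀ {Y : K^ n → Set a} → Defⱽ Y → ∀ j → Defᶠ (Fibre Y j)
 fibreᵈ dY j = atⱽ dY (updᵈ v₁ j s₀)

 ∀*ⁿ-¬Boundary : {Y : K^ n → Set a} → Defⱽ Y → ∀ j → ∀*ⁿ λ x → ¬ Boundary (Fibre Y j x) (x j)
 ∀*ⁿ-¬Boundary {Y = Y} dY j = ∀*ⁿ-update⁻ (¬ᵈ (Boundaryᵈ (atⱽ dY (updᵈ v₁ j s₀)) (v₀ j))) j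
   (∀*ⁿ-all λ x → ∀*-map (λ t ¬bd bd → ¬bd (Boundary-Ev {P = Fibre Y j (x [ j ≔ t ])} (1# , 0<1 , λ s _ →
         respⱽ dY (upd-upd x j) , respⱽ dY (≋-sym (upd-upd x j)))
       (Boundary-at (upd-same x j) bd)))
     (∀*-¬Boundary (atᶠ (fibreᵈ dY j) (λ i → constᵈ) s₀)))
   where
   Boundary-at : ∀ {P : Carrier → Set _} {t u} → t ≈ u → Boundary P t → Boundary P u
   Boundary-at e bd x y x<u u<y = bd x y (<-respʳ (sym e) x<u) (<-respˡ (sym e) u<y)

 -- Decomposition into bands between the boundary points of the fibres

 module Bands-of {n r b : ℕ} (J : Fin (suc r) → Fin n) (J-inj : Injective J)
   (IH : Decomposable n r (fromℕ b)) (k : Fin (suc r))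
   {Y : K^ n → Set a} (dY : Defⱽ Y) (Y-dep : DependsP J Y)
   (G : List (JFun (J ∘ punchIn k))) where

   J′ : Fin r → Fin n
   J′ = J ∘ punchIn k

   j : Fin n
   j = J k

   B : Carrier
   B = fromℕ b

   J′≢j : ∀ m → J′ m ≢ j
   J′≢j m e = punchInᵢ≢i k m (J-inj e)

   End : Set (s ⊔ ℓ)
   End = Maybe (JFun J′)

   side : End → Side n
   side = Maybe.map func

   F : K^ n → Carrier → Set _
   F = Fibre Y j

   F-dep : ∀ {x y} → Agree J′ x y → ∀ t → F x t → F y t
   F-dep e t = Y-dep (Agree-upd⁺ J-inj k e t)

   ValidEnd : End → K^ n → Set _
   ValidEnd nothing x = ⊤
   ValidEnd (just g) x = Good B (func g) x × Boundary (F x) (fn (func g) x)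

   validEndᵈ : ∀ e → Defⱽ (ValidEnd e)
   validEndᵈ nothing = fullᵈ (λ _ → tt)
   validEndᵈ (just g) = Goodᵈ B (func g) ×ᵈ Boundaryᵈ (atⱽ dY (updᵈ v₁ j s₀)) (fnᵈ (func g))

   validEnd-dep : ∀ e → DependsP J′ (ValidEnd e)
   validEnd-dep nothing e _ = tt
   validEnd-dep (just g) {x} {y} e (good , bd) = Good-depends (func g) (dep g) e good ,
     λ u v u< <v → Boundary-Ev {Q = F y} (1# , 0<1 , λ s _ → F-dep e s , F-dep (Agree-sym e) s)
       bd u v (<-respʳ (sym (dep g e)) u<) (<-respˡ (sym (dep g e)) <v)

   In-band : End × End → K^ n → Carrier → Set ℓ
   In-band (p , q) x t = OverSide (side p) x t × UnderSide (side q) x t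

   in-bandᵈ : ∀ pq {v : ⟪ Γ ⟫ → K^ n} {t : ⟪ Γ ⟫ → Carrier} → DefV v → DefF t →
              Def (λ ρ → In-band pq (v ρ) (t ρ))
   in-bandᵈ (p , q) dv dt = overᵈ (side p) dv dt ×ᵈ underᵈ (side q) dv dt

   over-dep : ∀ e {x y t} → Agree J′ x y → OverSide (side e) x t → OverSide (side e) y t
   over-dep nothing e p = tt
   over-dep (just g) e p = <-respˡ (dep g e) p

   under-dep : ∀ e {x y t} → Agree J′ x y → UnderSide (side e) x t → UnderSide (side e) y t
   under-dep nothing e p = tt
   under-dep (just g) e p = <-respʳ (dep g e) p

   orderedᵈ : ∀ p q → Defⱽ (SidesOrdered (side p) (side q))
   orderedᵈ nothing nothing = fullᵈ (λ _ → tt)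
   orderedᵈ nothing (just g) = fullᵈ (λ _ → tt)
   orderedᵈ (just f) nothing = fullᵈ (λ _ → tt)
   orderedᵈ (just f) (just g) = fnᵈ (func f) <ᵈ fnᵈ (func g)

   ordered-dep : ∀ p q → DependsP J′ (SidesOrdered (side p) (side q))
   ordered-dep nothing nothing e h = tt
   ordered-dep nothing (just g) e h = tt
   ordered-dep (just f) nothing e h = tt
   ordered-dep (just f) (just g) e h = <-respʳ (dep g e) (<-respˡ (dep f e) h)

   Base : End × End → K^ n → Set _
   Base (p , q) x = (ValidEnd p x × ValidEnd q x × SidesOrdered (side p) (side q) x) ×
     (∀ t → In-band (p , q) x t → F x t)

   bandBaseᵈ : ∀ pq → Defⱽ (Base pq)
   bandBaseᵈ (p , q) = (validEndᵈ p ×ᵈ validEndᵈ q ×ᵈ orderedᵈ p q) ×ᵈ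
     ∀ᵈ (in-bandᵈ (p , q) v₁ s₀ →ᵈ atⱽ dY (updᵈ v₁ j s₀))

   base-dep : ∀ pq → DependsP J′ (Base pq)
   base-dep (p , q) e ((vp , vq , o) , inn) =
     (validEnd-dep p e vp , validEnd-dep q e vq , ordered-dep p q e o) ,
     λ t (ov , un) → F-dep e t (inn t (over-dep p (Agree-sym e) ov , under-dep q (Agree-sym e) un))

   Covers : End × End → K^ n → Set _
   Covers pq x = Base pq x × In-band pq x (x j)

   coversᵈ : ∀ pq → Defⱽ (Covers pq)
   coversᵈ pq = bandBaseᵈ pq ×ᵈ in-bandᵈ pq v₀ (v₀ j)

   no-end-inside : ∀ {pq x t u v} → (∀ t → In-band pq x t → F x t) →
     In-band pq x t → In-band pq x u → Betw t u v → ¬ Boundary (F x) v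
   no-end-inside {p , q} {x} {t} {u} {v} inn (ot , ut) (ou , uu) b bd =
     let l , l<v , ov = room-below (side p) (between-over (side p) {x} ot ou b)
         m , v<m , un = room-above (side q) (between-under (side q) {x} ut uu b)
         w , l<w , w<m , ¬F = proj₂ (bd l m l<v v<m)
     in ¬F (inn w (ov l<w , un w<m))
     where
     room-below : ∀ f {v} → OverSide f x v → ∃ λ l → l < v × (∀ {w} → l < w → OverSide f x w)
     room-below nothing _ = _ , x-1<x , λ _ → tt
     room-below (just f) h = _ , h , λ k → k
     room-above : ∀ f {v} → UnderSide f x v → ∃ λ m → v < m × (∀ {w} → w < m → UnderSide f x w)
     room-above nothing _ = _ , x<x+1 , λ _ → tt
     room-above (just f) h = _ , h , λ k → k

   -- Every band lies in the fibre and so contains no boundary point of it, whereas the ends of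
   -- bands are boundary points. Hence no end of one band lies in another, and bands that meet are
   -- equal.
   meeting-bands : ∀ {pq pq′ x t u} → Base pq x → Base pq′ x → In-band pq x t →
                   In-band pq x u → In-band pq′ x u → In-band pq′ x t
   meeting-bands {pq} {p′ , q′} {x} {t} {u} (_ , inn) ((vp′ , vq′ , _) , _) t∈ u∈ (ou , uu) =
     over p′ vp′ ou , under q′ vq′ uu
     where
     over : ∀ e → ValidEnd e x → OverSide (side e) x u → OverSide (side e) x t
     over nothing _ _ = tt
     over (just g) (_ , bd) g<u = by-cases _ id λ g≮t →
       ⊥-elim (no-end-inside {pq} inn t∈ u∈ (inj₁ (≮⇒≥ g≮t , inj₁ g<u)) bd)
     under : ∀ e → ValidEnd e x → UnderSide (side e) x u → UnderSide (side e) x t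
     under nothing _ _ = tt
     under (just g) (_ , bd) u<g = by-cases _ id λ t≮g →
       ⊥-elim (no-end-inside {pq} inn t∈ u∈ (inj₂ (inj₁ u<g , ≮⇒≥ t≮g)) bd)

   Clear : List (End × End) → End × End → K^ n → Set _
   Clear es pq x = All (λ pq′ → Base pq′ x → ∀ t → In-band pq x t → ¬ In-band pq′ x t) es

   -- The functions in `G` may coincide over some `x`, so different pairs of ends can give the same
   -- band. Over such `x` the band is kept for one pair only, which makes the cells disjoint.
   Fresh : List (End × End) → End × End → K^ n → Set _
   Fresh es pq x = Base pq x × Clear es pq x

   freshᵈ : ∀ es pq → Defⱽ (Fresh es pq)
   freshᵈ es pq = bandBaseᵈ pq ×ᵈ Allᵈ es λ pq′ → bandBaseᵈ pq′ →ᵈ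
     ∀ᵈ (in-bandᵈ pq v₁ s₀ →ᵈ ¬ᵈ (in-bandᵈ pq′ v₁ s₀))

   in-band-dep : ∀ pq {x y t} → Agree J′ x y → In-band pq x t → In-band pq y t
   in-band-dep (p , q) e (o , u) = over-dep p e o , under-dep q e u

   fresh-dep : ∀ es pq → DependsP J′ (Fresh es pq)
   fresh-dep es pq e (base , clear) = base-dep pq e base , All.map
     (λ {pq′} h base′ t t∈ t∈′ → h (base-dep pq′ (Agree-sym e) base′) t
       (in-band-dep pq (Agree-sym e) t∈) (in-band-dep pq′ (Agree-sym e) t∈′)) clear

   module _ (p q : End) (es : List (End × End)) where

     Inside : CellOver B J′ → Set _
     Inside U = ∀ x → x ∈ₒ U → Fresh es (p , q) x

     band-over : ∀ U → Inside U → CellOver B J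
     band-over U U⊂ = record
       { cell = band {j = j} (cell U) (side p) (side q)
       ; valid = band (valid U) order≢j (good p λ x x∈ → proj₁ (proj₁ (proj₁ (U⊂ x x∈))))
           (good q λ x x∈ → proj₁ (proj₂ (proj₁ (proj₁ (U⊂ x x∈)))))
           (λ x x∈ → proj₂ (proj₂ (proj₁ (proj₁ (U⊂ x x∈)))))
       ; order⊆J = λ { zero → k , ≡.refl
                     ; (suc m) → let i , e = order⊆J U m in punchIn k i , e }
       ; J⊆order = λ i → by-cases (i ≡ k) (λ { ≡.refl → zero , ≡.refl })
           (λ i≢k → let m , e = J⊆order U (punchOut (i≢k ∘ ≡.sym)) in
             suc m , ≡.trans (≡.cong J (≡.sym (punchIn-punchOut (i≢k ∘ ≡.sym)))) e)
       }
       where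
       order≢j : ∀ m → lookup (order U) m ≢ j
       order≢j m e = let i , e′ = order⊆J U m in J′≢j i (≡.trans (≡.sym e′) e)
       good : ∀ e → (∀ x → x ∈ₒ U → ValidEnd e x) → GoodSide B (order U) (cell U) (side e)
       good nothing h = none
       good (just g) h = some (depends-order U (dep g)) (λ x x∈ → proj₁ (h x x∈))

     bands-over : ∀ {Us} → All Inside Us → List (CellOver B J)
     bands-over = All.reduce (λ {U} → band-over U)

     New : K^ n → Set _
     New x = Covers (p , q) x × All (λ pq′ → ¬ Covers pq′ x) es

     new-decomposition : Decomposition B J New
     new-decomposition = record
       { cells = bands-over (inside D)
       ; inside = reduce-All (λ U⊂ _ x (x∈ , t∈) →
           let base , clear = U⊂ x x∈ in (base , t∈) ,
           All.map (λ h (base′ , t∈′) → h base′ (x j) t∈ t∈′) clear) (inside D) (inside D)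
       ; disjoint = reduce-AllPairs (λ U⊂ V⊂ h x x∈ x∈′ → h x (proj₁ x∈) (proj₁ x∈′)) (inside D) (disjoint D)
       ; covers = ∀*ⁿ-map (λ x cov ((base , t∈) , old) → reduce-Any (λ U⊂ h → h , t∈) (inside D) (cov
           (base , All.map (λ {pq′} ¬cov base′ u u∈ u∈′ →
             ¬cov (base′ , meeting-bands {p , q} {pq′} base base′ t∈ u∈ u∈′)) old)))
           (covers D)
       }
       where
       D : Decomposition B J′ (Fresh es (p , q))
       D = decompose IH (λ e → punchIn-injective k _ _ (J-inj e)) (freshᵈ es (p , q)) (fresh-dep es (p , q))

   Remaining : List (End × End) → List (End × End) → K^ n → Set _
   Remaining es ps x = Any (λ pq → Covers pq x) ps × All (λ pq → ¬ Covers pq x) es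

   remaining-decomposition : ∀ es ps → Decomposition B J (Remaining es ps)
   remaining-decomposition es [] = ∅-decomposition λ { x (() , _) }
   remaining-decomposition es ((p , q) ∷ ps) = Decomposition-∪
     {X = New p q es} {X′ = Remaining ((p , q) ∷ es) ps}
     (coversᵈ (p , q) ×ᵈ Allᵈ es λ pq′ → ¬ᵈ (coversᵈ pq′))
     (new-decomposition p q es) (remaining-decomposition ((p , q) ∷ es) ps)
     (λ { x (cov , _) (_ , ¬cov ∷ _) → ¬cov cov })
     (λ { x (cov , old) → here cov , old })
     (λ { x (cov , _ ∷ old) → there cov , old })
     (λ x (cov , old) → by-cases (Covers (p , q) x) (λ h → inj₁ (h , old))
       (λ ¬h → inj₂ (Any.tail ¬h cov , ¬h ∷ old)))

   ends : List End
   ends = nothing ∷ List.map just G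

   pairs : List (End × End)
   pairs = List.cartesianProduct ends ends

   Bounded : K^ n → Set _
   Bounded x = ∀ t → Boundary (Fibre Y (J k) x) t →
     Any (λ g → t ≈ fn (func g) x × Good (fromℕ b) (func g) x) G

   boundedᵈ : Defⱽ Bounded
   boundedᵈ = ∀ᵈ (Boundaryᵈ (atⱽ dY (updᵈ v₂ j s₀)) s₀ →ᵈ
     Anyᵈ G λ g → (s₀ ≈ᵈ appⱽ (fnᵈ (func g)) v₁) ×ᵈ atⱽ (Goodᵈ B (func g)) v₁)

   covered : ∀ x → Bounded x → ¬ Boundary (F x) (x j) → Y x → Any (λ pq → Covers pq x) pairs
   covered x bounded ¬bd y∈ = Any.map combine (Any.cartesianProduct⁺ lower-end upper-end)
     where
     Lower Upper : End → Set _
     Lower e = ValidEnd e x × OverSide (side e) x (x j) × (∀ u → OverSide (side e) x u → u ≤ x j → F x u)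
     Upper e = ValidEnd e x × UnderSide (side e) x (x j) × (∀ u → UnderSide (side e) x u → x j ≤ u → F x u)
     combine : ∀ {pq} → Lower (proj₁ pq) × Upper (proj₂ pq) → Covers pq x
     combine {p , q} ((vp , ov , lo) , vq , un , hi) = ((vp , vq , ordered p q ov un) , λ t (ot , ut) →
         by-cases (t ≤ x j) (lo t ot) (λ t≰ → hi t ut (inj₁ (≰⇒> t≰)))) , ov , un
       where
       ordered : ∀ p q → OverSide (side p) x (x j) → UnderSide (side q) x (x j) →
                 SidesOrdered (side p) (side q) x
       ordered nothing nothing _ _ = tt
       ordered nothing (just g) _ _ = tt
       ordered (just f) nothing _ _ = tt
       ordered (just f) (just g) p q = <-trans p q
     t∈ : F x (x j)
     t∈ = respⱽ dY (≋-sym (upd-self x j refl)) y∈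
     dF : Def₁ (F x)
     dF = atᶠ (fibreᵈ dY j) (λ i → constᵈ) s₀
     lower-end : Any Lower ends
     lower-end = [ (λ all → here (tt , tt , λ u _ → all u)) ,
       (λ (l , l<t , bd , h) → there (Any.map⁺ (Any.map (λ {g} (l≈g , good) →
         (good , λ u v u< <v → bd u v (<-respʳ (sym l≈g) u<) (<-respˡ (sym l≈g) <v)) ,
         <-respˡ l≈g l<t , λ u g<u u≤t → h u (<-respˡ (sym l≈g) g<u) u≤t) (bounded l bd)))) ]′
       (below dF (x j) t∈ ¬bd)
     upper-end : Any Upper ends
     upper-end = [ (λ all → here (tt , tt , λ u _ → all u)) ,
       (λ (m , t<m , bd , h) → there (Any.map⁺ (Any.map (λ {g} (m≈g , good) →
         (good , λ u v u< <v → bd u v (<-respʳ (sym m≈g) u<) (<-respˡ (sym m≈g) <v)) ,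
         <-respʳ m≈g t<m , λ u u<g t≤u → h u t≤u (<-respʳ (sym m≈g) u<g)) (bounded m bd)))) ]′
       (above dF (x j) t∈ ¬bd)

   bands-decomposition : ∀*ⁿ Bounded → Decomposition (fromℕ b) J Y
   bands-decomposition bounded = Decomposition-refine
     {X = Remaining [] pairs} ((Anyᵈ pairs coversᵈ) ×ᵈ fullᵈ (λ _ → []))
     (remaining-decomposition [] pairs)
     (λ x (cov , _) → let _ , ((_ , inn) , x∈) = Any.satisfied cov in
       respⱽ dY (upd-self x j refl) (inn (x j) x∈))
     (∀*ⁿ-map₂ boundedᵈ (λ x h ¬bd y∈ → covered x h ¬bd y∈ , []) bounded (∀*ⁿ-¬Boundary dY j))

 dependent-functions : ∀ {r} {J : Fin r → Fin n} {S : K^ n → Carrier → Set a} → Defᶠ S →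
   (∀ x → ∀* (λ t → ¬ S x t)) → (∀ {x y} → Agree J x y → ∀ t → S x t → S y t) →
   ∃ λ (gs : List (JFun J)) → ∀ x t → S x t → Any (λ g → t ≈ fn (func g) x) gs
 dependent-functions {n = n} {J = J} {S} dS small S-dep =
   let fs , canonical , cover = uniform-finiteness dS small in
   package canonical , λ x t h → packaged canonical (cover x t h)
   where
   package : ∀ {fs} → All (Canonical S) fs → List (JFun J)
   package [] = []
   package (_∷_ {f} c cs) = record
     { func = f ; dep = λ e → c _ _ λ t → S-dep e t , S-dep (Agree-sym e) t } ∷ package cs
   packaged : ∀ {fs} (cs : All (Canonical S) fs) {P : DFun n → Set ℓ} → Any P fs →
              Any (P ∘ func) (package cs)
   packaged (c ∷ cs) (here p) = here p
   packaged (c ∷ cs) (there p) = there (packaged cs p)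

 -- Regions of points to which the walls of one colour are closest

 module Step {n r b : ℕ} (J : Fin (suc r) → Fin n) (J-inj : Injective J)
   (IH : Decomposable n r (fromℕ b)) (b-large : 20 ℕ.* top n ℕ.≤ b)
   {X : K^ n → Set a} (dX : Defⱽ X) (X-dep : DependsP J X) where

   open Ties b J J-inj IH b-large

   T B : Carrier
   T = fromℕ (top n)
   B = fromℕ b

   score : Wall → K^ n → Carrier
   score v x = Wt v * ∣ height v x ∣

   scoreᵈ : ∀ v → Funⱽ (score v)
   scoreᵈ v = constᵈ *ᵈ ∣ heightᵈ v ∣ᵈ

   score-dep : ∀ v → DependsF J (score v)
   score-dep v e = *-congˡ (∣∣-cong (height-dep v e))

   score-0 : ∀ v {x} → height v x ≈ 0# → score v x ≈ 0#
   score-0 v e = trans (*-congˡ (∣∣-zero e)) (zeroʳ _)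

   0≤score : ∀ v x → 0# ≤ score v x
   0≤score v x = *-nonneg (inj₁ (0<Wt v)) (0≤∣ height v x ∣)

   score-lip : ∀ v x y → score v x ≤ score v y + fromℕ 5 * (T * dist x y)
   score-lip v x y = lin 6 (λ W T a b d z → W :* a :≤ W :* (# 5 :* d :+ b) ∷
         W :* (# 5 :* d) :≤ T :* (# 5 :* d) ⊢ W :* a :≤ W :* b :+ # 5 :* (T :* d))
       {ρ = Wt v , T , ∣ height v x ∣ , ∣ height v y ∣ , dist x y , 0# , tt}
     (*-monoˡ-≤ (inj₁ (0<Wt v)) (≤-trans (≤-trans (inj₂ (∣∣-cong (lin 2 (λ a b → ⊢ a :≈ (a :- b) :+ b))))
         (∣+∣ (height v x - height v y) (height v y)))
       (lin 3 (λ a b c → a :≤ c ⊢ a :+ b :≤ c :+ b) (height-lip v x y))))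
     (*-monoʳ-≤ (*-nonneg (fromℕ-nonneg 5) (0≤dist x y)) (Wt≤T v))

   closer-Ev : ∀ v w j x t → score v (x [ j ≔ t ]) < score w (x [ j ≔ t ]) →
               Ev (λ s → score v (x [ j ≔ s ]) < score w (x [ j ≔ s ])) t
   closer-Ev v w j x t v<w =
     -- 10 = 5 + 5: each of the two scores changes by at most `5 * T` times the distance.
     let δ , 0<δ , δ≤ = scaled {K = fromℕ 10 * T}
           (lin 2 (λ v w → v :< w ⊢ :0 :< w :- v) v<w)
           (*-nonneg (fromℕ-nonneg 10) (fromℕ-nonneg (top n)))
     in δ , 0<δ , λ s s∈ → lin 10 (λ vs ws vt wt T d e m δ z →
           vs :≤ vt :+ # 5 :* (T :* d) ∷ wt :≤ ws :+ # 5 :* (T :* e) ∷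
           T :* d :≈ T :* m ∷ T :* e :≈ T :* m ∷
           T :* m :≤ T :* δ ∷ δ :+ # 10 :* T :* δ :≤ wt :- vt ∷ :0 :< δ ⊢ vs :< ws)
         {ρ = _ , _ , score v (x [ j ≔ t ]) , _ , T , dist (x [ j ≔ s ]) (x [ j ≔ t ]) ,
              dist (x [ j ≔ t ]) (x [ j ≔ s ]) , ∣ s - t ∣ , δ , 0# , tt}
         (score-lip v (x [ j ≔ s ]) (x [ j ≔ t ])) (score-lip w (x [ j ≔ t ]) (x [ j ≔ s ]))
         (*-congˡ (dist-upd x j s t)) (*-congˡ (trans (dist-upd x j t s) (∣-∣ t s)))
         (*-monoˡ-≤ (fromℕ-nonneg (top n)) (inj₁ s∈)) δ≤ 0<δ

   J′ : Fin (suc r) → Fin r → Fin n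
   J′ k = J ∘ punchIn k

   opaque
    edges : ∀ k → ∃ λ (gs : List (JFun (J′ k))) →
      ∀ x t → Boundary (Fibre X (J k) x) t → Any (λ g → t ≈ fn (func g) x) gs
    edges k = dependent-functions (Boundaryᵈ (atⱽ dX (updᵈ v₂ (J k) s₀)) s₀)
      (λ x → ∀*-¬Boundary (atᶠ (fibreᵈ dX (J k)) (λ i → constᵈ) s₀))
      (λ e t → Boundary-Ev (1# , 0<1 , λ s _ →
        X-dep (Agree-upd⁺ J-inj k e s) , X-dep (Agree-upd⁺ J-inj k (Agree-sym e) s)))

   βs : ∀ k → List (JFun (J′ k))
   βs k = proj₁ (edges k)

   SteepMeets : ∀ k → JFun (J′ k) → Fin (suc r) → List Wall → Set _
   SteepMeets k g k′ ws = k ≢ k′ → ∀*ⁿ λ x → Steep (func g) (J k′) x →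
     Any (λ w → colour w ≡ k′ × height w (x [ J k ≔ fn (func g) x ]) ≈ 0#) ws

   opaque
    steep-walls : ∃ λ ws → ∀ k → All (λ g → ∀ k′ → SteepMeets k g k′ ws) (βs k)
    steep-walls = collect-Fin {Q = λ k ws → All (λ g → ∀ k′ → SteepMeets k g k′ ws) (βs k)}
        (λ k mono → All.map λ {g} h k′ → meets-mono k g k′ mono (h k′))
        (λ k → collect-list {Q = λ g ws → ∀ k′ → SteepMeets k g k′ ws}
          (λ g mono h k′ → meets-mono k g k′ mono (h k′))
          (λ g → collect-Fin {Q = SteepMeets k g} (meets-mono k g) (meets k g)) (βs k))
      where
      open Collect {W = Wall} ℓ
      meets-mono : ∀ k g k′ → Monotone (SteepMeets k g k′)
      meets-mono k g k′ mono h k≢ = ∀*ⁿ-map (λ x p st → mono (p st)) (h k≢)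
      meets : ∀ k g k′ → ∃ (SteepMeets k g k′)
      meets k g k′ = by-cases (k ≡ k′) (λ k≡ → [] , λ k≢ → ⊥-elim (k≢ k≡)) known
        where
        known : k ≢ k′ → ∃ (SteepMeets k g k′)
        known k≢ = let ws , h = steep⇒wall k k′ k≢ (func g) (dep g) in ws , λ _ → h

   -- Makes the list of walls nonempty, so that there always is a closest wall, even if no boundary
   -- is steep.
   dummy : Wall
   dummy = record
     { colour = zero ; γ = dfun (λ _ → 0#) constᵈ ; slope = λ _ → 0#
     ; weight = proj₁ θ ; γ-dep = λ _ → refl ; slope≤3 = λ _ → 0≤3
     ; affine = λ x y → ≤-trans (inj₂ (trans (∣∣-zero (lin 1
           (λ d → d :≈ :0 ⊢ (:0 :- :0) :- d :≈ :0) (dot-0 x y))) (sym (zeroʳ δ₀))))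
         (*-monoˡ-≤ 0≤δ₀ (0≤dist x y))
     ; weight∈ = proj₁ (proj₂ θ) ; separate = proj₂ (proj₂ θ) }
     where
     0≤3 : ∣ 0# ∣ ≤ fromℕ 3
     0≤3 = ≤-trans (inj₂ ∣0∣) (fromℕ-nonneg 3)
     θ = weigh zero (λ _ → 0#) (λ _ → 0≤3)
     dot-0 : ∀ {m} (x y : K^ m) → dot (λ _ → 0#) (λ i → x i - y i) ≈ 0#
     dot-0 {zero} x y = refl
     dot-0 {suc m} x y = trans (+-cong (zeroˡ _) (dot-0 (x ∘ suc) (y ∘ suc))) (+-identityˡ 0#)

   walls : List Wall
   walls = dummy ∷ proj₁ steep-walls

   Tied : Wall → Wall → K^ n → Set ℓ
   Tied v w x = score v x ≈ score w x

   tied⇒zero : ∀ {v w} (v≢w : colour w ≢ colour v) x → Tied v w x →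
     (fn (Tie.tie v w v≢w {1#} (inj₁ refl)) x ≈ 0#) ⊎
     (fn (Tie.tie v w v≢w { - 1#} (inj₂ refl)) x ≈ 0#)
   tied⇒zero {v} {w} v≢w x e = by-cases (0# ≤ height v x) (λ v≥0 → by-cases (0# ≤ height w x)
       (λ w≥0 → inj₂ (lin 6 (λ V W a b m k → V :* m :≈ W :* k ∷ V :* m :≈ V :* a ∷ W :* k :≈ W :* b ⊢
           V :* a :+ (:- :1 :* W) :* b :≈ :0) e (*-congˡ (∣∣-pos v≥0)) (*-congˡ (∣∣-pos w≥0))))
       (λ w≱0 → inj₁ (lin 6 (λ V W a b m k → V :* m :≈ W :* k ∷ V :* m :≈ V :* a ∷ W :* k :≈ W :* (:- b) ⊢
           V :* a :+ (:1 :* W) :* b :≈ :0) e (*-congˡ (∣∣-pos v≥0)) (*-congˡ (∣∣-neg (inj₁ (≰⇒> w≱0)))))))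
     (λ v≱0 → by-cases (0# ≤ height w x)
       (λ w≥0 → inj₁ (lin 6 (λ V W a b m k → V :* m :≈ W :* k ∷ V :* m :≈ V :* (:- a) ∷ W :* k :≈ W :* b ⊢
           V :* a :+ (:1 :* W) :* b :≈ :0) e (*-congˡ (∣∣-neg (inj₁ (≰⇒> v≱0)))) (*-congˡ (∣∣-pos w≥0))))
       (λ w≱0 → inj₂ (lin 6 (λ V W a b m k → V :* m :≈ W :* k ∷ V :* m :≈ V :* (:- a) ∷ W :* k :≈ W :* (:- b) ⊢
           V :* a :+ (:- :1 :* W) :* b :≈ :0) e (*-congˡ (∣∣-neg (inj₁ (≰⇒> v≱0))))
           (*-congˡ (∣∣-neg (inj₁ (≰⇒> w≱0)))))))

   TieRoots : ∀ k → Wall → Wall → List (JFun (J′ k)) → Set _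
   TieRoots k v w gs = colour v ≡ k → colour w ≢ colour v → ∀*ⁿ λ x → ∀ t →
     Tied v w (x [ J k ≔ t ]) → Any (λ g → t ≈ fn (func g) x × Good B (func g) x) gs

   tieRoot : ∀ v w (w≢v : colour w ≢ colour v) {σ} → σ ≈ 1# ⊎ σ ≈ - 1# → JFun (J′ (colour v))
   tieRoot v w w≢v σ=±1 = record
     { func = Tie.root v w w≢v σ=±1 ; dep = λ {x} {y} → Tie.root-dep v w w≢v σ=±1 {x} {y} }

   pairRoots : ∀ k v w → ∃ (TieRoots k v w)
   pairRoots k v w = by-cases (colour v ≡ k × colour w ≢ colour v) known
     (λ ¬h → [] , λ v≡k w≢v → ⊥-elim (¬h (v≡k , w≢v)))
     where
     known : colour v ≡ k × colour w ≢ colour v → ∃ (TieRoots k v w)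
     known (≡.refl , w≢v) = tieRoot v w w≢v plus ∷ tieRoot v w w≢v minus ∷ [] , λ _ _ → ∀*ⁿ-map₂
         (∃ᵈ (appⱽ (fnᵈ (Tie.tie v w w≢v plus)) (updᵈ v₁ (J k) s₀) ≈ᵈ constᵈ) →ᵈ Goodᵈ (fromℕ b) (Tie.root v w w≢v plus))
         (λ x h₁ h₂ t e → [ (λ z → here (Tie.root-spec v w w≢v plus {x} {t} z , h₁ (t , z))) ,
                            (λ z → there (here (Tie.root-spec v w w≢v minus {x} {t} z , h₂ (t , z)))) ]′
           (tied⇒zero {v} {w} w≢v (x [ J k ≔ t ]) e))
         (Tie.root-bounded v w w≢v plus) (Tie.root-bounded v w w≢v minus)
       where
       plus : 1# ≈ 1# ⊎ 1# ≈ - 1#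
       plus = inj₁ refl
       minus : - 1# ≈ 1# ⊎ - 1# ≈ - 1#
       minus = inj₂ refl

   opaque
    tie-roots : ∀ k → ∃ λ gs → All (λ v → All (λ w → TieRoots k v w gs) walls) walls
    tie-roots k = collect-list {Q = λ v gs → All (λ w → TieRoots k v w gs) walls}
        (λ v mono → All.map λ {w} → root-mono v w mono)
        (λ v → collect-list {Q = TieRoots k v} (root-mono v) (pairRoots k v) walls) walls
      where
      open Collect {W = JFun (J′ k)} ℓ
      root-mono : ∀ v w → Monotone (TieRoots k v w)
      root-mono v w mono h v≡k w≢v = ∀*ⁿ-map (λ x p t e → mono (p t e)) (h v≡k w≢v)

   roots : ∀ k → List (JFun (J′ k))
   roots k = proj₁ (tie-roots k)

   G : ∀ k → List (JFun (J′ k))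
   G k = βs k List.++ roots k

   -- Only walls of other colours have to be beaten. Ties between walls of the same colour, about
   -- which `separate` says nothing, thus do not bound the regions.
   Wins : Fin (suc r) → K^ n → Wall → Set (s ⊔ ℓ)
   Wins k x v = colour v ≡ k × All (λ w → colour w ≢ k → score v x < score w x) walls

   Region : Fin (suc r) → K^ n → Set (s ⊔ ℓ)
   Region k x = Any (Wins k x) walls

   winsᵈ : ∀ k v → Defⱽ (λ x → Wins k x v)
   winsᵈ k v = constᵖ _ ×ᵈ Allᵈ walls λ w → constᵖ _ →ᵈ scoreᵈ v <ᵈ scoreᵈ w

   regionᵈ : ∀ k → Defⱽ (Region k)
   regionᵈ k = Anyᵈ walls (winsᵈ k)

   region-dep : ∀ k → DependsP J (Region k)
   region-dep k e = Any.map λ {v} (v≡k , h) → v≡k , All.map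
     (λ {w} p w≢k → <-respʳ (score-dep w e) (<-respˡ (score-dep v e) (p w≢k))) h

   region-disjoint : ∀ {k k′ x} → k ≢ k′ → Region k x → ¬ Region k′ x
   region-disjoint k≢k′ p q =
     let v , v∈ , v≡k , h = find p ; v′ , v′∈ , v′≡k′ , h′ = find q in
     <-irrefl refl (<-trans (All.lookup h v′∈ λ e → k≢k′ (≡.trans (≡.sym e) v′≡k′))
                            (All.lookup h′ v∈ λ e → k≢k′ (≡.trans (≡.sym v≡k) e)))

   Untied : K^ n → Set _
   Untied x = All (λ v → All (λ w → colour w ≢ colour v → ¬ Tied v w x) walls) walls

   untied : ∀*ⁿ Untied
   untied = ∀*ⁿ-All (λ v → Allᵈ walls λ w → constᵖ _ →ᵈ ¬ᵈ (scoreᵈ v ≈ᵈ scoreᵈ w))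
     (All.universal (λ v → ∀*ⁿ-All (λ w → constᵖ _ →ᵈ ¬ᵈ (scoreᵈ v ≈ᵈ scoreᵈ w))
       (All.universal (λ w → by-cases (colour w ≡ colour v) (λ e → ∀*ⁿ-all λ x w≢v → ⊥-elim (w≢v e))
         (λ w≢v → ∀*ⁿ-map₂ (¬ᵈ (fnᵈ (Tie.tie v w w≢v {1#} (inj₁ refl)) ≈ᵈ constᵈ))
           (λ x h h′ _ e → [ h , h′ ]′ (tied⇒zero {v} {w} w≢v x e))
           (Tie.zeros-small v w w≢v (inj₁ refl)) (Tie.zeros-small v w w≢v (inj₂ refl))))
         walls)) walls)

   closest : ∀ x v ws → ∃ λ m → m ∈ v ∷ ws × All (λ w → score m x ≤ score w x) (v ∷ ws)
   closest x v [] = v , here ≡.refl , ≤-refl ∷ []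
   closest x v (w ∷ ws) with closest x w ws
   ... | m , m∈ , h = by-cases (score v x ≤ score m x)
     (λ v≤m → v , here ≡.refl , ≤-refl ∷ All.map (≤-trans v≤m) h)
     (λ v≰m → m , there m∈ , inj₁ (≰⇒> v≰m) ∷ h)

   in-region : ∀ x → Untied x → ∃ λ k → Region k x
   in-region x un = let v , v∈ , h = closest x dummy (proj₁ steep-walls) in
     colour v , lose v∈ (≡.refl , All.zipWith (λ { (inj₁ p , _) _ → p
                                                 ; (inj₂ e , f) w≢v → ⊥-elim (f w≢v e) })
       (h , All.lookup un v∈))

   Y : Fin (suc r) → K^ n → Set _
   Y k x = X x × Region k x

   Yᵈ : ∀ k → Defⱽ (Y k)
   Yᵈ k = dX ×ᵈ regionᵈ k

   CrossTie : Fin (suc r) → K^ n → Set _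
   CrossTie k x = Any (λ v → colour v ≡ k × Any (λ w → colour w ≢ colour v × Tied v w x) walls) walls

   module _ (k : Fin (suc r)) (x : K^ n) (t : Carrier) where

     at : Carrier → K^ n
     at u = x [ J k ≔ u ]

     trichotomy : ¬ CrossTie k (at t) → ∀ {v} → v ∈ walls → colour v ≡ k → ∀ {w} → w ∈ walls →
                  colour w ≢ k → score v (at t) < score w (at t) ⊎ score w (at t) < score v (at t)
     trichotomy ¬tie {v} v∈ ≡.refl {w} w∈ w≢ with cmp (score v (at t)) (score w (at t))
     ... | tri< p _ _ = inj₁ p
     ... | tri≈ _ e _ = ⊥-elim (¬tie (lose v∈ (≡.refl , lose w∈ (w≢ , e))))
     ... | tri> _ _ q = inj₂ q

     stays : ∀ {v} → Wins k (at t) v → Ev (λ u → Wins k (at u) v) t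
     stays {v} (v≡k , h) = Ev-map (λ u p → v≡k , p) (Ev-All walls (All.map (λ {w} p → by-cases (colour w ≡ k)
         (λ e → 1# , 0<1 , λ _ _ w≢k → ⊥-elim (w≢k e))
         (λ w≢k → Ev-map (λ u q _ → q) (closer-Ev v w (J k) x t (p w≢k)))) h))

     loses : ¬ CrossTie k (at t) → ∀ {v} → v ∈ walls → ¬ Wins k (at t) v → Ev (λ u → ¬ Wins k (at u) v) t
     loses ¬tie {v} v∈ ¬win = by-cases (colour v ≡ k)
       (λ v≡k → by-cases (Any (λ w → colour w ≢ k × score w (at t) < score v (at t)) walls)
         (λ beaten → let w , w∈ , w≢k , w<v = find beaten in
           Ev-map (λ u p (_ , h) → <-irrefl refl (<-trans p (All.lookup h w∈ w≢k)))
             (closer-Ev w v (J k) x t w<v))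
         (λ unbeaten → ⊥-elim (¬win (v≡k , All.tabulate λ {w} w∈ w≢k →
           [ id , (λ q → ⊥-elim (unbeaten (lose w∈ (w≢k , q)))) ]′ (trichotomy ¬tie v∈ v≡k w∈ w≢k)))))
       (λ v≢k → 1# , 0<1 , λ u _ (v≡k , _) → v≢k v≡k)

     -- When no walls of different colours tie at `t`, winning and losing are both open conditions
     -- on the line. So near `t` the fibre of `Y k` is either that of `X` or empty.
     boundary-cases : Boundary (Fibre (Y k) (J k) x) t →
       CrossTie k (at t) ⊎ Boundary (Fibre X (J k) x) t × Region k (at t)
     boundary-cases bd = by-cases (CrossTie k (at t)) inj₁ λ ¬tie →
         by-cases (Region k (at t)) (λ p → inj₂ (inside-case p , p)) (λ ¬p → ⊥-elim (outside-case ¬tie ¬p))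
       where
       inside-case : Region k (at t) → Boundary (Fibre X (J k) x) t
       inside-case p = let v , v∈ , win = find p in
         Boundary-Ev {P = Fibre (Y k) (J k) x} {Q = Fibre X (J k) x} (Ev-map {P = λ u → Wins k (at u) v}
           (λ u w → proj₁ , λ q → q , lose v∈ w) (stays {v} win)) bd
       outside-case : ¬ CrossTie k (at t) → ¬ ¬ Region k (at t)
       outside-case ¬tie ¬p = Boundary-¬Ev {P = Fibre (Y k) (J k) x}
         (Ev-map {P = λ u → All (λ v → ¬ Wins k (at u) v) walls} (λ u h (_ , p) → All.All¬⇒¬Any h p)
           (Ev-All walls (All.tabulate λ {v} v∈ → loses ¬tie {v} v∈ (λ win → ¬p (lose v∈ win))))) bd

   EdgesMeet : ∀ k → K^ n → Set _
   EdgesMeet k x = All (λ g → Regular (func g) x × ∀ k′ → k ≢ k′ → Steep (func g) (J k′) x →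
     Any (λ w → colour w ≡ k′ × height w (x [ J k ≔ fn (func g) x ]) ≈ 0#) walls) (βs k)

   TiesMeet : ∀ k → K^ n → Set _
   TiesMeet k x = All (λ v → All (λ w → colour v ≡ k → colour w ≢ colour v → ∀ t → Tied v w (x [ J k ≔ t ]) →
     Any (λ g → t ≈ fn (func g) x × Good B (func g) x) (roots k)) walls) walls

   1≤B : 1# ≤ B
   1≤B = ≤-trans (≤-trans (inj₂ (sym (+-identityʳ 1#))) (fromℕ-mono (1≤top n)))
     (fromℕ-mono (ℕ.≤-trans (ℕ.m≤m+n (top n) _) b-large))

   module Bₖ (k : Fin (suc r)) = Bands-of {b = b} J J-inj IH k {Y = Y k} (Yᵈ k)
     (λ {x} {y} e (p , q) → X-dep e p , region-dep k {x} {y} e q) (G k)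

   bounded : ∀ k x → EdgesMeet k x → TiesMeet k x → Bₖ.Bounded k x
   bounded k x edges-meet ties-meet t bd = [ at-tie , at-edge ]′ (boundary-cases k x t bd)
     where
     zip-Any : ∀ {p q} {A : Set (s ⊔ ℓ)} {P : A → Set p} {Q : A → Set q} {xs} →
               All P xs → Any Q xs → Any (λ x → P x × Q x) xs
     zip-Any (p ∷ ps) (here q) = here (p , q)
     zip-Any (p ∷ ps) (there q) = there (zip-Any ps q)
     Near-edge : JFun (J′ k) → Set _
     Near-edge g = t ≈ fn (func g) x × Good B (func g) x
     at-tie : CrossTie k (x [ J k ≔ t ]) → Any Near-edge (G k)
     at-tie tie = let v , v∈ , v≡k , tie′ = find tie ; w , w∈ , w≢v , e = find tie′ in
       Any.++⁺ʳ (βs k) (All.lookup (All.lookup ties-meet v∈) w∈ v≡k w≢v t e)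
     at-edge : Boundary (Fibre X (J k) x) t × Region k (x [ J k ≔ t ]) → Any Near-edge (G k)
     at-edge (bdX , region) = Any.++⁺ˡ (Any.map
       (λ {g} ((reg , meets) , t≈g) → t≈g , Good-weaken {f = func g} {x = x} 1≤B
         ([ id , (λ (l , st) → ⊥-elim (not-steep g reg meets t≈g l st)) ]′ (flat⊎steep (func g) reg)))
       (zip-Any edges-meet (proj₂ (edges k) x t bdX)))
       where
       not-steep : ∀ g → Regular (func g) x → (∀ k′ → k ≢ k′ → Steep (func g) (J k′) x →
           Any (λ w → colour w ≡ k′ × height w (x [ J k ≔ fn (func g) x ]) ≈ 0#) walls) →
         t ≈ fn (func g) x → ∀ l → ¬ Steep (func g) l x
       not-steep g reg meets t≈g l st = by-cases (∃ λ m → J (punchIn k m) ≡ l) (λ { (m , ≡.refl) →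
           let w , w∈ , w≡k′ , e = find (meets (punchIn k m) (λ e → punchInᵢ≢i k m (≡.sym e)) st)
               v , v∈ , v≡k , win = find region
           -- The wall `w` contains the boundary point, so its score there is 0, and a winner of
           -- colour `k` would have a negative score.
           in <-irrefl refl (≤-<-trans (0≤score v (x [ J k ≔ t ])) (<-respʳ (trans (score-0 w {x [ J k ≔ t ]}
                (trans (congⱽ (heightᵈ w) (upd-cong (J k) ≋-refl t≈g)) e)) refl)
                (All.lookup win w∈ (λ w≡k → punchInᵢ≢i k m (≡.trans (≡.sym w≡k′) w≡k))))) })
         (λ l∉ → <-irrefl refl (<-trans 0<1 (<-respʳ (∣∣-zero
           (∂-free (func g) (dep g) (λ m e → l∉ (m , e)) (proj₁ (Nbhd-centre reg l)))) (proj₁ (proj₂ st)))))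

   meetᵈ : ∀ k (g : JFun (J′ k)) k′ → Defⱽ (λ x → k ≢ k′ → Steep (func g) (J k′) x →
     Any (λ w → colour w ≡ k′ × height w (x [ J k ≔ fn (func g) x ]) ≈ 0#) walls)
   meetᵈ k g k′ = constᵖ _ →ᵈ Steepᵈ (func g) (J k′) →ᵈ Anyᵈ walls λ w → constᵖ _ ×ᵈ
     appⱽ (heightᵈ w) (updᵈ v₀ (J k) (fnᵈ (func g))) ≈ᵈ constᵈ

   edgesMeetᵈ : ∀ k → Defⱽ (EdgesMeet k)
   edgesMeetᵈ k = Allᵈ (βs k) λ g → Regularᵈ (func g) ×ᵈ ∀Finᵈ (meetᵈ k g)

   region-decomposition : ∀ k → Decomposition B J (Y k)
   region-decomposition k = Bₖ.bands-decomposition k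
     (∀*ⁿ-map₂ (edgesMeetᵈ k) (bounded k) edges-meet ties-meet)
     where
     edges-meet : ∀*ⁿ (EdgesMeet k)
     edges-meet = ∀*ⁿ-All (λ g → Regularᵈ (func g) ×ᵈ ∀Finᵈ (meetᵈ k g))
       (All.map (λ {g} h → ∀*ⁿ-× (Regularᵈ (func g)) (∀*ⁿ-regular (func g))
         (∀*ⁿ-Fin (meetᵈ k g) λ k′ → by-cases (k ≡ k′) (λ e → ∀*ⁿ-all λ x k≢k′ → ⊥-elim (k≢k′ e))
           (λ k≢k′ → ∀*ⁿ-map (λ x p _ st → there (p st)) (h k′ k≢k′))))
         (proj₂ steep-walls k))
     tiesᵈ : ∀ v w → Defⱽ (λ x → colour v ≡ k → colour w ≢ colour v → ∀ t → Tied v w (x [ J k ≔ t ]) →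
       Any (λ g → t ≈ fn (func g) x × Good B (func g) x) (roots k))
     tiesᵈ v w = constᵖ _ →ᵈ constᵖ _ →ᵈ ∀ᵈ (
       appⱽ (scoreᵈ v) (updᵈ v₁ (J k) s₀) ≈ᵈ appⱽ (scoreᵈ w) (updᵈ v₁ (J k) s₀) →ᵈ
       Anyᵈ (roots k) λ g → (s₀ ≈ᵈ appⱽ (fnᵈ (func g)) v₁) ×ᵈ atⱽ (Goodᵈ B (func g)) v₁)
     ties-meet : ∀*ⁿ (TiesMeet k)
     ties-meet = ∀*ⁿ-All (λ v → Allᵈ walls (tiesᵈ v)) (All.map
       (λ {v} h → ∀*ⁿ-All (tiesᵈ v) (All.map (λ {w} h′ → by-cases (colour v ≡ k × colour w ≢ colour v)
         (λ (v≡k , w≢v) → ∀*ⁿ-map (λ x p _ _ → p) (h′ v≡k w≢v))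
         (λ ¬h → ∀*ⁿ-all λ x v≡k w≢v → ⊥-elim (¬h (v≡k , w≢v)))) h)) (proj₂ (tie-roots k)))

   Upto : ℕ → K^ n → Set _
   Upto m x = ∃ λ k → Fin.toℕ k ℕ.< m × Y k x

   uptoᵈ : ∀ m → Defⱽ (Upto m)
   uptoᵈ m = ∃Finᵈ λ k → constᵖ _ ×ᵈ Yᵈ k

   regions-upto : ∀ m → m ℕ.≤ suc r → Decomposition B J (Upto m)
   regions-upto zero _ = ∅-decomposition λ { x (_ , () , _) }
   regions-upto (suc m) m<r = Decomposition-∪ {X = Y k} {X′ = Upto m}
     (Yᵈ k) (region-decomposition k) (regions-upto m (ℕ.<⇒≤ m<r))
     (λ x (_ , p) (k′ , k′<m , _ , q) → region-disjoint
       (λ { ≡.refl → ℕ.<-irrefl ≡.refl (≡.subst (ℕ._< m) (Fin.toℕ-fromℕ< m<r) k′<m) }) p q)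
     (λ x y → k , ℕ.s≤s (ℕ.≤-reflexive (Fin.toℕ-fromℕ< m<r)) , y)
     (λ x (k′ , k′<m , y) → k′ , ℕ.<-trans k′<m (ℕ.n<1+n m) , y)
     (λ x (k′ , k′<1+m , y) → [ (λ k′<m → inj₂ (k′ , k′<m , y)) , (λ k′≡m → inj₁ (≡.subst (λ k → Y k x)
         (Fin.toℕ-injective (≡.trans k′≡m (≡.sym (Fin.toℕ-fromℕ< m<r)))) y)) ]′
       (ℕ.m≤n⇒m<n∨m≡n (ℕ.≤-pred k′<1+m)))
     where
     k : Fin (suc r)
     k = Fin.fromℕ< m<r

   step : Decomposition (fromℕ b) J X
   step = Decomposition-refine (uptoᵈ (suc r)) (regions-upto (suc r) ℕ.≤-refl) (λ x (_ , _ , p , _) → p)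
     (∀*ⁿ-map (λ x un p → let k , q = in-region x un in k , Fin.toℕ<n k , p , q) untied)

 -- One bound serves all `r`: the sides of new bands are edges with slopes at most 1 or ties with
 -- slopes at most `20 * top n`, whatever the bound of the cells below.
 decomposable : ∀ n r → Decomposable n r (fromℕ (bound n))
 decomposable n (suc r) J J-inj dX X-dep = Step.step J J-inj (decomposable n r) ℕ.≤-refl dX X-dep
 decomposable n zero J J-inj {X} dX X-dep = by-cases (∃ X)
   (λ (x , x∈) → record
     { cells = record { cell = whole ; valid = whole ; order⊆J = λ () ; J⊆order = λ () } ∷ []
     ; inside = (λ y _ → X-dep (agree λ ()) x∈) ∷ []
     ; disjoint = [] ∷ []
     ; covers = ∀*ⁿ-all λ _ _ → here tt })
   (λ empty → ∅-decomposition λ x x∈ → empty (x , x∈))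

 -- Charts and bounds for their slopes

 -- A section of the projection of K^ n to e of its coordinates.
 record Chart (n e : ℕ) : Set (s ⊔ ℓ) where
   field
     axes : Fin e → Fin n
     axes-inj : Injective axes
     coord : Fin n → JFun axes
     axis : ∀ k x → fn (func (coord (axes k))) x ≈ x (axes k)
 open Chart public

 module _ {n e : ℕ} where

   component : Chart n e → Fin n → DFun n
   component c i = func (coord c i)

   lift : Chart n e → K^ n → K^ n
   lift c x i = fn (component c i) x

   liftᵈ : ∀ c {v : ⟪ Γ ⟫ → K^ n} → DefV v → DefV (λ ρ → lift c (v ρ))
   liftᵈ c dv i = appⱽ (fnᵈ (component c i)) dv

   Tame : ℕ → Chart n e → K^ n → Set ℓ
   Tame m c x = ∀ i → Regular (component c i) x ×
     (Fin.toℕ i ℕ.< m → ∀ l → ∣ fn (∂ (component c i) l) x ∣ ≤ fromℕ (slopeBound m))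

   tameᵈ : ∀ m c → Defⱽ (Tame m c)
   tameᵈ m c = ∀Finᵈ λ i → Regularᵈ (component c i) ×ᵈ (constᵖ _ →ᵈ
     ∀Finᵈ λ l → ∣ fnᵈ (∂ (component c i) l) ∣ᵈ ≤ᵈ constᵈ)

   tame-dep : ∀ m c → DependsP (axes c) (Tame m c)
   tame-dep m c e t i = Regular-depends (component c i) (dep (coord c i)) e (proj₁ (t i)) ,
     λ i<m l → ≤-trans (inj₂ (∣∣-cong (sym (∂-depends (component c i) (dep (coord c i)) l e))))
       (proj₂ (t i) i<m l)

   lift-cong : ∀ c {x y} → Agree (axes c) x y → lift c x ≋ lift c y
   lift-cong c e i = dep (coord c i) e

   -- Up to small sets, the tame part of `c` is contained in the tame parts of the charts in `L`. It
   -- is put in terms of properties `W` of points because the charts have different axes, over which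
   -- smallness is measured.
   Controls : ℕ → Chart n e → List (Chart n e) → Set (Level.suc (s ⊔ ℓ))
   Controls m c L = ∀ {W : K^ n → Set (s ⊔ ℓ)} → Defⱽ W →
     All (λ c′ → ∀*ⁿ λ y → Tame n c′ y → W (lift c′ y)) L →
     ∀*ⁿ λ x → Tame m c x → W (lift c x)

   open Collect {W = Chart n e} (s ⊔ ℓ)

   Controls-mono : ∀ m c → Monotone (Controls m c)
   Controls-mono m c mono h dW hs = h dW (All.tabulate λ c∈ → All.lookup hs (mono c∈))

   tame-next : ∀ {m c x} (m<n : m ℕ.< n) → Tame m c x →
     (∀ l → ∣ fn (∂ (component c (Fin.fromℕ< m<n)) l) x ∣ ≤ 1#) → Tame (suc m) c x
   tame-next {m} {c} {x} m<n t h i = proj₁ (t i) , λ i≤m l →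
     [ (λ i<m → ≤-trans (proj₂ (t i) i<m l) (fromℕ-mono (slopeBound≤ m))) ,
       (λ i≡m → ≤-trans (≡.subst (λ i → ∣ fn (∂ (component c i) l) x ∣ ≤ 1#)
           (Fin.toℕ-injective (≡.trans (Fin.toℕ-fromℕ< m<n) (≡.sym i≡m))) (h l))
         (≤-trans (inj₂ (sym (+-identityʳ 1#))) (fromℕ-mono (1≤slopeBound (suc m))))) ]′
       (ℕ.m≤n⇒m<n∨m≡n (ℕ.≤-pred i≤m))

   projection-lip : ∀ {x : K^ n} (f : DFun n) i → (∀ y → fn f y ≈ y i) → Lip (fn f) 1# x
   projection-lip {x} f i f≈ = 1# , 0<1 , λ y _ → ≤-trans
     (inj₂ (trans (∣∣-cong (+-cong (f≈ y) (-‿cong (f≈ x)))) (∣-∣ _ _)))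
     (≤-trans (coord≤dist x y i) (inj₂ (sym (*-identityˡ _))))

   -- Exchange the axis l = axes k for the coordinate i, along which c is
   -- steep in the direction l.
   module Exchange (c : Chart n e) {m} (m<n : m ℕ.< n) (k : Fin e)
     (i∉ : ∀ k → axes c k ≢ Fin.fromℕ< m<n) where

     i l : Fin n
     i = Fin.fromℕ< m<n
     l = axes c k

     J : Fin (suc e) → Fin n
     J = i Vector.∷ axes c

     J-inj : Injective J
     J-inj {zero} {zero} _ = ≡.refl
     J-inj {zero} {suc b} e = ⊥-elim (i∉ b (≡.sym e))
     J-inj {suc a} {zero} e = ⊥-elim (i∉ a e)
     J-inj {suc a} {suc b} e = ≡.cong suc (axes-inj c e)

     J′ : Fin e → Fin n
     J′ = J ∘ punchIn (suc k)

     β : DFun n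
     β = component c i

     open SwapOver J J-inj zero (suc k) (λ ()) β (dep (coord c i)) public

     unswap : DFun n → K^ n → K^ n
     unswap δ y = y [ l ≔ fn δ y ]

     unswapᵈ : ∀ δ → DefV (λ (ρ : ⟪ ∅ ▸ vec n ⟫) → unswap δ (proj₂ ρ))
     unswapᵈ δ = updᵈ v₀ l (fnᵈ δ)

     unswap-agree : ∀ δ → DependsF J′ (fn δ) → ∀ {x y} → Agree J′ x y →
                    Agree (axes c) (unswap δ x) (unswap δ y)
     unswap-agree δ δ-dep {x} {y} e = agree λ a → trans (on (agree-upd e (fn δ x)) a)
       (upd-cong {x = y} l ≋-refl (δ-dep e) (axes c a))

     composite : DFun n → Fin n → DFun n
     composite δ j = dfun (λ y → fn (component c j) (unswap δ y)) (appⱽ (fnᵈ (component c j)) (unswapᵈ δ))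

     coordinate : ∀ δ → DependsF J′ (fn δ) → ∀ j → Σ (JFun J′) λ g →
       (j ≡ i × (∀ x → fn (func g) x ≈ x i)) ⊎ (j ≢ i × func g ≡ composite δ j)
     coordinate δ δ-dep j with j Fin.≟ i
     ... | yes j≡i = record { func = dfun (λ x → x i) (v₀ i) ; dep = λ {x} {y} e → ≡.subst (λ b → x (J b) ≈ y (J b))
                       (punchIn-punchOut {i = suc k} {zero} (λ ())) (on e (punchOut {i = suc k} {zero} (λ ()))) } ,
                     inj₁ (j≡i , λ _ → refl)
     ... | no j≢i = record { func = composite δ j ; dep = λ e → dep (coord c j) (unswap-agree δ δ-dep e) } ,
                     inj₂ (j≢i , ≡.refl)

     axis′ : ∀ δ (δ-dep : DependsF J′ (fn δ)) b → b ≢ suc k → ∀ x → fn (func (proj₁ (coordinate δ δ-dep (J b)))) x ≈ x (J b)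
     axis′ δ δ-dep b b≢ x with coordinate δ δ-dep (J b)
     ... | g , inj₁ (e , h) = trans (h x) (reflexive (≡.cong x (≡.sym e)))
     axis′ δ δ-dep zero b≢ x | g , inj₂ (j≢i , _) = ⊥-elim (j≢i ≡.refl)
     axis′ δ δ-dep (suc a) b≢ x | g , inj₂ (_ , ≡.refl) = trans (axis c a (unswap δ x))
       (upd-other x λ e → b≢ (≡.cong suc (axes-inj c e)))

     exchange : ∀ δ → DependsF J′ (fn δ) → Chart n e
     exchange δ δ-dep = record
       { axes = J′
       ; axes-inj = λ e → punchIn-injective (suc k) _ _ (J-inj e)
       ; coord = λ j → proj₁ (coordinate δ δ-dep j)
       ; axis = λ a → axis′ δ δ-dep (punchIn (suc k) a) (punchInᵢ≢i (suc k) a)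
       }

     lift-exchange : ∀ δ (δ-dep : DependsF J′ (fn δ)) {y} → On δ y → lift (exchange δ δ-dep) y ≋ lift c (unswap δ y)
     lift-exchange δ δ-dep {y} (_ , y≈) j with coordinate δ δ-dep j
     ... | g , inj₁ (≡.refl , h) = trans (h y) y≈
     ... | g , inj₂ (_ , ≡.refl) = refl

     -- Component `i` has become a coordinate, with slopes at most 1. The earlier components are
     -- composed with `δ`, which accounts for the growth of `slopeBound`; of the later ones only
     -- regularity is asked.
     tame-exchange : ∀ δ (δ-dep : DependsF J′ (fn δ)) {y} → (∀ j → Regular (component (exchange δ δ-dep) j) y) →
       Lip (fn δ) (fromℕ 3) y → Tame m c (unswap δ y) → Tame (suc m) (exchange δ δ-dep) y
     tame-exchange δ δ-dep {y} reg lip t j = reg j , λ j≤m →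
       proj₂ (good-lip⇒good (component (exchange δ δ-dep) j) (reg j) (bounded j≤m))
       where
       B B′ : Carrier
       B = fromℕ (slopeBound m)
       B′ = fromℕ (slopeBound (suc m))
       bounded : Fin.toℕ j ℕ.< suc m → Lip (fn (component (exchange δ δ-dep) j)) B′ y
       bounded j≤m with coordinate δ δ-dep j
       ... | g , inj₁ (_ , h) = Lip-weaken {f = fn (func g)}
         (≤-trans (inj₂ (sym (+-identityʳ 1#))) (fromℕ-mono (1≤slopeBound (suc m))))
         (projection-lip (func g) i h)
       ... | g , inj₂ (j≢i , ≡.refl) = Lip-weaken {f = fn (func g)}
         (lin 2 (λ B B′ → B′ :≈ (B :+ :1) :* # 4 ⊢ (B :+ :1) :* (:1 :+ # 3) :≤ B′)
           {ρ = B , B′ , tt} (trans (×1-homo-* (slopeBound m ℕ.+ 1) 4)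
             (*-congʳ (trans (×-homo-+ 1# (slopeBound m) 1) (+-congˡ (+-identityʳ 1#))))))
         (lip-substitute {F = fn (component c j)} {fn δ} {B + 1#} {fromℕ 3} {l} {y}
           (lin 1 (λ B → :0 :≤ B ∷ :0 :< :1 ⊢ :0 :≤ B :+ :1) (fromℕ-nonneg (slopeBound m)) 0<1)
           (fromℕ-nonneg 3) lip
           (good⇒lip {f = component c j} (proj₁ (t j) , proj₂ (t j) (j<m j≤m))))
         where
         j<m : Fin.toℕ j ℕ.< suc m → Fin.toℕ j ℕ.< m
         j<m j≤m = [ id , (λ j≡m → ⊥-elim (j≢i (Fin.toℕ-injective
           (≡.trans j≡m (≡.sym (Fin.toℕ-fromℕ< m<n)))))) ]′ (ℕ.m≤n⇒m<n∨m≡n (ℕ.≤-pred j≤m))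

     ControlsBranch : List (Chart n e) → DFun n → Set (Level.suc (s ⊔ ℓ))
     ControlsBranch L δ = Canonical Swapped δ → ∃ λ (can : Canonical Swapped δ) →
       Controls (suc m) (exchange δ (canonical⇒dep {δ} can)) L

     steep-controlled : ∀ L → All (ControlsBranch L) branches → ∀ {W : K^ n → Set (s ⊔ ℓ)} → Defⱽ W →
       All (λ c′ → ∀*ⁿ λ y → Tame n c′ y → W (lift c′ y)) L →
       ∀*ⁿ λ x → Steep β l x → Tame m c x → W (lift c x)
     steep-controlled L hs {W} dW hL = ∀*ⁿ-map (λ x h st → conclude x st (byContradiction (h st)))
         (transfer {N = λ y → ¬ All (λ δ → Reached δ y) branches} (¬ᵈ Allᵈ branches reachedᵈ)
           (λ y t ¬h h → ¬h (All.zipWith (λ {δ} (can , r) → reached-free δ can y t r)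
             (branches-canonical , h)))
           (∀*ⁿ-map (λ y h ¬h → ¬h h) (∀*ⁿ-All reachedᵈ
             (All.zipWith {P = Canonical Swapped} {Q = ControlsBranch L}
               (λ {δ} (can , h) → let can′ , h′ = h can in reached δ can′ h′) (branches-canonical , hs)))))
       where
       Reached : DFun n → K^ n → Set _
       Reached δ y = On δ y → Tame m c (unswap δ y) → W (lift c (unswap δ y))

       reachedᵈ : ∀ δ → Defⱽ (Reached δ)
       reachedᵈ δ = Onᵈ δ →ᵈ atⱽ (tameᵈ m c) (unswapᵈ δ) →ᵈ atⱽ dW (liftᵈ c (unswapᵈ δ))

       reached : ∀ δ (can : Canonical Swapped δ) →
                 Controls (suc m) (exchange δ (canonical⇒dep {δ} can)) L → ∀*ⁿ (Reached δ)
       reached δ can h = ∀*ⁿ-map₂ (∀Finᵈ λ j → Regularᵈ (component c′ j))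
         (λ y reg (lip , w) on t → respⱽ dW (lift-exchange δ δ-dep on)
           (w (tame-exchange δ δ-dep reg (lip on) t)))
         (∀*ⁿ-Fin (λ j → Regularᵈ (component c′ j)) (λ j → ∀*ⁿ-regular (component c′ j)))
         (∀*ⁿ-× (Onᵈ δ →ᵈ Lipᵈ) (branch-lip δ) (h dW hL))
         where
         δ-dep : DependsF J′ (fn δ)
         δ-dep = canonical⇒dep {δ} can
         c′ : Chart n e
         c′ = exchange δ δ-dep
         Lipᵈ : Defⱽ (Lip (fn δ) (fromℕ 3))
         Lipᵈ = Nbhdᵈ (∣ appⱽ (fnᵈ δ) v₀ -ᵈ appⱽ (fnᵈ δ) v₁ ∣ᵈ ≤ᵈ (constᵈ *ᵈ distᵈ v₁ v₀)) v₀

       reached-free : ∀ δ → Canonical Swapped δ → ∀ y t → Reached δ y → Reached δ (y [ l ≔ t ])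
       reached-free δ can y t h on t′ = respⱽ dW (λ j → lift-cong c (Agree-sym same) j)
         (h (On-dep δ δ-dep (Agree-sym free) on) (tame-dep m c same t′))
         where
         δ-dep : DependsF J′ (fn δ)
         δ-dep = canonical⇒dep {δ} can
         free : Agree J′ y (y [ l ≔ t ])
         free = Agree-sym (Agree-upd (punch≢ J-inj (suc k)) y)
         same : Agree (axes c) (unswap δ (y [ l ≔ t ])) (unswap δ y)
         same = unswap-agree δ δ-dep (Agree-sym free)

       conclude : ∀ x → Steep β l x → All (λ δ → Reached δ (x [ i ≔ fn β x ])) branches →
                  Tame m c x → W (lift c x)
       conclude x st hs t =
         let h , e , on = All.lookupAny hs (on-branch x st)
             same = agree λ a → trans (sym (upd-other x (i∉ a))) (sym (upd-self _ l (sym e) (axes c a)))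
         in respⱽ dW (lift-cong c (Agree-sym same)) (h on (tame-dep m c same t))

   opaque
    -- `d` is the number of components still to be treated. Where component `m` is flat, the chart
    -- is kept; where it is steep, it is so along one of the axes, as it does not depend on anything
    -- else, and this axis is exchanged for it.
    controls : ∀ d m → d ℕ.+ m ≡ n → ∀ c → ∃ (Controls m c)
    controls zero m ≡.refl c = c ∷ [] , λ { dW (h ∷ []) → h }
    controls (suc d) m d+m≡n c = by-cases (∃ λ k → axes c k ≡ i) on-axis
      (λ i∉ → combine λ k k≡i → i∉ (k , k≡i))
      where
      m<n : m ℕ.< n
      m<n = ℕ.≤-trans (ℕ.m≤n+m (suc m) d) (ℕ.≤-reflexive (≡.trans (ℕ.+-suc d m) d+m≡n))
      i : Fin n
      i = Fin.fromℕ< m<n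
      recur : ∀ c → ∃ (Controls (suc m) c)
      recur = controls d (suc m) (≡.trans (ℕ.+-suc d m) d+m≡n)
      L : List (Chart n e)
      L = proj₁ (recur c)
      L-controls : Controls (suc m) c L
      L-controls = proj₂ (recur c)
      on-axis : (∃ λ k → axes c k ≡ i) → ∃ (Controls m c)
      on-axis (k , k≡i) = L , λ dW hs → ∀*ⁿ-map (λ x w t → w (tame-next {c = c} m<n t λ l →
          ≡.subst (λ i → ∣ fn (∂ (component c i) l) x ∣ ≤ 1#) k≡i
            (proj₂ (good-lip⇒good (component c (axes c k)) (proj₁ (t (axes c k)))
              (projection-lip (component c (axes c k)) (axes c k) (axis c k))) l)))
        (L-controls dW hs)
      combine : (∀ k → axes c k ≢ i) → ∃ (Controls m c)
      combine i∉ = L List.++ L′ , λ {W} dW hs → ∀*ⁿ-map₂ {P = λ x → Tame (suc m) c x → W (lift c x)}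
          (tameᵈ (suc m) c →ᵈ atⱽ dW (liftᵈ c v₀))
          (λ x flat steep t → [ (λ good → flat (tame-next {c = c} m<n t (proj₂ good))) ,
            (λ (l , st) → by-cases (∃ λ k → axes c k ≡ l) (λ { (k , ≡.refl) → steep k st t })
              (λ l∉ → ⊥-elim (<-irrefl refl (<-trans 0<1 (<-respʳ (∣∣-zero
                (∂-free (component c i) (dep (coord c i)) (λ k e → l∉ (k , e))
                  (proj₁ (Nbhd-centre (proj₁ (t i)) l)))) (proj₁ (proj₂ st))))))) ]′
            (flat⊎steep (component c i) (proj₁ (t i))))
          (L-controls dW (All.++⁻ˡ L hs))
          (∀*ⁿ-Fin (λ k → Steepᵈ (component c i) (axes c k) →ᵈ tameᵈ m c →ᵈ atⱽ dW (liftᵈ c v₀))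
            λ k → X.steep-controlled k L′ (proj₂ exchanged k) dW (All.++⁻ʳ L hs))
        where
        module X (k : Fin e) = Exchange c m<n k i∉
        branch : ∀ k δ → ∃ λ L → X.ControlsBranch k L δ
        branch k δ = by-cases (Canonical (X.Swapped k) δ) known (λ ¬can → [] , λ can → ⊥-elim (¬can can))
          where
          known : Canonical (X.Swapped k) δ → ∃ λ L → X.ControlsBranch k L δ
          known can = let L , h = recur (X.exchange k δ (X.canonical⇒dep k {δ} can)) in
            L , λ _ → can , h
        branch-mono : ∀ k δ → Monotone (λ L → X.ControlsBranch k L δ)
        branch-mono k δ mono h can = let can′ , h′ = h can in
          can′ , Controls-mono (suc m) (X.exchange k δ (X.canonical⇒dep k {δ} can′)) mono h′
        exchanged : ∃ λ L′ → ∀ k → All (X.ControlsBranch k L′) (X.branches k)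
        exchanged = collect-Fin {Q = λ k L → All (X.ControlsBranch k L) (X.branches k)}
          (λ k mono → All.map λ {δ} h → branch-mono k δ mono h)
          (λ k → collect-list {Q = λ δ L → X.ControlsBranch k L δ} (branch-mono k) (branch k) (X.branches k))
        L′ : List (Chart n e)
        L′ = proj₁ exchanged

 -- Covering a set by disjoint patches of charts

 -- The projection of A to the coordinates J has empty interior.
 Small : ∀ {r} → (K^ n → Set a) → (Fin r → Fin n) → Set (ℓ ⊔ a)
 Small A J = ∀*ⁿ λ x → ¬ ∃ λ u → A u × Agree J u x

 agreeᵈ : ∀ {r} (J : Fin r → Fin n) {v w : ⟪ Γ ⟫ → K^ n} → DefV v → DefV w → Def (λ ρ → Agree J (v ρ) (w ρ))
 agreeᵈ J dv dw = ⇔ᵈ (∀Finᵈ λ k → dv (J k) ≈ᵈ dw (J k)) (λ _ → on) (λ _ → agree)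

 module _ {n e : ℕ} where

   module _ {A : K^ n → Set a} (dA : Defⱽ A)
     (thin : ∀ (J : Fin (suc e) → Fin n) → Injective J → Small A J)
     (J : Fin e → Fin n) (J-inj : Injective J) where

     private
       Value : Fin n → K^ n → Carrier → Set _
       Value i x t = ∃ λ u → (A u × Agree J u x) × u i ≈ t

       valueᵈ : ∀ i {v : ⟪ Γ ⟫ → K^ n} {t : ⟪ Γ ⟫ → Carrier} → DefV v → DefF t →
                Def (λ ρ → Value i (v ρ) (t ρ))
       valueᵈ i dv dt = ∃ᵈ ((atⱽ dA v₀ ×ᵈ agreeᵈ J v₀ (wkᵛ dv)) ×ᵈ v₀ i ≈ᵈ wk dt)

       Few : Fin n → K^ n → Set _
       Few i x = ∀* λ t → ¬ Value i x t

       fewᵈ : ∀ i → Defⱽ (Few i)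
       fewᵈ i = ∀*ᵈ (¬ᵈ (valueᵈ i v₁ s₀))

       -- With `i` as an additional coordinate the projection is small by `thin`; quantifying `i`
       -- innermost leaves finitely many values over almost every point.
       few : ∀ i → (∀ k → J k ≢ i) → ∀*ⁿ (Few i)
       few i i∉J = ∀*ⁿ-map (λ x h → ∀*-map (λ t ¬p (u , (u∈ , e) , u≈t) → ¬p (u , u∈ , agree λ
             { zero → trans u≈t (sym (upd-same x i))
             ; (suc k) → trans (on e k) (sym (upd-other x (i∉J k))) })) h)
         (∀*ⁿ-update (¬ᵈ (∃ᵈ (atⱽ dA v₀ ×ᵈ agreeᵈ (i Vector.∷ J) v₀ v₁))) i (thin (i Vector.∷ J) λ
             { {zero} {zero} _ → ≡.refl
             ; {zero} {suc b} e → ⊥-elim (i∉J b (≡.sym e))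
             ; {suc a} {zero} e → ⊥-elim (i∉J a e)
             ; {suc a} {suc b} e → ≡.cong suc (J-inj e) }))

       value-dep : ∀ i {x y} → Agree J x y → ∀ t → Value i x t → Value i y t
       value-dep i e t (u , (u∈ , e′) , u≈t) = u , (u∈ , agree λ k → trans (on e′ k) (on e k)) , u≈t

       values : ∀ i → ∃ λ (gs : List (JFun J)) → ∀ x t → Few i x × Value i x t →
                Any (λ g → t ≈ fn (func g) x) gs
       values i = dependent-functions (atⱽ (fewᵈ i) v₁ ×ᵈ valueᵈ i v₁ s₀)
         (λ x → by-cases (Few i x) (∀*-map λ t ¬v (_ , v) → ¬v v) (λ ¬few → ∀*-all λ t (f , _) → ¬few f))
         (λ e t (f , v) → ∀*-map (λ t ¬v v → ¬v (value-dep i (Agree-sym e) t v)) f , value-dep i e t v)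

       zero-function : JFun J
       zero-function = record { func = dfun (λ _ → 0#) constᵈ ; dep = λ _ → refl }

       module _ (v : Fin n → JFun J) where

         coordinate : ∀ i → Σ (JFun J) λ g → ((∃ λ k → J k ≡ i) × (∀ x → fn (func g) x ≈ x i)) ⊎
                                            ((∀ k → J k ≢ i) × g ≡ v i)
         coordinate i = by-cases (∃ λ k → J k ≡ i)
           (λ { (k , ≡.refl) → record { func = dfun (λ x → x (J k)) (v₀ (J k)) ; dep = λ e → on e k } ,
                               inj₁ ((k , ≡.refl) , λ _ → refl) })
           (λ i∉J → v i , inj₂ ((λ k k≡i → i∉J (k , k≡i)) , ≡.refl))

         chart : Chart n e
         chart = record
           { axes = J ; axes-inj = J-inj ; coord = λ i → proj₁ (coordinate i)
           ; axis = λ k x → [ (λ (_ , h) → h x) , (λ (J∌ , _) → ⊥-elim (J∌ k ≡.refl)) ]′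
               (proj₂ (coordinate (J k))) }

         on-chart : ∀ {x u} → Agree J u x → (∀ i → (∀ k → J k ≢ i) → u i ≈ fn (func (v i)) x) →
                    u ≋ lift chart x
         on-chart {x} {u} e h i = [ (λ { ((k , ≡.refl) , h′) → trans (on e k) (sym (h′ x)) })
           , (λ (i∉J , ≡v) → trans (h i i∉J) (reflexive (≡.cong (λ g → fn (func g) x) (≡.sym ≡v)))) ]′
           (proj₂ (coordinate i))

     charts : List (Chart n e)
     -- For `i` among the axes any choice will do, but there has to be one; `zero-function` provides
     -- it.
     charts = List.map chart (choices λ i → zero-function ∷ proj₁ (values i))

     charts-cover : ∀*ⁿ λ x → ∀ u → A u → Agree J u x → Any (λ c → u ≋ lift c x) charts
     charts-cover = ∀*ⁿ-map (λ x few u u∈ e → Any.map⁺ (Any.map (λ {v} h → on-chart v e h)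
         (∈-choices {P = λ i g → (∀ k → J k ≢ i) → u i ≈ fn (func g) x} λ i → by-cases (∃ λ k → J k ≡ i)
             (λ (k , k≡i) → here λ i∉J → ⊥-elim (i∉J k k≡i))
             (λ i∉J → there (Any.map (λ h _ → h) (proj₂ (values i) x (u i)
               (few i (λ k k≡i → i∉J (k , k≡i)) , u , (u∈ , e) , refl)))))))
       (∀*ⁿ-Fin (λ i → constᵖ _ →ᵈ fewᵈ i) λ i → by-cases (∃ λ k → J k ≡ i)
         (λ (k , k≡i) → ∀*ⁿ-all λ x i∉J → ⊥-elim (i∉J k k≡i))
         (λ i∉J → ∀*ⁿ-map (λ x h _ → h) (few i λ k k≡i → i∉J (k , k≡i))))

   record Patch : Set (s ⊔ ℓ) where
     field
       chart : Chart n e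
       base : CellOver (fromℕ (bound n)) (axes chart)
       tame : ∀ x → x ∈ₒ base → Tame n chart x
   open Patch public

   infix 4 _∈ₚ_
   _∈ₚ_ : K^ n → Patch → Set ℓ
   x ∈ₚ p = x ∈ₒ base p × x ≋ lift (chart p) x

   ∈ₚᵈ : ∀ p → Defⱽ (_∈ₚ p)
   ∈ₚᵈ p = ∈ᶜᵈ (cell (base p)) ×ᵈ v₀ ≋ᵈ liftᵈ (chart p) v₀

   Disjoint : List Patch → Set (s ⊔ ℓ)
   Disjoint = AllPairs λ p q → ∀ x → x ∈ₚ p → ¬ (x ∈ₚ q)

   lift-agree : ∀ (c : Chart n e) x → Agree (axes c) (lift c x) x
   lift-agree c x = agree λ k → axis c k x

   Covers : Chart n e → (K^ n → Set a) → List Patch → Set (a ⊔ s ⊔ ℓ)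
   Covers c R ps = ∀*ⁿ λ y → Tame n c y → R (lift c y) → Any (lift c y ∈ₚ_) ps

   module _ {R : K^ n → Set a} (dR : Defⱽ R) (c : Chart n e) where

     Over : K^ n → Set (ℓ ⊔ a)
     Over y = Tame n c y × R (lift c y)

     D : Decomposition (fromℕ (bound n)) (axes c) Over
     D = decompose (decomposable n e) (axes-inj c) (tameᵈ n c ×ᵈ atⱽ dR (liftᵈ c v₀))
       λ e (t , r) → tame-dep n c e t , respⱽ dR (lift-cong c e) r

     patch : ∀ {U} → (∀ x → x ∈ₒ U → Over x) → Patch
     patch {U} U⊂ = record { chart = c ; base = U ; tame = λ x x∈ → proj₁ (U⊂ x x∈) }

     over : List Patch
     over = All.reduce (λ {U} → patch {U}) (inside D)

     over⊂R : All (λ p → ∀ x → x ∈ₚ p → R x) over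
     over⊂R = reduce-All {Q = λ U → ∀ x → x ∈ₒ U → Over x}
       (λ U⊂ _ x (x∈ , e) → respⱽ dR (≋-sym e) (proj₂ (U⊂ x x∈)))
       (inside D) (inside D)

     over-disjoint : Disjoint over
     over-disjoint = reduce-AllPairs {S = λ U V → ∀ x → x ∈ₒ U → ¬ (x ∈ₒ V)}
       (λ U⊂ V⊂ h x x∈ x∈′ → h x (proj₁ x∈) (proj₁ x∈′))
       (inside D) (disjoint D)

     over-covers : Covers c R over
     over-covers = ∀*ⁿ-map (λ y cov t r → reduce-Any {Q = y ∈ₒ_}
       (λ {U} U⊂ h → ∈ₒ-depends U (Agree-sym (lift-agree c y)) h , lift-cong c (Agree-sym (lift-agree c y)))
       (inside D) (cov (t , r))) (covers D)

   Inside : (K^ n → Set a) → Patch → Set (ℓ ⊔ a)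
   Inside R p = ∀ x → x ∈ₚ p → R x

   Covering : List (Chart n e) → (K^ n → Set a) → Set (a ⊔ s ⊔ ℓ)
   Covering cs R = ∃ λ (ps : List Patch) → All (Inside R) ps × Disjoint ps × All (λ c → Covers c R ps) cs

   -- Each chart is applied only to what the patches of the preceding charts leave over; this makes
   -- all the patches disjoint.
   cover : ∀ cs {R : K^ n → Set a} → Defⱽ R → Covering cs R
   cover [] dR = [] , [] , [] , []
   cover {a} (c ∷ cs) {R} dR = join (cover cs {R′} (dR ×ᵈ Allᵈ ps λ p → ¬ᵈ (∈ₚᵈ p)))
     where
     ps : List Patch
     ps = over dR c
     R′ : K^ n → Set (a ⊔ s ⊔ ℓ)
     R′ x = R x × All (λ p → ¬ (x ∈ₚ p)) ps
     join : Covering cs R′ → Covering (c ∷ cs) R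
     join (qs , qs⊂ , qs-disjoint , qs-cover) = ps List.++ qs ,
       All.++⁺ (over⊂R dR c) (All.map {P = Inside R′} {Q = Inside R} (λ h x x∈ → proj₁ (h x x∈)) qs⊂) ,
       AllPairs.++⁺ (over-disjoint dR c) qs-disjoint (All.tabulate λ {p} p∈ →
         All.map {P = Inside R′} (λ {q} h x x∈p x∈q → All.lookup (proj₂ (h x x∈q)) p∈ x∈p) qs⊂) ,
       ∀*ⁿ-map (λ y cov t r → Any.++⁺ˡ (cov t r)) (over-covers dR c) ∷
       All.map {P = λ c → Covers c R′ qs} (λ {c′} → extend c′) qs-cover
       where
       extend : ∀ c → Covers c R′ qs → Covers c R (ps List.++ qs)
       extend c = ∀*ⁿ-map λ y cov t r → by-cases (Any (lift c y ∈ₚ_) ps) Any.++⁺ˡ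
         (λ ∉ps → Any.++⁺ʳ ps (cov t (r , All.¬Any⇒All¬ ps ∉ps)))

   patches : ∀ {A : K^ n → Set ℓ} → Defⱽ A →
     (∀ (J : Fin (suc e) → Fin n) → Injective J → Small A J) → ∃ λ (ps : List Patch) →
     All (Inside A) ps × Disjoint ps ×
     (∀ (J : Fin e → Fin n) → Injective J → Small (λ x → A x × ¬ Any (x ∈ₚ_) ps) J)
   patches {A = A} dA thin = ps , ps⊂A , ps-disjoint , small
     where
     open Collect {W = Chart n e} (s ⊔ ℓ)
     Inj : (Fin e → Fin n) → Set
     Inj J = ∀ i j → J i ≡ J j → i ≡ j
     chartsOver : ∀ J → Inj J → List (Chart n e)
     chartsOver J inj = charts dA thin J (inj _ _)
     Controlled : (Fin e → Fin n) → List (Chart n e) → Set (Level.suc (s ⊔ ℓ))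
     Controlled J L = Inj J → Σ (Inj J) λ inj → All (λ c → Controls 0 c L) (chartsOver J inj)
     -- `choices` enumerates all maps `Fin e → Fin n`; the ones that are not injective contribute no
     -- chart.
     controlled : ∃ λ L → All (λ J → Controlled J L) (choices λ _ → List.allFin n)
     controlled = collect-list {Q = Controlled}
       (λ J mono h inj → Prod.map₂ (All.map λ {c} → Controls-mono 0 c mono) (h inj)) control _
       where
       known : ∀ J → Inj J → ∃ (Controlled J)
       known J inj = let L , h = collect-list {Q = Controls 0} (Controls-mono 0)
                                   (controls n 0 (ℕ.+-identityʳ n)) (chartsOver J inj) in
         L , λ _ → inj , h
       control : ∀ J → ∃ (Controlled J)
       control J = by-cases (Inj J) (known J) (λ ¬inj → [] , λ inj → ⊥-elim (¬inj inj))
     L : List (Chart n e)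
     L = proj₁ controlled
     covered = cover L dA
     ps : List Patch
     ps = proj₁ covered
     ps⊂A = proj₁ (proj₂ covered)
     ps-disjoint = proj₁ (proj₂ (proj₂ covered))
     W : K^ n → Set (s ⊔ ℓ)
     W x = A x → Any (x ∈ₚ_) ps
     dW : Defⱽ W
     dW = dA →ᵈ Anyᵈ ps ∈ₚᵈ
     small : ∀ (J : Fin e → Fin n) → Injective J → Small (λ x → A x × ¬ Any (x ∈ₚ_) ps) J
     small J J-inj = ∀*ⁿ-map₂ (Allᵈ cs λ c → atⱽ dW (liftᵈ c v₀)) (λ x ws onto (u , (u∈ , ∉ps) , e) →
         let w , u≋ = All.lookupAny ws (onto u u∈ (agree λ k →
               ≡.subst (λ i → u i ≈ x i) (≡.sym (v≡J k)) (on e k)))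
         in ∉ps (respⱽ dW (≋-sym u≋) w u∈))
       (∀*ⁿ-All (λ c → atⱽ dW (liftᵈ c v₀)) (All.map (λ {c} h → ∀*ⁿ-map₂ (tameᵈ 0 c) (λ x t w → w t)
           (∀*ⁿ-Fin (λ i → Regularᵈ (component c i) ×ᵈ (constᵖ _ →ᵈ
               ∀Finᵈ λ l → ∣ fnᵈ (∂ (component c i) l) ∣ᵈ ≤ᵈ constᵈ))
             λ i → ∀*ⁿ-map (λ x r → r , λ ()) (∀*ⁿ-regular (component c i)))
           (h dW (proj₂ (proj₂ (proj₂ covered)))))
         (proj₂ known)))
       (charts-cover dA thin v (proj₁ known _ _))
       where
       Js : List (Fin e → Fin n)
       Js = choices λ _ → List.allFin n
       found : Any (λ v → ∀ k → v k ≡ J k) Js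
       found = ∈-choices {P = λ k i → i ≡ J k} λ k → Any.map ≡.sym (∈-allFin (J k))
       -- Functions in the list are found up to pointwise equality only, so `v` stands in for `J`.
       v : Fin e → Fin n
       v = Any.lookup found
       v≡J : ∀ k → v k ≡ J k
       v≡J = proj₂ (All.lookupAny (proj₂ controlled) found)
       known : Σ (Inj v) λ inj → All (λ c → Controls 0 c L) (chartsOver v inj)
       known = proj₁ (All.lookupAny {P = λ J → Controlled J L} (proj₂ controlled) found) λ i j vi≡vj →
         J-inj (≡.trans (≡.sym (v≡J i)) (≡.trans vi≡vj (v≡J j)))
       cs : List (Chart n e)
       cs = chartsOver v (proj₁ known)

 -- Comparison with the Euclidean norm; dimension

 open Geometry 𝓚 public using
   ( ‖_‖²; _⊖_; Ball; IsOpen; ContinuousOn; Graph; Matrix; _∙_; HasDifferentialAt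
   ; IsDifferential; OperatorNormBound; IsMFunction; IsC¹MFunction; Bound; lower; upper
   ; cellGraph; cellBand; IsCell; origin; graph; band; IsMCell; IsContinuousCell; dim_≤_; dim_<_
   ; IsBasicRectifiable; IsBasicRectifiablePartition)
   renaming (scalar to scalar′)

 ∣∣² : ∀ x → ∣ x ∣ * ∣ x ∣ ≈ x * x
 ∣∣² x = by-cases (0# ≤ x) (λ 0≤x → *-cong (∣∣-pos 0≤x) (∣∣-pos 0≤x))
   (λ 0≰x → let e = ∣∣-neg (inj₁ (≰⇒> 0≰x)) in
     trans (*-cong e e) (lin 1 (λ x → ⊢ (:- x) :* (:- x) :≈ x :* x)))

 0≤² : ∀ x → 0# ≤ x * x
 0≤² x = ≤-trans (*-nonneg (0≤∣ x ∣) (0≤∣ x ∣)) (inj₂ (∣∣² x))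

 ²-mono-≤ : ∀ {x y} → 0# ≤ x → x ≤ y → x * x ≤ y * y
 ²-mono-≤ 0≤x x≤y = ≤-trans (*-monoˡ-≤ 0≤x x≤y) (*-monoʳ-≤ (≤-trans 0≤x x≤y) x≤y)

 ²-cancel-< : ∀ {x y} → 0# ≤ y → x * x < y * y → x < y
 ²-cancel-< 0≤y x²<y² = by-cases _ id λ x≮y → ⊥-elim (≤⇒≯ (²-mono-≤ 0≤y (≮⇒≥ x≮y)) x²<y²)

 0≤‖_‖² : (x : K^ n) → 0# ≤ ‖ x ‖²
 0≤‖ x ‖² = sum-nonneg λ i → 0≤² (x i)

 ball⇒coord : ∀ {x y : K^ n} {δ} → 0# < δ → Ball x δ y → ∀ i → ∣ y i - x i ∣ < δ
 ball⇒coord {x = x} {y} 0<δ y∈ i = ²-cancel-< (inj₁ 0<δ)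
   (≤-<-trans (≤-trans (inj₂ (∣∣² _)) (≤-sum (λ i → 0≤² (y i - x i)) i)) y∈)

 coords⇒dist : ∀ (x y : K^ n) {ρ} → (∀ i → ∣ x i - y i ∣ ≤ ρ) → dist x y ≤ fromℕ n * ρ
 coords⇒dist {zero} x y h = ≤-trans (inj₂ (dist-[] x y)) (inj₂ (sym (zeroˡ _)))
 coords⇒dist {suc n} x y {ρ} h = ≤-trans (inj₂ (dist-∷ x y))
   (lin 4 (λ a d N ρ → a :≤ ρ ∷ d :≤ N :* ρ ⊢ a :+ d :≤ (:1 :+ N) :* ρ)
     (h zero) (coords⇒dist (x ∘ suc) (y ∘ suc) (h ∘ suc)))

 ‖‖²≤dist² : ∀ (x y : K^ n) → ‖ y ⊖ x ‖² ≤ dist x y * dist x y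
 ‖‖²≤dist² {zero} x y = 0≤² (dist x y)
 ‖‖²≤dist² {suc n} x y = ≤-trans
   (lin 5 (λ a m d S q → m :* m :≈ q ∷ S :≤ d :* d ∷ :0 :≤ m :* d ⊢ q :+ S :≤ (m :+ d) :* (m :+ d))
     {ρ = 0# , ∣ x zero - y zero ∣ , dist (x ∘ suc) (y ∘ suc) , _ , _ , tt}
     (trans (∣∣² _) (lin 2 (λ a b → ⊢ (a :- b) :* (a :- b) :≈ (b :- a) :* (b :- a))))
     (‖‖²≤dist² (x ∘ suc) (y ∘ suc)) (*-nonneg (0≤∣ _ ∣) (0≤dist _ _)))
   (inj₂ (*-cong (sym (dist-∷ x y)) (sym (dist-∷ x y))))

 dist⇒ball : ∀ {x y : K^ n} {δ} → dist x y < δ → Ball x δ y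
 dist⇒ball {x = x} {y} d<δ = ≤-<-trans (‖‖²≤dist² x y)
   (≤-<-trans (*-monoˡ-≤ (0≤dist x y) (inj₁ d<δ)) (<-respʳ refl
     (<-respˡ (*-comm _ _) (*-monoˡ-< (≤-<-trans (0≤dist x y) d<δ) d<δ))))

 -- Each coordinate is split off by `(m + d)² ≤ 2 m² + 2 d²`, which is linear in the squares and
 -- products and gives a power of 2.
 dist²≤‖‖² : ∀ (x y : K^ n) → dist x y * dist x y ≤ fromℕ (2 ℕ.^ n) * ‖ y ⊖ x ‖²
 dist²≤‖‖² {zero} x y = inj₂ (trans (*-cong (dist-[] x y) (dist-[] x y)) (trans (zeroˡ _) (sym (zeroʳ _))))
 dist²≤‖‖² {suc n} x y = ≤-trans (inj₂ (*-cong (dist-∷ x y) (dist-∷ x y)))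
   (lin 6 (λ m d P P′ q S → m :* m :≈ q ∷ d :* d :≤ P :* S ∷ :0 :≤ (m :- d) :* (m :- d) ∷
       P′ :* (q :+ S) :≈ (# 2 :* P) :* (q :+ S) ∷ :0 :≤ (P :- :1) :* q ⊢
       (m :+ d) :* (m :+ d) :≤ P′ :* (q :+ S))
     {ρ = ∣ x zero - y zero ∣ , dist (x ∘ suc) (y ∘ suc) , fromℕ (2 ℕ.^ n) , fromℕ (2 ℕ.^ suc n) , _ , _ , tt}
     (trans (∣∣² _) (lin 2 (λ a b → ⊢ (a :- b) :* (a :- b) :≈ (b :- a) :* (b :- a))))
     (dist²≤‖‖² (x ∘ suc) (y ∘ suc)) (0≤² _) (*-congʳ (×1-homo-* 2 (2 ℕ.^ n)))
     (*-nonneg (lin 1 (λ P → :1 :≤ P ⊢ :0 :≤ P :- :1)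
       (≤-trans (inj₂ (sym (+-identityʳ 1#))) (fromℕ-mono (ℕ.>-nonZero⁻¹ _ {{ℕ.m^n≢0 2 n}})))) (0≤² _)))

 ball-in-nbhd : ∀ {m} {δ} → 0# < δ → ∃ λ δ′ → 0# < δ′ × (∀ {x y : K^ m} → Ball x δ′ y → dist x y < δ)
 ball-in-nbhd {m} {δ} 0<δ = let δ′ , 0<δ′ , h = scaled {K = fromℕ m} 0<δ (fromℕ-nonneg m) in
   δ′ , 0<δ′ , λ {x} {y} y∈ → ≤-<-trans
     (coords⇒dist x y λ i → ≤-trans (inj₂ (∣-∣ _ _)) (inj₁ (ball⇒coord {x = x} {y} 0<δ′ y∈ i)))
     (lin 3 (λ e K δ → :0 :< e ∷ e :+ K :* e :≤ δ ⊢ K :* e :< δ) 0<δ′ h)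

 ball₁ : ∀ {s t ε} → 0# < ε → ∣ s - t ∣ < ε → Ball {1} (λ _ → t) ε (λ _ → s)
 ball₁ {s} {t} {ε} 0<ε h = ≤-<-trans (inj₂ (trans (+-identityʳ _) (sym (∣∣² (s - t)))))
   (≤-<-trans (*-monoˡ-≤ (0≤∣ s - t ∣) (inj₁ h)) (<-respˡ (*-comm ε _) (*-monoˡ-< 0<ε h)))

 arbitrarily-small : ∀ {a b} → 0# ≤ b → (∀ ε → 0# < ε → a ≤ ε * b) → a ≤ 0#
 arbitrarily-small {a} {b} 0≤b h = ≮⇒≥ λ 0<a →
   let ε , 0<ε , small = scaled {K = b} 0<a 0≤b in
   ≤⇒≯ (h ε 0<ε) (lin 3 (λ a b ε → :0 :< ε ∷ ε :+ b :* ε :≤ a ⊢ ε :* b :< a) 0<ε small)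

 infixl 5 _∷ʳ_
 _∷ʳ_ : K^ n → Carrier → K^ (suc n)
 _∷ʳ_ {zero} x t i = t
 _∷ʳ_ {suc n} x t zero = x zero
 _∷ʳ_ {suc n} x t (suc i) = (x ∘ suc ∷ʳ t) i

 init-∷ʳ : ∀ (x : K^ n) t → init (x ∷ʳ t) ≋ x
 init-∷ʳ {suc n} x t zero = refl
 init-∷ʳ {suc n} x t (suc i) = init-∷ʳ (x ∘ suc) t i

 last-∷ʳ : ∀ (x : K^ n) t → last (x ∷ʳ t) ≈ t
 last-∷ʳ {zero} x t = refl
 last-∷ʳ {suc n} x t = last-∷ʳ (x ∘ suc) t

 -- The functions that define a cell come without respect for the setoid equality. On `X` continuity
 -- forces it: equal points lie in every ball around each other.
 continuous-cong : ∀ {m} {X : K^ m → Set ℓ} {f : K^ m → Carrier} → ContinuousOn X (scalar′ f) →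
                   ∀ {x y} → X x → X y → x ≋ y → f x ≈ f y
 continuous-cong {f = f} cont {x} {y} x∈ y∈ x≋y = lin 3 (λ a b m → :- (b :- a) :≤ m ∷ b :- a :≤ m ∷ m :≤ :0 ⊢ a :≈ b)
   (-x≤∣x∣ _) (x≤∣x∣ _) (arbitrarily-small {b = 1#} (inj₁ 0<1) λ ε 0<ε →
     let δ , 0<δ , h = cont x x∈ ε 0<ε in
     ≤-trans (inj₁ (ball⇒coord {1} {scalar′ f x} {scalar′ f y} 0<ε (h y y∈ (dist⇒ball {x = x} {y}
       (<-respˡ (sym (dist-≋ {x = x} {y} x≋y)) 0<δ))) zero)) (inj₂ (sym (*-identityʳ ε))))

 -- Continuous cells have projections with interior

 module _ {m : ℕ} {Y : K^ m → Set ℓ} where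

   ContinuousBound : Bound m → Set (s ⊔ ℓ)
   ContinuousBound = MaybeAll.All λ f → Definable (Graph Y (scalar′ f)) × ContinuousOn Y (scalar′ f)

   Lo-move : ∀ f → ContinuousBound f → ∀ {x y t u} → Y x → Y y → x ≋ y → t ≈ u →
             Lo (lower f x) t → Lo (lower f y) u
   Lo-move nothing _ _ _ _ _ _ = tt
   Lo-move (just f) (MaybeAll.just (_ , cont)) x∈ y∈ e t≈u p =
     <-respʳ t≈u (<-respˡ (continuous-cong cont x∈ y∈ e) p)

   Hi-move : ∀ f → ContinuousBound f → ∀ {x y t u} → Y x → Y y → x ≋ y → t ≈ u →
             Hi (upper f x) t → Hi (upper f y) u
   Hi-move nothing _ _ _ _ _ _ = tt
   Hi-move (just f) (MaybeAll.just (_ , cont)) x∈ y∈ e t≈u p =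
     <-respˡ t≈u (<-respʳ (continuous-cong cont x∈ y∈ e) p)

 window : ∀ {m} (f g : Bound m) y → lower f y <± upper g y →
          ∃₂ λ a b → a < b × (∀ t → a < t → t < b → Lo (lower f y) t × Hi (upper g y) t)
 window nothing nothing y _ = 0# , 1# , 0<1 , λ _ _ _ → tt , tt
 window nothing (just g) y _ = g y - 1# , g y , x-1<x , λ _ _ t<b → tt , t<b
 window (just f) nothing y _ = f y , f y + 1# , x<x+1 , λ _ a<t _ → a<t , tt
 window (just f) (just g) y h = f y , g y , toLo (lower (just f) y) h , λ _ a<t t<b → a<t , t<b

 cell-resp : ∀ {m d} {C : K^ m → Set ℓ} → IsContinuousCell d C → ∀ {x y} → x ≋ y → C x → C y
 cell-resp (origin h) {y = y} _ _ = h y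
 cell-resp (graph f cY (_ , cont) (X⊂ , ⊂X)) x≋y x∈ =
   let y∈ , e = X⊂ x∈ ; y∈′ = cell-resp cY (x≋y ∘ inject₁) y∈ in
   ⊂X (y∈′ , trans (sym (x≋y _)) (trans e (continuous-cong cont y∈ y∈′ (x≋y ∘ inject₁))))
 cell-resp (band {Y = Y} f g cY gf gg _ (X⊂ , ⊂X)) {x} {y} x≋y x∈ =
   let y∈ , lo , hi = X⊂ x∈ ; y∈′ = cell-resp cY (x≋y ∘ inject₁) y∈ in
   ⊂X (y∈′ , fromLo (lower f (init y)) (Lo-move f gf y∈ y∈′ (x≋y ∘ inject₁) (x≋y _) (toLo (lower f (init x)) lo)) ,
             fromHi (upper g (init y)) (Hi-move g gg y∈ y∈′ (x≋y ∘ inject₁) (x≋y _) (toHi (upper g (init x)) hi)))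

 -- A graph keeps the coordinates of its base. A band adds its last coordinate, in which there is a
 -- nonempty interval over every point of the base.
 cell-projection : ∀ {m d} {C : K^ m → Set ℓ} → IsContinuousCell d C → Σ (Fin d → Fin m) λ J →
   Injective J × ¬ ∀*ⁿ (λ u → ¬ ∃ λ x → C x × (x ∘ J) ≋ u)
 cell-projection (origin h) = (λ ()) , (λ { {()} }) , λ { (almost (p , _)) → p ((λ ()) , h (λ ()) , λ ()) }
 cell-projection (graph f cY (_ , cont) (X⊂ , ⊂X)) =
   let J , J-inj , h = cell-projection cY in
   inject₁ ∘ J , J-inj ∘ Fin.inject₁-injective , λ small → h (∀*ⁿ-map (λ u ¬p (y , y∈ , e) →
       let y∈′ = cell-resp cY (≋-sym (init-∷ʳ y (f y))) y∈ in
       ¬p (y ∷ʳ f y , ⊂X (y∈′ , trans (last-∷ʳ y (f y))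
            (continuous-cong cont y∈ y∈′ (≋-sym (init-∷ʳ y (f y))))) ,
           λ k → trans (init-∷ʳ y (f y) (J k)) (e k))) small)
 cell-projection {suc m} {suc d} {C} (band {Y = Y} f g cY gf gg f<g (X⊂ , ⊂X)) =
   let J , J-inj , h = cell-projection cY
       J′ : Fin (suc d) → Fin (suc m)
       J′ = Fin.fromℕ m Vector.∷ (inject₁ ∘ J)
   in J′ , (λ { {zero} {zero} _ → ≡.refl
              ; {zero} {suc b} e → ⊥-elim (Fin.fromℕ≢inject₁ e)
              ; {suc a} {zero} e → ⊥-elim (Fin.fromℕ≢inject₁ (≡.sym e))
              ; {suc a} {suc b} e → ≡.cong suc (J-inj (Fin.inject₁-injective e)) }) ,
      λ { (almost small) → h (∀*ⁿ-map
        {P = λ u → ∀* λ t → ¬ ∃ λ x → C x × (x ∘ J′) ≋ (t Vector.∷ u)} (λ u few (y , y∈ , e) →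
        let a , b , a<b , inside = window f g y (f<g y y∈)
            t , a<t , t<b , ¬p = few a b a<b
            y∈′ = cell-resp cY (≋-sym (init-∷ʳ y t)) y∈
            lo , hi = inside t a<t t<b
            same = ≋-sym (init-∷ʳ y t)
        in ¬p (y ∷ʳ t , ⊂X (y∈′ ,
              fromLo (lower f (init (y ∷ʳ t))) (Lo-move f gf y∈ y∈′ same (sym (last-∷ʳ y t)) lo) ,
              fromHi (upper g (init (y ∷ʳ t))) (Hi-move g gg y∈ y∈′ same (sym (last-∷ʳ y t)) hi)) ,
            λ { zero → last-∷ʳ y t ; (suc k) → trans (init-∷ʳ y t (J k)) (e k) })) (almost small)) }

 definable-choiceⱽ : ∀ {m} n {S : K^ m → K^ n → Set a} →
   Def {∅ ▸ vec m ▸ vec n} (λ ρ → S (proj₂ (proj₁ ρ)) (proj₂ ρ)) →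
   ∃ λ (f : Fin n → DFun m) → ∀ x y → S x y → S x (λ i → fn (f i) x)
 definable-choiceⱽ zero dS = (λ ()) , λ x y → respⱽ (atⱽⱽ dS (λ i → constᵈ) v₀) λ ()
 definable-choiceⱽ (suc n) {S} dS =
   let f₀ , h₀ = definable-choice {S = λ x t → ∃ λ y → S x (t Vector.∷ y)}
                   (∃ᵈ (atⱽⱽ dS v₂ (consᵈ s₁ v₀)))
       f , h = definable-choiceⱽ n {λ x y → S x (fn f₀ x Vector.∷ y)}
                 (atⱽⱽ dS v₁ (consᵈ (appⱽ (fnᵈ f₀) v₁) v₀))
   in f₀ Vector.∷ f , λ x y p →
     let y′ , p′ = h₀ x (y zero) (y ∘ suc , respⱽ (atⱽⱽ dS (λ i → constᵈ) v₀) (≋-sym (∷-η y)) p)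
     in respⱽ (atⱽⱽ dS (λ i → constᵈ) v₀) (λ { zero → refl ; (suc i) → refl }) (h x y′ p′)

 graph-definable : ∀ {m} {X : K^ m → Set ℓ} {f : K^ m → Carrier} → Defⱽ X → Funⱽ f →
                   Definable (Graph X (scalar′ f))
 graph-definable {m} dX df = Defⱽ⇒Definable
   (atⱽ dX (λ i → v₀ (i ↑ˡ 1)) ×ᵈ (λ i → v₀ (m ↑ʳ i)) ≋ᵈ λ _ → appⱽ df λ i → v₀ (i ↑ˡ 1))

 -- Points as sequences, with junk value 0 beyond the dimension.
 seq : K^ n → ℕ → Carrier
 seq {zero} x i = 0#
 seq {suc n} x zero = x zero
 seq {suc n} x (suc i) = seq (x ∘ suc) i

 seqᵈ : {v : ⟪ Γ ⟫ → K^ n} → DefV v → ∀ i → DefF (λ ρ → seq (v ρ) i)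
 seqᵈ {n = zero} dv i = constᵈ
 seqᵈ {n = suc n} dv zero = dv zero
 seqᵈ {n = suc n} dv (suc i) = seqᵈ (dv ∘ suc) i

 seq-toℕ : ∀ (x : K^ n) i → seq x (toℕ i) ≡ x i
 seq-toℕ x zero = ≡.refl
 seq-toℕ x (suc i) = seq-toℕ (x ∘ suc) i

 seq-init : ∀ (x : K^ (suc n)) {i} → i ℕ.< n → seq (init x) i ≡ seq x i
 seq-init {suc n} x {zero} _ = ≡.refl
 seq-init {suc n} x {suc i} (ℕ.s≤s i<n) = seq-init (x ∘ suc) i<n

 seq-last : ∀ (x : K^ (suc n)) → seq x n ≡ last x
 seq-last {zero} x = ≡.refl
 seq-last {suc n} x = seq-last (x ∘ suc)

 seq-near : ∀ {x y : K^ n} {δ} → 0# < δ → (∀ i → ∣ y i - x i ∣ < δ) → ∀ i → ∣ seq y i - seq x i ∣ < δ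
 seq-near {zero} 0<δ h i = <-respˡ (sym (∣∣-zero (-‿inverseʳ 0#))) 0<δ
 seq-near {suc n} 0<δ h zero = h zero
 seq-near {suc n} {x} {y} 0<δ h (suc i) = seq-near {n} {x ∘ suc} {y ∘ suc} 0<δ (h ∘ suc) i

 -- Sets with a projection onto a set with interior contain cells

 module _ {n : ℕ} {A : K^ n → Set ℓ} (dA : Defⱽ A) where

   Onto : ∀ {d} → (Fin d → Fin n) → K^ d → Set ℓ
   Onto J u = ∃ λ x → A x × (x ∘ J) ≋ u

   ontoᵈ : ∀ {d} (J : Fin d → Fin n) → Defⱽ (Onto J)
   ontoᵈ J = ∃ᵈ (atⱽ dA v₀ ×ᵈ (λ k → v₀ (J k)) ≋ᵈ v₁)

   Thin : ∀ {d} → (Fin d → Fin n) → Set ℓ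
   Thin J = ∀*ⁿ λ u → ¬ Onto J u

   -- Cells are built in the fixed order of the coordinates, so coordinate `i` of a point may depend
   -- on earlier coordinates only. The hypothesis `thin`, that no axis can be replaced by an earlier
   -- coordinate, provides this: a dependence on a later axis would permit such a replacement.
   module _ {d : ℕ} (J : Fin d → Fin n) (J-inj : Injective J)
     (thin : ∀ i k → (∀ k → J k ≢ i) → toℕ i ℕ.< toℕ (J k) → Thin (updateAt J k (λ _ → i)))
     (¬thin : ¬ Thin J) where

     chosen : ∃ λ (f : Fin n → DFun d) → ∀ u x → A x × (x ∘ J) ≋ u →
              A (λ i → fn (f i) u) × (λ k → fn (f (J k)) u) ≋ u
     chosen = definable-choiceⱽ n {λ u x → A x × (x ∘ J) ≋ u} (atⱽ dA v₀ ×ᵈ (λ k → v₀ (J k)) ≋ᵈ v₁)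

     f : Fin n → DFun d
     f = proj₁ chosen

     section-spec : ∀ {u} → Onto J u → A (λ i → fn (f i) u) × (λ k → fn (f (J k)) u) ≋ u
     section-spec {u} (x , h) = proj₂ chosen u x h

     Later : Fin n → Fin d → Set
     Later i k = (∀ k → J k ≢ i) × toℕ i ℕ.< toℕ (J k)

     -- As the projection to `J′` is thin, on almost every line in direction `k` the section has
     -- finitely many values in coordinate `i`. Off the boundary points of their level sets it is
     -- locally constant.
     flat : ∀ i k → Later i k → ∀*ⁿ λ u → Onto J u → HasPartial (fn (f i)) k u 0#
     flat i k (i∉J , i<k) = ∀*ⁿ-update⁻ (ontoᵈ J →ᵈ HasPartialᵈ (fnᵈ (f i)) k v₀ constᵈ) k
         (∀*ⁿ-map (λ u few → on-line u (finite (atⱽ (ontoᵈ J′) (updᵈ (λ i → constᵈ) k s₀)) few))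
           (∀*ⁿ-update (¬ᵈ (ontoᵈ J′)) k (thin i k i∉J i<k)))
       where
       J′ : Fin d → Fin n
       J′ = updateAt J k (λ _ → i)
       on-line : ∀ u → (∃ λ cs → ∀ t → Onto J′ (u [ k ≔ t ]) → Any (t ≈_) cs) →
                 ∀* λ w → Onto J (u [ k ≔ w ]) → HasPartial (fn (f i)) k (u [ k ≔ w ]) 0#
       on-line u (cs , listed) = ∀*-map locally-constant (∀*-Any {R = Edge} edgeᵈ
           (All.universal (λ c → ∀*-map (λ w ¬bd (_ , bd) → ¬bd bd) (∀*-¬Boundary (levelᵈ c))) cs))
         where
         g : Carrier → Carrier
         g w = fn (f i) (u [ k ≔ w ])
         Value Edge : Carrier → Carrier → Set ℓ
         Value c w = g w ≈ c
         Edge c w = Value c w × Boundary (Value c) w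
         levelᵈ : ∀ c → Def₁ (Value c)
         levelᵈ c = appⱽ (fnᵈ (f i)) (updᵈ (λ i → constᵈ) k s₀) ≈ᵈ constᵈ
         edgeᵈ : ∀ c → Def₁ (Edge c)
         edgeᵈ c = levelᵈ c ×ᵈ Boundaryᵈ (appⱽ (fnᵈ (f i)) (updᵈ (λ i → constᵈ) k s₀) ≈ᵈ constᵈ) s₀
         locally-constant : ∀ w → ¬ Any (λ c → Edge c w) cs → Onto J (u [ k ≔ w ]) →
                            HasPartial (fn (f i)) k (u [ k ≔ w ]) 0#
         locally-constant w no-edge onto =
           let x∈ , x≋ = section-spec onto
               ¬edge , w∈ = All.lookupAny (All.¬Any⇒All¬ cs no-edge) (listed (g w) (_ , x∈ , λ k′ →
                 by-cases (k′ ≡ k) (λ { ≡.refl → trans (reflexive (≡.cong (λ i → fn (f i) (u [ k ≔ w ]))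
                          (updateAt-updates k J))) (sym (upd-same u k)) })
                   (λ k′≢k → trans (reflexive (≡.cong (λ i → fn (f i) (u [ k ≔ w ]))
                          (updateAt-minimal k′ k J k′≢k)))
                     (trans (x≋ k′) (trans (upd-other u k′≢k) (sym (upd-other u k′≢k)))))))
               a , b , a<w , w<b , h = inner-interval (levelᵈ _) w w∈ (λ bd → ¬edge (w∈ , bd))
           in constant⇒HasPartial (fnᵈ (f i)) k u a<w w<b h

     Nice : K^ d → Set ℓ
     Nice u = Onto J u × (∀ i → ContinuousAt (fn (f i)) u) ×
              (∀ i k → Later i k → HasPartial (fn (f i)) k u 0#)

     niceᵈ : Defⱽ Nice
     niceᵈ = ontoᵈ J ×ᵈ (∀Finᵈ λ i → ContinuousAtᵈ (fnᵈ (f i))) ×ᵈ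
       ∀Finᵈ λ i → ∀Finᵈ λ k → constᵖ _ →ᵈ HasPartialᵈ (fnᵈ (f i)) k v₀ constᵈ

     nice : ∃ (Nbhd Nice)
     nice = byContradiction λ none → ¬thin (∀*ⁿ-map₂ (∀Finᵈ λ i → ContinuousAtᵈ (fnᵈ (f i)))
       (λ u cont (flat , inner) onto → none (u , inner (onto , cont , λ i k later → flat i k later onto)))
       (∀*ⁿ-Fin (λ i → ContinuousAtᵈ (fnᵈ (f i))) λ i → ∀*ⁿ-continuous (fnᵈ (f i)))
       (∀*ⁿ-× (∀Finᵈ λ i → ∀Finᵈ λ k → flatᵈ i k)
         (∀*ⁿ-Fin (λ i → ∀Finᵈ λ k → flatᵈ i k) λ i → ∀*ⁿ-Fin (flatᵈ i) λ k →
           by-cases (Later i k) (λ later → ∀*ⁿ-map (λ u h _ → h) (flat i k later))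
             (λ ¬later → ∀*ⁿ-all λ u later → ⊥-elim (¬later later)))
         (∀*ⁿ-interior niceᵈ)))
       where
       flatᵈ : ∀ i k → Defⱽ (λ u → Later i k → Onto J u → HasPartial (fn (f i)) k u 0#)
       flatᵈ i k = constᵖ _ →ᵈ ontoᵈ J →ᵈ HasPartialᵈ (fnᵈ (f i)) k v₀ constᵈ

     u₀ : K^ d
     u₀ = proj₁ nice

     radius : ∃ λ ρ → 0# < ρ × (∀ u → (∀ k → ∣ u k - u₀ k ∣ < ρ) → Nice u)
     radius = let δ , 0<δ , h = proj₂ nice ; ρ , 0<ρ , small = scaled {K = fromℕ d} 0<δ (fromℕ-nonneg d) in
       ρ , 0<ρ , λ u u∈ → h u (≤-<-trans (coords⇒dist u₀ u λ k → ≤-trans (inj₂ (∣-∣ _ _)) (inj₁ (u∈ k)))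
         (lin 3 (λ e K δ → :0 :< e ∷ e :+ K :* e :≤ δ ⊢ K :* e :< δ) 0<ρ small))

     ρ : Carrier
     ρ = proj₁ radius

     0<ρ : 0# < ρ
     0<ρ = proj₁ (proj₂ radius)

     Near-u₀ : Fin d → Carrier → Set ℓ
     Near-u₀ k t = ∣ t - u₀ k ∣ < ρ

     Box : K^ d → Set ℓ
     Box u = ∀ k → Near-u₀ k (u k)

     box⇒nice : ∀ u → Box u → Nice u
     box⇒nice = proj₂ (proj₂ radius)

     near-u₀ : ∀ k {t} → t ≈ u₀ k → Near-u₀ k t
     near-u₀ k e = ≤-<-trans (inj₂ (∣∣-zero (trans (+-congʳ e) (-‿inverseʳ _)))) 0<ρ

     near-resp : ∀ k {t t′} → t ≈ t′ → Near-u₀ k t → Near-u₀ k t′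
     near-resp k e = <-respˡ (∣∣-cong (+-congʳ e))

     box-upd : ∀ {u k t} → Box u → Near-u₀ k t → Box (u [ k ≔ t ])
     box-upd {u} {k} {t} u∈ t∈ k′ = by-cases (k′ ≡ k)
       (λ { ≡.refl → near-resp k {t} {(u [ k ≔ t ]) k} (sym (upd-same u k)) t∈ })
       (λ k′≢k → near-resp k′ {u k′} {(u [ k ≔ t ]) k′} (sym (upd-other u k′≢k)) (u∈ k′))

     constant-along : ∀ i k → Later i k → ∀ {u t} → Box u → Near-u₀ k t → fn (f i) (u [ k ≔ t ]) ≈ fn (f i) u
     constant-along i k later {u} {t} u∈ t∈ = lin 4 (λ a b c m → c :≈ b ∷ a :- c :≤ m ∷ :- (a :- c) :≤ m ∷ m :≤ :0 ⊢ a :≈ b)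
         (congⱽ (fnᵈ (f i)) (upd-self u k refl)) (x≤∣x∣ _) (-x≤∣x∣ _)
         (arbitrarily-small (0≤∣ t - u k ∣) λ ε 0<ε →
           segment-lip {λ v → fn (f i) (u [ k ≔ v ])} (appⱽ (fnᵈ (f i)) (updᵈ (λ i → constᵈ) k s₀))
             λ v between → Near₁-cong (λ w → congⱽ (fnᵈ (f i)) (upd-upd u k))
               (congⱽ (fnᵈ (f i)) (≋-trans (upd-upd u k) (upd-cong k ≋-refl (upd-same u k)))) (upd-same u k)
               (proj₂ (proj₂ (box⇒nice _ (box-upd u∈ (convex between)))) i k later ε 0<ε))
       where
       convex : ∀ {v} → Betw (u k) t v → Near-u₀ k v
       convex {v} (inj₁ (p , q)) = ∣∣-<
         (lin 5 (λ v t u c r → v :≤ t ∷ t :- c :< r ⊢ v :- c :< r) {ρ = v , t , u k , u₀ k , ρ , tt} q (≤-<-trans (x≤∣x∣ _) t∈))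
         (lin 5 (λ v t u c r → u :≤ v ∷ :- (u :- c) :< r ⊢ :- (v :- c) :< r) {ρ = v , t , u k , u₀ k , ρ , tt} p (≤-<-trans (-x≤∣x∣ _) (u∈ k)))
       convex {v} (inj₂ (p , q)) = ∣∣-<
         (lin 5 (λ v t u c r → v :≤ u ∷ u :- c :< r ⊢ v :- c :< r) {ρ = v , t , u k , u₀ k , ρ , tt} q (≤-<-trans (x≤∣x∣ _) (u∈ k)))
         (lin 5 (λ v t u c r → t :≤ v ∷ :- (t :- c) :< r ⊢ :- (v :- c) :< r) {ρ = v , t , u k , u₀ k , ρ , tt} p (≤-<-trans (-x≤∣x∣ _) t∈))

     independent : ∀ i → (∀ k → J k ≢ i) → ∀ {u v} → Box u → Box v →
       (∀ k → toℕ (J k) ℕ.< toℕ i → v k ≈ u k) → fn (f i) v ≈ fn (f i) u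
     independent i i∉J {u} {v} u∈ v∈ same =
       trans (congⱽ (fnᵈ (f i)) (λ k → sym (If-yes (Fin.toℕ<n k)))) (along d ℕ.≤-refl)
       where
       mixed : ℕ → K^ d
       mixed m k = If (toℕ k ℕ.< m) (v k) (u k)
       mixed-box : ∀ m → Box (mixed m)
       mixed-box m k = by-cases (toℕ k ℕ.< m) (λ p → near-resp k {v k} {mixed m k} (sym (If-yes p)) (v∈ k))
         (λ p → near-resp k {u k} {mixed m k} (sym (If-no p)) (u∈ k))
       along : ∀ m → m ℕ.≤ d → fn (f i) (mixed m) ≈ fn (f i) u
       along zero _ = congⱽ (fnᵈ (f i)) λ k → If-no λ ()
       along (suc m) m<d = trans (trans (congⱽ (fnᵈ (f i)) split) moved) (along m (ℕ.<⇒≤ m<d))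
         where
         k : Fin d
         k = fromℕ< m<d
         k≡m : toℕ k ≡ m
         k≡m = Fin.toℕ-fromℕ< m<d
         split : mixed (suc m) ≋ (mixed m [ k ≔ v k ])
         split k′ = by-cases (k′ ≡ k)
           (λ { ≡.refl → trans (If-yes (ℕ.s≤s (ℕ.≤-reflexive k≡m))) (sym (upd-same (mixed m) k)) })
           (λ k′≢k → trans (by-cases (toℕ k′ ℕ.< m) (λ p → trans (If-yes (ℕ.m≤n⇒m≤1+n p)) (sym (If-yes p)))
               (λ p → trans (If-no λ q → [ p , (λ e → k′≢k (Fin.toℕ-injective (≡.trans e (≡.sym k≡m)))) ]′
                   (ℕ.m≤n⇒m<n∨m≡n (ℕ.≤-pred q))) (sym (If-no p))))
             (sym (upd-other (mixed m) k′≢k)))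
         moved : fn (f i) (mixed m [ k ≔ v k ]) ≈ fn (f i) (mixed m)
         moved = by-cases (toℕ (J k) ℕ.< toℕ i) (λ p → congⱽ (fnᵈ (f i)) (upd-self (mixed m) k
             (trans (same k p) (sym (If-no λ q → ℕ.<-irrefl k≡m q)))))
           (λ p → constant-along i k (i∉J , ℕ.≤∧≢⇒< (ℕ.≮⇒≥ p) (λ e → i∉J k (Fin.toℕ-injective (≡.sym e))))
             (mixed-box m) (v∈ k))

     -- The axes before coordinate `i` are read from the prefix; the later ones, which are still
     -- unknown and on which `f i` does not depend in the box, are set to the centre `u₀`.
     ext : Fin n → (ℕ → Carrier) → K^ d
     ext i w k = If (toℕ (J k) ℕ.< toℕ i) (w (toℕ (J k))) (u₀ k)

     ext-cong : ∀ i {w w′} → (∀ j → j ℕ.< toℕ i → w j ≈ w′ j) → ext i w ≋ ext i w′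
     ext-cong i h k = by-cases (toℕ (J k) ℕ.< toℕ i)
       (λ p → trans (If-yes p) (trans (h _ p) (sym (If-yes p))))
       (λ p → trans (If-no p) (sym (If-no p)))

     -- The defining condition of one step of the cell: an axis contributes a band with constant
     -- sides, any other coordinate a graph.
     Condition : Fin n → (ℕ → Carrier) → Set ℓ
     Condition i w = (∃ λ k → J k ≡ i × Near-u₀ k (w (toℕ i))) ⊎
                     ((∀ k → J k ≢ i) × w (toℕ i) ≈ fn (f i) (ext i w))

     conditionᵈ : ∀ i {m} {v : ⟪ Γ ⟫ → K^ m} → DefV v → Def (λ ρ → Condition i (seq (v ρ)))
     conditionᵈ i dv = (∃Finᵈ λ k → constᵖ _ ×ᵈ ∣ seqᵈ dv (toℕ i) -ᵈ constᵈ ∣ᵈ <ᵈ constᵈ) ⊎ᵈ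
       (constᵖ _ ×ᵈ seqᵈ dv (toℕ i) ≈ᵈ appⱽ (fnᵈ (f i)) λ k → ifᵈ (constᵖ _) (seqᵈ dv _) constᵈ)

     condition-cong : ∀ i {w w′} → (∀ j → j ℕ.≤ toℕ i → w j ≈ w′ j) → Condition i w → Condition i w′
     condition-cong i {w} {w′} h (inj₁ (k , Jk≡i , p)) =
       inj₁ (k , Jk≡i , near-resp k {w (toℕ i)} {w′ (toℕ i)} (h _ ℕ.≤-refl) p)
     condition-cong i h (inj₂ (i∉J , e)) = inj₂ (i∉J , trans (sym (h _ ℕ.≤-refl)) (trans e
       (congⱽ (fnᵈ (f i)) (ext-cong i λ j j<i → h j (ℕ.<⇒≤ j<i)))))

     Prefix : ∀ m → K^ m → Set ℓ
     Prefix m x = ∀ i → toℕ i ℕ.< m → Condition i (seq x)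

     prefixᵈ : ∀ m → Defⱽ (Prefix m)
     prefixᵈ m = ∀Finᵈ λ i → constᵖ _ →ᵈ conditionᵈ i v₀

     on-axis : ∀ k {w} → Condition (J k) w → Near-u₀ k (w (toℕ (J k)))
     on-axis k {w} (inj₁ (k′ , e , p)) = ≡.subst (λ k′ → Near-u₀ k′ (w (toℕ (J k)))) (J-inj e) p
     on-axis k (inj₂ (J∌ , _)) = ⊥-elim (J∌ k ≡.refl)

     ext-box : ∀ {m} i {x : K^ m} → toℕ i ≡ m → Prefix m x → Box (ext i (seq x))
     ext-box i {x} ≡.refl p k = by-cases (toℕ (J k) ℕ.< toℕ i)
       (λ q → near-resp k {seq x (toℕ (J k))} {ext i (seq x) k} (sym (If-yes q)) (on-axis k {seq x} (p (J k) q)))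
       (λ q → near-u₀ k (If-no q))

     continuous : ∀ {m} i → toℕ i ≡ m → ContinuousOn (Prefix m) (scalar′ λ x → fn (f i) (ext i (seq x)))
     continuous {m} i i≡m x x∈ ε 0<ε =
       let δ , 0<δ , h = proj₁ (proj₂ (box⇒nice (ext i (seq x)) (ext-box i {x} i≡m x∈))) i ε 0<ε
           δ′ , 0<δ′ , small = scaled {δ} {K = fromℕ d} 0<δ (fromℕ-nonneg d)
       in δ′ , 0<δ′ , λ y _ y∈ → ball₁ {F y} {F x} 0<ε (≤-<-trans (inj₂ (∣-∣ (F y) (F x)))
         (h (ext i (seq y)) (≤-<-trans
           (coords⇒dist (ext i (seq x)) (ext i (seq y)) λ k → close y 0<δ′ (ball⇒coord {x = x} {y} 0<δ′ y∈) k)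
           (lin 3 (λ e K δ → :0 :< e ∷ e :+ K :* e :≤ δ ⊢ K :* e :< δ)
             {ρ = δ′ , fromℕ d , δ , tt} 0<δ′ small))))
       where
       F : K^ m → Carrier
       F x = fn (f i) (ext i (seq x))
       close : ∀ y {δ} → 0# < δ → (∀ j → ∣ y j - x j ∣ < δ) → ∀ k → ∣ ext i (seq x) k - ext i (seq y) k ∣ ≤ δ
       close y {δ} 0<δ h k = by-cases (toℕ (J k) ℕ.< toℕ i)
         (λ p → ≤-trans (inj₂ (trans (∣-∣ (ext i (seq x) k) (ext i (seq y) k))
             (∣∣-cong (+-cong (If-yes p) (-‿cong (If-yes p))))))
           (inj₁ (seq-near {x = x} {y} 0<δ h (toℕ (J k)))))
         (λ p → ≤-trans (inj₂ (∣∣-zero (trans (+-cong (If-no p) (-‿cong (If-no p))) (-‿inverseʳ (u₀ k)))))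
           (inj₁ 0<δ))

     constant : ∀ {m} c → Definable (Graph (Prefix m) (scalar′ λ _ → c)) ×
                          ContinuousOn (Prefix m) (scalar′ λ _ → c)
     constant {m} c = graph-definable (prefixᵈ m) constᵈ , λ x _ ε 0<ε → 1# , 0<1 , λ y _ _ →
       ball₁ {c} {c} 0<ε (<-respˡ (sym (∣∣-zero (-‿inverseʳ c))) 0<ε)

     shorten : ∀ {m} {z : K^ (suc m)} → Prefix (suc m) z → Prefix m (init z)
     shorten {z = z} p i i<m = condition-cong i {seq z} {seq (init z)} (λ j j≤i → reflexive (≡.sym
       (seq-init z (ℕ.≤-<-trans j≤i i<m)))) (p i (ℕ.m≤n⇒m≤1+n i<m))

     lengthen : ∀ {m} {z : K^ (suc m)} i → toℕ i ≡ m → Prefix m (init z) → Condition i (seq z) →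
                Prefix (suc m) z
     lengthen {m} {z} i i≡m p c i′ i′≤m = [ (λ i′<m → condition-cong i′ {seq (init z)} {seq z}
         (λ j j≤i → reflexive (seq-init z (ℕ.≤-<-trans j≤i i′<m))) (p i′ i′<m)) ,
       (λ i′≡m → ≡.subst (λ i → Condition i (seq z)) (Fin.toℕ-injective (≡.trans i≡m (≡.sym i′≡m))) c) ]′
       (ℕ.m≤n⇒m<n∨m≡n (ℕ.≤-pred i′≤m))

     at-last : ∀ {m} {z : K^ (suc m)} (i : Fin n) → toℕ i ≡ m → seq z (toℕ i) ≈ last z
     at-last {m} {z} i i≡m = reflexive (≡.trans (≡.cong (seq z) i≡m) (seq-last z))

     -- Numbers the axes met so far by the dimensions of the cell built so far. At the end all `d`
     -- axes are numbered injectively, so the dimension is at least `d`.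
     Numbering : ℕ → ℕ → Set
     Numbering m d′ = Σ (∀ k → toℕ (J k) ℕ.< m → Fin d′) λ I → ∀ k k′ p p′ → I k p ≡ I k′ p′ → k ≡ k′

     Built : ℕ → Set (Level.suc (s ⊔ ℓ))
     Built m = ∃ λ d′ → IsContinuousCell d′ (Prefix m) × Numbering m d′

     build : ∀ {m} → m ℕ.< n → Built m → Built (suc m)
     build {m} m<n (d′ , cell , I , I-inj) = by-cases (∃ λ k → J k ≡ i)
       (λ (k , Jk≡i) → box k Jk≡i) graph-step
       where
       i : Fin n
       i = fromℕ< m<n
       i≡m : toℕ i ≡ m
       i≡m = Fin.toℕ-fromℕ< m<n
       box : ∀ k → J k ≡ i → Built (suc m)
       box k Jk≡i = suc d′ , band (just λ _ → u₀ k - ρ) (just λ _ → u₀ k + ρ) cell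
           (MaybeAll.just (constant (u₀ k - ρ))) (MaybeAll.just (constant (u₀ k + ρ)))
           (λ _ _ → fromLo (lower (just λ _ → u₀ k - ρ) u₀) (lin 2 (λ u ρ → :0 :< ρ ⊢ u :- ρ :< u :+ ρ) 0<ρ))
           ( (λ {z} p → let q = near z p in shorten {z = z} p ,
               fromLo (lower (just λ _ → u₀ k - ρ) u₀) (lin 4 (λ z u ρ m → :- (z :- u) :≤ m ∷ m :< ρ ⊢ u :- ρ :< z) (-x≤∣x∣ _) q) ,
               fromHi (upper (just λ _ → u₀ k + ρ) u₀) (lin 4 (λ z u ρ m → z :- u :≤ m ∷ m :< ρ ⊢ z :< u :+ ρ) (x≤∣x∣ _) q))
           , (λ {z} (p , lo , hi) → lengthen {z = z} i i≡m p (inj₁ (k , Jk≡i , near-resp k {last z} {seq z (toℕ i)}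
               (sym (at-last {z = z} i i≡m)) (∣∣-<
                 (lin 3 (λ z u ρ → z :< u :+ ρ ⊢ z :- u :< ρ) (toHi (upper (just λ _ → u₀ k + ρ) u₀) hi))
                 (lin 3 (λ z u ρ → u :- ρ :< z ⊢ :- (z :- u) :< ρ) (toLo (lower (just λ _ → u₀ k - ρ) u₀) lo))))))) ,
         (λ k p → number k (ℕ.m≤n⇒m<n∨m≡n (ℕ.≤-pred p))) ,
         λ k k′ p p′ → number-inj k k′ (ℕ.m≤n⇒m<n∨m≡n (ℕ.≤-pred p)) (ℕ.m≤n⇒m<n∨m≡n (ℕ.≤-pred p′))
         where
         near : ∀ z → Prefix (suc m) z → Near-u₀ k (last z)
         near z p = near-resp k {seq z (toℕ (J k))} {last z}
           (trans (reflexive (≡.cong (seq z ∘ toℕ) Jk≡i)) (at-last {z = z} i i≡m))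
           (on-axis k {seq z} (p (J k) (ℕ.s≤s (ℕ.≤-reflexive (≡.trans (≡.cong toℕ Jk≡i) i≡m)))))
         Place : Fin d → Set
         Place k = toℕ (J k) ℕ.< m ⊎ toℕ (J k) ≡ m
         number : ∀ k → Place k → Fin (suc d′)
         number k = [ (λ p → suc (I k p)) , (λ _ → zero) ]′
         number-inj : ∀ k k′ (p : Place k) (p′ : Place k′) → number k p ≡ number k′ p′ → k ≡ k′
         number-inj k k′ (inj₁ p) (inj₁ p′) e = I-inj k k′ p p′ (Fin.suc-injective e)
         number-inj k k′ (inj₂ p) (inj₂ p′) e = J-inj (Fin.toℕ-injective (≡.trans p (≡.sym p′)))
       graph-step : ¬ (∃ λ k → J k ≡ i) → Built (suc m)
       graph-step i∉J = d′ , graph (λ x → fn (f i) (ext i (seq x))) cell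
           (graph-definable (prefixᵈ m) (appⱽ (fnᵈ (f i)) λ k → ifᵈ (constᵖ _) (seqᵈ v₀ _) constᵈ) ,
            continuous i i≡m)
           ( (λ {z} p → shorten {z = z} p , [ (λ (k , e , _) → ⊥-elim (i∉J (k , e)))
                                    , (λ (_ , e) → trans (sym (at-last {z = z} i i≡m)) (trans e (same z))) ]′
               (p i (ℕ.s≤s (ℕ.≤-reflexive i≡m))))
           , (λ {z} (p , e) → lengthen {z = z} i i≡m p (inj₂ ((λ k e → i∉J (k , e)) ,
               trans (at-last {z = z} i i≡m) (trans e (sym (same z))))))) ,
         (λ k p → I k (earlier k p)) , λ k k′ p p′ → I-inj k k′ (earlier k p) (earlier k′ p′)
         where
         same : ∀ z → fn (f i) (ext i (seq z)) ≈ fn (f i) (ext i (seq (init z)))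
         same z = congⱽ (fnᵈ (f i)) (ext-cong i λ j j<i → reflexive (≡.sym
           (seq-init z (ℕ.<-≤-trans j<i (ℕ.≤-reflexive i≡m)))))
         earlier : ∀ k → toℕ (J k) ℕ.< suc m → toℕ (J k) ℕ.< m
         earlier k p = [ id , (λ e → ⊥-elim (i∉J (k , Fin.toℕ-injective (≡.trans e (≡.sym i≡m))))) ]′
           (ℕ.m≤n⇒m<n∨m≡n (ℕ.≤-pred p))

     prefix-cells : ∀ m → m ℕ.≤ n → Built m
     prefix-cells zero _ = 0 , origin (λ x i ()) , (λ k ()) , λ k k′ ()
     prefix-cells (suc m) m<n = build m<n (prefix-cells m (ℕ.<⇒≤ m<n))

     prefix⊂A : ∀ {x} → Prefix n x → A x
     prefix⊂A {x} p = respⱽ dA coordinates (proj₁ spec)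
       where
       u∈ : Box (x ∘ J)
       u∈ k = near-resp k {seq x (toℕ (J k))} {x (J k)} (reflexive (seq-toℕ x (J k)))
         (on-axis k {seq x} (p (J k) (Fin.toℕ<n (J k))))
       spec = section-spec (proj₁ (box⇒nice _ u∈))
       ext∈ : ∀ i → Box (ext i (seq x))
       ext∈ i k = by-cases (toℕ (J k) ℕ.< toℕ i) (λ q → near-resp k {x (J k)} {ext i (seq x) k}
           (sym (trans (If-yes q) (reflexive (seq-toℕ x (J k))))) (u∈ k))
         (λ q → near-u₀ k (If-no q))
       coordinates : (λ i → fn (f i) (x ∘ J)) ≋ x
       coordinates i = [ (λ { (k , ≡.refl , _) → proj₂ spec k })
         , (λ (i∉J , e) → trans (sym (independent i i∉J {x ∘ J} {ext i (seq x)} u∈ (ext∈ i) λ k q →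
               trans (If-yes q) (reflexive (seq-toℕ x (J k)))))
             (trans (sym e) (reflexive (seq-toℕ x i)))) ]′
         (p i (Fin.toℕ<n i))

     triangular-cell : ∃₂ λ d′ C → IsContinuousCell d′ C × (∀ {x} → C x → A x) × d ℕ.≤ d′
     triangular-cell = let d′ , cell , I , I-inj = prefix-cells n ℕ.≤-refl in
       d′ , Prefix n , cell , prefix⊂A ,
       Fin.injective⇒≤ {f = λ k → I k (Fin.toℕ<n (J k))} (I-inj _ _ _ _)

   weight-of : ∀ {d} → (Fin d → Fin n) → ℕ
   weight-of J = Vector.foldr ℕ._+_ 0 (toℕ ∘ J)

   lighter : ∀ {d} (J : Fin d → Fin n) k {i} → toℕ i ℕ.< toℕ (J k) →
             weight-of (updateAt J k (λ _ → i)) ℕ.< weight-of J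
   lighter J zero i<j = ℕ.+-monoˡ-< _ i<j
   lighter J (suc k) i<j = ℕ.+-monoʳ-< (toℕ (J zero)) (lighter (J ∘ suc) k i<j)

   updated-inj : ∀ {d} (J : Fin d → Fin n) → Injective J → ∀ k {i} → (∀ k → J k ≢ i) →
                 Injective (updateAt J k (λ _ → i))
   updated-inj J J-inj k {i} i∉J {a} {b} = by-cases (a ≡ k)
     (λ { ≡.refl → by-cases (b ≡ k) (λ b≡k _ → ≡.sym b≡k)
       (λ b≢k e → ⊥-elim (i∉J b (≡.trans (≡.sym (updateAt-minimal b k J b≢k))
         (≡.trans (≡.sym e) (updateAt-updates k J))))) })
     (λ a≢k → by-cases (b ≡ k) (λ { ≡.refl e → ⊥-elim (i∉J a (≡.trans (≡.sym (updateAt-minimal a k J a≢k))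
         (≡.trans e (updateAt-updates k J)))) })
       (λ b≢k e → J-inj (≡.trans (≡.sym (updateAt-minimal a k J a≢k))
         (≡.trans e (updateAt-minimal b k J b≢k)))))

   -- By induction on the sum of the coordinates J.
   contains-cell : ∀ {d} N (J : Fin d → Fin n) → weight-of J ℕ.< N → Injective J → ¬ Thin J →
     ∃₂ λ d′ C → IsContinuousCell d′ C × (∀ {x} → C x → A x) × d ℕ.≤ d′
   contains-cell (suc N) J (ℕ.s≤s J≤N) J-inj ¬thin = by-cases
     (∃₂ λ i k → (∀ k → J k ≢ i) × toℕ i ℕ.< toℕ (J k) × ¬ Thin (updateAt J k (λ _ → i)))
     (λ (i , k , i∉J , i<k , ¬thin′) → contains-cell N (updateAt J k (λ _ → i))
       (ℕ.<-≤-trans (lighter J k i<k) J≤N) (updated-inj J J-inj k i∉J) ¬thin′)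
     (λ none → triangular-cell J J-inj
       (λ i k i∉J i<k → byContradiction λ ¬thin′ → none (i , k , i∉J , i<k , ¬thin′)) ¬thin)

   onto⇔ : ∀ {d} (J : Fin d → Fin n) → Injective J → (Small A J → Thin J) × (Thin J → Small A J)
   onto⇔ J J-inj = (λ small → proj₁ (∀*ⁿ-reindex (¬ᵈ (ontoᵈ J)) J J-inj)
       (∀*ⁿ-map (λ x ¬p (u , u∈ , e) → ¬p (u , u∈ , agree e)) small)) ,
     (λ thin → ∀*ⁿ-map (λ x ¬p (u , u∈ , e) → ¬p (u , u∈ , on e))
       (proj₂ (∀*ⁿ-reindex (¬ᵈ (ontoᵈ J)) J J-inj) thin))

   dim≤⇒small : ∀ {e} → dim A ≤ e → (J : Fin (suc e) → Fin n) → Injective J → Small A J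
   dim≤⇒small dimA J J-inj = proj₂ (onto⇔ J J-inj) (byContradiction λ ¬thin →
     let d′ , C , cell , C⊂A , e<d′ = contains-cell (suc (weight-of J)) J ℕ.≤-refl J-inj ¬thin
     in ℕ.<-irrefl ≡.refl (ℕ.<-≤-trans e<d′ (dimA d′ C cell C⊂A)))

   -- A cell of dimension `d ≥ e` inside `A` has a projection to `d` coordinates that is not small,
   -- although already the projection of `A` to the first `e` of these is.
   small⇒dim< : ∀ {e} → (∀ (J : Fin e → Fin n) → Injective J → Small A J) → dim A < e
   small⇒dim< {e} small d C cell C⊂A = ℕ.≰⇒> λ e≤d →
     let J , J-inj , ¬thin = cell-projection cell
         J₀ = λ k → J (Fin.inject≤ k e≤d)
         J₀-inj : Injective J₀
         J₀-inj eq = Fin.inject≤-injective e≤d e≤d _ _ (J-inj eq)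
         small-J : Small A J
         small-J = ∀*ⁿ-map (λ x ¬p (u , u∈ , e) → ¬p (u , u∈ , agree λ k → on e (Fin.inject≤ k e≤d)))
           (small J₀ J₀-inj)
     in ¬thin (∀*ⁿ-map (λ u ¬p (x , x∈ , e) → ¬p (x , C⊂A x∈ , e)) (proj₁ (onto⇔ J J-inj) small-J))

 -- Patches are basic rectifiable; the partition

 extend-permutation : ∀ {e n} → e ℕ.≤ n → (I : Fin e → Fin n) → Injective I →
   Σ (Permutation (e ℕ.+ (n ℕ.∸ e)) n) λ σ → ∀ p → σ ⟨$⟩ʳ (p ↑ˡ (n ℕ.∸ e)) ≡ I p
 extend-permutation ℕ.z≤n I I-inj = Perm.id , λ ()
 extend-permutation {suc e} {suc n} (ℕ.s≤s e≤n) I I-inj =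
   let I₀≢ : ∀ p → I zero ≢ I (suc p)
       I₀≢ p eq = case I-inj eq of λ ()
       σ , h = extend-permutation e≤n (λ p → punchOut (I₀≢ p))
         λ eq → Fin.suc-injective (I-inj (Fin.punchOut-injective (I₀≢ _) (I₀≢ _) eq))
   in Perm.insert zero (I zero) σ , λ
     { zero → ≡.refl
     ; (suc p) → ≡.trans (Perm.insert-punchIn zero (I zero) σ (p ↑ˡ (n ℕ.∸ e)))
         (≡.trans (≡.cong (punchIn (I zero)) (h p)) (punchIn-punchOut (I₀≢ p))) }

 sum-last : ∀ {n} (x : K^ (suc n)) → sum x ≈ sum (init x) + last x
 sum-last {zero} x = +-comm _ _
 sum-last {suc n} x = lin 4 (λ a s i l → s :≈ i :+ l ⊢ a :+ s :≈ (a :+ i) :+ l)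
   {ρ = x zero , _ , _ , last x , tt} (sum-last (x ∘ suc))

 dist-last : ∀ {n} (x y : K^ (suc n)) → dist x y ≈ dist (init x) (init y) + ∣ last x - last y ∣
 dist-last {zero} x y = trans (dist-∷ x y) (trans (+-cong refl (trans (dist-[] _ _) (sym (dist-[] _ _)))) (+-comm _ _))
 dist-last {suc n} x y = trans (dist-∷ x y) (lin 5 (λ a d i l e → d :≈ i :+ l ∷ e :≈ a :+ i ⊢ a :+ d :≈ e :+ l)
   {ρ = _ , _ , dist (init (x ∘ suc)) (init (y ∘ suc)) , _ , _ , tt}
   (dist-last (x ∘ suc) (y ∘ suc)) (dist-∷ (init x) (init y)))

 -- The coordinate subspaces of K^ n

 -- The first element of the list js is the last coordinate of K^ r.
 emb : ∀ {r} → Vec (Fin n) r → K^ r → K^ n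
 emb [] u = λ _ → 0#
 emb (j ∷ js) u = emb js (init u) [ j ≔ last u ]

 embᵈ : ∀ {r} (js : Vec (Fin n) r) {v : ⟪ Γ ⟫ → K^ r} → DefV v → DefV (λ ρ → emb js (v ρ))
 embᵈ [] dv = λ _ → constᵈ
 embᵈ (j ∷ js) dv = updᵈ (embᵈ js (dv ∘ inject₁)) j (dv (Fin.fromℕ _))

 -- `js` lists the coordinates with the last one first, whereas points of `K^ r` list it last; hence
 -- the reversal.
 place : ∀ {r} → Vec (Fin n) r → Fin r → Fin n
 place js = lookup js ∘ opposite

 emb-off : ∀ {r} (js : Vec (Fin n) r) {i} → (∀ k → lookup js k ≢ i) → ∀ u → emb js u i ≈ 0#
 emb-off [] i∉ u = refl
 emb-off (j ∷ js) i∉ u = trans (upd-other (emb js (init u)) (i∉ zero ∘ ≡.sym)) (emb-off js (i∉ ∘ suc) (init u))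

 emb-dist : ∀ {r} (js : Vec (Fin n) r) u v → dist (emb js u) (emb js v) ≤ dist u v
 emb-dist [] u v = ≤-trans (inj₂ (dist-≋ ≋-refl)) (0≤dist u v)
 emb-dist (j ∷ js) u v = ≤-trans (dist-upd≤ (emb js (init u)) (emb js (init v)) j (last u) (last v))
   (lin 4 (λ a b m d → a :≤ b ∷ d :≈ b :+ m ⊢ a :+ m :≤ d) (emb-dist js (init u) (init v)) (dist-last u v))

 Points : ∀ {r} {js : Vec (Fin n) r} → Cell js → K^ r → Set ℓ
 Points {js = js} C u = emb js u ∈ᶜ C

 pointsᵈ : ∀ {r} {js : Vec (Fin n) r} (C : Cell js) → Defⱽ (Points C)
 pointsᵈ {js = js} C = atⱽ (∈ᶜᵈ C) (embᵈ js v₀)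

 emb-ball : ∀ {r} (js : Vec (Fin n) r) {P : K^ n → Set a} {u} → Nbhd P (emb js u) →
            ∃ λ δ → 0# < δ × (∀ v → Ball u δ v → P (emb js v))
 emb-ball js {u = u} (δ , 0<δ , h) = let δ′ , 0<δ′ , small = ball-in-nbhd 0<δ in
   δ′ , 0<δ′ , λ v v∈ → h (emb js v) (≤-<-trans (emb-dist js u v) (small {u} {v} v∈))

 module _ {n : ℕ} {B : Carrier} where

   emb-lookup : ∀ {r} {js : Vec (Fin n) r} {C : Cell js} → Valid B C → ∀ u k →
                emb js u (lookup js k) ≈ u (opposite k)
   emb-lookup {js = j ∷ js} (band v j∉ _ _ _) u zero = upd-same (emb js (init u)) j
   emb-lookup {js = j ∷ js} (band v j∉ _ _ _) u (suc k) =
     trans (upd-other (emb js (init u)) (j∉ k)) (emb-lookup v (init u) k)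

   emb-dot : ∀ {r} {js : Vec (Fin n) r} {C : Cell js} → Valid B C → ∀ q u v →
     dot q (λ i → emb js v i - emb js u i) ≈ dot (q ∘ place js) (λ k → v k - u k)
   emb-dot whole q u v = zeros q
     where
     zeros : ∀ {m} (q : K^ m) → dot q (λ i → 0# - 0#) ≈ 0#
     zeros {zero} q = refl
     zeros {suc m} q = trans (+-cong (trans (*-congˡ (-‿inverseʳ 0#)) (zeroʳ _)) (zeros (q ∘ suc))) (+-identityˡ 0#)
   emb-dot {suc r} {j ∷ js} (band v j∉ _ _ _) q x y = trans (dot-upd q (emb js (init y)) (emb js (init x)) j
       (trans (emb-off js j∉ (init y)) (sym (emb-off js j∉ (init x)))))
     (trans (+-cong (emb-dot v q (init x) (init y)) refl) (sym (trans
       (sum-last λ k → q (place (j ∷ js) k) * (y k - x k))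
       (+-cong (sum-cong λ k → *-congʳ (reflexive (≡.cong q (place-init k))))
               (*-congʳ (reflexive (≡.cong q place-last)))))))
     where
     place-last : place (j ∷ js) (Fin.fromℕ r) ≡ j
     place-last = ≡.cong (lookup (j ∷ js)) (Fin.opposite-involutive zero)
     place-init : ∀ k → place (j ∷ js) (inject₁ k) ≡ place js k
     place-init k = ≡.cong (lookup (j ∷ js)) (≡.trans
       (≡.cong (opposite ∘ inject₁) (≡.sym (Fin.opposite-involutive k)))
       (Fin.opposite-involutive (suc (opposite k))))

   place-inj : ∀ {r} {js : Vec (Fin n) r} {C : Cell js} → Valid B C → Injective (place js)
   place-inj v eq = ≡.trans (≡.sym (Fin.opposite-involutive _))
     (≡.trans (≡.cong opposite (distinct v eq)) (Fin.opposite-involutive _))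
     where
     distinct : ∀ {r} {js : Vec (Fin n) r} {C : Cell js} → Valid B C → Injective (lookup js)
     distinct (band v j∉ _ _ _) {zero} {zero} _ = ≡.refl
     distinct (band v j∉ _ _ _) {zero} {suc b} e = ⊥-elim (j∉ b (≡.sym e))
     distinct (band v j∉ _ _ _) {suc a} {zero} e = ⊥-elim (j∉ a e)
     distinct (band v j∉ _ _ _) {suc a} {suc b} e = ≡.cong suc (distinct v e)

   cell-open : ∀ {r} {js : Vec (Fin n) r} {C : Cell js} → Valid B C → 0# ≤ B → ∀ {x} → x ∈ᶜ C →
               Nbhd (_∈ᶜ C) x
   cell-open whole 0≤B _ = 1# , 0<1 , λ _ _ → tt
   cell-open {C = band {j = j} C f g} (band v j∉ gf gg _) 0≤B {x} (x∈ , over , under) =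
     Nbhd-map (λ y (p , q , r) → p , q , r) (Nbhd-× (cell-open v 0≤B x∈) (Nbhd-× (over-open gf over) (under-open gg under)))
     where
     L : Carrier
     L = (B + 1#) + 1#
     0≤L : 0# ≤ L
     0≤L = lin 1 (λ B → :0 :≤ B ∷ :0 :< :1 ⊢ :0 :≤ B :+ :1 :+ :1) 0≤B 0<1
     gap : ∀ (f : DFun n) → Lip (fn f) (B + 1#) x → ∀ {c} → 0# < c →
           Nbhd (λ y → ∣ fn f y - fn f x ∣ + ∣ x j - y j ∣ < c) x
     gap f (δ , 0<δ , lip) {c} 0<c =
       let η , 0<η , small = scaled {c} {L} 0<c 0≤L
           m , 0<m , m≤δ , m≤η = positive-minimum 0<δ 0<η
       in m , 0<m , λ y y∈ → lin 7 (λ F X B d η c z → F :≤ (B :+ :1) :* d ∷ X :≤ d ∷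
             (B :+ :1 :+ :1) :* d :≤ (B :+ :1 :+ :1) :* η ∷ :0 :< η ∷ η :+ (B :+ :1 :+ :1) :* η :≤ c ⊢ F :+ X :< c)
           {ρ = _ , _ , B , dist x y , η , c , 0# , tt}
           (lip y (<-≤-trans y∈ m≤δ)) (coord≤dist x y j)
           (*-monoˡ-≤ 0≤L (inj₁ (<-≤-trans y∈ m≤η))) 0<η small
     over-open : ∀ {f} → GoodSide B _ C f → OverSide f x (x j) → Nbhd (λ y → OverSide f y (y j)) x
     over-open none _ = 1# , 0<1 , λ _ _ → tt
     over-open (some {f} _ good) f<x = Nbhd-map
       (λ y h → lin 6 (λ fy fx xj yj F X → fy :- fx :≤ F ∷ xj :- yj :≤ X ∷ F :+ X :< xj :- fx ⊢ fy :< yj)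
         (x≤∣x∣ _) (x≤∣x∣ _) h)
       (gap f (good⇒lip (good x x∈)) (lin 2 (λ f x → f :< x ⊢ :0 :< x :- f) f<x))
     under-open : ∀ {f} → GoodSide B _ C f → UnderSide f x (x j) → Nbhd (λ y → UnderSide f y (y j)) x
     under-open none _ = 1# , 0<1 , λ _ _ → tt
     under-open (some {f} _ good) x<f = Nbhd-map
       (λ y h → lin 6 (λ fy fx xj yj F X → :- (fy :- fx) :≤ F ∷ :- (xj :- yj) :≤ X ∷ F :+ X :< fx :- xj ⊢ yj :< fy)
         (-x≤∣x∣ _) (-x≤∣x∣ _) h)
       (gap f (good⇒lip (good x x∈)) (lin 2 (λ f x → x :< f ⊢ :0 :< f :- x) x<f))

   small-factor : ∀ N {ε} → 0# < ε → ∃ λ ε′ → 0# < ε′ × fromℕ N * (ε′ * ε′) ≤ ε * ε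
   small-factor N {ε} 0<ε =
     let ε′ , 0<ε′ , h = scaled {ε} {fromℕ N} 0<ε (fromℕ-nonneg N) in
     ε′ , 0<ε′ , lin 5 (λ N e ε z w → :0 :≤ e :* e ∷ e :* (e :+ N :* e) :≤ e :* ε ∷ e :* ε :≤ ε :* ε ⊢ N :* (e :* e) :≤ ε :* ε)
       {ρ = fromℕ N , ε′ , ε , 0# , 0# , tt}
       (0≤² ε′) (*-monoˡ-≤ (inj₁ 0<ε′) h)
       (*-monoʳ-≤ (inj₁ 0<ε) (lin 3 (λ e Ne ε → e :+ Ne :≤ ε ∷ :0 :≤ Ne ⊢ e :≤ ε)
         h (*-nonneg (fromℕ-nonneg N) (inj₁ 0<ε′))))

   sum-bound : ∀ {d} (x : K^ d) {c} → (∀ i → x i ≤ c) → sum x ≤ fromℕ d * c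
   sum-bound {zero} x h = inj₂ (sym (zeroˡ _))
   sum-bound {suc d} x {c} h = lin 4 (λ a s N c → a :≤ c ∷ s :≤ N :* c ⊢ a :+ s :≤ (:1 :+ N) :* c)
     (h zero) (sum-bound (x ∘ suc) (h ∘ suc))

   -- Each component is at most `c` times the ℓ¹ distance; its square costs the power of 2 from
   -- `dist²≤‖‖²`, and there are `d` components to add. The error of the differential and the
   -- operator norm are both estimated in this way.
   components-bound : ∀ {r d} (w : K^ d) {c} (u v : K^ r) → (∀ i → ∣ w i ∣ ≤ c * dist u v) →
     ‖ w ‖² ≤ fromℕ (d ℕ.* 2 ℕ.^ r) * (c * c) * ‖ v ⊖ u ‖²
   components-bound {r} {d} w {c} u v h = ≤-trans
     (sum-bound (λ i → w i * w i) λ i → ≤-trans (inj₂ (sym (∣∣² (w i)))) (≤-trans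
       (²-mono-≤ (0≤∣ w i ∣) (h i))
       (lin 4 (λ c D P S → c :* c :* (D :* D) :≤ c :* c :* (P :* S) ⊢ (c :* D) :* (c :* D) :≤ c :* c :* (P :* S))
         (*-monoˡ-≤ (0≤² c) (dist²≤‖‖² u v)))))
     (lin 5 (λ d c P S N → N :* (c :* c :* S) :≈ (d :* P) :* (c :* c :* S) ⊢ d :* (c :* c :* (P :* S)) :≤ N :* (c :* c) :* S)
       {ρ = fromℕ d , c , fromℕ (2 ℕ.^ r) , _ , fromℕ (d ℕ.* 2 ℕ.^ r) , tt}
       (*-congʳ (×1-homo-* d (2 ℕ.^ r))))

   module Differential {r d : ℕ} {js : Vec (Fin n) r} {C : Cell js} (valid : Valid B C)
     (g : Fin d → DFun n) {B′ M : Carrier} (good : ∀ x → x ∈ᶜ C → ∀ i → Good B′ (g i) x)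
     (M-large : fromℕ (d ℕ.* 2 ℕ.^ r) * (B′ * B′) ≤ M * M) where

     map : K^ r → K^ d
     map u i = fn (g i) (emb js u)

     Dmap : K^ r → Matrix d r
     Dmap u i k = fn (∂ (g i) (place js k)) (emb js u)

     map-definable : Definable (Graph (Points C) map)
     map-definable = Defⱽ⇒Definable (atⱽ (pointsᵈ C) (λ i → v₀ (i ↑ˡ d)) ×ᵈ
       (λ i → v₀ (r ↑ʳ i)) ≋ᵈ λ i → appⱽ (fnᵈ (g i)) (embᵈ js λ k → v₀ (k ↑ˡ d)))

     isDifferential : IsDifferential (Points C) map Dmap
     isDifferential u u∈ ε 0<ε =
       let ε′ , 0<ε′ , small = small-factor (d ℕ.* 2 ℕ.^ r) 0<ε
           δ , 0<δ , near = emb-ball js {u = u} (Nbhd-Fin λ i →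
             regular⇒near (g i) (proj₁ (good (emb js u) u∈ i)) ε′ 0<ε′)
       in δ , 0<δ , λ v _ v∈ → ≤-trans
         (components-bound ((map v ⊖ map u) ⊖ (Dmap u ∙ (v ⊖ u))) {ε′} u v λ i → ≤-trans
           (inj₂ (∣∣-cong (+-congˡ (-‿cong (sym (emb-dot valid (gradient (g i) (emb js u)) u v))))))
           (≤-trans (near v v∈ i) (*-monoˡ-≤ (inj₁ 0<ε′) (emb-dist js u v))))
         (*-monoʳ-≤ 0≤‖ v ⊖ u ‖² small)

     operatorNormBound : OperatorNormBound M (Points C) Dmap
     operatorNormBound u u∈ v _ = ≤-trans
       (≤-trans (components-bound (Dmap u ∙ v) {B′} (λ _ → 0#) v λ i → ≤-trans
         (inj₂ (∣∣-cong (sum-cong λ k → *-congˡ (minus-0 (v k)))))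
         (dot-bound {q = Dmap u i} {x = λ _ → 0#} {y = v} λ k → proj₂ (good (emb js u) u∈ i) (place js k)))
         (inj₂ (*-congˡ (sum-cong λ k → *-cong (sym (minus-0 (v k))) (sym (minus-0 (v k)))))))
       (*-monoʳ-≤ 0≤‖ v ‖² M-large)
       where
       minus-0 : ∀ t → t ≈ t - 0#
       minus-0 t = lin 1 (λ t → ⊢ t :≈ t :- :0)

     isMFunction : IsMFunction M (Points C) map
     isMFunction = map-definable , Dmap , isDifferential , operatorNormBound

     isC¹ : ∀ i → ContinuousOn (Points C) (λ u → Dmap u i)
     isC¹ i u u∈ ε 0<ε =
       let ε′ , 0<ε′ , small = scaled {K = fromℕ r} 0<ε (fromℕ-nonneg r)
           δ , 0<δ , near = emb-ball js {u = u} (Nbhd-Fin λ j →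
             proj₂ (Nbhd-centre (proj₁ (good (emb js u) u∈ i)) j) ε′ 0<ε′)
       in δ , 0<δ , λ v _ v∈ → dist⇒ball {x = Dmap u i} {Dmap v i} (≤-<-trans
         (coords⇒dist (Dmap u i) (Dmap v i) λ k → inj₁ (near v v∈ (place js k)))
         (lin 3 (λ e K ε → :0 :< e ∷ e :+ K :* e :≤ ε ⊢ K :* e :< ε) 0<ε′ small))

 module _ {n b : ℕ} {M : Carrier} where

   B : Carrier
   B = fromℕ b

   bound-of : ∀ {r} → Vec (Fin n) r → Side n → Bound r
   bound-of js = Maybe.map λ f u → fn f (emb js u)

   lower-of : ∀ {r} (js : Vec (Fin n) r) f {u t} →
     (OverSide f (emb js u) t → Lo (lower (bound-of js f) u) t) ×
     (Lo (lower (bound-of js f) u) t → OverSide f (emb js u) t)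
   lower-of js nothing = (λ _ → tt) , (λ _ → tt)
   lower-of js (just f) = id , id

   upper-of : ∀ {r} (js : Vec (Fin n) r) f {u t} →
     (UnderSide f (emb js u) t → Hi (upper (bound-of js f) u) t) ×
     (Hi (upper (bound-of js f) u) t → UnderSide f (emb js u) t)
   upper-of js nothing = (λ _ → tt) , (λ _ → tt)
   upper-of js (just f) = id , id

   cell⇒MCell : ∀ {r} {js : Vec (Fin n) r} {C : Cell js} → Valid B C →
     (∀ m → m ℕ.≤ r → fromℕ (1 ℕ.* 2 ℕ.^ m) * (B * B) ≤ M * M) →
     IsCell (λ Y f → IsC¹MFunction M Y (scalar′ f)) r (Points C)
   cell⇒MCell whole large = origin λ _ → tt
   cell⇒MCell {suc r} {j ∷ js} {band C f g} (band v j∉ gf gg f<g) large =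
     band (bound-of js f) (bound-of js g) (cell⇒MCell v (λ m m≤r → large m (ℕ.m≤n⇒m≤1+n m≤r)))
       (side gf) (side gg) (λ u u∈ → ordered f g u (f<g _ u∈))
       ( (λ {u} (x∈ , over , under) → ∈ᶜ-depends v (init-agree u) x∈ ,
           fromLo (lower (bound-of js f) (init u)) (proj₁ (lower-of js f {init u}) (over-resp gf (init-agree u) (top-coord u) over)) ,
           fromHi (upper (bound-of js g) (init u)) (proj₁ (upper-of js g {init u}) (under-resp gg (init-agree u) (top-coord u) under)))
       , (λ {u} (x∈ , over , under) → ∈ᶜ-depends v (Agree-sym (init-agree u)) x∈ ,
           over-resp gf (Agree-sym (init-agree u)) (sym (top-coord u)) (proj₂ (lower-of js f {init u}) (toLo (lower (bound-of js f) (init u)) over)) ,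
           under-resp gg (Agree-sym (init-agree u)) (sym (top-coord u)) (proj₂ (upper-of js g {init u}) (toHi (upper (bound-of js g) (init u)) under))))
     where
     init-agree : ∀ u → Agree (lookup js) (emb (j ∷ js) u) (emb js (init u))
     init-agree u = Agree-upd j∉ (emb js (init u))
     top-coord : ∀ u → emb (j ∷ js) u j ≈ last u
     top-coord u = upd-same (emb js (init u)) j
     side : ∀ {f} → GoodSide B js C f →
            MaybeAll.All (λ f → IsC¹MFunction M (Points C) (scalar′ f)) (bound-of js f)
     side none = MaybeAll.nothing
     side (some {f} _ good) = MaybeAll.just (D.map-definable , D.Dmap , D.isDifferential , D.operatorNormBound , D.isC¹)
       where module D = Differential v (λ (_ : Fin 1) → f) {B} {M} (λ x x∈ _ → good x x∈) (large r (ℕ.n≤1+n r))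
     ordered : ∀ f g u → SidesOrdered f g (emb js u) → lower (bound-of js f) u <± upper (bound-of js g) u
     ordered nothing nothing u _ = Sup.[ _ ]<⊤⁺
     ordered nothing (just g) u _ = fromLo (lower nothing u) tt
     ordered (just f) nothing u _ = Sup.[ _ ]<⊤⁺
     ordered (just f) (just g) u p = fromHi (upper (bound-of js (just g)) u) p

 -- The bound `suc n` on `d` covers the `n ∸ e` components of a patch and also the single component
 -- of a side of a cell when `n` is 0.
 finalBound-large : ∀ {n d r b} → d ℕ.≤ suc n → r ℕ.≤ n → b ℕ.≤ bound n ℕ.+ slopeBound n →
   fromℕ (d ℕ.* 2 ℕ.^ r) * (fromℕ b * fromℕ b) ≤ fromℕ (finalBound n) * fromℕ (finalBound n)
 finalBound-large {n} {d} {r} {b} d≤ r≤ b≤ = ≤-trans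
   (inj₂ (trans (*-congˡ (sym (×1-homo-* b b))) (sym (×1-homo-* (d ℕ.* 2 ℕ.^ r) (b ℕ.* b)))))
   (≤-trans (fromℕ-mono in-ℕ) (inj₂ (×1-homo-* (finalBound n) (finalBound n))))
   where
   β : ℕ
   β = bound n ℕ.+ slopeBound n
   1≤scale : 1 ℕ.≤ scale n
   1≤scale = ℕ.*-mono-≤ (ℕ.s≤s (ℕ.z≤n {n})) (ℕ.>-nonZero⁻¹ _ {{ℕ.m^n≢0 2 n}})
   in-ℕ : (d ℕ.* 2 ℕ.^ r) ℕ.* (b ℕ.* b) ℕ.≤ finalBound n ℕ.* finalBound n
   in-ℕ = ℕ.≤-trans (ℕ.*-mono-≤ (ℕ.≤-trans (ℕ.*-mono-≤ d≤ (ℕ.^-monoʳ-≤ 2 r≤))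
       (ℕ.≤-trans (ℕ.≤-reflexive (≡.sym (ℕ.*-identityʳ (scale n)))) (ℕ.*-monoʳ-≤ (scale n) 1≤scale)))
       (ℕ.*-mono-≤ b≤ b≤))
     (ℕ.≤-trans (ℕ.≤-reflexive (ℕ.[m*n]*[o*p]≡[m*o]*[n*p] (scale n) (scale n) β β))
       (ℕ.*-mono-≤ (ℕ.n≤1+n (scale n ℕ.* β)) (ℕ.n≤1+n (scale n ℕ.* β))))

 module _ {n e : ℕ} (e≤n : e ℕ.≤ n) where

   -- The permutation puts the axes first, in the order in which the base cell is built. The
   -- coordinates on the axes then satisfy the chart equations by `axis`, and the others form the
   -- graph.
   patch-rectifiable : (p : Patch {n} {e}) → IsBasicRectifiable e (fromℕ (finalBound n)) (_∈ₚ p)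
   patch-rectifiable p =
     (finalBound n , lin 1 (λ N → :0 :≤ N ⊢ :- N :≤ N) (fromℕ-nonneg (finalBound n)) , ≤-refl) ,
     σ , Points C , D.map ,
     (fromℕ-pos (scale n ℕ.* (bound n ℕ.+ slopeBound n)) , e , cell⇒MCell {b = bound n} (valid U) λ m m≤e →
       finalBound-large (ℕ.s≤s ℕ.z≤n) (ℕ.≤-trans m≤e e≤n) (ℕ.m≤m+n (bound n) (slopeBound n))) ,
     (λ u u∈ → let δ , 0<δ , h = emb-ball js {u = u} (cell-open (valid U) (fromℕ-nonneg (bound n)) u∈) in
       δ , 0<δ , λ {v} → h v) ,
     D.isMFunction , to , from
     where
     U : CellOver (fromℕ (bound n)) (axes (chart p))
     U = Patch.base p
     js : Vec (Fin n) e
     js = order U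
     C : Cell js
     C = cell U
     φ : Chart n e
     φ = chart p
     extended : Σ (Permutation (e ℕ.+ (n ℕ.∸ e)) n) λ σ → ∀ k → σ ⟨$⟩ʳ (k ↑ˡ (n ℕ.∸ e)) ≡ place js k
     extended = extend-permutation e≤n (place js) (place-inj (valid U))
     σ : Permutation (e ℕ.+ (n ℕ.∸ e)) n
     σ = proj₁ extended
     module D = Differential (valid U) (λ q → component φ (σ ⟨$⟩ʳ (e ↑ʳ q)))
       {fromℕ (slopeBound n)} {fromℕ (finalBound n)}
       (λ x x∈ q → proj₁ (tame p x x∈ (σ ⟨$⟩ʳ (e ↑ʳ q))) , proj₂ (tame p x x∈ (σ ⟨$⟩ʳ (e ↑ʳ q))) (Fin.toℕ<n _))
       (finalBound-large {n} {n ℕ.∸ e} {e} (ℕ.≤-trans (ℕ.m∸n≤m n e) (ℕ.n≤1+n n)) e≤n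
         (ℕ.m≤n+m (slopeBound n) (bound n)))
     first : K^ n → K^ e
     first x = take e (x ∘ (σ ⟨$⟩ʳ_))
     agree-order : ∀ x → Agree (lookup js) (emb js (first x)) x
     agree-order x = agree λ k → trans (emb-lookup (valid U) (first x) k) (reflexive (≡.cong x
       (≡.trans (proj₂ extended (opposite k)) (≡.cong (lookup js) (Fin.opposite-involutive k)))))
     value : ∀ x i → fn (component φ i) (emb js (first x)) ≈ fn (component φ i) x
     value x i = depends-order U (dep (coord φ i)) (agree-order x)
     to : ∀ {x} → x ∈ₚ p → Graph (Points C) D.map (x ∘ (σ ⟨$⟩ʳ_))
     to {x} (x∈ , e′) = ∈ᶜ-depends (valid U) (Agree-sym (agree-order x)) x∈ ,
       λ q → trans (e′ _) (sym (value x _))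
     from : ∀ {x} → Graph (Points C) D.map (x ∘ (σ ⟨$⟩ʳ_)) → x ∈ₚ p
     from {x} (x∈ , e′) = ∈ᶜ-depends (valid U) (agree-order x) x∈ , λ i →
       ≡.subst Coordinate (Perm.inverseʳ σ) (coordinate (σ ⟨$⟩ˡ i))
       where
       Coordinate : Fin n → Set ℓ
       Coordinate i = x i ≈ lift φ x i
       coordinate : ∀ m → Coordinate (σ ⟨$⟩ʳ m)
       coordinate m with splitAt e m in eq
       ... | inj₁ k = ≡.subst (Coordinate ∘ (σ ⟨$⟩ʳ_)) (Fin.splitAt⁻¹-↑ˡ eq)
         (≡.subst Coordinate (≡.sym (≡.trans (proj₂ extended k) (proj₂ (order⊆J U (opposite k)))))
           (sym (axis φ (proj₁ (order⊆J U (opposite k))) x)))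
       ... | inj₂ q = ≡.subst (Coordinate ∘ (σ ⟨$⟩ʳ_)) (Fin.splitAt⁻¹-↑ʳ eq) (trans (e′ q) (value x _))

   partition : ∀ (A : K^ n → Set ℓ) → Definable A → dim A ≤ e → ∃ λ k → Σ (Fin (suc k) → K^ n → Set ℓ) λ As →
       IsBasicRectifiablePartition e (fromℕ (finalBound n)) A As
   partition A definableA dimA = List.length ps , As , record
     { definable = λ { zero → Defⱽ⇒Definable rest-definable ; (suc i) → Defⱽ⇒Definable (∈ₚᵈ (List.lookup ps i)) }
     ; union = (λ {x} x∈ → by-cases (∃ λ i → x ∈ₚ List.lookup ps i)
         (λ (i , x∈ₚ) → suc i , x∈ₚ) (λ none → zero , x∈ , λ i x∈ₚ → none (i , x∈ₚ)))
       , λ { (zero , x∈ , _) → x∈ ; {x} (suc i , x∈ₚ) → All.lookup (proj₁ (proj₂ patched)) (∈-lookup i) x x∈ₚ }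
     ; disjoint = λ { zero zero i≢j → ⊥-elim (i≢j ≡.refl) ; zero (suc j) _ x ((_ , ∉) , x∈) → ⊥-elim (∉ j x∈)
                    ; (suc i) zero _ x (x∈ , (_ , ∉)) → ⊥-elim (∉ i x∈)
                    ; (suc i) (suc j) i≢j x (x∈ , x∈′) →
                        ⊥-elim (separated (proj₁ (proj₂ (proj₂ patched))) i j (i≢j ∘ ≡.cong suc) x x∈ x∈′) }
     ; dim-zero = small⇒dim< rest-definable λ J J-inj → ∀*ⁿ-map
         (λ x ¬p (u , (u∈ , ∉) , e′) → ¬p (u , (u∈ , λ ∈ps → ∉ (Any.index ∈ps) (Any.lookup-index ∈ps)) , e′))
         (proj₂ (proj₂ (proj₂ patched)) J J-inj)
     ; rectifiable = λ i → patch-rectifiable (List.lookup ps i)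
     }
     where
     dA : Defⱽ A
     dA = Definable⇒Defⱽ definableA
     patched : ∃ λ (ps : List (Patch {n} {e})) → All (Inside A) ps × Disjoint ps ×
       (∀ (J : Fin e → Fin n) → Injective J → Small (λ x → A x × ¬ Any (x ∈ₚ_) ps) J)
     patched = patches dA (dim≤⇒small dA dimA)
     ps : List (Patch {n} {e})
     ps = proj₁ patched
     As : Fin (suc (List.length ps)) → K^ n → Set ℓ
     As zero x = A x × (∀ i → ¬ (x ∈ₚ List.lookup ps i))
     As (suc i) x = x ∈ₚ List.lookup ps i
     rest-definable : Defⱽ (As zero)
     rest-definable = dA ×ᵈ ∀Finᵈ λ i → ¬ᵈ (∈ₚᵈ (List.lookup ps i))
     separated : ∀ {ps : List (Patch {n} {e})} → Disjoint ps → ∀ i j → i ≢ j →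
                 ∀ x → x ∈ₚ List.lookup ps i → ¬ (x ∈ₚ List.lookup ps j)
     separated (h ∷ hs) zero zero i≢j x p q = i≢j ≡.refl
     separated (h ∷ hs) zero (suc j) i≢j x p q = All.lookup h (∈-lookup j) x p q
     separated (h ∷ hs) (suc i) zero i≢j x p q = All.lookup h (∈-lookup i) x q p
     separated (h ∷ hs) (suc i) (suc j) i≢j x p q = separated hs i j (i≢j ∘ ≡.cong suc) x p q

open import Data.Nat.Base using (_≤_)

corollary3p11 : (∀ {a} → ExcludedMiddle a) → ∀ s ℓ → Σ (ℕ → ℕ) λ M → ∀ (𝓚 : SaturatedOMinimalField s ℓ) →
    let open Geometry 𝓚 in
    ∀ (e n : ℕ) → e ≤ n →
    ∀ (A : Pred (K^ n) ℓ) → Definable A → dim A ≤ e →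
    ∃ λ (k : ℕ) → Σ (Fin (suc k) → Pred (K^ n) ℓ) λ As →
    IsBasicRectifiablePartition e (fromℕ (M n)) A As
corollary3p11 em s ℓ = Constants.finalBound , λ 𝓚 e n e≤n →
    Rectification.partition (record { s = s ; ℓ = ℓ ; em = em ; 𝓚 = 𝓚 }) e≤n
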